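{- Let $x,y,z$ be non-negative integers and $\mathbf{a}=(a_1,\dots,a_n)$ a sequence of positive integers with $y+2\operatorname{O}(\mathbf{a})\ge a_1+1$. Write $s=\mathbf{s}_n(\mathbf{a})$, $E=\operatorname{E}(\mathbf{a})$, $O=\operatorname{O}(\mathbf{a})$, and set $a_k:=0$ for $k>n$. If $y$ is odd, then \[ \operatorname{M}(\mathcal{R}_{x,y,z}(\mathbf{a}))=\prod_{i=1}^{\frac{y-1}{2}}(2x+2i)_{2s+2y+2z-4i+1}\cdot\frac{1}{2^{y-1}}\frac{\operatorname{H}(s+y+z-1)\operatorname{H}_2(y)\operatorname{H}_2(2E+2z+1)\operatorname{H}_2(2O+1)\operatorname{H}_2(2s+y+2z)}{\operatorname{H}(s+z)\operatorname{H}_2(2E+y+2z)\operatorname{H}_2(2O+y)\operatorname{H}_2(2s+2y+2z-1)} \] \[ \times\operatorname{Q}\Big(x+\tfrac{y-1}{2}+a_{2\lfloor\frac{n+1}{2}\rfloor},a_{2\lfloor\frac{n+1}{2}\rfloor-1},\dots,a_1\Big)\operatorname{Q}\Big(x+\tfrac{y-1}{2}+a_{2\lfloor\frac{n}{2}\rfloor+1},a_{2\lfloor\frac{n}{2}\rfloor},\dots,a_1,z\Big), \] and if $y$ is even, then \[ \operatorname{M}(\mathcal{R}_{x,y,z}(\mathbf{a}))=\prod_{i=1}^{\frac{y}{2}}(2x+2i)_{2s+2y+2z-4i+1}\cdot\frac{\operatorname{H}(s+y+z)\operatorname{H}_2(y)\operatorname{H}_2(2E+2z)\operatorname{H}_2(2O)\operatorname{H}_2(2s+y+2z)}{\operatorname{H}(s+z)\operatorname{H}_2(2E+y+2z)\operatorname{H}_2(2O+y)\operatorname{H}_2(2s+2y+2z)}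 \] \[ \times\operatorname{K}\Big(x+\tfrac{y}{2}+a_{2\lfloor\frac{n+1}{2}\rfloor},a_{2\lfloor\frac{n+1}{2}\rfloor-1},\dots,a_1\Big)\operatorname{K}\Big(x+\tfrac{y}{2}+a_{2\lfloor\frac{n}{2}\rfloor+1},a_{2\lfloor\frac{n}{2}\rfloor},\dots,a_1,z\Big). \] Empty products are $1$.
   Context: Work on the triangular lattice drawn with horizontal lattice lines; unit triangles are up- or down-pointing. A lozenge is the union of two unit triangles sharing an edge; a tiling of a region is a covering by lozenges without gaps or overlaps; $\operatorname{M}(R)$ is the number of tilings of $R$ (or, for weighted lozenges, the sum over tilings of the product of lozenge weights). A vertical lozenge is the union of an up- and a down-pointing unit triangle sharing a horizontal edge. A "vertical zigzag western side with $N$ unit segments": from the north-west corner, the western boundary consists of $N$ unit segments alternately in the south-west and south-east directions, the first going south-west. "Weighting the western vertical lozenges by $\frac12$": for each $i$, the vertical lozenge formed by the leftmost unit triangle of row $2i-1$ and that of row $2i$ (rows counted from the top) gets weight $\frac12$, all others weight $1$. For a sequence $\mathbf{b}=(b_1,\dots,b_m)$: $\operatorname{E}(\mathbf{b})=\sum_{i\text{ even}}b_i$, $\operatorname{O}(\mathbf{b})=\sum_{i\text{ odd}}b_i$, $\mathbf{s}_k(\mathbf{b})=\sum_{i\le k}b_i$. $\operatorname{H}(n)=0!\,1!\cdots(n-1)!$; $\operatorname{H}_2(n)=0!\,2!\cdots(n-2)!$ for even $n$ and $1!\,3!\cdots(n-2)!$ for odd $n$ (empty products $=1$). Pochhammer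 symbol: $(u)_m=u(u+1)\cdots(u+m-1)$ for $m>0$, $(u)_0=1$, $(u)_m=1/((u-1)(u-2)\cdots(u+m))$ for $m<0$. $\mathcal{Q}(\mathbf{t})$, for $\mathbf{t}=(t_1,\dots,t_{2l})$ non-negative: region with northern side $\operatorname{O}(\mathbf{t})$, straight northeastern side $2\operatorname{E}(\mathbf{t})$, southern side $\operatorname{E}(\mathbf{t})+\operatorname{O}(\mathbf{t})$, vertical zigzag western side with $2\operatorname{E}(\mathbf{t})$ unit segments; along the southern side from left to right, leave a segment $t_1$, remove the up-pointing triangle of side $t_2$ resting on the southern side, leave $t_3$, remove an up-pointing triangle of side $t_4$, etc. $\mathcal{K}(\mathbf{t})$: same but with northeastern side $2\operatorname{E}(\mathbf{t})-1$ and zigzag western side with $2\operatorname{E}(\mathbf{t})-1$ unit segments. $\operatorname{Q}(\mathbf{t})=\operatorname{M}(\mathcal{Q}(\mathbf{t}))$, $\operatorname{K}(\mathbf{t})=\operatorname{M}(\mathcal{K}(\mathbf{t}))$. $\mathcal{R}_{x,y,z}(\mathbf{a})$: start from the region with northern side $x+\operatorname{E}(\mathbf{a})$, northeastern side $y+z+2\operatorname{O}(\mathbf{a})-1$, southeastern side $y+z+2\operatorname{E}(\mathbf{a})-1$, southern side $x+\operatorname{O}(\mathbf{a})$, and vertical zigzag western side with $2(y+z+\mathbf{s}_n(\mathbf{a})-1)$ unit segments. Let $V$ be its eastern vertex (where the northeastern and southeastern sides meet), $\ell$ the horizontal lattice line $z$ units above $V$, and $P$ the point where $\ell$ meets the northeastern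 side. Going left from $P$ along $\ell$, mark consecutive segments of lengths $a_1,a_2,\dots,a_n$; remove the up-pointing triangle having the $i$-th segment as base for odd $i$, and the down-pointing triangle having the $i$-th segment as its top side for even $i$ (so the triangle of side $a_1$ has its right side on the northeastern side). The result is $\mathcal{R}_{x,y,z}(\mathbf{a})$ (unweighted). -}

module Defs where

open import Data.Bool using (Bool; true; false; not; _∧_; _∨_; if_then_else_)
open import Data.Nat as ℕ using (ℕ; zero; suc; _≡ᵇ_; _%_; ⌊_/2⌋)
open import Data.Integer as ℤ using (ℤ; +_; ∣_∣)
open import Data.Rational as ℚ using (ℚ)
open import Data.List using (List; []; _∷_; _++_; length; filterᵇ; map; upTo)
open import Data.Bool.ListAction using (any)
open import Data.Nat.ListAction using (sum)
open import Data.Product using (_×_; _,_; proj₁; proj₂)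
open import Relation.Nullary.Decidable using (does)

-- Triangular lattice.
-- A lattice point is (X , Y) : ℤ × ℤ, where Y is the height (horizontal
-- lattice line number, increasing upwards) and X is the horizontal
-- coordinate measured in HALF unit lengths.  Lattice points are exactly
-- the (X , Y) with X ≡ Y (mod 2); all polygons below are placed so that
-- their vertices are lattice points.

Point : Set
Point = ℤ × ℤ

data Dir : Set where
  E W NE NW SE SW : Dir

step : Dir → Point → Point
step E  (x , y) = (x ℤ.+ + 2 , y)
step W  (x , y) = (x ℤ.- + 2 , y)
step NE (x , y) = (x ℤ.+ + 1 , y ℤ.+ + 1)
step NW (x , y) = (x ℤ.- + 1 , y ℤ.+ + 1)
step SE (x , y) = (x ℤ.+ + 1 , y ℤ.- + 1)
step SW (x , y) = (x ℤ.- + 1 , y ℤ.- + 1)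

Word : Set
Word = List (Dir × ℕ)

stepsN : Dir → ℕ → Point → List Point
stepsN d zero    p = []
stepsN d (suc k) p = step d p ∷ stepsN d k (step d p)

steps : Dir → ℕ → Point → Point
steps d zero    p = p
steps d (suc k) p = steps d k (step d p)

walkRest : Point → Word → List Point
walkRest p []            = []
walkRest p ((d , k) ∷ w) = stepsN d k p ++ walkRest (steps d k p) w

walk : Point → Word → List Point
walk p w = p ∷ walkRest p w

record Polygon : Set where
  constructor poly
  field
    start : Point
    word  : Word

vertices : Polygon → List Point
vertices P = walk (Polygon.start P) (Polygon.word P)

segments : List Point → List (Point × Point)
segments []            = []
segments (p ∷ [])      = []
segments (p ∷ q ∷ ps)  = (p , q) ∷ segments (q ∷ ps)

-- Unit triangles.  tri Y c is the unit triangle lying in the horizontal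
-- strip between the lattice lines Y and Y+1 whose horizontal "centre"
-- (apex abscissa) is c.  It is up-pointing iff c + Y is odd (its apex
-- (c , Y+1) is then a lattice point), down-pointing otherwise.

record Tri : Set where
  constructor tri
  field
    row : ℤ
    pos : ℤ

isUp : Tri → Bool
isUp (tri y c) = (∣ c ℤ.+ y ∣ % 2) ≡ᵇ 1

_==ℤ_ : ℤ → ℤ → Bool
a ==ℤ b = does (a ℤ.≟ b)

_≤ℤ_ : ℤ → ℤ → Bool
a ≤ℤ b = does (a ℤ.≤? b)

_==T_ : Tri → Tri → Bool
tri y c ==T tri y′ c′ = (y ==ℤ y′) ∧ (c ==ℤ c′)

-- Does the horizontal ray going east from the centroid of the unit
-- triangle t cross the (unit, lattice) boundary segment (p , q)?
-- (Centroids have non-integer height, so the ray never meets a vertex.)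
crosses : Tri → Point × Point → Bool
crosses (tri y c) ((x₁ , y₁) , (x₂ , y₂)) =
  if y₁ ==ℤ y₂ then false
  else (if does (y₁ ℤ.<? y₂) then test x₁ y₁ x₂ else test x₂ y₂ x₁)
  where
  test : ℤ → ℤ → ℤ → Bool
  test xl yl xh =
    (yl ==ℤ y) ∧ (if xh ==ℤ (xl ℤ.+ + 1) then c ≤ℤ xl else (c ℤ.+ + 1) ≤ℤ xl)

count : {A : Set} → (A → Bool) → List A → ℕ
count f []       = 0
count f (x ∷ xs) = if f x then suc (count f xs) else count f xs

-- Interior of a polygon (even–odd / ray-casting rule): a unit triangle
-- lies inside iff the eastward ray from its centroid crosses the
-- boundary an odd number of times.
insideP : Polygon → Tri → Bool
insideP P t = (count (crosses t) (segments (vertices P)) % 2) ≡ᵇ 1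

rangeℤ : ℤ → ℤ → List ℤ
rangeℤ lo hi = map (λ i → lo ℤ.+ + i) (upTo (suc ∣ hi ℤ.- lo ∣))

minL maxL : ℤ → List ℤ → ℤ
minL d []       = d
minL d (x ∷ xs) = ℤ._⊓_ x (minL x xs)
maxL d []       = d
maxL d (x ∷ xs) = ℤ._⊔_ x (maxL x xs)

concatMap : {A B : Set} → (A → List B) → List A → List B
concatMap f []       = []
concatMap f (x ∷ xs) = f x ++ concatMap f xs

boxTris : Polygon → List Tri
boxTris P =
  concatMap (λ y → map (λ c → tri y c) (rangeℤ x₀ x₁)) (rangeℤ y₀ (y₁ ℤ.- + 1))
  where
  xs = map proj₁ (vertices P)
  ys = map proj₂ (vertices P)
  x₀ = minL (+ 0) xs
  x₁ = maxL (+ 0) xs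
  y₀ = minL (+ 0) ys
  y₁ = maxL (+ 0) ys

record Region : Set where
  constructor region
  field
    outer   : Polygon
    removed : List Polygon

regionTris : Region → List Tri
regionTris (region P hs) =
  filterᵇ (λ t → insideP P t ∧ not (any (λ h → insideP h t) hs)) (boxTris P)

-- Lozenge tilings = perfect matchings of adjacent unit triangles.
-- Two unit triangles form a lozenge iff they share an edge.

adjacent : Tri → Tri → Bool
adjacent (tri y c) (tri y′ c′) =
  ((y ==ℤ y′) ∧ ((c′ ==ℤ (c ℤ.+ + 1)) ∨ (c ==ℤ (c′ ℤ.+ + 1))))
  ∨ ((c ==ℤ c′) ∧ (((y′ ==ℤ (y ℤ.- + 1)) ∧ isUp (tri y c))
                 ∨ ((y ==ℤ (y′ ℤ.- + 1)) ∧ isUp (tri y′ c′))))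

-- Number of lozenge tilings of a (duplicate-free) list of unit triangles:
-- in any tiling the first triangle t is covered by a lozenge t ∪ u for a
-- unique adjacent u; summing over u counts every tiling exactly once.
-- (The fuel argument is the number of triangles, which is always enough.)
tilingsCount : ℕ → List Tri → ℕ
tilingsCount _       []       = 1
tilingsCount zero    (_ ∷ _)  = 0
tilingsCount (suc f) (t ∷ ts) =
  sum (map (λ u → tilingsCount f (filterᵇ (λ v → not (v ==T u)) ts))
           (filterᵇ (adjacent t) ts))

M : Region → ℕ
M R = tilingsCount (length ts) ts
  where ts = regionTris R

Osum Esum : List ℕ → ℕ
Osum []       = 0
Osum (b ∷ bs) = b ℕ.+ Esum bs
Esum []       = 0
Esum (b ∷ bs) = Osum bs

-- b_k (1-based), with b_k = 0 for k > n (and for k = 0)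
aget : List ℕ → ℕ → ℕ
aget []       _             = 0
aget (b ∷ bs) zero          = 0
aget (b ∷ bs) (suc zero)    = b
aget (b ∷ bs) (suc (suc k)) = aget bs (suc k)

desc : List ℕ → ℕ → List ℕ
desc b zero    = []
desc b (suc j) = aget b (suc j) ∷ desc b j

zigzag : ℕ → Word
zigzag N = go N true
  where
  go : ℕ → Bool → Word
  go zero    _     = []
  go (suc k) true  = (SW , 1) ∷ go k false
  go (suc k) false = (SE , 1) ∷ go k true

upTriangle : Point → ℕ → Polygon
upTriangle p a = poly p ((E , a) ∷ (NW , a) ∷ (SW , a) ∷ [])

downTriangle : Point → ℕ → Polygon
downTriangle p a = poly p ((E , a) ∷ (SW , a) ∷ (NW , a) ∷ [])

southHoles : ℤ → List ℕ → List Polygon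
southHoles X []                 = []
southHoles X (t₁ ∷ [])          = []
southHoles X (t₁ ∷ t₂ ∷ ts) =
  upTriangle (X ℤ.+ + (2 ℕ.* t₁) , + 0) t₂
  ∷ southHoles (X ℤ.+ + (2 ℕ.* (t₁ ℕ.+ t₂))) ts

-- 𝒬(t): NW corner at (0 , 2E); traced counterclockwise:
-- western zigzag (2E segments), southern side E+O, northeastern side 2E,
-- northern side O.
QRegion : List ℕ → Region
QRegion t = region
  (poly (+ 0 , + (2 ℕ.* e))
        (zigzag (2 ℕ.* e) ++ ((E , e ℕ.+ o) ∷ (NW , 2 ℕ.* e) ∷ (W , o) ∷ [])))
  (southHoles (+ 0) t)
  where e = Esum t
        o = Osum t

-- 𝒦(t): same with northeastern side and zigzag of length 2E-1; the NW
-- corner is (1 , 2E-1) so that the SW corner is (0 , 0).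
KRegion : List ℕ → Region
KRegion t = region
  (poly (+ 1 , + (2 ℕ.* e ℕ.∸ 1))
        (zigzag (2 ℕ.* e ℕ.∸ 1) ++ ((E , e ℕ.+ o) ∷ (NW , 2 ℕ.* e ℕ.∸ 1) ∷ (W , o) ∷ [])))
  (southHoles (+ 0) t)
  where e = Esum t
        o = Osum t

Q K : List ℕ → ℕ
Q t = M (QRegion t)
K t = M (KRegion t)

lineHoles : Point → Bool → List ℕ → List Polygon
lineHoles P _ [] = []
lineHoles (X , Y) true  (a ∷ as) =
  upTriangle (X ℤ.- + (2 ℕ.* a) , Y) a ∷ lineHoles (X ℤ.- + (2 ℕ.* a) , Y) false as
lineHoles (X , Y) false (a ∷ as) =
  downTriangle (X ℤ.- + (2 ℕ.* a) , Y) a ∷ lineHoles (X ℤ.- + (2 ℕ.* a) , Y) true as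

-- ℛ_{x,y,z}(a).  NW corner at (0 , H), H = 2(y+z+s-1); traced
-- counterclockwise: western zigzag, southern side x+O, southeastern side
-- y+z+2E-1 (going NE up to the eastern vertex V), northeastern side
-- y+z+2O-1 (going NW), northern side x+E.  P = V moved z units up along
-- the northeastern side (so P lies on the line ℓ z units above V).
RRegion : ℕ → ℕ → ℕ → List ℕ → Region
RRegion x y z a = region
  (poly (+ 0 , + H) (zigzag H ++ ((E , x ℕ.+ o) ∷ (NE , se) ∷ (NW , ne) ∷ (W , x ℕ.+ e) ∷ [])))
  (lineHoles P true a)
  where
  s = sum a
  e = Esum a
  o = Osum a
  H = 2 ℕ.* (y ℕ.+ z ℕ.+ s ℕ.∸ 1)
  ne = y ℕ.+ z ℕ.+ 2 ℕ.* o ℕ.∸ 1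
  se = y ℕ.+ z ℕ.+ 2 ℕ.* e ℕ.∸ 1
  V = steps NE se (+ (2 ℕ.* (x ℕ.+ o)) , + 0)
  P = steps NW z V

factorial : ℕ → ℕ
factorial zero    = 1
factorial (suc n) = suc n ℕ.* factorial n

Hf : ℕ → ℕ
Hf zero    = 1
Hf (suc n) = Hf n ℕ.* factorial n

H₂ : ℕ → ℕ
H₂ zero          = 1
H₂ (suc zero)    = 1
H₂ (suc (suc n)) = H₂ n ℕ.* factorial n

-- Pochhammer symbol (u)_m for m ≥ 0 (only non-negative m occur here)
poch : ℕ → ℕ → ℕ
poch u zero    = 1
poch u (suc m) = u ℕ.* poch (suc u) m

prodTo : ℕ → (ℕ → ℕ) → ℕ
prodTo zero    f = 1
prodTo (suc n) f = prodTo n f ℕ.* f (suc n)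

-- ℕ → ℚ and the quotient of two naturals as a rational
-- (only used with non-zero denominators; x // 0 is set to 0).
⟦_⟧ : ℕ → ℚ
⟦ n ⟧ = (+ n) ℚ./ 1

_//_ : ℕ → ℕ → ℚ
n // zero    = ℚ.0ℚ
n // suc d   = (+ n) ℚ./ suc d

{-# OPTIONS --safe #-}
module Submission where

-- Cut the region along the line ℓ. The vertical lozenges crossing ℓ form a set S, and the two
-- parts are trapezoids with a zigzag side whose bases have dents: S together with the bases of
-- the triangles removed above, resp. below, ℓ (filling a removed triangle over its dents only
-- adds forced lozenges). Row by row the dents interlace, and since there are odd and even
-- monic polynomials φ with φ (n + 1) (x + 1) − φ (n + 1) (x − 1) = 2 (n + 1) φ n x, the number
-- of tilings of a dented trapezoid is a determinant in the φ n, hence a constant times a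
-- Vandermonde determinant in the squares of the positions of the dents. The two families of
-- triangles together fill an interval, so the interaction of S with both of them depends on
-- that interval only: up to the numbers Q or K of the two trapezoids without S, the sum over S
-- equals the one in which all the other dents lie on one side. The latter counts the tilings
-- of a half hexagon, which is again a trapezoid, with a single block of dents.

-- The line `ℓ` does not cut the region into two trapezoids: it runs `z` units above the eastern
-- vertex, and from that vertex on the lower part narrows. It is completed to a trapezoid by a
-- triangle of side `z` at the right end of `ℓ`, which then counts as one more removed triangle.
-- This cap is the last entry `z` of the second list in the theorem and the `trues z` throughout the
-- proof.
--
-- A trapezoid with n rows has tilings only for exactly `rank n` dents, half of n rounded up. Write
-- o and e for the numbers of dents above and below `ℓ` besides S, the cap included. The two parts
-- have 2(h + o) and 2(h + e) rows for y = 2h + 1, and one row less each for y = 2h. So S has h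
-- elements in every nonzero term, also after the other dents have been moved to one side, and the
-- parity of y decides between `Q` and `K`.
--
-- All identities are proved with denominators multiplied out: a count times a positive constant
-- equals a product. Rationals enter at the very end. The geometry (ray casting in a bounding box,
-- greedy matching of a list of triangles) is first reduced to rows of Boolean marks, where a mark
-- means that a unit triangle is absent, whether it was removed or is already covered.

-- Chains of marked cells, trapezoids and the half hexagon

module Chains where

  open import Data.Bool using (Bool; true; false; not)
  open import Data.Nat using (ℕ; zero; suc; pred; _+_; _*_)
  open import Data.Nat.Properties
  open import Data.List using (List; []; _∷_; _++_; length; replicate)
  open import Data.List.Properties using (length-++; length-replicate)
  open import Relation.Binary.PropositionalEquality
  open import Algebra.Properties.CommutativeSemigroup +-commutativeSemigroup using () renaming (interchange to +-interchange)
  open ≡-Reasoning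

  falses trues : ℕ → List Bool
  falses n = replicate n false
  trues n = replicate n true

  -- `D` marks the cells missing from the region, `V` in addition those used up by vertical lozenges
  -- from the neighbouring row. `sumM D` below runs over exactly these `V`.
  data _⊑_ : List Bool → List Bool → Set where
    nil  : [] ⊑ []
    keep : ∀ {D V} → D ⊑ V → (true ∷ D) ⊑ (true ∷ V)
    free : ∀ {D V} b → D ⊑ V → (false ∷ D) ⊑ (b ∷ V)

  ⊑-length : ∀ {D V} → D ⊑ V → length V ≡ length D
  ⊑-length nil = refl
  ⊑-length (keep s) = cong suc (⊑-length s)
  ⊑-length (free b s) = cong suc (⊑-length s)

  ⊑-refl : ∀ D → D ⊑ D
  ⊑-refl [] = nil
  ⊑-refl (true ∷ D) = keep (⊑-refl D)
  ⊑-refl (false ∷ D) = free false (⊑-refl D)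

  falses-⊑ : ∀ V → falses (length V) ⊑ V
  falses-⊑ [] = nil
  falses-⊑ (b ∷ V) = free b (falses-⊑ V)

  sumM : List Bool → (List Bool → ℕ) → ℕ
  sumM []          f = f []
  sumM (true  ∷ D) f = sumM D (λ V → f (true ∷ V))
  sumM (false ∷ D) f = sumM D (λ V → f (false ∷ V)) + sumM D (λ V → f (true ∷ V))

  sumB : ℕ → (List Bool → ℕ) → ℕ
  sumB n = sumM (falses n)

  sumM-cong : ∀ D {f g} → (∀ V → D ⊑ V → f V ≡ g V) → sumM D f ≡ sumM D g
  sumM-cong []          h = h [] nil
  sumM-cong (true ∷ D)  h = sumM-cong D (λ V s → h _ (keep s))
  sumM-cong (false ∷ D) h = cong₂ _+_ (sumM-cong D (λ V s → h _ (free false s))) (sumM-cong D (λ V s → h _ (free true s)))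

  sumB-cong : ∀ n {f g} → (∀ V → length V ≡ n → f V ≡ g V) → sumB n f ≡ sumB n g
  sumB-cong n h = sumM-cong (falses n) (λ V s → h V (trans (⊑-length s) (length-replicate n)))

  sumM-zero : ∀ D → sumM D (λ _ → 0) ≡ 0
  sumM-zero []          = refl
  sumM-zero (true ∷ D)  = sumM-zero D
  sumM-zero (false ∷ D) = cong₂ _+_ (sumM-zero D) (sumM-zero D)

  sumM-+ : ∀ D (f g : List Bool → ℕ) → sumM D (λ V → f V + g V) ≡ sumM D f + sumM D g
  sumM-+ []          f g = refl
  sumM-+ (true ∷ D)  f g = sumM-+ D _ _
  sumM-+ (false ∷ D) f g = trans (cong₂ _+_ (sumM-+ D _ _) (sumM-+ D _ _))
    (+-interchange (sumM D _) (sumM D _) (sumM D _) (sumM D _))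

  sumM-*ˡ : ∀ D c (f : List Bool → ℕ) → c * sumM D f ≡ sumM D (λ V → c * f V)
  sumM-*ˡ []          c f = refl
  sumM-*ˡ (true ∷ D)  c f = sumM-*ˡ D c _
  sumM-*ˡ (false ∷ D) c f = trans (*-distribˡ-+ c _ _) (cong₂ _+_ (sumM-*ˡ D c _) (sumM-*ˡ D c _))

  sumM-swap : ∀ D U (f : List Bool → List Bool → ℕ) → sumM D (λ V → sumM U (f V)) ≡ sumM U (λ P → sumM D (λ V → f V P))
  sumM-swap []          U f = refl
  sumM-swap (true ∷ D)  U f = sumM-swap D U _
  sumM-swap (false ∷ D) U f = trans (cong₂ _+_ (sumM-swap D U _) (sumM-swap D U _)) (sym (sumM-+ U _ _))

  -- Associativity of the product of a row vector, a matrix and a column vector. It hands one row of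
  -- the region from one side of a cut to the other.
  sumM-exchange : ∀ D U (t : List Bool → ℕ) (w : List Bool → List Bool → ℕ) (g : List Bool → ℕ) →
    sumM U (λ P → t P * sumM D (λ V → w P V * g V)) ≡ sumM D (λ V → sumM U (λ P → w P V * t P) * g V)
  sumM-exchange D U t w g = begin
    sumM U (λ P → t P * sumM D (λ V → w P V * g V))
      ≡⟨ sumM-cong U (λ P _ → sumM-*ˡ D (t P) _) ⟩
    sumM U (λ P → sumM D (λ V → t P * (w P V * g V)))
      ≡⟨ sumM-swap U D _ ⟩
    sumM D (λ V → sumM U (λ P → t P * (w P V * g V)))
      ≡⟨ sumM-cong D (λ V _ → sumM-cong U (λ P _ → reorder (t P) (w P V) (g V))) ⟩
    sumM D (λ V → sumM U (λ P → g V * (w P V * t P)))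
      ≡⟨ sumM-cong D (λ V _ → trans (sym (sumM-*ˡ U (g V) _)) (*-comm (g V) _)) ⟩
    sumM D (λ V → sumM U (λ P → w P V * t P) * g V) ∎
    where
    reorder : ∀ a b c → a * (b * c) ≡ c * (b * a)
    reorder a b c = trans (*-comm a _) (trans (cong (_* a) (*-comm b c)) (*-assoc c b a))

  sumB-++ : ∀ m n (f : List Bool → ℕ) → sumB (m + n) f ≡ sumB m (λ S → sumB n (λ R → f (S ++ R)))
  sumB-++ zero    n f = refl
  sumB-++ (suc m) n f = cong₂ _+_ (sumB-++ m n _) (sumB-++ m n _)

  none full : List Bool → ℕ
  none []          = 1
  none (true ∷ _)  = 0
  none (false ∷ l) = none l
  full []          = 1
  full (true ∷ l)  = full l
  full (false ∷ _) = 0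

  none-falses : ∀ n → none (falses n) ≡ 1
  none-falses zero    = refl
  none-falses (suc n) = none-falses n

  sumB-none : ∀ n (f : List Bool → ℕ) → sumB n (λ V → none V * f V) ≡ f (falses n)
  sumB-none zero    f = +-identityʳ _
  sumB-none (suc n) f = trans (cong₂ _+_ (sumB-none n _) (sumM-zero (falses n))) (+-identityʳ _)

  sumB-full : ∀ n (f : List Bool → ℕ) → sumB n (λ V → full V * f V) ≡ f (trues n)
  sumB-full zero    f = +-identityʳ _
  sumB-full (suc n) f = trans (cong (_+ sumB n _) (sumM-zero (falses n))) (sumB-full n _)

  -- Number of ways (0 or 1) to pair off consecutive unmarked cells of a chain;
  -- the flag says that the cell before the chain is still waiting for its partner.
  pm : Bool → List Bool → ℕ
  pm false []          = 1
  pm true  []          = 0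
  pm false (true ∷ l)  = pm false l
  pm false (false ∷ l) = pm true l
  pm true  (true ∷ l)  = 0
  pm true  (false ∷ l) = pm false l

  -- The order of the cells in a row, where the two kinds of triangles alternate. Nothing is lost if
  -- the lengths agree or the first list is longer by one.
  il : List Bool → List Bool → List Bool
  il []       ys = []
  il (x ∷ xs) ys = x ∷ il ys xs

  ev : ℕ → Bool
  ev zero    = true
  ev (suc n) = not (ev n)

  -- `P` marks the base side of a row and `V` the far side. Because of the zigzag, row n + 1 from
  -- the top opens with a base-side triangle for even n and with a far-side one for odd n; the flag
  -- is `ev n`.
  fit : Bool → List Bool → List Bool → ℕ
  fit true  V P = pm false (il P V)
  fit false V P = pm false (il V P)

  -- A row with l positions on its longer-base side has below b l of them on the other side.
  below : Bool → ℕ → ℕ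
  below true  l = pred l
  below false l = l

  above : Bool → ℕ → ℕ
  above true  l = suc l
  above false l = l

  -- Tilings of an n-row trapezoid (zigzag on the left, rows losing one cell each on the
  -- right) whose base row has its base-side unit triangles marked in P removed.
  T : ℕ → List Bool → ℕ
  T zero    P = none P
  T (suc n) P = sumB (below (ev n) (length P)) (λ V → fit (ev n) V P * T n V)

  baseLength : ℕ → ℕ → ℕ
  baseLength zero    x = x
  baseLength (suc n) x = above (ev n) (baseLength n x)

  below-above : ∀ b l → below b (above b l) ≡ l
  below-above true  l = refl
  below-above false l = refl

  pm-blocked : ∀ m R → length R ≡ m → pm false (il R (trues m)) ≡ full R
  pm-blocked zero    []          e = refl
  pm-blocked (suc m) (true ∷ R)  e = pm-blocked m R (suc-injective e)
  pm-blocked (suc m) (false ∷ R) e = refl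

  -- The m cells of `R` lie between m + 1 consecutive absent cells. They have no possible partner,
  -- so they must be absent themselves, and what remains is the chain of `V` and `S`. The two
  -- versions differ in which of the lists opens the chain.
  pm-blockᵈ : ∀ b V S m R → length S ≡ length V → length R ≡ m →
    pm b (il (V ++ trues (suc m)) (S ++ R)) ≡ full R * pm b (il V S)
  pm-blockᵘ : ∀ b V S m R → length S ≡ suc (length V) → length R ≡ m →
    pm b (il (S ++ R) (V ++ trues (suc m))) ≡ full R * pm b (il S V)
  pm-blockᵈ false [] [] m R e₁ e₂ = trans (pm-blocked m R e₂) (sym (*-identityʳ (full R)))
  pm-blockᵈ true  [] [] m R e₁ e₂ = sym (*-zeroʳ (full R))
  pm-blockᵈ false (true ∷ V)  (s ∷ S) m R e₁ e₂ = pm-blockᵘ false V (s ∷ S) m R e₁ e₂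
  pm-blockᵈ false (false ∷ V) (s ∷ S) m R e₁ e₂ = pm-blockᵘ true V (s ∷ S) m R e₁ e₂
  pm-blockᵈ true  (true ∷ V)  (s ∷ S) m R e₁ e₂ = sym (*-zeroʳ (full R))
  pm-blockᵈ true  (false ∷ V) (s ∷ S) m R e₁ e₂ = pm-blockᵘ false V (s ∷ S) m R e₁ e₂
  pm-blockᵘ false V (true ∷ S)  m R e₁ e₂ = pm-blockᵈ false V S m R (suc-injective e₁) e₂
  pm-blockᵘ false V (false ∷ S) m R e₁ e₂ = pm-blockᵈ true V S m R (suc-injective e₁) e₂
  pm-blockᵘ true  V (true ∷ S)  m R e₁ e₂ = sym (*-zeroʳ (full R))
  pm-blockᵘ true  V (false ∷ S) m R e₁ e₂ = pm-blockᵈ false V S m R (suc-injective e₁) e₂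

  -- A chain does not know which of its lists is the base side. The row below the cut with base `S`
  -- and far side `V` is the same chain as a row above the cut with base `V` and far side `S`; hence
  -- the change of flag.
  fit-block : ∀ b V S m R → length S ≡ above b (length V) → length R ≡ m →
    fit (not b) (S ++ R) (V ++ trues (suc m)) ≡ full R * fit b V S
  fit-block true  V S m R e₁ e₂ = pm-blockᵘ false V S m R e₁ e₂
  fit-block false V S m R e₁ e₂ = pm-blockᵈ false V S m R e₁ e₂

  below-block : ∀ b l m → below (not b) (l + suc m) ≡ above b l + m
  below-block true  l m = +-suc l m
  below-block false l m = cong pred (+-suc l m)

  -- Trades one row across the cut: the last row of the lower trapezoid becomes the new base row of
  -- the upper one, at the price of one more dent in the block.
  T-block : ∀ n b V m → ev n ≡ not b →
    sumB (above b (length V)) (λ S → fit b V S * T n (S ++ trues m)) ≡ T (suc n) (V ++ trues (suc m))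
  T-block n b V m e = sym (begin
    T (suc n) (V ++ trues (suc m))
      ≡⟨ cong (λ c → sumB (below c (length (V ++ trues (suc m)))) (λ R → fit c R (V ++ trues (suc m)) * T n R)) e ⟩
    sumB (below (not b) (length (V ++ trues (suc m)))) g
      ≡⟨ cong (λ l → sumB (below (not b) l) g) (trans (length-++ V) (cong (length V +_) (length-replicate (suc m)))) ⟩
    sumB (below (not b) (length V + suc m)) g
      ≡⟨ cong (λ l → sumB l g) (below-block b (length V) m) ⟩
    sumB (above b (length V) + m) g
      ≡⟨ sumB-++ (above b (length V)) m g ⟩
    sumB (above b (length V)) (λ S → sumB m (λ R → g (S ++ R)))
      ≡⟨ sumB-cong _ (λ S eS → trans (sumB-cong m (λ R eR →
           trans (cong (_* T n (S ++ R)) (fit-block b V S m R eS eR)) (*-assoc (full R) _ _)))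
           (sumB-full m (λ R → fit b V S * T n (S ++ R)))) ⟩
    sumB (above b (length V)) (λ S → fit b V S * T n (S ++ trues m)) ∎)
    where
    g : List Bool → ℕ
    g R = fit (not b) R (V ++ trues (suc m)) * T n R

  -- Both sides count the tilings of a half hexagon: the right-hand side cuts it along its
  -- lowest line, where the forced lozenges above a longer block of dents restore its lower part.
  half-hexagon : ∀ k x n m → ev k ≡ ev n →
    sumB (baseLength k x) (λ S → T k S * T n (S ++ trues m)) ≡ T (k + n) (falses x ++ trues (k + m))
  half-hexagon zero    x n m e = sumB-none x (λ S → T n (S ++ trues m))
  half-hexagon (suc k) x n m e = begin
    sumB l′ (λ S → T (suc k) S * T n (S ++ trues m))
      ≡⟨ sumB-cong l′ (λ S eS → trans (cong (λ j → sumB j (λ V → fit (ev k) V S * T k V) * T n (S ++ trues m))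
           (trans (cong (below (ev k)) eS) (below-above (ev k) l))) (*-comm _ (T n (S ++ trues m)))) ⟩
    sumB l′ (λ S → T n (S ++ trues m) * sumB l (λ V → fit (ev k) V S * T k V))
      ≡⟨ sumM-exchange (falses l) (falses l′) (λ S → T n (S ++ trues m)) (λ S V → fit (ev k) V S) (T k) ⟩
    sumB l (λ V → sumB l′ (λ S → fit (ev k) V S * T n (S ++ trues m)) * T k V)
      ≡⟨ sumB-cong l (λ V eV → trans (cong (_* T k V) (trans
           (cong (λ j → sumB (above (ev k) j) (λ S → fit (ev k) V S * T n (S ++ trues m))) (sym eV))
           (T-block n (ev k) V m (sym e)))) (*-comm _ (T k V))) ⟩
    sumB l (λ V → T k V * T (suc n) (V ++ trues (suc m)))
      ≡⟨ half-hexagon k x (suc n) (suc m) (trans (sym (not-invol (ev k))) (cong not e)) ⟩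
    T (k + suc n) (falses x ++ trues (k + suc m))
      ≡⟨ cong₂ (λ i j → T i (falses x ++ trues j)) (+-suc k n) (+-suc k m) ⟩
    T (suc k + n) (falses x ++ trues (suc k + m)) ∎
    where
    l l′ : ℕ
    l = baseLength k x
    l′ = above (ev k) l
    not-invol : ∀ b → not (not b) ≡ b
    not-invol true = refl
    not-invol false = refl

-- Determinants of lists of columns and the Vandermonde evaluation

module Determinants where

  open import Data.Nat as ℕ using (ℕ; zero; suc)
  import Data.Nat.Properties as ℕ
  open import Data.Integer using (ℤ; 0ℤ; 1ℤ; -1ℤ; +_; _+_; _-_; _*_; -_)
  open import Data.Integer.Properties
  open import Data.Integer.Tactic.RingSolver using (solve-∀)
  open import Data.List using (List; []; _∷_; _++_; length; map)
  open import Data.List.Properties using (++-assoc)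
  open import Data.List.Relation.Binary.Pointwise as PW using (Pointwise; []; _∷_)
  open import Data.List.Relation.Unary.All using (All; []; _∷_)
  open import Data.Empty using (⊥-elim)
  open import Function using (_∘_)
  open import Relation.Binary.PropositionalEquality
  open ≡-Reasoning

  Column : Set
  Column = ℕ → ℤ

  Functional : Set
  Functional = List Column → ℤ

  -- Expansion along row `o`. Columns that are passed over are absorbed into the functional, and the
  -- minus sign before the recursive call produces the alternating signs of the cofactors.
  laplace : ℕ → Functional → Functional
  laplace o F []       = 0ℤ
  laplace o F (c ∷ cs) = c o * F cs - laplace o (F ∘ (c ∷_)) cs

  -- D n o cs is the determinant of the rows o, …, o + n − 1 of the columns cs
  -- (0 when the number of columns is not n).
  D : ℕ → ℕ → Functional
  D zero    o []      = 1ℤ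
  D zero    o (_ ∷ _) = 0ℤ
  D (suc n) o cs      = laplace o (D n (suc o)) cs

  axpy : ℤ → Column → Column → Column
  axpy a c d i = a * c i + d i

  -- No permutations appear: the first three properties pass from `F` to `laplace o F`, so induction
  -- on the number of rows gives them for `D`.
  Extensional Linear Alternating Alternating′ : Functional → Set
  Extensional F  = ∀ {cs ds} → Pointwise _≗_ cs ds → F cs ≡ F ds
  Linear F       = ∀ pre a c d post → F (pre ++ axpy a c d ∷ post) ≡ a * F (pre ++ c ∷ post) + F (pre ++ d ∷ post)
  Alternating F  = ∀ pre c post → F (pre ++ c ∷ c ∷ post) ≡ 0ℤ
  Alternating′ F = ∀ pre c mid post → F (pre ++ c ∷ mid ++ c ∷ post) ≡ 0ℤ

  laplace-cong : ∀ o {F G : Functional} → (∀ l → F l ≡ G l) → ∀ cs → laplace o F cs ≡ laplace o G cs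
  laplace-cong o h []       = refl
  laplace-cong o h (c ∷ cs) = cong₂ (λ u v → c o * u - v) (h cs) (laplace-cong o (λ l → h (c ∷ l)) cs)

  laplace-ext : ∀ o {F} → Extensional F → Extensional (laplace o F)
  laplace-ext o hF []       = refl
  laplace-ext o {F} hF {c ∷ cs} {d ∷ ds} (e ∷ es) = cong₂ _-_ (cong₂ _*_ (e o) (hF es))
    (trans (laplace-cong o (λ l → hF (e ∷ PW.refl (λ _ → refl))) cs) (laplace-ext o (λ h → hF ((λ _ → refl) ∷ h)) es))

  private
    combine : ∀ a e u v u′ v′ → e * (a * u + v) - (a * u′ + v′) ≡ a * (e * u - u′) + (e * v - v′)
    combine = solve-∀

  laplace-lin : ∀ o {F} → Linear F → Linear (laplace o F)
  laplace-lin o {F} hF [] a c d post = trans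
    (cong (λ u → (a * c o + d o) * F post - u) (head-lin (λ l → l) post))
    (expand a (c o) (d o) (F post) (laplace o (F ∘ (c ∷_)) post) (laplace o (F ∘ (d ∷_)) post))
    where
    expand : ∀ a c d f u v → (a * c + d) * f - (a * u + v) ≡ a * (c * f - u) + (d * f - v)
    expand = solve-∀
    -- The modified column has been absorbed into the functional; `k` puts back the columns passed
    -- over after it.
    head-lin : (k : List Column → List Column) → ∀ l → laplace o (λ l′ → F (axpy a c d ∷ k l′)) l
      ≡ a * laplace o (λ l′ → F (c ∷ k l′)) l + laplace o (λ l′ → F (d ∷ k l′)) l
    head-lin k []      = sym (trans (+-identityʳ _) (*-zeroʳ a))
    head-lin k (e ∷ l) = trans (cong₂ (λ u v → e o * u - v) (hF [] a c d (k l)) (head-lin (k ∘ (e ∷_)) l))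
      (combine a (e o) _ _ _ _)
  laplace-lin o {F} hF (x ∷ pre) a c d post = trans
    (cong₂ (λ u v → x o * u - v) (hF pre a c d post) (laplace-lin o (λ pre → hF (x ∷ pre)) pre a c d post))
    (combine a (x o) _ _ _ _)

  laplace-0 : ∀ o {F : Functional} → (∀ l → F l ≡ 0ℤ) → ∀ cs → laplace o F cs ≡ 0ℤ
  laplace-0 o h []       = refl
  laplace-0 o h (c ∷ cs) = trans (cong₂ (λ u v → c o * u - v) (h cs) (laplace-0 o (λ l → h (c ∷ l)) cs))
    (trans (+-identityʳ _) (*-zeroʳ (c o)))

  -- When the two equal columns come first, the two terms expanding along them cancel, and every
  -- term passing over both vanishes because `F` is alternating.
  laplace-alt : ∀ o {F} → Alternating F → Alternating (laplace o F)
  laplace-alt o {F} hF [] c post = trans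
    (cong (λ u → c o * F (c ∷ post) - (c o * F (c ∷ post) - u)) (laplace-0 o (hF [] c) post))
    (cancel (c o * F (c ∷ post)))
    where
    cancel : ∀ a → a - (a - 0ℤ) ≡ 0ℤ
    cancel = solve-∀
  laplace-alt o {F} hF (x ∷ pre) c post = trans
    (cong₂ (λ u v → x o * u - v) (hF pre c post) (laplace-alt o (λ pre → hF (x ∷ pre)) pre c post))
    (trans (+-identityʳ _) (*-zeroʳ (x o)))

  D-ext : ∀ n o → Extensional (D n o)
  D-ext zero    o []      = refl
  D-ext zero    o (_ ∷ _) = refl
  D-ext (suc n) o         = laplace-ext o (D-ext n (suc o))

  D-lin : ∀ n o → Linear (D n o)
  D-lin zero    o []        a c d post = sym (trans (+-identityʳ _) (*-zeroʳ a))
  D-lin zero    o (_ ∷ pre) a c d post = sym (trans (+-identityʳ _) (*-zeroʳ a))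
  D-lin (suc n) o = laplace-lin o (D-lin n (suc o))

  D-alt : ∀ n o → Alternating (D n o)
  D-alt zero    o []        c post = refl
  D-alt zero    o (_ ∷ pre) c post = refl
  D-alt (suc n) o = laplace-alt o (D-alt n (suc o))

  laplace-length : ∀ n o {F : Functional} → (∀ l → length l ≢ n → F l ≡ 0ℤ) → ∀ cs → length cs ≢ suc n → laplace o F cs ≡ 0ℤ
  laplace-length n o h [] e = refl
  laplace-length n o {F} h (c ∷ cs) e = trans (cong₂ (λ u v → c o * u - v) (h cs (λ e′ → e (cong suc e′))) (rest n h e))
    (trans (+-identityʳ _) (*-zeroʳ (c o)))
    where
    rest : ∀ n → (∀ l → length l ≢ n → F l ≡ 0ℤ) → suc (length cs) ≢ suc n → laplace o (F ∘ (c ∷_)) cs ≡ 0ℤ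
    rest zero    h e = laplace-0 o (λ l → h (c ∷ l) (λ ())) cs
    rest (suc n) h e = laplace-length n o (λ l e′ → h (c ∷ l) (e′ ∘ ℕ.suc-injective)) cs (e ∘ cong suc)

  -- The reason why a trapezoid with a wrong number of dents has no tilings (`T-vanishes`).
  D-length : ∀ n o cs → length cs ≢ n → D n o cs ≡ 0ℤ
  D-length zero    o []       h = ⊥-elim (h refl)
  D-length zero    o (c ∷ cs) h = refl
  D-length (suc n) o cs       h = laplace-length n o (D-length n (suc o)) cs h

  snoc-++ : ∀ {A : Set} (pre : List A) x post → (pre ++ x ∷ []) ++ post ≡ pre ++ x ∷ post
  snoc-++ pre x post = ++-assoc pre (x ∷ []) post

  linear-next : ∀ F → Linear F → ∀ pre x a c d post →
    F (pre ++ x ∷ axpy a c d ∷ post) ≡ a * F (pre ++ x ∷ c ∷ post) + F (pre ++ x ∷ d ∷ post)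
  linear-next F hF pre x a c d post = trans (cong F (sym (snoc-++ pre x _))) (trans (hF (pre ++ x ∷ []) a c d post)
    (cong₂ (λ u v → a * F u + F v) (snoc-++ pre x _) (snoc-++ pre x _)))

  -- Linear expansion of the value at two equal columns `c + d`, which is 0, as are the terms with
  -- `c` or `d` repeated.
  swap-adjacent : ∀ F → Linear F → Alternating F → ∀ pre c d post → F (pre ++ c ∷ d ∷ post) ≡ - F (pre ++ d ∷ c ∷ post)
  swap-adjacent F hF alt pre c d post = begin
    x ≡⟨ solve₁ x y ⟩
    (1ℤ * (1ℤ * 0ℤ + x) + (1ℤ * y + 0ℤ)) - y
      ≡⟨ cong₂ (λ u v → (1ℤ * (1ℤ * u + x) + (1ℤ * y + v)) - y) (sym (alt pre c post)) (sym (alt pre d post)) ⟩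
    (1ℤ * (1ℤ * F (pre ++ c ∷ c ∷ post) + x) + (1ℤ * y + F (pre ++ d ∷ d ∷ post))) - y
      ≡⟨ cong₂ (λ u v → (1ℤ * u + v) - y) (sym (linear-next F hF pre c 1ℤ c d post)) (sym (linear-next F hF pre d 1ℤ c d post)) ⟩
    (1ℤ * F (pre ++ c ∷ s ∷ post) + F (pre ++ d ∷ s ∷ post)) - y
      ≡⟨ cong (_- y) (sym (hF pre 1ℤ c d (s ∷ post))) ⟩
    F (pre ++ s ∷ s ∷ post) - y
      ≡⟨ cong (_- y) (alt pre s post) ⟩
    0ℤ - y
      ≡⟨ +-identityˡ (- y) ⟩
    - y ∎
    where
    s : Column
    s = axpy 1ℤ c d
    x y : ℤ
    x = F (pre ++ c ∷ d ∷ post)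
    y = F (pre ++ d ∷ c ∷ post)
    solve₁ : ∀ x y → x ≡ (1ℤ * (1ℤ * 0ℤ + x) + (1ℤ * y + 0ℤ)) - y
    solve₁ = solve-∀

  alternating′ : ∀ F → Linear F → Alternating F → Alternating′ F
  alternating′ F hF alt pre c []        post = alt pre c post
  alternating′ F hF alt pre c (m ∷ mid) post = trans (swap-adjacent F hF alt pre c m (mid ++ c ∷ post))
    (cong -_ (trans (cong F (sym (snoc-++ pre m (c ∷ mid ++ c ∷ post)))) (alternating′ F hF alt (pre ++ m ∷ []) c mid post)))

  _⊖_ : Column → Column → Column
  c ⊖ d = axpy -1ℤ d c

  diffs : Column → List Column → List Column
  diffs c []       = []
  diffs c (e ∷ es) = (e ⊖ c) ∷ diffs e es

  private
    drop-0 : ∀ x → -1ℤ * 0ℤ + x ≡ x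
    drop-0 = solve-∀

  -- Working from the left, the neighbour of the current difference is already a plain column again,
  -- so splitting the difference leaves a term with two equal adjacent columns, which vanishes.
  D-telescope : ∀ n o pre c es → D n o (pre ++ c ∷ diffs c es) ≡ D n o (pre ++ c ∷ es)
  D-telescope n o pre c []       = refl
  D-telescope n o pre c (e ∷ es) = begin
    D n o (pre ++ c ∷ (e ⊖ c) ∷ diffs e es)
      ≡⟨ linear-next (D n o) (D-lin n o) pre c -1ℤ c e (diffs e es) ⟩
    -1ℤ * D n o (pre ++ c ∷ c ∷ diffs e es) + D n o (pre ++ c ∷ e ∷ diffs e es)
      ≡⟨ cong (λ u → -1ℤ * u + D n o (pre ++ c ∷ e ∷ diffs e es)) (D-alt n o pre c (diffs e es)) ⟩
    -1ℤ * 0ℤ + D n o (pre ++ c ∷ e ∷ diffs e es)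
      ≡⟨ drop-0 _ ⟩
    D n o (pre ++ c ∷ e ∷ diffs e es)
      ≡⟨ cong (D n o) (sym (snoc-++ pre c _)) ⟩
    D n o ((pre ++ c ∷ []) ++ e ∷ diffs e es)
      ≡⟨ D-telescope n o (pre ++ c ∷ []) e es ⟩
    D n o ((pre ++ c ∷ []) ++ e ∷ es)
      ≡⟨ cong (D n o) (snoc-++ pre c _) ⟩
    D n o (pre ++ c ∷ e ∷ es) ∎

  D-subtract-first : ∀ n o c pre es → D n o (c ∷ pre ++ map (_⊖ c) es) ≡ D n o (c ∷ pre ++ es)
  D-subtract-first n o c pre []       = refl
  D-subtract-first n o c pre (e ∷ es) = begin
    D n o (c ∷ pre ++ (e ⊖ c) ∷ map (_⊖ c) es)
      ≡⟨ D-lin n o (c ∷ pre) -1ℤ c e (map (_⊖ c) es) ⟩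
    -1ℤ * D n o (c ∷ pre ++ c ∷ map (_⊖ c) es) + D n o (c ∷ pre ++ e ∷ map (_⊖ c) es)
      ≡⟨ cong (λ u → -1ℤ * u + D n o (c ∷ pre ++ e ∷ map (_⊖ c) es)) (alternating′ (D n o) (D-lin n o) (D-alt n o) [] c pre (map (_⊖ c) es)) ⟩
    -1ℤ * 0ℤ + D n o (c ∷ pre ++ e ∷ map (_⊖ c) es)
      ≡⟨ drop-0 _ ⟩
    D n o (c ∷ pre ++ e ∷ map (_⊖ c) es)
      ≡⟨ cong (λ l → D n o (c ∷ l)) (sym (snoc-++ pre e _)) ⟩
    D n o (c ∷ (pre ++ e ∷ []) ++ map (_⊖ c) es)
      ≡⟨ D-subtract-first n o c (pre ++ e ∷ []) es ⟩
    D n o (c ∷ (pre ++ e ∷ []) ++ es)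
      ≡⟨ cong (λ l → D n o (c ∷ l)) (snoc-++ pre e _) ⟩
    D n o (c ∷ pre ++ e ∷ es) ∎

  laplace-zeros : ∀ o (F : Functional) {cs} → All (λ c → c o ≡ 0ℤ) cs → laplace o F cs ≡ 0ℤ
  laplace-zeros o F []       = refl
  laplace-zeros o F {c ∷ cs} (e ∷ es) = cong₂ (λ u v → u * F cs - v) e (laplace-zeros o (F ∘ (c ∷_)) es)

  D-unit-row : ∀ n o c {ds} → c o ≡ 1ℤ → All (λ d → d o ≡ 0ℤ) ds → D (suc n) o (c ∷ ds) ≡ D n (suc o) ds
  D-unit-row n o c {ds} e es = trans (cong₂ (λ u v → u * D n (suc o) ds - v) e (laplace-zeros o (D n (suc o) ∘ (c ∷_)) es))
    (trans (+-identityʳ _) (*-identityˡ _))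

  laplace-shift : ∀ o (F G : Functional) → (∀ l → F l ≡ G (map (_∘ suc) l)) → ∀ cs → laplace (suc o) F cs ≡ laplace o G (map (_∘ suc) cs)
  laplace-shift o F G h []       = refl
  laplace-shift o F G h (c ∷ cs) = cong₂ (λ u v → c (suc o) * u - v) (h cs) (laplace-shift o (F ∘ (c ∷_)) (G ∘ ((c ∘ suc) ∷_)) (λ l → h (c ∷ l)) cs)

  D-shift : ∀ n o cs → D n (suc o) cs ≡ D n o (map (_∘ suc) cs)
  D-shift zero    o []       = refl
  D-shift zero    o (c ∷ cs) = refl
  D-shift (suc n) o cs = laplace-shift o (D n (suc (suc o))) (D n (suc o)) (D-shift n (suc o)) cs

  scale : ℤ → Column → Column
  scale a c i = a * c i

  -- Linearity applied to 0 = 1 · 0 + 0 gives x = x + x.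
  D-zero-column : ∀ n o pre post → D n o (pre ++ (λ _ → 0ℤ) ∷ post) ≡ 0ℤ
  D-zero-column n o pre post = self-double (trans
    (D-ext n o (PW.++⁺ (PW.refl {R = _≗_} (λ _ → refl) {pre}) ((λ _ → refl) ∷ PW.refl {R = _≗_} (λ _ → refl) {post})))
    (D-lin n o pre 1ℤ (λ _ → 0ℤ) (λ _ → 0ℤ) post))
    where
    self-double : ∀ {x} → x ≡ 1ℤ * x + x → x ≡ 0ℤ
    self-double {x} e = trans (sub x) (trans (cong (_- x) (sym e)) (+-inverseʳ x))
      where
      sub : ∀ x → x ≡ (1ℤ * x + x) - x
      sub = solve-∀

  D-scale : ∀ n o pre a c post → D n o (pre ++ scale a c ∷ post) ≡ a * D n o (pre ++ c ∷ post)
  D-scale n o pre a c post = begin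
    D n o (pre ++ scale a c ∷ post)
      ≡⟨ D-ext n o (PW.++⁺ (PW.refl {R = _≗_} (λ _ → refl) {pre}) ((λ i → sym (+-identityʳ (a * c i))) ∷ PW.refl {R = _≗_} (λ _ → refl) {post})) ⟩
    D n o (pre ++ axpy a c (λ _ → 0ℤ) ∷ post)
      ≡⟨ D-lin n o pre a c _ post ⟩
    a * D n o (pre ++ c ∷ post) + D n o (pre ++ (λ _ → 0ℤ) ∷ post)
      ≡⟨ cong (λ u → a * D n o (pre ++ c ∷ post) + u) (D-zero-column n o pre post) ⟩
    a * D n o (pre ++ c ∷ post) + 0ℤ
      ≡⟨ +-identityʳ _ ⟩
    a * D n o (pre ++ c ∷ post) ∎

  product : {A : Set} → (A → ℤ) → List A → ℤ
  product f []       = 1ℤ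
  product f (x ∷ xs) = f x * product f xs

  D-scale-columns : {A : Set} (a : A → ℤ) (c : A → Column) → ∀ n o pre xs →
    D n o (pre ++ map (λ x → scale (a x) (c x)) xs) ≡ product a xs * D n o (pre ++ map c xs)
  D-scale-columns a c n o pre []       = sym (*-identityˡ _)
  D-scale-columns a c n o pre (x ∷ xs) = begin
    D n o (pre ++ scale (a x) (c x) ∷ map (λ x → scale (a x) (c x)) xs)
      ≡⟨ D-scale n o pre (a x) (c x) _ ⟩
    a x * D n o (pre ++ c x ∷ map (λ x → scale (a x) (c x)) xs)
      ≡⟨ cong (λ l → a x * D n o l) (sym (snoc-++ pre (c x) _)) ⟩
    a x * D n o ((pre ++ c x ∷ []) ++ map (λ x → scale (a x) (c x)) xs)
      ≡⟨ cong (a x *_) (D-scale-columns a c n o (pre ++ c x ∷ []) xs) ⟩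
    a x * (product a xs * D n o ((pre ++ c x ∷ []) ++ map c xs))
      ≡⟨ cong (λ l → a x * (product a xs * D n o l)) (snoc-++ pre (c x) _) ⟩
    a x * (product a xs * D n o (pre ++ c x ∷ map c xs))
      ≡⟨ sym (*-assoc (a x) _ _) ⟩
    a x * product a xs * D n o (pre ++ c x ∷ map c xs) ∎

  rowProduct : (ℕ → ℤ) → ℕ → ℕ → ℤ
  rowProduct r zero    o = 1ℤ
  rowProduct r (suc n) o = r o * rowProduct r n (suc o)

  scaleRows : (ℕ → ℤ) → Column → Column
  scaleRows r c i = r i * c i

  laplace-scale-rows : ∀ r o (F G : Functional) p → (∀ l → F (map (scaleRows r) l) ≡ p * G l) →
    ∀ cs → laplace o F (map (scaleRows r) cs) ≡ r o * p * laplace o G cs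
  laplace-scale-rows r o F G p h []       = sym (*-zeroʳ (r o * p))
  laplace-scale-rows r o F G p h (c ∷ cs) = trans
    (cong₂ (λ u v → r o * c o * u - v) (h cs) (laplace-scale-rows r o (F ∘ (scaleRows r c ∷_)) (G ∘ (c ∷_)) p (λ l → h (c ∷ l)) cs))
    (regroup (r o) (c o) p (G cs) _)
    where
    regroup : ∀ r c p g l → r * c * (p * g) - r * p * l ≡ r * p * (c * g - l)
    regroup = solve-∀

  D-scale-rows : ∀ r n o cs → D n o (map (scaleRows r) cs) ≡ rowProduct r n o * D n o cs
  D-scale-rows r zero    o []       = refl
  D-scale-rows r zero    o (c ∷ cs) = refl
  D-scale-rows r (suc n) o cs = laplace-scale-rows r o (D n (suc o)) (D n (suc o)) _ (D-scale-rows r n (suc o)) cs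

  -- Monic polynomials of degree `i` in `X`, built with nodes `γ`. The constants `δ` are 0 in the
  -- application; they are there to make the family closed under divided differences, which produce
  -- the values at the subtracted point as new constants.
  newton : (γ δ : ℕ → ℤ) → ℤ → Column
  newton γ δ X zero    = 1ℤ
  newton γ δ X (suc i) = (X - γ i) * newton γ δ X i + δ i

  vandermonde : List ℤ → ℤ
  vandermonde []       = 1ℤ
  vandermonde (X ∷ Xs) = product (_- X) Xs * vandermonde Xs

  -- Dividing the difference of two Newton columns by Y − X gives another such family.
  newton-difference : ∀ γ δ X Y i →
    (newton γ δ Y ⊖ newton γ δ X) (suc i) ≡ (Y - X) * newton (γ ∘ suc) (λ j → newton γ δ X (suc j)) Y i
  newton-difference γ δ X Y zero = lem (γ 0) (δ 0) X Y
    where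
    lem : ∀ g d X Y → -1ℤ * ((X - g) * 1ℤ + d) + ((Y - g) * 1ℤ + d) ≡ (Y - X) * 1ℤ
    lem = solve-∀
  newton-difference γ δ X Y (suc i) = trans
    (lem₁ (γ (suc i)) (δ (suc i)) X Y (newton γ δ X (suc i)) (newton γ δ Y (suc i)))
    (trans (cong (λ u → (Y - γ (suc i)) * u + (Y - X) * newton γ δ X (suc i)) (newton-difference γ δ X Y i))
      (lem₂ (γ (suc i)) X Y _ (newton γ δ X (suc i))))
    where
    lem₁ : ∀ g d X Y a b → -1ℤ * ((X - g) * a + d) + ((Y - g) * b + d) ≡ (Y - g) * (-1ℤ * a + b) + (Y - X) * a
    lem₁ = solve-∀
    lem₂ : ∀ g X Y u a → (Y - g) * ((Y - X) * u) + (Y - X) * a ≡ (Y - X) * ((Y - g) * u + a)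
    lem₂ = solve-∀

  -- Subtracting the first column leaves 1, 0, ..., 0 in the top row, and dividing the other columns
  -- by `Y - X` leaves Newton columns with new nodes and constants. Hence the induction is over all
  -- `γ` and `δ`.
  D-vandermonde : ∀ γ δ Xs → D (length Xs) 0 (map (newton γ δ) Xs) ≡ vandermonde Xs
  D-vandermonde γ δ []       = refl
  D-vandermonde γ δ (X ∷ Xs) = begin
    D (suc (length Xs)) 0 (v ∷ map (newton γ δ) Xs)
      ≡⟨ sym (D-subtract-first (suc (length Xs)) 0 v [] (map (newton γ δ) Xs)) ⟩
    D (suc (length Xs)) 0 (v ∷ map (_⊖ v) (map (newton γ δ) Xs))
      ≡⟨ D-unit-row (length Xs) 0 v refl (zeros Xs) ⟩
    D (length Xs) 1 (map (_⊖ v) (map (newton γ δ) Xs))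
      ≡⟨ D-shift (length Xs) 0 _ ⟩
    D (length Xs) 0 (map (_∘ suc) (map (_⊖ v) (map (newton γ δ) Xs)))
      ≡⟨ D-ext (length Xs) 0 (differences Xs) ⟩
    D (length Xs) 0 (map (λ Y → scale (Y - X) (newton (γ ∘ suc) δ′ Y)) Xs)
      ≡⟨ D-scale-columns (_- X) (newton (γ ∘ suc) δ′) (length Xs) 0 [] Xs ⟩
    product (_- X) Xs * D (length Xs) 0 (map (newton (γ ∘ suc) δ′) Xs)
      ≡⟨ cong (product (_- X) Xs *_) (D-vandermonde (γ ∘ suc) δ′ Xs) ⟩
    product (_- X) Xs * vandermonde Xs ∎
    where
    v : Column
    v = newton γ δ X
    δ′ : ℕ → ℤ
    δ′ j = newton γ δ X (suc j)
    zeros : ∀ Ys → All (λ d → d 0 ≡ 0ℤ) (map (_⊖ v) (map (newton γ δ) Ys))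
    zeros []       = []
    zeros (Y ∷ Ys) = refl ∷ zeros Ys
    differences : ∀ Ys → Pointwise _≗_ (map (_∘ suc) (map (_⊖ v) (map (newton γ δ) Ys))) (map (λ Y → scale (Y - X) (newton (γ ∘ suc) δ′ Y)) Ys)
    differences []       = []
    differences (Y ∷ Ys) = newton-difference γ δ X Y ∷ differences Ys

-- Interlacing dents, determinants in φ and discriminants

module Products where

  open Chains
  open Determinants
  open import Data.Bool using (Bool; true; false; not)
  open import Data.Nat as ℕ using (ℕ; zero; suc; s≤s)
  import Data.Nat.Properties as ℕ
  open import Data.Integer using (ℤ; 0ℤ; 1ℤ; -1ℤ; +_; _+_; _-_; _*_; -_)
  open import Data.Integer.Properties
  open import Data.Integer.Tactic.RingSolver using (solve-∀)
  open import Data.List using (List; []; _∷_; _++_; length; map)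
  open import Data.List.Properties using (length-replicate; length-map; map-∘)
  open import Data.List.Relation.Binary.Pointwise as PW using (Pointwise; []; _∷_)
  open import Data.List.Relation.Unary.All using (All; []; _∷_)
  open import Function using (_∘_)
  open import Relation.Binary.PropositionalEquality
  open ≡-Reasoning

  sumℤ : List Bool → (List Bool → ℤ) → ℤ
  sumℤ []          f = f []
  sumℤ (true  ∷ D) f = sumℤ D (λ V → f (true ∷ V))
  sumℤ (false ∷ D) f = sumℤ D (λ V → f (false ∷ V)) + sumℤ D (λ V → f (true ∷ V))

  sumℤ-cong : ∀ D {f g} → (∀ V → D ⊑ V → f V ≡ g V) → sumℤ D f ≡ sumℤ D g
  sumℤ-cong []          h = h [] nil
  sumℤ-cong (true ∷ D)  h = sumℤ-cong D (λ V s → h _ (keep s))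
  sumℤ-cong (false ∷ D) h = cong₂ _+_ (sumℤ-cong D (λ V s → h _ (free false s))) (sumℤ-cong D (λ V s → h _ (free true s)))

  sumℤ-zero : ∀ D (f : List Bool → ℤ) → (∀ V → f V ≡ 0ℤ) → sumℤ D f ≡ 0ℤ
  sumℤ-zero []          f h = h []
  sumℤ-zero (true ∷ D)  f h = sumℤ-zero D _ (λ V → h _)
  sumℤ-zero (false ∷ D) f h = cong₂ _+_ (sumℤ-zero D _ (λ V → h _)) (sumℤ-zero D _ (λ V → h _))

  pos-sumM : ∀ D (f : List Bool → ℕ) → + sumM D f ≡ sumℤ D (λ V → + f V)
  pos-sumM []          f = refl
  pos-sumM (true ∷ D)  f = pos-sumM D _
  pos-sumM (false ∷ D) f = trans (pos-+ (sumM D _) _) (cong₂ _+_ (pos-sumM D _) (pos-sumM D _))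

  sumℤ-*ˡ : ∀ D c (f : List Bool → ℤ) → c * sumℤ D f ≡ sumℤ D (λ V → c * f V)
  sumℤ-*ˡ []          c f = refl
  sumℤ-*ˡ (true ∷ D)  c f = sumℤ-*ˡ D c _
  sumℤ-*ˡ (false ∷ D) c f = trans (*-distribˡ-+ c _ _) (cong₂ _+_ (sumℤ-*ˡ D c _) (sumℤ-*ˡ D c _))

  marks : {A : Set} → (ℕ → A) → ℕ → List Bool → List A
  marks f t []          = []
  marks f t (true ∷ P)  = f t ∷ marks f (suc t) P
  marks f t (false ∷ P) = marks f (suc t) P

  marks-cong : ∀ {f g : ℕ → Column} → (∀ t → f t ≗ g t) → ∀ t P → Pointwise _≗_ (marks f t P) (marks g t P)
  marks-cong h t []          = []
  marks-cong h t (true ∷ P)  = h t ∷ marks-cong h (suc t) P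
  marks-cong h t (false ∷ P) = marks-cong h (suc t) P

  map-marks : {A B : Set} (g : A → B) (f : ℕ → A) → ∀ t P → map g (marks f t P) ≡ marks (g ∘ f) t P
  map-marks g f t []          = refl
  map-marks g f t (true ∷ P)  = cong (g (f t) ∷_) (map-marks g f (suc t) P)
  map-marks g f t (false ∷ P) = map-marks g f (suc t) P

  module Interlacing (n o : ℕ) (f F : ℕ → Column) (f≗ : ∀ t → f t ≗ (F (suc t) ⊖ F t)) where

    Dn : List Column → ℤ
    Dn = D n o

    -- `c` belongs to a mark of `V` that is still to be followed by a mark of `P`. If no mark of `P`
    -- is left, such a chain has no pairing, whence the 0.
    after : List Column → Column → List Column → ℤ
    after pre c []       = 0ℤ
    after pre c (e ∷ es) = Dn (pre ++ c ∷ diffs e es)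

    -- The chain can be paired off exactly when the marks of `V` and `P` alternate, beginning with
    -- `V` and ending with `P`. As the determinant is linear in each column, summing over the
    -- positions of one mark of `V` between two marks of `P` telescopes to a difference of values of
    -- `F`.
    interlaceᵈ : ∀ pre t P →
      sumℤ (falses (length P)) (λ V → + pm false (il V P) * Dn (pre ++ marks f t V)) ≡ Dn (pre ++ diffs (F t) (marks F (suc t) P))
    interlaceᵘ : ∀ pre c t p P →
      sumℤ (falses (length P)) (λ V → + pm false (il (p ∷ P) V) * Dn (pre ++ c ∷ marks f t V)) ≡ after pre c (marks F t (p ∷ P))

    -- The next mark of `V` is either at `t` or further right. The two columns `f t` and
    -- `e - F (t + 1)` add up to `e - F t`.
    split-gap : ∀ pre t es →
      Dn (pre ++ diffs (F (suc t)) es) + after pre (f t) es ≡ Dn (pre ++ diffs (F t) es)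
    split-gap pre t []       = +-identityʳ _
    split-gap pre t (e ∷ es) = begin
      Dn (pre ++ (e ⊖ F (suc t)) ∷ diffs e es) + Dn (pre ++ f t ∷ diffs e es)
        ≡⟨ cong (_+ Dn (pre ++ f t ∷ diffs e es)) (sym (*-identityˡ (Dn (pre ++ (e ⊖ F (suc t)) ∷ diffs e es)))) ⟩
      1ℤ * Dn (pre ++ (e ⊖ F (suc t)) ∷ diffs e es) + Dn (pre ++ f t ∷ diffs e es)
        ≡⟨ sym (D-lin n o pre 1ℤ (e ⊖ F (suc t)) (f t) (diffs e es)) ⟩
      Dn (pre ++ axpy 1ℤ (e ⊖ F (suc t)) (f t) ∷ diffs e es)
        ≡⟨ D-ext n o (PW.++⁺ (PW.refl {R = _≗_} (λ _ → refl) {pre})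
             ((λ i → trans (cong (λ u → 1ℤ * (e ⊖ F (suc t)) i + u) (f≗ t i)) (lem (e i) (F (suc t) i) (F t i)))
              ∷ PW.refl {R = _≗_} (λ _ → refl) {diffs e es})) ⟩
      Dn (pre ++ (e ⊖ F t) ∷ diffs e es) ∎
      where
      lem : ∀ e a b → 1ℤ * (-1ℤ * a + e) + (-1ℤ * b + a) ≡ -1ℤ * b + e
      lem = solve-∀

    interlaceᵈ pre t []          = *-identityˡ _
    interlaceᵈ pre t (true ∷ P)  = begin
      sumℤ (falses (length P)) (λ V → 0ℤ * Dn (pre ++ marks f (suc t) V))
        + sumℤ (falses (length P)) (λ V → + pm false (il (true ∷ P) V) * Dn (pre ++ f t ∷ marks f (suc t) V))
        ≡⟨ cong₂ _+_ (sumℤ-zero (falses (length P)) _ (λ V → refl)) (interlaceᵘ pre (f t) (suc t) true P) ⟩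
      0ℤ + Dn (pre ++ f t ∷ diffs (F (suc t)) (marks F (suc (suc t)) P))
        ≡⟨ +-identityˡ _ ⟩
      Dn (pre ++ f t ∷ diffs (F (suc t)) (marks F (suc (suc t)) P))
        ≡⟨ D-ext n o (PW.++⁺ (PW.refl {R = _≗_} (λ _ → refl) {pre}) (f≗ t ∷ PW.refl {R = _≗_} (λ _ → refl))) ⟩
      Dn (pre ++ diffs (F t) (F (suc t) ∷ marks F (suc (suc t)) P)) ∎
    interlaceᵈ pre t (false ∷ P) = trans
      (cong₂ _+_ (interlaceᵈ pre (suc t) P) (interlaceᵘ pre (f t) (suc t) false P))
      (split-gap pre t (marks F (suc (suc t)) P))
    interlaceᵘ pre c t true P = trans
      (sumℤ-cong (falses (length P)) (λ V _ → cong (λ l → + pm false (il V P) * Dn l) (sym (snoc-++ pre c (marks f t V)))))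
      (trans (interlaceᵈ (pre ++ c ∷ []) t P) (cong Dn (snoc-++ pre c _)))
    interlaceᵘ pre c t false []      = refl
    interlaceᵘ pre c t false (p ∷ P) = trans
      (cong₂ _+_ (interlaceᵘ pre c (suc t) p P) (sumℤ-zero (falses (length P)) _ (λ V → refl)))
      (+-identityʳ _)

  -- The central factorial of step 2, (x - n + 1)(x - n + 3) ⋯ (x + n - 1), with opposite factors
  -- paired. It has the parity of `n`.
  φ : ℕ → ℤ → ℤ
  φ zero          x = 1ℤ
  φ (suc zero)    x = x
  φ (suc (suc n)) x = φ n x * (x * x - (1ℤ + + n) * (1ℤ + + n))

  φ-shiftʳ : ∀ n x → φ (suc n) (x + 1ℤ) ≡ φ n x * (x + 1ℤ + + n)
  φ-shiftʳ zero          x = lem x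
    where
    lem : ∀ x → x + 1ℤ ≡ 1ℤ * (x + 1ℤ + 0ℤ)
    lem = solve-∀
  φ-shiftʳ (suc zero)    x = lem x
    where
    lem : ∀ x → 1ℤ * ((x + 1ℤ) * (x + 1ℤ) - 1ℤ) ≡ x * (x + 1ℤ + 1ℤ)
    lem = solve-∀
  φ-shiftʳ (suc (suc n)) x = trans (cong (_* ((x + 1ℤ) * (x + 1ℤ) - (1ℤ + + suc n) * (1ℤ + + suc n))) (φ-shiftʳ n x)) (lem (φ n x) x (+ n))
    where
    lem : ∀ p x n → p * (x + 1ℤ + n) * ((x + 1ℤ) * (x + 1ℤ) - (1ℤ + (1ℤ + n)) * (1ℤ + (1ℤ + n)))
      ≡ p * (x * x - (1ℤ + n) * (1ℤ + n)) * (x + 1ℤ + (+ 2 + n))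
    lem = solve-∀

  φ-shiftˡ : ∀ n x → φ (suc n) (x - 1ℤ) ≡ φ n x * (x - 1ℤ - + n)
  φ-shiftˡ zero          x = lem x
    where
    lem : ∀ x → x - 1ℤ ≡ 1ℤ * (x - 1ℤ - 0ℤ)
    lem = solve-∀
  φ-shiftˡ (suc zero)    x = lem x
    where
    lem : ∀ x → 1ℤ * ((x - 1ℤ) * (x - 1ℤ) - 1ℤ) ≡ x * (x - 1ℤ - 1ℤ)
    lem = solve-∀
  φ-shiftˡ (suc (suc n)) x = trans (cong (_* ((x - 1ℤ) * (x - 1ℤ) - (1ℤ + + suc n) * (1ℤ + + suc n))) (φ-shiftˡ n x)) (lem (φ n x) x (+ n))
    where
    lem : ∀ p x n → p * (x - 1ℤ - n) * ((x - 1ℤ) * (x - 1ℤ) - (1ℤ + (1ℤ + n)) * (1ℤ + (1ℤ + n)))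
      ≡ p * (x * x - (1ℤ + n) * (1ℤ + n)) * (x - 1ℤ - (+ 2 + n))
    lem = solve-∀

  φ-difference : ∀ n x → -1ℤ * φ (suc n) (x - 1ℤ) + φ (suc n) (x + 1ℤ) ≡ (+ 2 * (1ℤ + + n)) * φ n x
  φ-difference n x = trans (cong₂ (λ u v → -1ℤ * u + v) (φ-shiftˡ n x) (φ-shiftʳ n x)) (lem (φ n x) x (+ n))
    where
    lem : ∀ p x n → -1ℤ * (p * (x - 1ℤ - n)) + p * (x + 1ℤ + n) ≡ (+ 2 * (1ℤ + n)) * p
    lem = solve-∀

  dbl : ℕ → ℕ
  dbl zero    = zero
  dbl (suc n) = suc (suc (dbl n))

  -- The base-side triangles of an n-row trapezoid lie in the columns 2, 4, … for even n
  -- and in the columns 1, 3, … for odd n.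
  abscissa : Bool → ℕ → ℤ
  abscissa true  t = + 2 * (1ℤ + + t)
  abscissa false t = + 2 * + t + 1ℤ

  -- The zigzag acts as a mirror at position 0: even positions go with the odd polynomials, which
  -- vanish there, and odd positions with the even ones.
  basis : Bool → ℤ → Column
  basis true  x i = φ (suc (dbl i)) x
  basis false x i = φ (dbl i) x

  cols : Bool → List Bool → List Column
  cols b = marks (λ t → basis b (abscissa b t)) 0

  -- The constants of `φ-difference` for the degrees occurring in `basis`; passing from one row to
  -- the next costs their product.
  rowFactor : Bool → ℕ → ℤ
  rowFactor true  i = + 2 * (1ℤ + + suc (dbl i))
  rowFactor false i = + 2 * (1ℤ + + dbl i)

  -- The number of dents forced on a trapezoid with `n` rows, namely half of `n` rounded up: its
  -- base length when the top has length 0.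
  rank : ℕ → ℕ
  rank n = baseLength n 0

  norm : ℕ → ℤ
  norm zero    = 1ℤ
  norm (suc n) = rowProduct (rowFactor (ev n)) (rank n) 0 * norm n

  φ-odd-0 : ∀ i → φ (suc (dbl i)) 0ℤ ≡ 0ℤ
  φ-odd-0 zero    = refl
  φ-odd-0 (suc i) = cong (_* (0ℤ * 0ℤ - (1ℤ + + suc (dbl i)) * (1ℤ + + suc (dbl i)))) (φ-odd-0 i)

  marks-suc : {A : Set} (f : ℕ → A) → ∀ t P → marks f (suc t) P ≡ marks (λ t → f (suc t)) t P
  marks-suc f t []          = refl
  marks-suc f t (true ∷ P)  = cong (f (suc t) ∷_) (marks-suc f (suc t) P)
  marks-suc f t (false ∷ P) = marks-suc f (suc t) P

  private
    weigh-sum : ∀ l k c N (w t : List Bool → ℕ) (cs : List Bool → List Column) →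
      (∀ V → length V ≡ l → + t V * N ≡ D k 0 (cs V)) →
      + sumB l (λ V → w V ℕ.* t V) * (rowProduct c k 0 * N) ≡ sumℤ (falses l) (λ V → + w V * D k 0 (map (scaleRows c) (cs V)))
    weigh-sum l k c N w t cs h = begin
      + sumB l (λ V → w V ℕ.* t V) * (R * N)
        ≡⟨ *-comm _ (R * N) ⟩
      (R * N) * + sumB l (λ V → w V ℕ.* t V)
        ≡⟨ cong ((R * N) *_) (pos-sumM (falses l) _) ⟩
      (R * N) * sumℤ (falses l) (λ V → + (w V ℕ.* t V))
        ≡⟨ sumℤ-*ˡ (falses l) (R * N) _ ⟩
      sumℤ (falses l) (λ V → (R * N) * + (w V ℕ.* t V))
        ≡⟨ sumℤ-cong (falses l) (λ V s → begin
             (R * N) * + (w V ℕ.* t V)       ≡⟨ cong ((R * N) *_) (pos-* (w V) (t V)) ⟩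
             (R * N) * (+ w V * + t V)       ≡⟨ lem R N (+ w V) (+ t V) ⟩
             + w V * (R * (+ t V * N))       ≡⟨ cong (λ u → + w V * (R * u)) (h V (trans (⊑-length s) (length-replicate l))) ⟩
             + w V * (R * D k 0 (cs V))      ≡⟨ cong (+ w V *_) (sym (D-scale-rows c k 0 (cs V))) ⟩
             + w V * D k 0 (map (scaleRows c) (cs V)) ∎) ⟩
      sumℤ (falses l) (λ V → + w V * D k 0 (map (scaleRows c) (cs V))) ∎
      where
      R : ℤ
      R = rowProduct c k 0
      lem : ∀ r n w t → (r * n) * (w * t) ≡ w * (r * (t * n))
      lem = solve-∀

  -- In both steps the sum over the triangles of the next row interlacing P telescopes, as
  -- φ (n + 1) (x + 1) − φ (n + 1) (x − 1) is a multiple of φ n x.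
  step-even : ∀ k P N t → (∀ V → length V ≡ length P → + t V * N ≡ D k 0 (cols false V)) →
    + sumB (length P) (λ V → pm false (il V P) ℕ.* t V) * (rowProduct (rowFactor false) k 0 * N) ≡ D k 0 (cols true P)
  step-even k P N t h = begin
    + sumB (length P) (λ V → pm false (il V P) ℕ.* t V) * (rowProduct (rowFactor false) k 0 * N)
      ≡⟨ weigh-sum (length P) k (rowFactor false) N (λ V → pm false (il V P)) t (cols false) h ⟩
    sumℤ (falses (length P)) (λ V → + pm false (il V P) * D k 0 (map (scaleRows (rowFactor false)) (cols false V)))
      ≡⟨ sumℤ-cong (falses (length P)) (λ V _ → cong (λ l → + pm false (il V P) * D k 0 l) (map-marks _ _ 0 V)) ⟩
    sumℤ (falses (length P)) (λ V → + pm false (il V P) * D k 0 (marks f 0 V))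
      ≡⟨ Interlacing.interlaceᵈ k 0 f F f≗ [] 0 P ⟩
    D k 0 (diffs (F 0) (marks F 1 P))
      ≡⟨ from-zero (marks F 1 P) ⟩
    D k 0 (marks F 1 P)
      ≡⟨ cong (D k 0) (marks-suc F 0 P) ⟩
    D k 0 (marks (λ t → F (suc t)) 0 P)
      ≡⟨ D-ext k 0 (marks-cong {λ t → F (suc t)} (λ t i → refl) 0 P) ⟩
    D k 0 (cols true P) ∎
    where
    f F : ℕ → Column
    f t = scaleRows (rowFactor false) (basis false (abscissa false t))
    F t = basis true (+ 2 * + t)
    f≗ : ∀ t → f t ≗ (F (suc t) ⊖ F t)
    f≗ t i = trans (sym (φ-difference (dbl i) (+ 2 * + t + 1ℤ)))
      (cong₂ (λ u v → -1ℤ * φ (suc (dbl i)) u + φ (suc (dbl i)) v) (lem₁ (+ t)) (lem₂ (+ t)))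
      where
      lem₁ : ∀ t → + 2 * t + 1ℤ - 1ℤ ≡ + 2 * t
      lem₁ = solve-∀
      lem₂ : ∀ t → + 2 * t + 1ℤ + 1ℤ ≡ + 2 * (1ℤ + t)
      lem₂ = solve-∀
    -- `F 0` consists of odd polynomials at 0, so it is the zero column. The first difference, taken
    -- from the left boundary, is therefore the first column itself.
    from-zero : ∀ es → D k 0 (diffs (F 0) es) ≡ D k 0 es
    from-zero []       = refl
    from-zero (e ∷ es) = trans
      (D-ext k 0 ((λ i → trans (cong (λ u → -1ℤ * u + e i) (φ-odd-0 i)) (+-identityˡ (e i))) ∷ PW.refl {R = _≗_} (λ _ → refl)))
      (D-telescope k 0 [] e es)

  step-odd : ∀ k p P N t → (∀ V → length V ≡ length P → + t V * N ≡ D k 0 (cols true V)) →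
    + sumB (length P) (λ V → pm false (il (p ∷ P) V) ℕ.* t V) * (rowProduct (rowFactor true) k 0 * N) ≡ D (suc k) 0 (cols false (p ∷ P))
  step-odd k p P N t h = begin
    + sumB (length P) (λ V → pm false (il (p ∷ P) V) ℕ.* t V) * (rowProduct (rowFactor true) k 0 * N)
      ≡⟨ weigh-sum (length P) k (rowFactor true) N (λ V → pm false (il (p ∷ P) V)) t (cols true) h ⟩
    sumℤ (falses (length P)) (λ V → + pm false (il (p ∷ P) V) * D k 0 (map (scaleRows (rowFactor true)) (cols true V)))
      ≡⟨ sumℤ-cong (falses (length P)) (λ V _ → cong (λ u → + pm false (il (p ∷ P) V) * u) (add-row V)) ⟩
    sumℤ (falses (length P)) (λ V → + pm false (il (p ∷ P) V) * D (suc k) 0 (one ∷ marks f 0 V))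
      ≡⟨ Interlacing.interlaceᵘ (suc k) 0 f F f≗ [] one 0 p P ⟩
    Interlacing.after (suc k) 0 f F f≗ [] one (marks F 0 (p ∷ P))
      ≡⟨ first-column 0 (p ∷ P) ⟩
    D (suc k) 0 (cols false (p ∷ P)) ∎
    where
    one : Column
    one _ = 1ℤ
    f F : ℕ → Column
    f t zero    = 0ℤ
    f t (suc i) = scaleRows (rowFactor true) (basis true (abscissa true t)) i
    F t = basis false (abscissa false t)
    f≗ : ∀ t → f t ≗ (F (suc t) ⊖ F t)
    f≗ t zero    = refl
    f≗ t (suc i) = trans (sym (φ-difference (suc (dbl i)) (+ 2 * (1ℤ + + t))))
      (cong (λ u → -1ℤ * φ (suc (suc (dbl i))) u + φ (suc (suc (dbl i))) (+ 2 * (1ℤ + + t) + 1ℤ)) (lem (+ t)))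
      where
      lem : ∀ t → + 2 * (1ℤ + t) - 1ℤ ≡ + 2 * t + 1ℤ
      lem = solve-∀
    zero-row : ∀ t V → All (λ c → c 0 ≡ 0ℤ) (marks f t V)
    zero-row t []          = []
    zero-row t (true ∷ V)  = refl ∷ zero-row (suc t) V
    zero-row t (false ∷ V) = zero-row (suc t) V
    -- Here the chain opens with `P`, which has one mark more than `V`. The column `one` stands for
    -- a fictitious mark of `V` at the left end, and row 0 belongs to the constant polynomial `φ 0`,
    -- whose differences vanish; bordering by both leaves the determinant unchanged.
    add-row : ∀ V → D k 0 (map (scaleRows (rowFactor true)) (cols true V)) ≡ D (suc k) 0 (one ∷ marks f 0 V)
    add-row V = sym (begin
      D (suc k) 0 (one ∷ marks f 0 V)        ≡⟨ D-unit-row k 0 one refl (zero-row 0 V) ⟩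
      D k 1 (marks f 0 V)                    ≡⟨ D-shift k 0 _ ⟩
      D k 0 (map (_∘ suc) (marks f 0 V))     ≡⟨ cong (D k 0) (trans (map-marks _ f 0 V) (sym (map-marks _ _ 0 V))) ⟩
      D k 0 (map (scaleRows (rowFactor true)) (cols true V)) ∎)
    diffs-row : ∀ t t′ V → All (λ c → c 0 ≡ 0ℤ) (diffs (F t) (marks F t′ V))
    diffs-row t t′ []          = []
    diffs-row t t′ (true ∷ V)  = refl ∷ diffs-row t′ (suc t′) V
    diffs-row t t′ (false ∷ V) = diffs-row t (suc t′) V
    -- `one` may be replaced by the first column `F t`: both have 1 in row 0, where all the
    -- differences have 0.
    first-column : ∀ t V → Interlacing.after (suc k) 0 f F f≗ [] one (marks F t V) ≡ D (suc k) 0 (marks F t V)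
    first-column t []          = refl
    first-column t (false ∷ V) = first-column (suc t) V
    first-column t (true ∷ V)  = begin
      D (suc k) 0 (one ∷ diffs (F t) (marks F (suc t) V))  ≡⟨ D-unit-row k 0 one refl (diffs-row t (suc t) V) ⟩
      D k 1 (diffs (F t) (marks F (suc t) V))              ≡⟨ sym (D-unit-row k 0 (F t) refl (diffs-row t (suc t) V)) ⟩
      D (suc k) 0 (F t ∷ diffs (F t) (marks F (suc t) V))  ≡⟨ D-telescope (suc k) 0 [] (F t) (marks F (suc t) V) ⟩
      D (suc k) 0 (F t ∷ marks F (suc t) V) ∎

  -- The bound on the length says that the base has room for the required dents. In particular the
  -- base of a nonempty trapezoid is nonempty, which the odd step needs in order to start its chain.
  T-determinant : ∀ n P → rank n ℕ.≤ length P → + T n P * norm n ≡ D (rank n) 0 (cols (ev n) P)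
  T-determinant zero    P r = trans (*-identityʳ _) (go 0 P)
    where
    go : ∀ t P → + none P ≡ D 0 0 (marks (λ t → basis true (abscissa true t)) t P)
    go t []          = refl
    go t (true ∷ P)  = refl
    go t (false ∷ P) = go (suc t) P
  T-determinant (suc n) P r = step (ev n) (rank n) P (norm n) (T n) r (T-determinant n)
    where
    step : ∀ b k P N t → above b k ℕ.≤ length P → (∀ V → k ℕ.≤ length V → + t V * N ≡ D k 0 (cols b V)) →
      + sumB (below b (length P)) (λ V → fit b V P ℕ.* t V) * (rowProduct (rowFactor b) k 0 * N) ≡ D (above b k) 0 (cols (not b) P)
    step true  k (p ∷ P) N t (s≤s r) h = step-odd k p P N t (λ V e → h V (ℕ.≤-trans r (ℕ.≤-reflexive (sym e))))
    step false k P       N t r       h = step-even k P N t (λ V e → h V (ℕ.≤-trans r (ℕ.≤-reflexive (sym e))))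

  points : Bool → ℕ → List Bool → List ℤ
  points b = marks (abscissa b)

  weight : Bool → ℤ → ℤ
  weight true  x = x
  weight false x = 1ℤ

  -- The determinant of the polynomials `φ` at the points of `L`: each is a polynomial in x², with
  -- an additional factor x in odd degree, which accounts for `weight`.
  discriminant : Bool → List ℤ → ℤ
  discriminant b L = product (weight b) L * vandermonde (map (λ x → x * x) L)

  node : Bool → ℕ → ℤ
  node true  i = (1ℤ + + suc (dbl i)) * (1ℤ + + suc (dbl i))
  node false i = (1ℤ + + dbl i) * (1ℤ + + dbl i)

  basis-newton : ∀ b x → basis b x ≗ scale (weight b x) (newton (node b) (λ _ → 0ℤ) (x * x))
  basis-newton true  x zero    = sym (*-identityʳ x)
  basis-newton false x zero    = refl
  basis-newton true  x (suc i) = trans (cong (_* (x * x - node true i)) (basis-newton true x i))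
    (lem x _ (x * x - node true i))
    where
    lem : ∀ w p g → w * p * g ≡ w * (g * p + 0ℤ)
    lem = solve-∀
  basis-newton false x (suc i) = trans (cong (_* (x * x - node false i)) (basis-newton false x i))
    (lem 1ℤ _ (x * x - node false i))
    where
    lem : ∀ w p g → w * p * g ≡ w * (g * p + 0ℤ)
    lem = solve-∀

  D-points : ∀ b L → D (length L) 0 (map (basis b) L) ≡ discriminant b L
  D-points b L = begin
    D (length L) 0 (map (basis b) L)
      ≡⟨ D-ext (length L) 0 (pointwise L) ⟩
    D (length L) 0 (map (λ x → scale (weight b x) (newton (node b) (λ _ → 0ℤ) (x * x))) L)
      ≡⟨ D-scale-columns (weight b) _ (length L) 0 [] L ⟩
    product (weight b) L * D (length L) 0 (map (λ x → newton (node b) (λ _ → 0ℤ) (x * x)) L)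
      ≡⟨ cong (product (weight b) L *_) (trans
           (cong₂ (λ n cs → D n 0 cs) (sym (length-map (λ x → x * x) L)) (map-∘ L))
           (D-vandermonde (node b) (λ _ → 0ℤ) (map (λ x → x * x) L))) ⟩
    discriminant b L ∎
    where
    pointwise : ∀ L → Pointwise _≗_ (map (basis b) L) (map (λ x → scale (weight b x) (newton (node b) (λ _ → 0ℤ) (x * x))) L)
    pointwise []      = []
    pointwise (x ∷ L) = basis-newton b x ∷ pointwise L

  T-product : ∀ n P → rank n ℕ.≤ length P → length (points (ev n) 0 P) ≡ rank n →
    + T n P * norm n ≡ discriminant (ev n) (points (ev n) 0 P)
  T-product n P r e = begin
    + T n P * norm n                                             ≡⟨ T-determinant n P r ⟩
    D (rank n) 0 (cols (ev n) P)                                 ≡⟨ cong₂ (λ k cs → D k 0 cs) (sym e) (sym (map-marks _ _ 0 P)) ⟩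
    D (length L) 0 (map (basis (ev n)) L)                        ≡⟨ D-points (ev n) L ⟩
    discriminant (ev n) L ∎
    where
    L : List ℤ
    L = points (ev n) 0 P

  T-vanishes : ∀ n P → rank n ℕ.≤ length P → length (points (ev n) 0 P) ≢ rank n → + T n P * norm n ≡ 0ℤ
  T-vanishes n P r e = trans (T-determinant n P r) (D-length (rank n) 0 (cols (ev n) P)
    (λ e′ → e (trans (sym (trans (cong length (sym (map-marks (basis (ev n)) _ 0 P))) (length-map (basis (ev n)) (points (ev n) 0 P)))) e′)))

  cross : List ℤ → List ℤ → ℤ
  cross L L′ = product (λ x → product (λ y → y * y - x * x) L′) L

  product-++ : {A : Set} (g : A → ℤ) → ∀ L L′ → product g (L ++ L′) ≡ product g L * product g L′
  product-++ g []      L′ = sym (*-identityˡ _)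
  product-++ g (x ∷ L) L′ = trans (cong (g x *_) (product-++ g L L′)) (sym (*-assoc (g x) _ _))

  product-map : {A B : Set} (g : B → ℤ) (f : A → B) → ∀ L → product g (map f L) ≡ product (λ x → g (f x)) L
  product-map g f []      = refl
  product-map g f (x ∷ L) = cong (g (f x) *_) (product-map g f L)

  product-* : {A : Set} (f g h : A → ℤ) → (∀ x → f x * g x ≡ h x) → ∀ L → product f L * product g L ≡ product h L
  product-* f g h e []      = refl
  product-* f g h e (x ∷ L) = trans (lem (f x) (g x) (product f L) (product g L)) (cong₂ _*_ (e x) (product-* f g h e L))
    where
    lem : ∀ a b p q → a * p * (b * q) ≡ a * b * (p * q)
    lem = solve-∀

  squares : List ℤ → List ℤ
  squares = map (λ x → x * x)

  vandermonde-++ : ∀ L L′ → vandermonde (squares (L ++ L′)) ≡ vandermonde (squares L) * vandermonde (squares L′) * cross L L′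
  vandermonde-++ []      L′ = lem (vandermonde (squares L′))
    where
    lem : ∀ v → v ≡ 1ℤ * v * 1ℤ
    lem = solve-∀
  vandermonde-++ (x ∷ L) L′ = begin
    product (_- x * x) (squares (L ++ L′)) * vandermonde (squares (L ++ L′))
      ≡⟨ cong₂ _*_ (product-map (_- x * x) (λ y → y * y) (L ++ L′)) (vandermonde-++ L L′) ⟩
    product g (L ++ L′) * (v * w * c)
      ≡⟨ cong (_* (v * w * c)) (product-++ g L L′) ⟩
    product g L * product g L′ * (v * w * c)
      ≡⟨ cong (λ u → u * product g L′ * (v * w * c)) (sym (product-map (_- x * x) (λ y → y * y) L)) ⟩
    product (_- x * x) (squares L) * product g L′ * (v * w * c)
      ≡⟨ lem (product (_- x * x) (squares L)) (product g L′) v w c ⟩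
    product (_- x * x) (squares L) * v * w * (product g L′ * c) ∎
    where
    g : ℤ → ℤ
    g y = y * y - x * x
    v w c : ℤ
    v = vandermonde (squares L)
    w = vandermonde (squares L′)
    c = cross L L′
    lem : ∀ a b v w c → a * b * (v * w * c) ≡ a * v * w * (b * c)
    lem = solve-∀

  discriminant-++ : ∀ b L L′ → discriminant b (L ++ L′) ≡ discriminant b L * discriminant b L′ * cross L L′
  discriminant-++ b L L′ = trans (cong₂ _*_ (product-++ (weight b) L L′) (vandermonde-++ L L′))
    (lem (product (weight b) L) (product (weight b) L′) (vandermonde (squares L)) (vandermonde (squares L′)) (cross L L′))
    where
    lem : ∀ p q v w c → p * q * (v * w * c) ≡ p * v * (q * w) * c
    lem = solve-∀

  -- If A and B together form C, the interaction of S with A and B only depends on C.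
  discriminant-exchange : ∀ b S A B C → (∀ g → product g A * product g B ≡ product g C) →
    discriminant b (S ++ A) * discriminant b (S ++ B) * discriminant b C
      ≡ discriminant b A * discriminant b B * (discriminant b S * discriminant b (S ++ C))
  discriminant-exchange b S A B C h = begin
    discriminant b (S ++ A) * discriminant b (S ++ B) * discriminant b C
      ≡⟨ cong₂ (λ u v → u * v * discriminant b C) (discriminant-++ b S A) (discriminant-++ b S B) ⟩
    (s * a * cross S A) * (s * b′ * cross S B) * c
      ≡⟨ lem₁ s a b′ c (cross S A) (cross S B) ⟩
    a * b′ * (s * (s * c * (cross S A * cross S B)))
      ≡⟨ cong (λ u → a * b′ * (s * (s * c * u))) (product-* (λ x → product (λ y → y * y - x * x) A) (λ x → product (λ y → y * y - x * x) B) (λ x → product (λ y → y * y - x * x) C) (λ x → h (λ y → y * y - x * x)) S) ⟩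
    a * b′ * (s * (s * c * cross S C))
      ≡⟨ cong (λ u → a * b′ * (s * u)) (sym (discriminant-++ b S C)) ⟩
    a * b′ * (s * discriminant b (S ++ C)) ∎
    where
    s a b′ c : ℤ
    s = discriminant b S
    a = discriminant b A
    b′ = discriminant b B
    c = discriminant b C
    lem₁ : ∀ s a b c x y → (s * a * x) * (s * b * y) * c ≡ a * b * (s * (s * c * (x * y)))
    lem₁ = solve-∀

  marks-++ : {A : Set} (f : ℕ → A) → ∀ t P R → marks f t (P ++ R) ≡ marks f t P ++ marks f (t ℕ.+ length P) R
  marks-++ f t []          R = cong (λ u → marks f u R) (sym (ℕ.+-identityʳ t))
  marks-++ f t (true ∷ P)  R = cong (f t ∷_) (trans (marks-++ f (suc t) P R) (cong (λ u → marks f (suc t) P ++ marks f u R) (sym (ℕ.+-suc t (length P)))))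
  marks-++ f t (false ∷ P) R = trans (marks-++ f (suc t) P R) (cong (λ u → marks f (suc t) P ++ marks f u R) (sym (ℕ.+-suc t (length P))))

  marks-falses : {A : Set} (f : ℕ → A) → ∀ t n → marks f t (falses n) ≡ []
  marks-falses f t zero    = refl
  marks-falses f t (suc n) = marks-falses f (suc t) n

  product-complement : (g : ℤ → ℤ) (f : ℕ → ℤ) → ∀ t A →
    product g (marks f t A) * product g (marks f t (map not A)) ≡ product g (marks f t (trues (length A)))
  product-complement g f t []          = refl
  product-complement g f t (true ∷ A)  = trans (*-assoc (g (f t)) _ _) (cong (g (f t) *_) (product-complement g f (suc t) A))
  product-complement g f t (false ∷ A) = trans (lem (product g (marks f (suc t) A)) (g (f t)) (product g (marks f (suc t) (map not A)))) (cong (g (f t) *_) (product-complement g f (suc t) A))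
    where
    lem : ∀ p a q → p * (a * q) ≡ a * (p * q)
    lem = solve-∀

  -- The dents above the line, those below it and the cap of side `z` fill an interval. Equality of
  -- multisets is expressed by equality of all products over them, as `discriminant-exchange` asks.
  product-filled : (g : ℤ → ℤ) (f : ℕ → ℤ) → ∀ t A z →
    product g (marks f t A) * product g (marks f t (map not A ++ trues z)) ≡ product g (marks f t (trues (length A ℕ.+ z)))
  product-filled g f t A z = begin
    product g (marks f t A) * product g (marks f t (map not A ++ trues z))
      ≡⟨ cong (λ l → product g (marks f t A) * product g l) (marks-++ f t (map not A) (trues z)) ⟩
    product g (marks f t A) * product g (marks f t (map not A) ++ marks f (t ℕ.+ length (map not A)) (trues z))
      ≡⟨ cong (product g (marks f t A) *_) (product-++ g (marks f t (map not A)) _) ⟩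
    product g (marks f t A) * (product g (marks f t (map not A)) * Z (length (map not A)))
      ≡⟨ sym (*-assoc (product g (marks f t A)) _ _) ⟩
    product g (marks f t A) * product g (marks f t (map not A)) * Z (length (map not A))
      ≡⟨ cong₂ _*_ (product-complement g f t A) (cong Z (trans (length-map not A) (sym (length-replicate (length A))))) ⟩
    product g (marks f t (trues (length A))) * Z (length (trues (length A)))
      ≡⟨ sym (product-++ g (marks f t (trues (length A))) _) ⟩
    product g (marks f t (trues (length A)) ++ marks f (t ℕ.+ length (trues (length A))) (trues z))
      ≡⟨ cong (product g) (sym (marks-++ f t (trues (length A)) (trues z))) ⟩
    product g (marks f t (trues (length A) ++ trues z))
      ≡⟨ cong (λ l → product g (marks f t l)) (++-replicate (length A) z) ⟩
    product g (marks f t (trues (length A ℕ.+ z))) ∎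
    where
    Z : ℕ → ℤ
    Z l = product g (marks f (t ℕ.+ l) (trues z))
    ++-replicate : ∀ m n → trues m ++ trues n ≡ trues (m ℕ.+ n)
    ++-replicate zero    n = refl
    ++-replicate (suc m) n = cong (true ∷_) (++-replicate m n)

-- From lists of unit triangles to rows of marks

module Transfer where

  open Chains
  open Determinants using (snoc-++)
  open import Defs
  open import Data.Bool using (Bool; true; false; not; _∧_; if_then_else_)
  open import Data.Bool.Properties using (∧-zeroʳ)
  open import Data.Nat using (ℕ; zero; suc; _+_; _*_; _∸_; _≤_; _<_; z≤n; s≤s; _%_; _≡ᵇ_)
  open import Data.Nat.Properties
  open import Data.Nat.DivMod using ([m+n]%n≡m%n)
  open import Data.Nat.ListAction using (sum)
  open import Data.Nat.ListAction.Properties using (sum-++)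
  open import Data.Integer as ℤ using (ℤ; +_)
  import Data.Integer.Properties as ℤ
  open import Data.List using (List; []; _∷_; _++_; length; map; filterᵇ)
  open import Data.List.Properties using (map-++; length-++; ++-identityʳ)
  open import Data.Product using (Σ; _,_; proj₁; proj₂)
  open import Relation.Nullary.Decidable using (dec-true; dec-false)
  open import Relation.Binary.PropositionalEquality
  open ≡-Reasoning

  -- A triangle points down exactly when the one above it in the same column points up. The latter
  -- is the condition that `adjacent` tests for a vertical lozenge.
  down : ℕ → ℕ → Bool
  down i c = isUp (tri (+ suc i) (+ c))

  odd : ℕ → Bool
  odd n = (n % 2) ≡ᵇ 1

  odd-suc : ∀ n → odd (suc n) ≡ not (odd n)
  odd-suc zero          = refl
  odd-suc (suc zero)    = refl
  odd-suc (suc (suc n)) = trans (odd-2+ (suc n)) (trans (odd-suc n) (cong not (sym (odd-2+ n))))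
    where
    odd-2+ : ∀ n → odd (suc (suc n)) ≡ odd n
    odd-2+ n = cong (_≡ᵇ 1) (trans (cong (_% 2) (+-comm 2 n)) ([m+n]%n≡m%n n 2))

  down-sucʳ : ∀ i c → down i (suc c) ≡ not (down i c)
  down-sucʳ i c = odd-suc (c + suc i)

  down-sucˡ : ∀ i c → down (suc i) c ≡ not (down i c)
  down-sucˡ i c = trans (cong odd (+-suc c (suc i))) (odd-suc (c + suc i))

  ==ℤ-refl : ∀ x → (x ==ℤ x) ≡ true
  ==ℤ-refl x = dec-true (x ℤ.≟ x) refl

  ==ℤ-neq : ∀ {x y} → x ≢ y → (x ==ℤ y) ≡ false
  ==ℤ-neq {x} {y} n = dec-false (x ℤ.≟ y) n

  +-neq : ∀ {m n} → m ≢ n → + m ≢ + n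
  +-neq h e = h (ℤ.+-injective e)

  adjacent-right : ∀ i c → adjacent (tri (+ i) (+ c)) (tri (+ i) (+ suc c)) ≡ true
  adjacent-right i c rewrite ==ℤ-refl (+ i) | +-comm c 1 | ==ℤ-refl (+ suc c) = refl

  adjacent-far-right : ∀ i c k → adjacent (tri (+ i) (+ c)) (tri (+ i) (+ (suc (suc c) + k))) ≡ false
  adjacent-far-right i c k
    rewrite ==ℤ-refl (+ i)
          | ==ℤ-neq (+-neq {suc (suc c) + k} {c + 1} (λ e → <⇒≢ (s≤s (s≤s (m≤m+n c k))) (trans (+-comm 1 c) (sym e))))
          | ==ℤ-neq (+-neq {c} {suc (suc c) + k + 1} (<⇒≢ (≤-trans (m≤n+m (suc c) 1) (≤-trans (m≤m+n (suc (suc c)) k) (m≤m+n _ 1)))))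
          | ==ℤ-neq (+-neq {c} {suc (suc c) + k} (<⇒≢ (≤-trans (m≤n+m (suc c) 1) (m≤m+n (suc (suc c)) k))))
          = refl

  private
    suc≢pred : ∀ i k → ((+ (suc i + k)) ==ℤ (+ i ℤ.- + 1)) ≡ false
    suc≢pred zero    k = refl
    suc≢pred (suc i) k = ==ℤ-neq (+-neq (>⇒≢ (≤-trans (s≤s (n≤1+n i)) (m≤m+n (suc (suc i)) k))))

  adjacent-up : ∀ i c → adjacent (tri (+ i) (+ c)) (tri (+ suc i) (+ c)) ≡ down i c
  adjacent-up i c
    rewrite ==ℤ-neq (+-neq {i} {suc i} (<⇒≢ ≤-refl)) | ==ℤ-refl (+ c)
          | trans (cong (λ j → (+ suc j) ==ℤ (+ i ℤ.- + 1)) (sym (+-identityʳ i))) (suc≢pred i 0)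
          | ==ℤ-refl (+ i) = refl

  adjacent-up-apart : ∀ i c c′ → c ≢ c′ → adjacent (tri (+ i) (+ c)) (tri (+ suc i) (+ c′)) ≡ false
  adjacent-up-apart i c c′ h rewrite ==ℤ-neq (+-neq {i} {suc i} (<⇒≢ ≤-refl)) | ==ℤ-neq (+-neq h) = refl

  adjacent-far-up : ∀ i c k c′ → adjacent (tri (+ i) (+ c)) (tri (+ (suc (suc i) + k)) (+ c′)) ≡ false
  adjacent-far-up i c k c′
    rewrite ==ℤ-neq (+-neq {i} {suc (suc i) + k} (<⇒≢ (≤-trans (m≤n+m (suc i) 1) (m≤m+n (suc (suc i)) k))))
          | trans (cong (λ j → (+ j) ==ℤ (+ i ℤ.- + 1)) (cong suc (sym (+-suc i k)))) (suc≢pred i (suc k))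
          | ==ℤ-neq (+-neq {i} {suc i + k} (<⇒≢ (s≤s (m≤m+n i k))))
          = ∧-zeroʳ _

  remove : Tri → List Tri → List Tri
  remove u = filterᵇ (λ v → not (v ==T u))

  ==T-refl : ∀ i c → (tri (+ i) (+ c) ==T tri (+ i) (+ c)) ≡ true
  ==T-refl i c rewrite ==ℤ-refl (+ i) | ==ℤ-refl (+ c) = refl

  ==T-row : ∀ {i i′} c c′ → i ≢ i′ → (tri (+ i) (+ c) ==T tri (+ i′) (+ c′)) ≡ false
  ==T-row c c′ h rewrite ==ℤ-neq (+-neq h) = refl

  ==T-col : ∀ i {c c′} → c ≢ c′ → (tri (+ i) (+ c) ==T tri (+ i) (+ c′)) ≡ false
  ==T-col i h rewrite ==ℤ-neq (+-neq h) = ∧-zeroʳ _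

  cellsOf : ℕ → ℕ → List Bool → List Tri
  cellsOf i c []          = []
  cellsOf i c (true ∷ l)  = cellsOf i (suc c) l
  cellsOf i c (false ∷ l) = tri (+ i) (+ c) ∷ cellsOf i (suc c) l

  rowsOf : ℕ → ℕ → List (List Bool) → List Tri
  rowsOf o i []       = []
  rowsOf o i (r ∷ rs) = cellsOf i o r ++ rowsOf o (suc i) rs

  filterᵇ-++ : ∀ (q : Tri → Bool) xs ys → filterᵇ q (xs ++ ys) ≡ filterᵇ q xs ++ filterᵇ q ys
  filterᵇ-++ q []       ys = refl
  filterᵇ-++ q (x ∷ xs) ys with q x
  ... | true  = cong (x ∷_) (filterᵇ-++ q xs ys)
  ... | false = filterᵇ-++ q xs ys

  length-filterᵇ : ∀ (q : Tri → Bool) xs → length (filterᵇ q xs) ≤ length xs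
  length-filterᵇ q []       = z≤n
  length-filterᵇ q (x ∷ xs) with q x
  ... | true  = s≤s (length-filterᵇ q xs)
  ... | false = m≤n⇒m≤1+n (length-filterᵇ q xs)

  cells-none : ∀ (q : Tri → Bool) i c l → (∀ c′ → c ≤ c′ → c′ < c + length l → q (tri (+ i) (+ c′)) ≡ false) → filterᵇ q (cellsOf i c l) ≡ []
  cells-none q i c []          h = refl
  cells-none q i c (true ∷ l)  h = cells-none q i (suc c) l (λ c′ a b → h c′ (<⇒≤ a) (≤-trans b (≤-reflexive (sym (+-suc c _)))))
  cells-none q i c (false ∷ l) h rewrite h c ≤-refl (m<m+n c (s≤s z≤n)) =
    cells-none q i (suc c) l (λ c′ a b → h c′ (<⇒≤ a) (≤-trans b (≤-reflexive (sym (+-suc c _)))))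

  cells-all : ∀ (q : Tri → Bool) i c l → (∀ c′ → c ≤ c′ → c′ < c + length l → q (tri (+ i) (+ c′)) ≡ true) → filterᵇ q (cellsOf i c l) ≡ cellsOf i c l
  cells-all q i c []          h = refl
  cells-all q i c (true ∷ l)  h = cells-all q i (suc c) l (λ c′ a b → h c′ (<⇒≤ a) (≤-trans b (≤-reflexive (sym (+-suc c _)))))
  cells-all q i c (false ∷ l) h rewrite h c ≤-refl (m<m+n c (s≤s z≤n)) = cong (_ ∷_)
    (cells-all q i (suc c) l (λ c′ a b → h c′ (<⇒≤ a) (≤-trans b (≤-reflexive (sym (+-suc c _))))))

  rows-none : ∀ (q : Tri → Bool) o i rs → (∀ i′ c → i ≤ i′ → q (tri (+ i′) (+ c)) ≡ false) → filterᵇ q (rowsOf o i rs) ≡ []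
  rows-none q o i []       h = refl
  rows-none q o i (r ∷ rs) h = trans (filterᵇ-++ q (cellsOf i o r) _)
    (cong₂ _++_ (cells-none q i o r (λ c _ _ → h i c ≤-refl)) (rows-none q o (suc i) rs (λ i′ c a → h i′ c (<⇒≤ a))))

  rows-all : ∀ (q : Tri → Bool) o i rs → (∀ i′ c → i ≤ i′ → q (tri (+ i′) (+ c)) ≡ true) → filterᵇ q (rowsOf o i rs) ≡ rowsOf o i rs
  rows-all q o i []       h = refl
  rows-all q o i (r ∷ rs) h = trans (filterᵇ-++ q (cellsOf i o r) _)
    (cong₂ _++_ (cells-all q i o r (λ c _ _ → h i c ≤-refl)) (rows-all q o (suc i) rs (λ i′ c a → h i′ c (<⇒≤ a))))

  cells-++ : ∀ i c l l′ → cellsOf i c (l ++ l′) ≡ cellsOf i c l ++ cellsOf i (c + length l) l′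
  cells-++ i c []          l′ = cong (λ d → cellsOf i d l′) (sym (+-identityʳ c))
  cells-++ i c (true ∷ l)  l′ = trans (cells-++ i (suc c) l l′) (cong (λ d → cellsOf i (suc c) l ++ cellsOf i d l′) (sym (+-suc c _)))
  cells-++ i c (false ∷ l) l′ = cong (_ ∷_) (trans (cells-++ i (suc c) l l′) (cong (λ d → cellsOf i (suc c) l ++ cellsOf i d l′) (sym (+-suc c _))))

  -- Processes the current row from left to right, given the marks (true = absent) of its
  -- cells and of those of the next row: a present cell is matched with its right neighbour
  -- or, if it points down, with the cell above, which is then marked in the next row.
  scan : (down pending : Bool) (cur nxt : List Bool) → (List Bool → ℕ) → ℕ
  scan d true  []            nxt       k = 0
  scan d false []            nxt       k = k nxt
  scan d p     (b ∷ cur)     []        k = pm p (b ∷ cur) * k []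
  scan d false (true ∷ cur)  (n ∷ nxt) k = scan (not d) false cur nxt (λ l → k (n ∷ l))
  scan d true  (true ∷ cur)  (n ∷ nxt) k = 0
  scan d true  (false ∷ cur) (n ∷ nxt) k = scan (not d) false cur nxt (λ l → k (n ∷ l))
  scan d false (false ∷ cur) (n ∷ nxt) k = scan (not d) true cur nxt (λ l → k (n ∷ l))
    + (if d ∧ not n then scan (not d) false cur nxt (λ l → k (true ∷ l)) else 0)

  scan-cong : ∀ d p cur nxt {k k′} → (∀ l → k l ≡ k′ l) → scan d p cur nxt k ≡ scan d p cur nxt k′
  scan-cong d true  []            nxt       h = refl
  scan-cong d false []            nxt       h = h nxt
  scan-cong d false (b ∷ cur)     []        h = cong (pm false (b ∷ cur) *_) (h [])
  scan-cong d true  (b ∷ cur)     []        h = cong (pm true (b ∷ cur) *_) (h [])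
  scan-cong d false (true ∷ cur)  (n ∷ nxt) h = scan-cong (not d) false cur nxt (λ l → h (n ∷ l))
  scan-cong d true  (true ∷ cur)  (n ∷ nxt) h = refl
  scan-cong d true  (false ∷ cur) (n ∷ nxt) h = scan-cong (not d) false cur nxt (λ l → h (n ∷ l))
  scan-cong d false (false ∷ cur) (n ∷ nxt) h = cong₂ _+_
    (scan-cong (not d) true cur nxt (λ l → h (n ∷ l)))
    (cong (λ u → if d ∧ not n then u else 0) (scan-cong (not d) false cur nxt (λ l → h (true ∷ l))))

  process : Bool → List Bool → List (List Bool) → ℕ
  process d r []        = scan d false r [] (λ _ → 1)
  process d r (r′ ∷ rs) = scan d false r r′ (λ l → process (not d) l rs)

  rightNeighbour : ℕ → ℕ → List Bool → List Tri
  rightNeighbour i c (false ∷ _) = tri (+ i) (+ c) ∷ []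
  rightNeighbour i c _           = []

  adjacent-cells : ∀ i c cur → filterᵇ (adjacent (tri (+ i) (+ c))) (cellsOf i (suc c) cur) ≡ rightNeighbour i (suc c) cur
  adjacent-cells i c []            = refl
  adjacent-cells i c (true ∷ cur)  = cells-none _ i (suc (suc c)) cur (λ c′ a _ →
    trans (cong (λ d → adjacent (tri (+ i) (+ c)) (tri (+ i) (+ d))) (sym (proj₂ (≤⇒+ a)))) (adjacent-far-right i c (proj₁ (≤⇒+ a))))
    where
    ≤⇒+ : ∀ {m n} → m ≤ n → Σ ℕ (λ k → m + k ≡ n)
    ≤⇒+ {m} {n} a = n ∸ m , m+[n∸m]≡n a
  adjacent-cells i c (false ∷ cur) rewrite adjacent-right i c = cong (_ ∷_) (adjacent-cells i c (true ∷ cur))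

  remove-row-above : ∀ i c o ls → remove (tri (+ i) (+ c)) (rowsOf o (suc i) ls) ≡ rowsOf o (suc i) ls
  remove-row-above i c o ls = rows-all _ o (suc i) ls (λ i′ c′ a → cong not (==T-row c′ c (>⇒≢ a)))

  remove-head : ∀ i c cur X → remove (tri (+ i) (+ c)) X ≡ X →
    remove (tri (+ i) (+ c)) (tri (+ i) (+ c) ∷ cellsOf i (suc c) cur ++ X) ≡ cellsOf i (suc c) cur ++ X
  remove-head i c cur X h rewrite ==T-refl i c = trans (filterᵇ-++ _ (cellsOf i (suc c) cur) X)
    (cong₂ _++_ (cells-all _ i (suc c) cur (λ c′ a _ → cong not (==T-col i (>⇒≢ a)))) h)

  -- Serves the topmost row and any part of a row reaching beyond the end of the next one. No cell
  -- considered has a neighbour in `X`, so the cells can only be paired among themselves.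
  tilings-last : ∀ i c cur X K →
    (∀ c′ → c ≤ c′ → filterᵇ (adjacent (tri (+ i) (+ c′))) X ≡ []) →
    (∀ c′ → remove (tri (+ i) (+ c′)) X ≡ X) →
    (∀ f → length X ≤ f → tilingsCount f X ≡ K) →
    ∀ f → length (cellsOf i c cur ++ X) ≤ f → tilingsCount f (cellsOf i c cur ++ X) ≡ pm false cur * K
  tilings-last i c [] X K adj rem hK f b = trans (hK f b) (sym (*-identityˡ K))
  tilings-last i c (true ∷ cur) X K adj rem hK f b = tilings-last i (suc c) cur X K (λ c′ a → adj c′ (<⇒≤ a)) rem hK f b
  tilings-last i c (false ∷ cur) X K adj rem hK (suc f) (s≤s b) = trans
    (cong (λ l → sum (map (λ u → tilingsCount f (remove u (cellsOf i (suc c) cur ++ X))) l)) neighbours)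
    (choose cur b)
    where
    neighbours : filterᵇ (adjacent (tri (+ i) (+ c))) (cellsOf i (suc c) cur ++ X) ≡ rightNeighbour i (suc c) cur
    neighbours = trans (filterᵇ-++ _ (cellsOf i (suc c) cur) X)
      (trans (cong₂ _++_ (adjacent-cells i c cur) (adj c ≤-refl)) (++-identityʳ _))
    choose : ∀ cur → length (cellsOf i (suc c) cur ++ X) ≤ f →
      sum (map (λ u → tilingsCount f (remove u (cellsOf i (suc c) cur ++ X))) (rightNeighbour i (suc c) cur)) ≡ pm true cur * K
    choose []            b = refl
    choose (true ∷ cur)  b = refl
    choose (false ∷ cur) b = trans (+-identityʳ _) (trans
      (cong (tilingsCount f) (remove-head i (suc c) cur X (rem (suc c))))
      (tilings-last i (suc (suc c)) cur X K (λ c′ a → adj c′ (<⇒≤ (<⇒≤ a))) rem hK f (<⇒≤ b)))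

  module Row (o i : ℕ) (ls : List (List Bool))
    (ih : ∀ r f → length (cellsOf (suc i) o r ++ rowsOf o (suc (suc i)) ls) ≤ f →
      tilingsCount f (cellsOf (suc i) o r ++ rowsOf o (suc (suc i)) ls) ≡ process (down (suc i) o) r ls) where

    above-rows : List Bool → List Tri
    above-rows r = rowsOf o (suc i) (r ∷ ls)

    scan-cont : List Bool → List Bool → ℕ
    scan-cont pr l = process (down (suc i) o) (pr ++ l) ls

    upNeighbour : ℕ → Bool → List Tri
    upNeighbour c n = if down i c ∧ not n then tri (+ suc i) (+ c) ∷ [] else []

    adjacent-prefix : ∀ c pr → o + length pr ≤ c → filterᵇ (adjacent (tri (+ i) (+ c))) (cellsOf (suc i) o pr) ≡ []
    adjacent-prefix c pr e = cells-none _ (suc i) o pr (λ c′ _ a → adjacent-up-apart i c c′ (>⇒≢ (≤-trans a e)))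

    adjacent-rows : ∀ c → filterᵇ (adjacent (tri (+ i) (+ c))) (rowsOf o (suc (suc i)) ls) ≡ []
    adjacent-rows c = rows-none _ o (suc (suc i)) ls (λ i′ c′ a →
      trans (cong (λ j → adjacent (tri (+ i) (+ c)) (tri (+ j) (+ c′))) (sym (m+[n∸m]≡n a))) (adjacent-far-up i c (i′ ∸ suc (suc i)) c′))

    adjacent-nxt : ∀ c n nxt → filterᵇ (adjacent (tri (+ i) (+ c))) (cellsOf (suc i) c (n ∷ nxt)) ≡ upNeighbour c n
    adjacent-nxt c true nxt rewrite ∧-zeroʳ (down i c) =
      cells-none _ (suc i) (suc c) nxt (λ c′ a _ → adjacent-up-apart i c c′ (<⇒≢ a))
    adjacent-nxt c false nxt rewrite adjacent-up i c with down i c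
    ... | true  = cong (_ ∷_) (cells-none _ (suc i) (suc c) nxt (λ c′ a _ → adjacent-up-apart i c c′ (<⇒≢ a)))
    ... | false = cells-none _ (suc i) (suc c) nxt (λ c′ a _ → adjacent-up-apart i c c′ (<⇒≢ a))

    adjacent-above : ∀ c pr n nxt → o + length pr ≡ c →
      filterᵇ (adjacent (tri (+ i) (+ c))) (above-rows (pr ++ n ∷ nxt)) ≡ upNeighbour c n
    adjacent-above c pr n nxt e = begin
      filterᵇ q (cellsOf (suc i) o (pr ++ n ∷ nxt) ++ rowsOf o (suc (suc i)) ls)
        ≡⟨ filterᵇ-++ q (cellsOf (suc i) o (pr ++ n ∷ nxt)) _ ⟩
      filterᵇ q (cellsOf (suc i) o (pr ++ n ∷ nxt)) ++ filterᵇ q (rowsOf o (suc (suc i)) ls)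
        ≡⟨ cong₂ _++_ (trans (cong (filterᵇ q) (cells-++ (suc i) o pr (n ∷ nxt))) (filterᵇ-++ q (cellsOf (suc i) o pr) _)) (adjacent-rows c) ⟩
      (filterᵇ q (cellsOf (suc i) o pr) ++ filterᵇ q (cellsOf (suc i) (o + length pr) (n ∷ nxt))) ++ []
        ≡⟨ ++-identityʳ _ ⟩
      filterᵇ q (cellsOf (suc i) o pr) ++ filterᵇ q (cellsOf (suc i) (o + length pr) (n ∷ nxt))
        ≡⟨ cong₂ _++_ (adjacent-prefix c pr (≤-reflexive e)) (trans (cong (λ d → filterᵇ q (cellsOf (suc i) d (n ∷ nxt))) e) (adjacent-nxt c n nxt)) ⟩
      upNeighbour c n ∎
      where
      q : Tri → Bool
      q = adjacent (tri (+ i) (+ c))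

    remove-up : ∀ c cur pr nxt → o + length pr ≡ c →
      remove (tri (+ suc i) (+ c)) (cellsOf i (suc c) cur ++ above-rows (pr ++ false ∷ nxt)) ≡ cellsOf i (suc c) cur ++ above-rows (pr ++ true ∷ nxt)
    remove-up c cur pr nxt e = trans (filterᵇ-++ q (cellsOf i (suc c) cur) _) (cong₂ _++_
      (cells-all q i (suc c) cur (λ c′ _ _ → cong not (==T-row {i} {suc i} c′ c (<⇒≢ ≤-refl))))
      (trans (filterᵇ-++ q (cellsOf (suc i) o (pr ++ false ∷ nxt)) _) (cong₂ _++_ row (remove-row-above (suc i) c o ls))))
      where
      q : Tri → Bool
      q v = not (v ==T tri (+ suc i) (+ c))
      here : filterᵇ q (cellsOf (suc i) c (false ∷ nxt)) ≡ cellsOf (suc i) c (true ∷ nxt)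
      here rewrite ==T-refl (suc i) c = cells-all q (suc i) (suc c) nxt (λ c′ a _ → cong not (==T-col (suc i) (>⇒≢ a)))
      row : filterᵇ q (cellsOf (suc i) o (pr ++ false ∷ nxt)) ≡ cellsOf (suc i) o (pr ++ true ∷ nxt)
      row = begin
        filterᵇ q (cellsOf (suc i) o (pr ++ false ∷ nxt))
          ≡⟨ cong (filterᵇ q) (cells-++ (suc i) o pr (false ∷ nxt)) ⟩
        filterᵇ q (cellsOf (suc i) o pr ++ cellsOf (suc i) (o + length pr) (false ∷ nxt))
          ≡⟨ filterᵇ-++ q (cellsOf (suc i) o pr) _ ⟩
        filterᵇ q (cellsOf (suc i) o pr) ++ filterᵇ q (cellsOf (suc i) (o + length pr) (false ∷ nxt))
          ≡⟨ cong₂ _++_ (cells-all q (suc i) o pr (λ c′ _ a → cong not (==T-col (suc i) (<⇒≢ (≤-trans a (≤-reflexive e))))))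
               (trans (cong (λ d → filterᵇ q (cellsOf (suc i) d (false ∷ nxt))) e) here) ⟩
        cellsOf (suc i) o pr ++ cellsOf (suc i) c (true ∷ nxt)
          ≡⟨ cong (λ d → cellsOf (suc i) o pr ++ cellsOf (suc i) d (true ∷ nxt)) (sym e) ⟩
        cellsOf (suc i) o pr ++ cellsOf (suc i) (o + length pr) (true ∷ nxt)
          ≡⟨ sym (cells-++ (suc i) o pr (true ∷ nxt)) ⟩
        cellsOf (suc i) o (pr ++ true ∷ nxt) ∎

    extend : ∀ {c} pr (n : Bool) → o + length pr ≡ c → o + length (pr ++ n ∷ []) ≡ suc c
    extend pr n e = trans (cong (λ u → o + u) (trans (length-++ pr) (+-comm (length pr) 1))) (trans (+-suc o _) (cong suc e))

    no-next : ∀ c cur pr → o + length pr ≤ c → ∀ f → length (cellsOf i c cur ++ above-rows pr) ≤ f →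
      tilingsCount f (cellsOf i c cur ++ above-rows pr) ≡ pm false cur * process (down (suc i) o) pr ls
    no-next c cur pr e = tilings-last i c cur (above-rows pr) _
      (λ c′ a → trans (filterᵇ-++ _ (cellsOf (suc i) o pr) _) (cong₂ _++_ (adjacent-prefix c′ pr (≤-trans e a)) (adjacent-rows c′)))
      (λ c′ → remove-row-above i c′ o (pr ∷ ls)) (ih pr)

    -- The list is ordered by rows from the bottom and from left to right, so its first triangle can
    -- be joined only to its right neighbour or, if it points down, to the triangle above. `pr` is
    -- the part of the next row above the cells already treated, with the marks it has received from
    -- them.
    tilings-scan : ∀ c cur pr nxt → o + length pr ≡ c → ∀ f → length (cellsOf i c cur ++ above-rows (pr ++ nxt)) ≤ f →
      tilingsCount f (cellsOf i c cur ++ above-rows (pr ++ nxt)) ≡ scan (down i c) false cur nxt (scan-cont pr)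

    tilings-next : ∀ c cur pr n nxt → o + length pr ≡ c → ∀ f → length (cellsOf i (suc c) cur ++ above-rows (pr ++ n ∷ nxt)) ≤ f →
      tilingsCount f (cellsOf i (suc c) cur ++ above-rows (pr ++ n ∷ nxt)) ≡ scan (not (down i c)) false cur nxt (λ l → scan-cont pr (n ∷ l))
    tilings-next c cur pr n nxt e f b = begin
      tilingsCount f (cellsOf i (suc c) cur ++ above-rows (pr ++ n ∷ nxt))
        ≡⟨ cong (λ r → tilingsCount f (cellsOf i (suc c) cur ++ above-rows r)) (sym (snoc-++ pr n nxt)) ⟩
      tilingsCount f (cellsOf i (suc c) cur ++ above-rows ((pr ++ n ∷ []) ++ nxt))
        ≡⟨ tilings-scan (suc c) cur (pr ++ n ∷ []) nxt (extend pr n e) f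
             (subst (λ r → length (cellsOf i (suc c) cur ++ above-rows r) ≤ f) (sym (snoc-++ pr n nxt)) b) ⟩
      scan (down i (suc c)) false cur nxt (scan-cont (pr ++ n ∷ []))
        ≡⟨ cong (λ d → scan d false cur nxt (scan-cont (pr ++ n ∷ []))) (down-sucʳ i c) ⟩
      scan (not (down i c)) false cur nxt (scan-cont (pr ++ n ∷ []))
        ≡⟨ scan-cong (not (down i c)) false cur nxt (λ l → cong (λ r → process (down (suc i) o) r ls) (snoc-++ pr n l)) ⟩
      scan (not (down i c)) false cur nxt (λ l → scan-cont pr (n ∷ l)) ∎

    tilings-scan c []           pr nxt       e f b = ih (pr ++ nxt) f b
    tilings-scan c (x ∷ cur)    pr []        e f b = trans
      (cong (λ r → tilingsCount f (cellsOf i c (x ∷ cur) ++ above-rows r)) (++-identityʳ pr))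
      (trans (no-next c (x ∷ cur) pr (≤-reflexive e) f (subst (λ r → length (cellsOf i c (x ∷ cur) ++ above-rows r) ≤ f) (++-identityʳ pr) b))
        (cong (λ r → pm false (x ∷ cur) * process (down (suc i) o) r ls) (sym (++-identityʳ pr))))
    tilings-scan c (true ∷ cur) pr (n ∷ nxt) e f b = tilings-next c cur pr n nxt e f b
    tilings-scan c (false ∷ cur) pr (n ∷ nxt) e (suc f) (s≤s b) = begin
      sum (map g (filterᵇ (adjacent (tri (+ i) (+ c))) (cellsOf i (suc c) cur ++ above-rows (pr ++ n ∷ nxt))))
        ≡⟨ cong (λ l → sum (map g l)) (trans (filterᵇ-++ _ (cellsOf i (suc c) cur) _) (cong₂ _++_ (adjacent-cells i c cur) (adjacent-above c pr n nxt e))) ⟩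
      sum (map g (rightNeighbour i (suc c) cur ++ upNeighbour c n))
        ≡⟨ trans (cong sum (map-++ g (rightNeighbour i (suc c) cur) _)) (sum-++ (map g (rightNeighbour i (suc c) cur)) _) ⟩
      sum (map g (rightNeighbour i (suc c) cur)) + sum (map g (upNeighbour c n))
        ≡⟨ cong₂ _+_ (right cur nxt b) (up n b) ⟩
      scan (not (down i c)) true cur nxt (λ l → scan-cont pr (n ∷ l))
        + (if down i c ∧ not n then scan (not (down i c)) false cur nxt (λ l → scan-cont pr (true ∷ l)) else 0) ∎
      where
      g : Tri → ℕ
      g u = tilingsCount f (remove u (cellsOf i (suc c) cur ++ above-rows (pr ++ n ∷ nxt)))
      right : ∀ cur nxt → length (cellsOf i (suc c) cur ++ above-rows (pr ++ n ∷ nxt)) ≤ f →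
        sum (map (λ u → tilingsCount f (remove u (cellsOf i (suc c) cur ++ above-rows (pr ++ n ∷ nxt)))) (rightNeighbour i (suc c) cur))
          ≡ scan (not (down i c)) true cur nxt (λ l → scan-cont pr (n ∷ l))
      right []            nxt        b = refl
      right (true ∷ cur)  []         b = refl
      right (true ∷ cur)  (n′ ∷ nxt) b = refl
      right (false ∷ cur) []         b = trans (+-identityʳ _) (trans
        (cong (tilingsCount f) (remove-head i (suc c) cur _ (remove-row-above i (suc c) o ((pr ++ n ∷ []) ∷ ls))))
        (no-next (suc (suc c)) cur (pr ++ n ∷ []) (≤-trans (≤-reflexive (extend pr n e)) (n≤1+n (suc c))) f (<⇒≤ b)))
      right (false ∷ cur) (n′ ∷ nxt) b = trans (+-identityʳ _) (begin
        tilingsCount f (remove (tri (+ i) (+ suc c)) (cellsOf i (suc c) (false ∷ cur) ++ above-rows (pr ++ n ∷ n′ ∷ nxt)))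
          ≡⟨ cong (tilingsCount f) (remove-head i (suc c) cur _ (remove-row-above i (suc c) o ((pr ++ n ∷ n′ ∷ nxt) ∷ ls))) ⟩
        tilingsCount f (cellsOf i (suc (suc c)) cur ++ above-rows (pr ++ n ∷ n′ ∷ nxt))
          ≡⟨ cong (λ r → tilingsCount f (cellsOf i (suc (suc c)) cur ++ above-rows r)) (sym (snoc-++ pr n (n′ ∷ nxt))) ⟩
        tilingsCount f (cellsOf i (suc (suc c)) cur ++ above-rows ((pr ++ n ∷ []) ++ n′ ∷ nxt))
          ≡⟨ tilings-next (suc c) cur (pr ++ n ∷ []) n′ nxt (extend pr n e) f
               (subst (λ r → length (cellsOf i (suc (suc c)) cur ++ above-rows r) ≤ f) (sym (snoc-++ pr n (n′ ∷ nxt))) (<⇒≤ b)) ⟩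
        scan (not (down i (suc c))) false cur nxt (λ l → scan-cont (pr ++ n ∷ []) (n′ ∷ l))
          ≡⟨ cong (λ d → scan (not d) false cur nxt (λ l → scan-cont (pr ++ n ∷ []) (n′ ∷ l))) (down-sucʳ i c) ⟩
        scan (not (not (down i c))) false cur nxt (λ l → scan-cont (pr ++ n ∷ []) (n′ ∷ l))
          ≡⟨ scan-cong (not (not (down i c))) false cur nxt (λ l → cong (λ r → process (down (suc i) o) r ls) (snoc-++ pr n (n′ ∷ l))) ⟩
        scan (not (not (down i c))) false cur nxt (λ l → scan-cont pr (n ∷ n′ ∷ l)) ∎)
      up : ∀ n → length (cellsOf i (suc c) cur ++ above-rows (pr ++ n ∷ nxt)) ≤ f →
        sum (map (λ u → tilingsCount f (remove u (cellsOf i (suc c) cur ++ above-rows (pr ++ n ∷ nxt)))) (upNeighbour c n))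
          ≡ (if down i c ∧ not n then scan (not (down i c)) false cur nxt (λ l → scan-cont pr (true ∷ l)) else 0)
      up true b rewrite ∧-zeroʳ (down i c) = refl
      up false b with down i c | tilings-next c cur pr true nxt e f
      ... | false | _ = refl
      ... | true  | t = trans (+-identityʳ _) (trans (cong (tilingsCount f) (remove-up c cur pr nxt e))
        (t (≤-trans (subst (λ l → length l ≤ length (cellsOf i (suc c) cur ++ above-rows (pr ++ false ∷ nxt))) (remove-up c cur pr nxt e) (length-filterᵇ _ (cellsOf i (suc c) cur ++ above-rows (pr ++ false ∷ nxt)))) b)))

  tilings-process : ∀ o i r rs f → length (rowsOf o i (r ∷ rs)) ≤ f →
    tilingsCount f (rowsOf o i (r ∷ rs)) ≡ process (down i o) r rs
  tilings-process o i r [] f b = trans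
    (tilings-last i o r [] 1 (λ _ _ → refl) (λ _ → refl) (λ _ _ → refl) f b)
    (last r)
    where
    last : ∀ r → pm false r * 1 ≡ scan (down i o) false r [] (λ _ → 1)
    last []      = refl
    last (_ ∷ _) = refl
  tilings-process o i r (r′ ∷ rs) f b = trans
    (Row.tilings-scan o i rs (λ r → tilings-process o (suc i) r rs) o r [] r′ (+-identityʳ o) f b)
    (cong (λ d → scan (down i o) false r r′ (λ l → process d l rs)) (down-sucˡ i o))

-- Trapezoids with removed triangles, upright, inverted and glued

module Trapezoids where

  open Chains
  open Transfer using (scan; process)
  open import Data.Bool using (Bool; true; false; not)
  open import Data.Bool.Properties using (not-involutive)
  open import Data.Nat using (ℕ; zero; suc; pred; _+_; _*_; _≤_; s≤s)
  open import Data.Nat.Properties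
  open import Data.List using (List; []; _∷_; _++_; length; map)
  open import Data.List.Properties using (length-replicate)
  open import Data.Product using (Σ; _×_; _,_)
  open import Relation.Binary.PropositionalEquality
  open ≡-Reasoning

  -- Sum over the sets of vertical lozenges joining two rows: D marks the absent cells of the
  -- lower row pointing down, U the absent cells above them.
  sum2 : List Bool → List Bool → (List Bool → List Bool → ℕ) → ℕ
  sum2 []          U           k = k [] U
  sum2 (d ∷ D)     []          k = k (d ∷ D) []
  sum2 (true ∷ D)  (u ∷ U)     k = sum2 D U (λ D′ U′ → k (true ∷ D′) (u ∷ U′))
  sum2 (false ∷ D) (true ∷ U)  k = sum2 D U (λ D′ U′ → k (false ∷ D′) (true ∷ U′))
  sum2 (false ∷ D) (false ∷ U) k = sum2 D U (λ D′ U′ → k (false ∷ D′) (false ∷ U′)) + sum2 D U (λ D′ U′ → k (true ∷ D′) (true ∷ U′))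

  sum2-zero : ∀ D U {k} → (∀ D′ U′ → k D′ U′ ≡ 0) → sum2 D U k ≡ 0
  sum2-zero []          U           h = h [] U
  sum2-zero (d ∷ D)     []          h = h (d ∷ D) []
  sum2-zero (true ∷ D)  (u ∷ U)     h = sum2-zero D U (λ D′ U′ → h _ _)
  sum2-zero (false ∷ D) (true ∷ U)  h = sum2-zero D U (λ D′ U′ → h _ _)
  sum2-zero (false ∷ D) (false ∷ U) h = cong₂ _+_ (sum2-zero D U (λ D′ U′ → h _ _)) (sum2-zero D U (λ D′ U′ → h _ _))

  sum2-diagonal : ∀ D k → sum2 D D k ≡ sumM D (λ V → k V V)
  sum2-diagonal []          k = refl
  sum2-diagonal (true ∷ D)  k = sum2-diagonal D _
  sum2-diagonal (false ∷ D) k = cong₂ _+_ (sum2-diagonal D _) (sum2-diagonal D _)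

  -- Over the removed triangles every place of the line is blocked from above or from below, and the
  -- last `z` places lie beyond the upper base. No vertical lozenge fits there, so the sum has one
  -- term.
  sum2-complement : ∀ A z k → sum2 (map not A ++ trues z) A k ≡ k (map not A ++ trues z) A
  sum2-complement []          zero    k = refl
  sum2-complement []          (suc z) k = refl
  sum2-complement (true ∷ A)  z       k = sum2-complement A z _
  sum2-complement (false ∷ A) z       k = sum2-complement A z _

  sum2-falses : ∀ x B A k → sum2 (falses x ++ B) (falses x ++ A) k ≡ sumB x (λ S → sum2 B A (λ B′ A′ → k (S ++ B′) (S ++ A′)))
  sum2-falses zero    B A k = refl
  sum2-falses (suc x) B A k = cong₂ _+_ (sum2-falses x B A _) (sum2-falses x B A _)

  -- The vertical lozenges may be chosen during the scan or all beforehand; in the second form the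
  -- rest of the row contributes `pm`. The two mutually recursive versions are for rows opening with
  -- a down-pointing and with an up-pointing triangle.
  scan-down : ∀ p D P U X k → length D ≤ suc (length P) → length U ≤ suc (length X) →
    scan true p (il D P) (il U X) k ≡ sum2 D U (λ D′ U′ → pm p (il D′ P) * k (il U′ X))
  scan-up : ∀ p D P U X k → length D ≤ length P → length U ≤ length X →
    scan false p (il P D) (il X U) k ≡ sum2 D U (λ D′ U′ → pm p (il P D′) * k (il X U′))
  scan-down true  []      P U X k a b = refl
  scan-down false []      P U X k a b = sym (*-identityˡ _)
  scan-down true  (d ∷ D) P [] X k a b = refl
  scan-down false (d ∷ D) P [] X k a b = refl
  scan-down false (true ∷ D)  P (u ∷ U)     X k (s≤s a) (s≤s b) = scan-up false D P U X _ a b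
  scan-down true  (true ∷ D)  P (u ∷ U)     X k (s≤s a) (s≤s b) = sym (sum2-zero D U (λ _ _ → refl))
  scan-down true  (false ∷ D) P (true ∷ U)  X k (s≤s a) (s≤s b) = scan-up false D P U X _ a b
  scan-down true  (false ∷ D) P (false ∷ U) X k (s≤s a) (s≤s b) = trans (scan-up false D P U X _ a b)
    (sym (trans (cong (λ u → sum2 D U (λ D′ U′ → pm false (il P D′) * k (false ∷ il X U′)) + u) (sum2-zero D U (λ _ _ → refl))) (+-identityʳ _)))
  scan-down false (false ∷ D) P (true ∷ U)  X k (s≤s a) (s≤s b) = trans (+-identityʳ _) (scan-up true D P U X _ a b)
  scan-down false (false ∷ D) P (false ∷ U) X k (s≤s a) (s≤s b) = cong₂ _+_ (scan-up true D P U X _ a b) (scan-up false D P U X _ a b)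
  scan-up true  []      []      U X k a b = refl
  scan-up false []      []      U X k a b = sym (*-identityˡ _)
  scan-up true  []      (x ∷ P) [] [] k a b = refl
  scan-up true  (d ∷ D) (x ∷ P) [] [] k a b = refl
  scan-up false []      (x ∷ P) [] [] k a b = refl
  scan-up false (d ∷ D) (x ∷ P) [] [] k a b = refl
  scan-up true  D (true ∷ P)  U (y ∷ X) k a b = sym (sum2-zero D U (λ _ _ → refl))
  scan-up true  D (false ∷ P) U (y ∷ X) k a b = scan-down false D P U X _ a b
  scan-up false D (true ∷ P)  U (y ∷ X) k a b = scan-down false D P U X _ a b
  scan-up false D (false ∷ P) U (y ∷ X) k a b = trans (+-identityʳ _) (scan-down true D P U X _ a b)

  row : Bool → List Bool → List Bool → List Bool
  row true  P D = il P D
  row false P D = il D P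

  -- Forced p D A: in the chain d₁ a₁ d₂ a₂ …, both neighbours of a marked dᵢ are marked
  -- (p is the mark of the cell before the chain).
  data Forced : Bool → List Bool → List Bool → Set where
    done     : ∀ {p} → Forced p [] []
    unmarked : ∀ {p a D A} → Forced a D A → Forced p (false ∷ D) (a ∷ A)
    marked   : ∀ {D A} → Forced true D A → Forced true (true ∷ D) (true ∷ A)

  -- In a row opening with a base-side cell, that cell is the left neighbour of the first far-side
  -- cell. Otherwise nothing precedes the first far-side cell, which then cannot be marked.
  Forces : Bool → List Bool → List Bool → Set
  Forces true  D A = Σ Bool λ a → Σ (List Bool) λ A′ → (A ≡ a ∷ A′) × Forced a D A′
  Forces false D A = Forced false D A

  forced-length : ∀ {p D A} → Forced p D A → length A ≡ length D
  forced-length done    = refl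
  forced-length (unmarked f)  = cong suc (forced-length f)
  forced-length (marked f) = cong suc (forced-length f)

  forces-length : ∀ b {D A} → Forces b D A → length A ≡ above b (length D)
  forces-length true  (a , A , refl , f) = cong suc (forced-length f)
  forces-length false f = forced-length f

  compatible : (pending mark : Bool) → Set
  compatible pending mark = pending ≡ true → mark ≡ false

  -- A far-side cell whose neighbours are all absent has no partner in its row. Hence the pairing
  -- number vanishes unless `V` marks it, and the additional terms of the unrestricted sum are 0.
  -- `compatible` expresses that a cell waiting for a partner is not itself absent.
  forced-sum : ∀ {p D A} → Forced p D A → ∀ {P} → A ⊑ P → ∀ b → compatible b p → (f : List Bool → ℕ) →
    sumM D (λ V → pm b (il V P) * f V) ≡ sumB (length D) (λ V → pm b (il V P) * f V)
  forced-sumᵘ : ∀ {a D A} → Forced a D A → ∀ {q P} → (a ∷ A) ⊑ (q ∷ P) → ∀ b → (f : List Bool → ℕ) →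
    sumM D (λ V → pm b (il (q ∷ P) V) * f V) ≡ sumB (length D) (λ V → pm b (il (q ∷ P) V) * f V)
  forced-sum done nil b c f = refl
  forced-sum (unmarked {D = D} fd) {q ∷ P} s true  c f = cong₂ _+_ (forced-sumᵘ fd s false _)
    (trans (sumM-zero D) (sym (sumM-zero (falses (length D)))))
  forced-sum (unmarked fd) {q ∷ P} s false c f = cong₂ _+_ (forced-sumᵘ fd s true _) (forced-sumᵘ fd s false _)
  forced-sum (marked fd) s@(keep _) true  c f with () ← c refl
  forced-sum (marked {D} fd) s@(keep _) false c f = trans (forced-sumᵘ fd s false _)
    (cong (_+ sumB (length D) (λ V → pm false (il (true ∷ _) V) * f (true ∷ V))) (sym (sumM-zero (falses (length D)))))
  forced-sumᵘ {D = D} fd (keep s)       true  f = trans (sumM-zero D) (sym (sumM-zero (falses (length D))))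
  forced-sumᵘ fd (keep s)       false f = forced-sum fd s false (λ ()) f
  forced-sumᵘ {D = D} fd (free true s)  true  f = trans (sumM-zero D) (sym (sumM-zero (falses (length D))))
  forced-sumᵘ fd (free true s)  false f = forced-sum fd s false (λ ()) f
  forced-sumᵘ fd (free false s) true  f = forced-sum fd s false (λ ()) f
  forced-sumᵘ fd (free false s) false f = forced-sum fd s true (λ _ → refl) f

  forces-sum : ∀ b {D A} → Forces b D A → ∀ {P} → A ⊑ P → (f : List Bool → ℕ) →
    sumM D (λ V → fit b V P * f V) ≡ sumB (length D) (λ V → fit b V P * f V)
  forces-sum true  (a , A , refl , fd) {[]}    () f
  forces-sum true  (a , A , refl , fd) {q ∷ P} s  f = forced-sumᵘ fd s false f
  forces-sum false fd                          s  f = forced-sum fd s false (λ ()) f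

  -- A trapezoid with triangles standing on its base cut out: each row is given by the marks A
  -- of its base-side cells and the marks D of the others, which are also the marks of the
  -- base-side cells of the next row.
  data Trapezoid : ℕ → List Bool → Set where
    apex  : ∀ x → Trapezoid 0 (falses x)
    layer : ∀ {n D A} → Forces (ev n) D A → Trapezoid n D → Trapezoid (suc n) A

  rowsAbove : ∀ {n A} → Trapezoid n A → List (List Bool)
  rowsAbove (apex x)              = []
  rowsAbove (layer {n} {D} {A} f t) = row (ev n) A D ∷ rowsAbove t

  -- For an upright trapezoid, where vertical lozenges leave a row through its far side. `row-scan′`
  -- is for an inverted one, where they leave through the base side.
  row-scan : ∀ b (D : List Bool) {P U X} k → length P ≡ above b (length D) → length U ≡ above (not b) (length X) →
    scan (not b) false (row b P D) (row (not b) U X) k ≡ sum2 D U (λ D′ U′ → fit b D′ P * k (row (not b) U′ X))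
  row-scan true  D {P} {U} {X} k e e′ = scan-up false D P U X k (≤-trans (n≤1+n _) (≤-reflexive (sym e))) (≤-reflexive e′)
  row-scan false D {P} {U} {X} k e e′ = scan-down false D P U X k (≤-trans (≤-reflexive (sym e)) (n≤1+n _)) (≤-reflexive e′)

  row-scan′ : ∀ b (D : List Bool) {P U X} k → length D ≡ above b (length P) → length U ≤ above b (length X) →
    scan b false (row b D P) (row (not b) X U) k ≡ sum2 D U (λ D′ U′ → fit b P D′ * k (row (not b) X U′))
  row-scan′ true  D {P} {U} {X} k e e′ = scan-down false D P U X k (≤-reflexive e) e′
  row-scan′ false D {P} {U} {X} k e e′ = scan-up false D P U X k (≤-reflexive e) e′

  -- The scan only sees the `V` containing the marks of the removed triangles; `forces-sum` extends
  -- the sum to all `V`. Row by row the triangles are thus forgotten, except for their bases in `P`,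
  -- which may also contain marks made from below.
  process-trapezoid : ∀ {n D A} → Forces (ev n) D A → (t : Trapezoid n D) → ∀ P → A ⊑ P →
    process (not (ev n)) (row (ev n) P D) (rowsAbove t) ≡ T (suc n) P
  process-trapezoid fd (apex x) P s = trans (last (il P (falses x))) (sym (begin
    sumB (pred (length P)) (λ V → pm false (il P V) * none V)
      ≡⟨ cong (λ l → sumB (pred l) (λ V → pm false (il P V) * none V)) (trans (⊑-length s) (trans (forces-length true fd) (cong suc (length-replicate x)))) ⟩
    sumB x (λ V → pm false (il P V) * none V)
      ≡⟨ sumB-cong x (λ V _ → *-comm (pm false (il P V)) (none V)) ⟩
    sumB x (λ V → none V * pm false (il P V))
      ≡⟨ sumB-none x _ ⟩
    pm false (il P (falses x)) ∎))
    where
    last : ∀ r → scan false false r [] (λ _ → 1) ≡ pm false r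
    last []      = refl
    last (x ∷ r) = *-identityʳ _
  process-trapezoid {suc n} {D} {A} fd (layer {D = E} fd′ t) P s = begin
    scan (not (not (ev n))) false (row (not (ev n)) P D) (row (ev n) D E) k
      ≡⟨ scan-it (ev n) fd fd′ ⟩
    sum2 D D (λ D′ U′ → fit (not (ev n)) D′ P * k (row (ev n) U′ E))
      ≡⟨ sum2-diagonal D _ ⟩
    sumM D (λ V → fit (not (ev n)) V P * k (row (ev n) V E))
      ≡⟨ sumM-cong D (λ V sV → cong (fit (not (ev n)) V P *_) (trans
           (cong (λ d → process d (row (ev n) V E) (rowsAbove t)) (not-involutive (not (ev n))))
           (process-trapezoid fd′ t V sV))) ⟩
    sumM D (λ V → fit (not (ev n)) V P * T (suc n) V)
      ≡⟨ forces-sum (not (ev n)) fd s (T (suc n)) ⟩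
    sumB (length D) (λ V → fit (not (ev n)) V P * T (suc n) V)
      ≡⟨ cong (λ l → sumB l (λ V → fit (not (ev n)) V P * T (suc n) V)) (sym (trans (cong (below (not (ev n))) (trans (⊑-length s) (forces-length (not (ev n)) fd))) (below-above (not (ev n)) (length D)))) ⟩
    T (suc (suc n)) P ∎
    where
    k : List Bool → ℕ
    k l = process (not (not (not (ev n)))) l (rowsAbove t)
    scan-it : ∀ b → Forces (not b) D A → Forces b E D → ∀ {k} →
      scan (not (not b)) false (row (not b) P D) (row b D E) k ≡ sum2 D D (λ D′ U′ → fit (not b) D′ P * k (row b U′ E))
    scan-it true  f f′ {k} = row-scan false D {P} {D} {E} k (trans (⊑-length s) (forces-length false f)) (forces-length true f′)
    scan-it false f f′ {k} = row-scan true D {P} {D} {E} k (trans (⊑-length s) (forces-length true f)) (forces-length false f′)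

  processAll : Bool → List (List Bool) → ℕ
  processAll d []       = 1
  processAll d (r ∷ rs) = process d r rs

  rowsBelow : ∀ {n A} → Trapezoid n A → List (List Bool) → List (List Bool)
  rowsBelow (apex x)                  acc = acc
  rowsBelow (layer {n} {D} {A} f t) acc = rowsBelow t (row (ev n) A D ∷ acc)

  ≤-above : ∀ b {l} → l ≤ above b l
  ≤-above true  = n≤1+n _
  ≤-above false = ≤-refl

  process-lower-step : ∀ {n D A} → Forces (ev n) D A → ∀ P → D ⊑ P → ∀ C rest → length A ≤ length C →
    process (ev n) (row (ev n) A P) (row (not (ev n)) C A ∷ rest)
      ≡ sumM A (λ V → fit (ev n) P V * process (not (ev n)) (row (not (ev n)) C V) rest)
  process-lower-step {n} {D} {A} fd P s C rest e = trans
    (row-scan′ (ev n) A {P} {A} {C} (λ l → process (not (ev n)) l rest) (trans (forces-length (ev n) fd) (cong (above (ev n)) (sym (⊑-length s)))) (≤-trans e (≤-above (ev n))))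
    (sum2-diagonal A _)

  -- An inverted trapezoid is scanned from apex to base. Afterwards only the weight `T n P` of each
  -- set `P` of marks on its base matters for the rows `C` and `rest` standing on it.
  process-lower : ∀ {n A} (t : Trapezoid n A) C rest → length A ≤ length C →
    processAll true (rowsBelow t (row (ev n) C A ∷ rest)) ≡ sumM A (λ P → T n P * process (ev n) (row (ev n) C P) rest)
  process-lower (apex x) C rest e = sym (sumB-none x (λ P → process true (row true C P) rest))
  process-lower (layer {n} {D} {A} fd t) C rest e = begin
    processAll true (rowsBelow t (row (ev n) A D ∷ row (not (ev n)) C A ∷ rest))
      ≡⟨ process-lower t A _ (≤-trans (≤-above (ev n)) (≤-reflexive (sym (forces-length (ev n) fd)))) ⟩
    sumM D (λ P → T n P * process (ev n) (row (ev n) A P) (row (not (ev n)) C A ∷ rest))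
      ≡⟨ sumM-cong D (λ P s → cong (T n P *_) (process-lower-step {n} fd P s C rest e)) ⟩
    sumM D (λ P → T n P * sumM A (λ V → fit (ev n) P V * X V))
      ≡⟨ sumM-exchange A D (T n) (λ P V → fit (ev n) P V) X ⟩
    sumM A (λ V → sumM D (λ P → fit (ev n) P V * T n P) * X V)
      ≡⟨ sumM-cong A (λ V s → cong (_* X V) (begin
           sumM D (λ P → fit (ev n) P V * T n P)
             ≡⟨ forces-sum (ev n) fd s (T n) ⟩
           sumB (length D) (λ P → fit (ev n) P V * T n P)
             ≡⟨ cong (λ l → sumB l (λ P → fit (ev n) P V * T n P)) (sym (trans (cong (below (ev n)) (trans (⊑-length s) (forces-length (ev n) fd))) (below-above (ev n) (length D)))) ⟩
           T (suc n) V ∎)) ⟩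
    sumM A (λ V → T (suc n) V * X V) ∎
    where
    X : List Bool → ℕ
    X V = process (not (ev n)) (row (not (ev n)) C V) rest
  none-++ : ∀ S B → none B ≡ 1 → none (S ++ B) ≡ none S
  none-++ []          B h = h
  none-++ (true ∷ S)  B h = refl
  none-++ (false ∷ S) B h = none-++ S B h

  -- Two trapezoids glued along their bases, the lower one upside down; S marks the vertical
  -- lozenges across the common base, of which the cut-out triangles leave free x places.
  process-glued : ∀ {m n B D} x A z (t : Trapezoid m B) (fd : Forces (ev n) D (falses x ++ A)) (u : Trapezoid n D) →
    B ≡ falses x ++ (map not A ++ trues z) → ev m ≡ ev (suc n) →
    processAll true (rowsBelow t (rowsAbove (layer fd u)))
      ≡ sumB x (λ S → T m (S ++ (map not A ++ trues z)) * T (suc n) (S ++ A))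
  -- Without rows below the line there are no dents below it, and `none` admits only the empty `S`.
  process-glued {n = n} {D = D} x A z (apex x′) fd u eB par = begin
    process true (row (ev n) (falses x ++ A) D) (rowsAbove u)
      ≡⟨ cong (λ d → process d (row (ev n) (falses x ++ A) D) (rowsAbove u)) par ⟩
    process (not (ev n)) (row (ev n) (falses x ++ A) D) (rowsAbove u)
      ≡⟨ process-trapezoid fd u _ (⊑-refl _) ⟩
    T (suc n) (falses x ++ A)
      ≡⟨ sym (sumB-none x (λ S → T (suc n) (S ++ A))) ⟩
    sumB x (λ S → none S * T (suc n) (S ++ A))
      ≡⟨ sumB-cong x (λ S _ → cong (_* T (suc n) (S ++ A)) (sym (none-++ S _ empty))) ⟩
    sumB x (λ S → none (S ++ (map not A ++ trues z)) * T (suc n) (S ++ A)) ∎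
    where
    drop-falses : ∀ x l → none (falses x ++ l) ≡ none l
    drop-falses zero    l = refl
    drop-falses (suc x) l = drop-falses x l
    empty : none (map not A ++ trues z) ≡ 1
    empty = trans (sym (drop-falses x _)) (trans (cong none (sym eB)) (none-falses x′))
  process-glued {n = n} {D = D} x A z (layer {m} {E} fd′ t) fd u refl par = begin
    processAll true (rowsBelow t (row (ev m) B₀ E ∷ row (ev n) A₀ D ∷ rowsAbove u))
      ≡⟨ process-lower t B₀ _ (≤-trans (≤-above (ev m)) (≤-reflexive (sym (forces-length (ev m) fd′)))) ⟩
    sumM E (λ P → T m P * process (ev m) (row (ev m) B₀ P) (row (ev n) A₀ D ∷ rowsAbove u))
      ≡⟨ sumM-cong E (λ P s → cong (T m P *_) (step (ev m) (ev n) same fd′ fd P s)) ⟩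
    sumM E (λ P → T m P * sumB x (λ S → fit (ev m) P (S ++ B₁) * process (not (ev m)) (row (ev n) (S ++ A) D) (rowsAbove u)))
      ≡⟨ sumM-exchange (falses x) E (T m) (λ P S → fit (ev m) P (S ++ B₁)) (λ S → process (not (ev m)) (row (ev n) (S ++ A) D) (rowsAbove u)) ⟩
    sumB x (λ S → sumM E (λ P → fit (ev m) P (S ++ B₁) * T m P) * process (not (ev m)) (row (ev n) (S ++ A) D) (rowsAbove u))
      ≡⟨ sumB-cong x (λ S eS → cong₂ _*_ (lower S eS)
           (trans (cong (λ b → process (not b) (row (ev n) (S ++ A) D) (rowsAbove u)) same)
             (process-trapezoid fd u (S ++ A) (falses-++-⊑ A S eS)))) ⟩
    sumB x (λ S → T (suc m) (S ++ B₁) * T (suc n) (S ++ A)) ∎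
    where
    B₁ A₀ B₀ : List Bool
    B₁ = map not A ++ trues z
    A₀ = falses x ++ A
    B₀ = falses x ++ B₁
    same : ev m ≡ ev n
    same = trans (sym (not-involutive (ev m))) (trans (cong not par) (not-involutive (ev n)))
    falses-++-⊑ : ∀ {x} C S → length S ≡ x → (falses x ++ C) ⊑ (S ++ C)
    falses-++-⊑ C []      refl = ⊑-refl C
    falses-++-⊑ C (b ∷ S) refl = free b (falses-++-⊑ C S refl)
    step : ∀ b c → b ≡ c → Forces b E B₀ → Forces c D A₀ → ∀ P → E ⊑ P →
      process b (row b B₀ P) (row c A₀ D ∷ rowsAbove u)
        ≡ sumB x (λ S → fit b P (S ++ B₁) * process (not b) (row c (S ++ A) D) (rowsAbove u))
    step b .b refl f′ f P s = begin
      process b (row b B₀ P) (row b A₀ D ∷ rowsAbove u)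
        -- The base row of the upper part is read as the next row of the lower one; base side and
        -- far side change places, and with them the flag.
        ≡⟨ cong (λ r → process b (row b B₀ P) (r ∷ rowsAbove u)) (row-swap b A₀) ⟩
      scan b false (row b B₀ P) (row (not b) D A₀) (λ l → process (not b) l (rowsAbove u))
        ≡⟨ row-scan′ b B₀ {P} {A₀} {D} _ (trans (forces-length b f′) (cong (above b) (sym (⊑-length s)))) (≤-reflexive (forces-length b f)) ⟩
      sum2 B₀ A₀ (λ D′ U′ → fit b P D′ * process (not b) (row (not b) D U′) (rowsAbove u))
        ≡⟨ sum2-falses x B₁ A _ ⟩
      sumB x (λ S → sum2 B₁ A (λ D′ U′ → fit b P (S ++ D′) * process (not b) (row (not b) D (S ++ U′)) (rowsAbove u)))
        ≡⟨ sumB-cong x (λ S _ → trans (sum2-complement A z _)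
             (cong (λ r → fit b P (S ++ B₁) * process (not b) r (rowsAbove u)) (sym (row-swap b (S ++ A))))) ⟩
      sumB x (λ S → fit b P (S ++ B₁) * process (not b) (row b (S ++ A) D) (rowsAbove u)) ∎
      where
      row-swap : ∀ b X → row b X D ≡ row (not b) D X
      row-swap true  X = refl
      row-swap false X = refl
    lower : ∀ S → length S ≡ x → sumM E (λ P → fit (ev m) P (S ++ B₁) * T m P) ≡ T (suc m) (S ++ B₁)
    lower S eS = trans (forces-sum (ev m) fd′ (falses-++-⊑ B₁ S eS) (T m))
      (cong (λ l → sumB l (λ P → fit (ev m) P (S ++ B₁) * T m P))
        (sym (trans (cong (below (ev m)) (trans (⊑-length (falses-++-⊑ B₁ S eS)) (forces-length (ev m) fd′))) (below-above (ev m) (length E)))))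

-- Factorials, Pochhammer products and powers of two

module Factorials where

  open Chains
  open Products using (dbl; rank)
  open import Defs using (factorial; Hf; H₂; poch; prodTo)
  open import Data.Bool using (Bool; true; false; not)
  open import Data.Nat using (ℕ; zero; suc; _+_; _*_; _∸_; _^_; _≤_; z≤n; s≤s; NonZero)
  open import Data.Nat.Properties
  open import Data.Nat.Tactic.RingSolver using (solve-∀)
  open import Data.List using (List; []; _∷_; _++_; length; map)
  open import Relation.Binary.PropositionalEquality
  open ≡-Reasoning

  trueCount : List Bool → ℕ
  trueCount []          = 0
  trueCount (true ∷ P)  = suc (trueCount P)
  trueCount (false ∷ P) = trueCount P

  trueCount-++ : ∀ P R → trueCount (P ++ R) ≡ trueCount P + trueCount R
  trueCount-++ []          R = refl
  trueCount-++ (true ∷ P)  R = cong suc (trueCount-++ P R)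
  trueCount-++ (false ∷ P) R = trueCount-++ P R

  trueCount-trues : ∀ n → trueCount (trues n) ≡ n
  trueCount-trues zero    = refl
  trueCount-trues (suc n) = cong suc (trueCount-trues n)

  trueCount-falses : ∀ n → trueCount (falses n) ≡ 0
  trueCount-falses zero    = refl
  trueCount-falses (suc n) = trueCount-falses n

  ev-dbl : ∀ k → ev (dbl k) ≡ true
  ev-dbl zero    = refl
  ev-dbl (suc k) rewrite ev-dbl k = refl

  baseLength-even : ∀ k x → baseLength (dbl k) x ≡ k + x
  baseLength-odd  : ∀ k x → baseLength (suc (dbl k)) x ≡ suc k + x
  baseLength-even zero    x = refl
  baseLength-even (suc k) x rewrite ev-dbl k = cong suc (baseLength-even k x)
  baseLength-odd k x rewrite ev-dbl k = cong suc (baseLength-even k x)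

  dbl≡2* : ∀ n → dbl n ≡ 2 * n
  dbl≡2* zero    = refl
  dbl≡2* (suc n) = cong suc (trans (cong suc (dbl≡2* n)) (sym (+-suc n (n + 0))))

  rank-even : ∀ k → rank (dbl k) ≡ k
  rank-even k = trans (baseLength-even k 0) (+-identityʳ k)

  rank-odd : ∀ k → rank (suc (dbl k)) ≡ suc k
  rank-odd k = trans (baseLength-odd k 0) (+-identityʳ (suc k))

  poch-+ : ∀ u m n → poch u (m + n) ≡ poch u m * poch (u + m) n
  poch-+ u zero    n = trans (cong (λ v → poch v n) (sym (+-identityʳ u))) (sym (*-identityˡ _))
  poch-+ u (suc m) n = begin
    u * poch (suc u) (m + n)                        ≡⟨ cong (u *_) (poch-+ (suc u) m n) ⟩
    u * (poch (suc u) m * poch (suc u + m) n)     ≡⟨ sym (*-assoc u _ _) ⟩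
    u * poch (suc u) m * poch (suc (u + m)) n     ≡⟨ cong (λ v → u * poch (suc u) m * poch v n) (sym (+-suc u m)) ⟩
    poch u (suc m) * poch (u + suc m) n ∎

  poch-last : ∀ u m → poch u (suc m) ≡ poch u m * (u + m)
  poch-last u m = trans (cong (poch u) (+-comm 1 m)) (trans (poch-+ u m 1) (cong (poch u m *_) (*-identityʳ _)))

  poch-1 : ∀ m → poch 1 m ≡ factorial m
  poch-1 zero    = refl
  poch-1 (suc m) = trans (poch-last 1 m) (trans (cong (_* suc m) (poch-1 m)) (*-comm (factorial m) (suc m)))

  -- U L m is the product of 2L + i + j over 1 ≤ i ≤ j ≤ m.
  U : ℕ → ℕ → ℕ
  U L zero    = 1
  U L (suc m) = poch (2 * L + 2) (suc m) * U (suc L) m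

  U-last : ∀ L m → U L (suc m) ≡ U L m * poch (2 * L + m + 2) (suc m)
  U-last L zero    = trans (*-comm (poch (2 * L + 2) 1) 1) (cong (λ v → 1 * poch (v + 2) 1) (sym (+-identityʳ (2 * L))))
  U-last L (suc m) = begin
    poch (2 * L + 2) (suc (suc m)) * U (suc L) (suc m)
      ≡⟨ cong₂ _*_ (poch-last (2 * L + 2) (suc m)) (U-last (suc L) m) ⟩
    poch (2 * L + 2) (suc m) * (2 * L + 2 + suc m) * (U (suc L) m * poch (2 * suc L + m + 2) (suc m))
      ≡⟨ cong₂ (λ u v → poch (2 * L + 2) (suc m) * u * (U (suc L) m * poch v (suc m))) (lem₁ L m) (lem₂ L m) ⟩
    poch (2 * L + 2) (suc m) * v * (U (suc L) m * poch (suc v) (suc m))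
      ≡⟨ lem₃ (poch (2 * L + 2) (suc m)) v (U (suc L) m) (poch (suc v) (suc m)) ⟩
    poch (2 * L + 2) (suc m) * U (suc L) m * (v * poch (suc v) (suc m)) ∎
    where
    v : ℕ
    v = 2 * L + suc m + 2
    lem₁ : ∀ L m → 2 * L + 2 + suc m ≡ 2 * L + suc m + 2
    lem₁ = solve-∀
    lem₂ : ∀ L m → 2 * suc L + m + 2 ≡ suc (2 * L + suc m + 2)
    lem₂ = solve-∀
    lem₃ : ∀ p v u q → p * v * (u * q) ≡ p * u * (v * q)
    lem₃ = solve-∀

  -- Removes the row i = 1 and the last column from the triangle of factors; their factors are
  -- consecutive numbers and form a single Pochhammer symbol.
  U-two : ∀ L m → U L (suc (suc m)) ≡ U (suc L) m * poch (2 * L + 2) (2 * m + 3)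
  U-two L m = begin
    p * U (suc L) (suc m)
      ≡⟨ cong (p *_) (U-last (suc L) m) ⟩
    p * (U (suc L) m * poch (2 * suc L + m + 2) (suc m))
      ≡⟨ cong (λ v → p * (U (suc L) m * poch v (suc m))) (lem₁ L m) ⟩
    p * (U (suc L) m * poch (2 * L + 2 + suc (suc m)) (suc m))
      ≡⟨ lem₂ p (U (suc L) m) _ ⟩
    U (suc L) m * (p * poch (2 * L + 2 + suc (suc m)) (suc m))
      ≡⟨ cong (U (suc L) m *_) (sym (poch-+ (2 * L + 2) (suc (suc m)) (suc m))) ⟩
    U (suc L) m * poch (2 * L + 2) (suc (suc m) + suc m)
      ≡⟨ cong (λ n → U (suc L) m * poch (2 * L + 2) n) (lem₃ m) ⟩
    U (suc L) m * poch (2 * L + 2) (2 * m + 3) ∎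
    where
    p : ℕ
    p = poch (2 * L + 2) (suc (suc m))
    lem₁ : ∀ L m → 2 * suc L + m + 2 ≡ 2 * L + 2 + suc (suc m)
    lem₁ = solve-∀
    lem₂ : ∀ p u q → p * (u * q) ≡ u * (p * q)
    lem₂ = solve-∀
    lem₃ : ∀ m → suc (suc m) + suc m ≡ 2 * m + 3
    lem₃ = solve-∀

  -- Each application of `U-two` raises `x` by one and lowers the size by two. The factors split off
  -- are the Pochhammer product in the theorem.
  U-steps : ∀ x h μ → U x (dbl h + μ) ≡ U (x + h) μ * prodTo h (λ i → poch (2 * x + 2 * i) (2 * μ + 3 + 4 * h ∸ 4 * i))
  U-steps x zero    μ = trans (cong (λ v → U v μ) (sym (+-identityʳ x))) (sym (*-identityʳ _))
  U-steps x (suc h) μ = begin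
    U x (suc (suc (dbl h + μ)))
      ≡⟨ cong (U x) (sym (trans (+-suc (dbl h) (suc μ)) (cong suc (+-suc (dbl h) μ)))) ⟩
    U x (dbl h + suc (suc μ))
      ≡⟨ U-steps x h (suc (suc μ)) ⟩
    U (x + h) (suc (suc μ)) * prodTo h f′
      ≡⟨ cong₂ _*_ (trans (U-two (x + h) μ) (cong₂ (λ u n → U u μ * n) (sym (+-suc x h)) (cong₂ poch (lem₁ x h) (sym last)))) (prodTo-cong h (λ i → cong (λ n → poch (2 * x + 2 * i) (n ∸ 4 * i)) (lem₂ h μ))) ⟩
    U (x + suc h) μ * f (suc h) * prodTo h f
      ≡⟨ trans (*-assoc (U (x + suc h) μ) _ _) (cong (U (x + suc h) μ *_) (*-comm (f (suc h)) _)) ⟩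
    U (x + suc h) μ * (prodTo h f * f (suc h)) ∎
    where
    f f′ : ℕ → ℕ
    f i = poch (2 * x + 2 * i) (2 * μ + 3 + 4 * suc h ∸ 4 * i)
    f′ i = poch (2 * x + 2 * i) (2 * suc (suc μ) + 3 + 4 * h ∸ 4 * i)
    lem₁ : ∀ x h → 2 * (x + h) + 2 ≡ 2 * x + 2 * suc h
    lem₁ = solve-∀
    lem₂ : ∀ h μ → 2 * suc (suc μ) + 3 + 4 * h ≡ 2 * μ + 3 + 4 * suc h
    lem₂ = solve-∀
    last : 2 * μ + 3 + 4 * suc h ∸ 4 * suc h ≡ 2 * μ + 3
    last = m+n∸n≡m (2 * μ + 3) (4 * suc h)
    prodTo-cong : ∀ n {g g′ : ℕ → ℕ} → (∀ i → g i ≡ g′ i) → prodTo n g ≡ prodTo n g′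
    prodTo-cong zero    e = refl
    prodTo-cong (suc n) e = cong₂ _*_ (prodTo-cong n e) (e (suc n))

  triangular : ℕ → ℕ
  triangular zero    = 0
  triangular (suc m) = triangular m + m

  four-power : ∀ t → 4 ^ t ≡ 2 ^ dbl t
  four-power t = trans (^-*-assoc 2 2 t) (cong (2 ^_) (sym (dbl≡2* t)))

  triangular-square : ∀ m → dbl (triangular m) + m ≡ m * m
  triangular-square zero    = refl
  triangular-square (suc m) = begin
    dbl (triangular m + m) + suc m              ≡⟨ cong (_+ suc m) (dbl≡2* (triangular m + m)) ⟩
    2 * (triangular m + m) + suc m            ≡⟨ lem₁ (triangular m) m ⟩
    2 * triangular m + m + (2 * m + 1)    ≡⟨ cong (λ d → d + m + (2 * m + 1)) (sym (dbl≡2* (triangular m))) ⟩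
    dbl (triangular m) + m + (2 * m + 1)    ≡⟨ cong (_+ (2 * m + 1)) (triangular-square m) ⟩
    m * m + (2 * m + 1)                     ≡⟨ lem₂ m ⟩
    suc m * suc m ∎
    where
    lem₁ : ∀ t m → 2 * (t + m) + suc m ≡ 2 * t + m + (2 * m + 1)
    lem₁ = solve-∀
    lem₂ : ∀ m → m * m + (2 * m + 1) ≡ suc m * suc m
    lem₂ = solve-∀

  triangular-+ : ∀ m n → triangular (m + n) ≡ triangular m + triangular n + m * n
  triangular-+ zero    n = sym (+-identityʳ _)
  triangular-+ (suc m) n = trans (cong (_+ (m + n)) (triangular-+ m n)) (lem (triangular m) (triangular n) m n)
    where
    lem : ∀ t u m n → t + u + m * n + (m + n) ≡ t + m + u + suc m * n
    lem = solve-∀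

  factorial≢0 : ∀ n → NonZero (factorial n)
  factorial≢0 zero    = _
  factorial≢0 (suc n) = m*n≢0 (suc n) (factorial n) {{_}} {{factorial≢0 n}}

  Hf≢0 : ∀ n → NonZero (Hf n)
  Hf≢0 zero    = _
  Hf≢0 (suc n) = m*n≢0 (Hf n) (factorial n) {{Hf≢0 n}} {{factorial≢0 n}}

  H₂≢0 : ∀ n → NonZero (H₂ n)
  H₂≢0 zero          = _
  H₂≢0 (suc zero)    = _
  H₂≢0 (suc (suc n)) = m*n≢0 (H₂ n) (factorial n) {{H₂≢0 n}} {{factorial≢0 n}}

  poch≢0 : ∀ u m → NonZero (poch (suc u) m)
  poch≢0 u zero    = _
  poch≢0 u (suc m) = m*n≢0 (suc u) (poch (suc (suc u)) m) {{_}} {{poch≢0 (suc u) m}}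

  U≢0 : ∀ L m → NonZero (U L m)
  U≢0 L zero    = _
  U≢0 L (suc m) = m*n≢0 (poch (2 * L + 2) (suc m)) (U (suc L) m)
    {{subst (λ u → NonZero (poch u (suc m))) (sym (+-suc (2 * L) 1)) (poch≢0 (2 * L + 1) (suc m))}} {{U≢0 (suc L) m}}

  -- The quotient of `H₂ (2k + 2)` by `H₂ (2k + 1)` is 2 · 4 ⋯ 2k. Converts the normalisation for
  -- even row numbers into that for odd ones.
  H₂-Hf : ∀ k → H₂ (dbl (suc k)) * Hf k ≡ 2 ^ k * H₂ (suc (dbl k)) * Hf (suc k)
  H₂-Hf zero    = refl
  H₂-Hf (suc k) = begin
    H₂ (dbl (suc k)) * (suc (suc (dbl k)) * f) * (Hf k * factorial k)
      ≡⟨ lem₁ (H₂ (dbl (suc k))) (suc (suc (dbl k))) f (Hf k) (factorial k) ⟩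
    H₂ (dbl (suc k)) * Hf k * (suc (suc (dbl k)) * f * factorial k)
      ≡⟨ cong₂ (λ u v → u * (v * f * factorial k)) (H₂-Hf k) (dbl≡2* (suc k)) ⟩
    2 ^ k * H₂ (suc (dbl k)) * Hf (suc k) * (2 * suc k * f * factorial k)
      ≡⟨ lem₂ (2 ^ k) (H₂ (suc (dbl k))) (Hf (suc k)) (suc k) f (factorial k) ⟩
    2 ^ suc k * (H₂ (suc (dbl k)) * f) * (Hf (suc k) * (suc k * factorial k)) ∎
    where
    f : ℕ
    f = factorial (suc (dbl k))
    lem₁ : ∀ h n f g a → h * (n * f) * (g * a) ≡ h * g * (n * f * a)
    lem₁ = solve-∀
    lem₂ : ∀ p h g n f a → p * h * g * (2 * n * f * a) ≡ 2 * p * (h * f) * (g * (n * a))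
    lem₂ = solve-∀

  trueCount-complement : ∀ A z → trueCount A + trueCount (map not A ++ trues z) ≡ length A + z
  trueCount-complement []          z = trueCount-trues z
  trueCount-complement (true ∷ A)  z = cong suc (trueCount-complement A z)
  trueCount-complement (false ∷ A) z = trans (+-suc (trueCount A) _) (cong suc (trueCount-complement A z))

  trueCount≤length : ∀ P → trueCount P ≤ length P
  trueCount≤length []          = z≤n
  trueCount≤length (true ∷ P)  = s≤s (trueCount≤length P)
  trueCount≤length (false ∷ P) = m≤n⇒m≤1+n (trueCount≤length P)

  pochFactor : ℕ → ℕ → ℕ → ℕ
  pochFactor x h μ = prodTo h (λ i → poch (2 * x + 2 * i) (2 * μ + 3 + 4 * h ∸ 4 * i))

-- Explicit values of norms and discriminants

module Evaluation where

  open Chains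
  open Determinants using (product; rowProduct; vandermonde)
  open Products
  open Factorials
  open import Defs using (factorial; Hf; H₂; poch)
  open import Data.Bool using (Bool; true; false; not)
  open import Data.Nat as ℕ using (ℕ; zero; suc; _^_)
  import Data.Nat.Properties as ℕ
  import Data.Nat.Tactic.RingSolver as ℕR
  open import Data.Integer using (ℤ; 0ℤ; 1ℤ; +_; _+_; _-_; _*_)
  open import Data.Integer.Properties
  open import Data.Integer.Tactic.RingSolver using (solve-∀)
  open import Data.List using (List; []; _∷_; _++_; length; map)
  open import Data.List.Properties using (length-++; length-replicate)
  open import Data.Product using (_×_; _,_; proj₁; proj₂)
  open import Relation.Nullary using (yes; no)
  open import Relation.Binary.PropositionalEquality
  open ≡-Reasoning

  marks-length : {A : Set} (f : ℕ → A) → ∀ t P → length (marks f t P) ≡ trueCount P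
  marks-length f t []          = refl
  marks-length f t (true ∷ P)  = cong suc (marks-length f (suc t) P)
  marks-length f t (false ∷ P) = marks-length f (suc t) P

  -- t P · ν is the discriminant of P if P has r marks, and 0 otherwise.
  record Evaluates (b : Bool) (r : ℕ) (l : ℕ) (t : List Bool → ℕ) (ν : ℤ) : Set where
    field
      hit  : ∀ P → length P ≡ l → trueCount P ≡ r → + t P * ν ≡ discriminant b (points b 0 P)
      miss : ∀ P → length P ≡ l → trueCount P ≢ r → + t P * ν ≡ 0ℤ

  T-evaluates : ∀ n l → rank n ℕ.≤ l → Evaluates (ev n) (rank n) l (T n) (norm n)
  T-evaluates n l h = record
    { hit  = λ P e c → T-product n P (subst (rank n ℕ.≤_) (sym e) h) (trans (marks-length _ 0 P) c)
    ; miss = λ P e c → T-vanishes n P (subst (rank n ℕ.≤_) (sym e) h) (λ c′ → c (trans (sym (marks-length _ 0 P)) c′)) }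

  -- The case `r = 0` of a trapezoid with 2r - 1 rows: truncated subtraction leaves no row, and
  -- without dents the discriminant is 1 for either value of `b`.
  none-evaluates : ∀ b l → Evaluates b 0 l none 1ℤ
  none-evaluates b l = record { hit = λ P _ → hit 0 P ; miss = λ P _ → miss P }
    where
    hit : ∀ t P → trueCount P ≡ 0 → + none P * 1ℤ ≡ discriminant b (points b t P)
    hit t []          c = refl
    hit t (false ∷ P) c = hit (suc t) P c
    miss : ∀ P → trueCount P ≢ 0 → + none P * 1ℤ ≡ 0ℤ
    miss []          c with () ← c refl
    miss (true ∷ P)  c = refl
    miss (false ∷ P) c = miss P c

  private
    points-++ : ∀ b S R → points b 0 (S ++ R) ≡ points b 0 S ++ points b (length S) R
    points-++ b S R = marks-++ (abscissa b) 0 S R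

  -- Only the union of the complementary sets A and B enters the sum over S.
  exchange-sum : ∀ {b r l t₁ t₂ t₃ t₄ ν₁ ν₂ ν₃ ν₄} A z →
    Evaluates b (r ℕ.+ trueCount A) (l ℕ.+ length A) t₁ ν₁ →
    Evaluates b (r ℕ.+ trueCount (map not A ++ trues z)) (l ℕ.+ length (map not A ++ trues z)) t₂ ν₂ →
    Evaluates b r l t₃ ν₃ →
    Evaluates b (r ℕ.+ (length A ℕ.+ z)) (l ℕ.+ (length A ℕ.+ z)) t₄ ν₄ →
    + sumB l (λ S → t₂ (S ++ (map not A ++ trues z)) ℕ.* t₁ (S ++ A)) * (ν₁ * ν₂) * discriminant b (points b l (trues (length A ℕ.+ z)))
      ≡ discriminant b (points b l A) * discriminant b (points b l (map not A ++ trues z))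
        * (+ sumB l (λ S → t₃ S ℕ.* t₄ (S ++ trues (length A ℕ.+ z))) * (ν₃ * ν₄))
  exchange-sum {b} {r} {l} {t₁} {t₂} {t₃} {t₄} {ν₁} {ν₂} {ν₃} {ν₄} A z E₁ E₂ E₃ E₄ = begin
    + sumB l f * (ν₁ * ν₂) * dC
      ≡⟨ trans (*-assoc (+ sumB l f) _ _) (trans (*-comm (+ sumB l f) _) (trans (cong (ν₁ * ν₂ * dC *_) (pos-sumM (falses l) f)) (sumℤ-*ˡ (falses l) (ν₁ * ν₂ * dC) _))) ⟩
    sumℤ (falses l) (λ S → ν₁ * ν₂ * dC * + f S)
      ≡⟨ sumℤ-cong (falses l) (λ S s → pointwise S (trans (⊑-length s) (length-replicate l))) ⟩
    sumℤ (falses l) (λ S → dA * dB * (ν₃ * ν₄) * + g S)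
      ≡⟨ sym (trans (cong (dA * dB *_) (*-comm (+ sumB l g) _)) (trans (sym (*-assoc (dA * dB) _ _))
           (trans (cong (dA * dB * (ν₃ * ν₄) *_) (pos-sumM (falses l) g)) (sumℤ-*ˡ (falses l) (dA * dB * (ν₃ * ν₄)) _)))) ⟩
    dA * dB * (+ sumB l g * (ν₃ * ν₄)) ∎
    where
    B C : List Bool
    B = map not A ++ trues z
    C = trues (length A ℕ.+ z)
    f g : List Bool → ℕ
    f S = t₂ (S ++ B) ℕ.* t₁ (S ++ A)
    g S = t₃ S ℕ.* t₄ (S ++ C)
    dA dB dC : ℤ
    dA = discriminant b (points b l A)
    dB = discriminant b (points b l B)
    dC = discriminant b (points b l C)
    long : ∀ S R → length S ≡ l → length (S ++ R) ≡ l ℕ.+ length R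
    long S R e = trans (length-++ S) (cong (ℕ._+ length R) e)
    C-length : length C ≡ length A ℕ.+ z
    C-length = length-replicate (length A ℕ.+ z)
    disc-++ : ∀ S R → length S ≡ l → discriminant b (points b 0 (S ++ R)) ≡ discriminant b (points b 0 S ++ points b l R)
    disc-++ S R e = cong (discriminant b) (trans (points-++ b S R) (cong (λ k → points b 0 S ++ points b k R) e))
    pointwise : ∀ S → length S ≡ l → ν₁ * ν₂ * dC * + f S ≡ dA * dB * (ν₃ * ν₄) * + g S
    pointwise S e with trueCount S ℕ.≟ r
    ... | yes c = begin
      ν₁ * ν₂ * dC * + (t₂ (S ++ B) ℕ.* t₁ (S ++ A))
        ≡⟨ cong (ν₁ * ν₂ * dC *_) (pos-* (t₂ (S ++ B)) _) ⟩
      ν₁ * ν₂ * dC * (+ t₂ (S ++ B) * + t₁ (S ++ A))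
        ≡⟨ lem₁ ν₁ ν₂ dC (+ t₂ (S ++ B)) (+ t₁ (S ++ A)) ⟩
      (+ t₁ (S ++ A) * ν₁) * (+ t₂ (S ++ B) * ν₂) * dC
        ≡⟨ cong₂ (λ u v → u * v * dC)
             (trans (Evaluates.hit E₁ (S ++ A) (long S A e) (trans (trueCount-++ S A) (cong (ℕ._+ trueCount A) c))) (disc-++ S A e))
             (trans (Evaluates.hit E₂ (S ++ B) (long S B e) (trans (trueCount-++ S B) (cong (ℕ._+ trueCount B) c))) (disc-++ S B e)) ⟩
      discriminant b (points b 0 S ++ points b l A) * discriminant b (points b 0 S ++ points b l B) * dC
        ≡⟨ discriminant-exchange b (points b 0 S) (points b l A) (points b l B) (points b l C) (λ g → product-filled g (abscissa b) l A z) ⟩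
      dA * dB * (discriminant b (points b 0 S) * discriminant b (points b 0 S ++ points b l C))
        ≡⟨ cong₂ (λ u v → dA * dB * (u * v)) (sym (Evaluates.hit E₃ S e c))
             (trans (sym (disc-++ S C e)) (sym (Evaluates.hit E₄ (S ++ C) (trans (long S C e) (cong (l ℕ.+_) C-length))
               (trans (trueCount-++ S C) (cong₂ ℕ._+_ c (trueCount-trues (length A ℕ.+ z))))))) ⟩
      dA * dB * ((+ t₃ S * ν₃) * (+ t₄ (S ++ C) * ν₄))
        ≡⟨ lem₂ (dA * dB) (+ t₃ S) ν₃ (+ t₄ (S ++ C)) ν₄ ⟩
      dA * dB * (ν₃ * ν₄) * (+ t₃ S * + t₄ (S ++ C))
        ≡⟨ cong (dA * dB * (ν₃ * ν₄) *_) (sym (pos-* (t₃ S) _)) ⟩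
      dA * dB * (ν₃ * ν₄) * + g S ∎
      where
      lem₁ : ∀ a b c x y → a * b * c * (x * y) ≡ (y * a) * (x * b) * c
      lem₁ = solve-∀
      lem₂ : ∀ d x a y b → d * ((x * a) * (y * b)) ≡ d * (a * b) * (x * y)
      lem₂ = solve-∀
    -- If `S` has a wrong size, then so has `S ++ A`, and a factor vanishes on either side.
    ... | no c = trans vanish₁ (sym vanish₂)
      where
      vanish₁ : ν₁ * ν₂ * dC * + f S ≡ 0ℤ
      vanish₁ = trans (cong (ν₁ * ν₂ * dC *_) (pos-* (t₂ (S ++ B)) _)) (trans (lem ν₁ ν₂ dC (+ t₂ (S ++ B)) (+ t₁ (S ++ A)))
        (trans (cong (_* (ν₂ * dC * + t₂ (S ++ B))) (Evaluates.miss E₁ (S ++ A) (long S A e)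
          (λ c′ → c (ℕ.+-cancelʳ-≡ (trueCount A) _ _ (trans (sym (trueCount-++ S A)) c′))))) refl))
        where
        lem : ∀ a b c x y → a * b * c * (x * y) ≡ (y * a) * (b * c * x)
        lem = solve-∀
      vanish₂ : dA * dB * (ν₃ * ν₄) * + g S ≡ 0ℤ
      vanish₂ = trans (cong (dA * dB * (ν₃ * ν₄) *_) (pos-* (t₃ S) _)) (trans (lem (dA * dB) (+ t₃ S) ν₃ (+ t₄ (S ++ C)) ν₄)
        (cong (_* (dA * dB * ν₄ * + t₄ (S ++ C))) (Evaluates.miss E₃ S e c)))
        where
        lem : ∀ d x a y b → d * (a * b) * (x * y) ≡ (x * a) * (d * b * y)
        lem = solve-∀

  column : Bool → ℕ → ℕ
  column true  L = 2 ℕ.* L ℕ.+ 2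
  column false L = 2 ℕ.* L ℕ.+ 1

  abscissa-column : ∀ b L → abscissa b L ≡ + column b L
  abscissa-column true  L = trans (lem (+ L)) (cong (_+ + 2) (sym (pos-* 2 L)))
    where
    lem : ∀ l → + 2 * (1ℤ + l) ≡ + 2 * l + + 2
    lem = solve-∀
  abscissa-column false L = cong (_+ 1ℤ) (sym (pos-* 2 L))

  abscissa-+ : ∀ b L j → abscissa b (L ℕ.+ j) ≡ abscissa b L + + 2 * + j
  abscissa-+ true  L j = lem (+ L) (+ j)
    where
    lem : ∀ l j → + 2 * (1ℤ + (l + j)) ≡ + 2 * (1ℤ + l) + + 2 * j
    lem = solve-∀
  abscissa-+ false L j = lem (+ L) (+ j)
    where
    lem : ∀ l j → + 2 * (l + j) + 1ℤ ≡ + 2 * l + 1ℤ + + 2 * j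
    lem = solve-∀

  -- Each factor is (q + 2j)² - q² = 4 j (q + j) with q = `column b L` and j running from `i + 1`.
  gap-product : ∀ b L i m → product (_- abscissa b L * abscissa b L) (squares (points b (L ℕ.+ suc i) (trues m)))
    ≡ + (4 ^ m ℕ.* poch (suc i) m ℕ.* poch (column b L ℕ.+ suc i) m)
  gap-product b L i zero    = refl
  gap-product b L i (suc m) = begin
    (p * p - q * q) * product (_- q * q) (squares (points b (suc (L ℕ.+ suc i)) (trues m)))
      ≡⟨ cong₂ _*_ factor (trans (cong (λ k → product (_- q * q) (squares (points b k (trues m)))) (sym (ℕ.+-suc L (suc i)))) (gap-product b L (suc i) m)) ⟩
    + (4 ℕ.* (suc i ℕ.* (c ℕ.+ suc i))) * + (4 ^ m ℕ.* poch (suc (suc i)) m ℕ.* poch (c ℕ.+ suc (suc i)) m)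
      ≡⟨ sym (pos-* (4 ℕ.* (suc i ℕ.* (c ℕ.+ suc i))) _) ⟩
    + (4 ℕ.* (suc i ℕ.* (c ℕ.+ suc i)) ℕ.* (4 ^ m ℕ.* poch (suc (suc i)) m ℕ.* poch (c ℕ.+ suc (suc i)) m))
      ≡⟨ cong +_ (trans (cong (λ n → 4 ℕ.* (suc i ℕ.* (c ℕ.+ suc i)) ℕ.* (4 ^ m ℕ.* poch (suc (suc i)) m ℕ.* poch n m)) (ℕ.+-suc c (suc i)))
           (lem (suc i) (c ℕ.+ suc i) (4 ^ m) (poch (suc (suc i)) m) (poch (suc (c ℕ.+ suc i)) m))) ⟩
    + (4 ^ suc m ℕ.* poch (suc i) (suc m) ℕ.* poch (c ℕ.+ suc i) (suc m)) ∎
    where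
    p q : ℤ
    p = abscissa b (L ℕ.+ suc i)
    q = abscissa b L
    c : ℕ
    c = column b L
    lem : ∀ j d f u v → 4 ℕ.* (j ℕ.* d) ℕ.* (f ℕ.* u ℕ.* v) ≡ 4 ℕ.* f ℕ.* (j ℕ.* u) ℕ.* (d ℕ.* v)
    lem = ℕR.solve-∀
    square-difference : ∀ c j → (c + + 2 * j) * (c + + 2 * j) - c * c ≡ + 4 * (j * (c + j))
    square-difference = solve-∀
    factor : p * p - q * q ≡ + (4 ℕ.* (suc i ℕ.* (c ℕ.+ suc i)))
    factor = begin
      p * p - q * q
        ≡⟨ cong (λ u → u * u - q * q) (abscissa-+ b L (suc i)) ⟩
      (q + + 2 * + suc i) * (q + + 2 * + suc i) - q * q
        ≡⟨ square-difference q (+ suc i) ⟩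
      + 4 * (+ suc i * (q + + suc i))
        ≡⟨ cong (λ u → + 4 * (+ suc i * (u + + suc i))) (abscissa-column b L) ⟩
      + 4 * (+ suc i * + (c ℕ.+ suc i))
        ≡⟨ sym (trans (pos-* 4 (suc i ℕ.* (c ℕ.+ suc i))) (cong (+ 4 *_) (pos-* (suc i) (c ℕ.+ suc i)))) ⟩
      + (4 ℕ.* (suc i ℕ.* (c ℕ.+ suc i))) ∎

  discriminant-step : ∀ b L m → discriminant b (points b L (trues (suc m)))
    ≡ weight b (abscissa b L) * + (4 ^ m ℕ.* factorial m ℕ.* poch (suc (column b L)) m) * discriminant b (points b (suc L) (trues m))
  discriminant-step b L m = begin
    weight b q * product (weight b) R * (product (_- q * q) (squares R) * vandermonde (squares R))
      ≡⟨ cong (λ u → weight b q * product (weight b) R * (u * vandermonde (squares R))) gaps ⟩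
    weight b q * product (weight b) R * (g * vandermonde (squares R))
      ≡⟨ lem (weight b q) (product (weight b) R) g (vandermonde (squares R)) ⟩
    weight b q * g * (product (weight b) R * vandermonde (squares R)) ∎
    where
    q g : ℤ
    q = abscissa b L
    g = + (4 ^ m ℕ.* factorial m ℕ.* poch (suc (column b L)) m)
    R : List ℤ
    R = points b (suc L) (trues m)
    lem : ∀ w p g v → w * p * (g * v) ≡ w * g * (p * v)
    lem = solve-∀
    gaps : product (_- q * q) (squares R) ≡ g
    gaps = trans (cong (λ k → product (_- q * q) (squares (points b k (trues m)))) (ℕ.+-comm 1 L))
      (trans (gap-product b L 0 m) (cong₂ (λ u v → + (4 ^ m ℕ.* u ℕ.* poch v m)) (poch-1 m) (ℕ.+-comm (column b L) 1)))

  -- At even positions the weight `2 L + 2` of the first point is the diagonal factor i = j = 1 of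
  -- `U`. At odd positions there is no weight, so that m + 1 points only give a `U` of size m.
  discriminant-even : ∀ L m → discriminant true (points true L (trues m)) ≡ + (4 ^ triangular m ℕ.* Hf m ℕ.* U L m)
  discriminant-even L zero    = refl
  discriminant-even L (suc m) = begin
    discriminant true (points true L (trues (suc m)))
      ≡⟨ discriminant-step true L m ⟩
    abscissa true L * + g * discriminant true (points true (suc L) (trues m))
      ≡⟨ cong₂ (λ u v → u * + g * v) (abscissa-column true L) (discriminant-even (suc L) m) ⟩
    + c * + g * + d
      ≡⟨ trans (cong (_* + d) (sym (pos-* c g))) (sym (pos-* (c ℕ.* g) d)) ⟩
    + (c ℕ.* g ℕ.* d)
      ≡⟨ cong +_ (trans (lem c (4 ^ m) (factorial m) (poch (suc c) m) (4 ^ triangular m) (Hf m) (U (suc L) m))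
           (cong (λ u → u ℕ.* (Hf m ℕ.* factorial m) ℕ.* (c ℕ.* poch (suc c) m ℕ.* U (suc L) m)) (sym (ℕ.^-distribˡ-+-* 4 (triangular m) m)))) ⟩
    + (4 ^ triangular (suc m) ℕ.* Hf (suc m) ℕ.* U L (suc m)) ∎
    where
    c g d : ℕ
    c = column true L
    g = 4 ^ m ℕ.* factorial m ℕ.* poch (suc c) m
    d = 4 ^ triangular m ℕ.* Hf m ℕ.* U (suc L) m
    lem : ∀ c f a p t h u → c ℕ.* (f ℕ.* a ℕ.* p) ℕ.* (t ℕ.* h ℕ.* u) ≡ t ℕ.* f ℕ.* (h ℕ.* a) ℕ.* (c ℕ.* p ℕ.* u)
    lem = ℕR.solve-∀

  discriminant-odd : ∀ L m → discriminant false (points false L (trues (suc m))) ≡ + (4 ^ triangular (suc m) ℕ.* Hf (suc m) ℕ.* U L m)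
  discriminant-odd L zero    = refl
  discriminant-odd L (suc m) = begin
    discriminant false (points false L (trues (suc (suc m))))
      ≡⟨ discriminant-step false L (suc m) ⟩
    1ℤ * + g * discriminant false (points false (suc L) (trues (suc m)))
      ≡⟨ cong₂ _*_ (*-identityˡ (+ g)) (discriminant-odd (suc L) m) ⟩
    + g * + d
      ≡⟨ sym (pos-* g d) ⟩
    + (g ℕ.* d)
      ≡⟨ cong +_ (trans (lem (4 ^ suc m) (factorial (suc m)) (poch (suc c) (suc m)) (4 ^ triangular (suc m)) (Hf (suc m)) (U (suc L) m))
           (cong₂ (λ u v → u ℕ.* (Hf (suc m) ℕ.* factorial (suc m)) ℕ.* (poch v (suc m) ℕ.* U (suc L) m))
             (sym (ℕ.^-distribˡ-+-* 4 (triangular (suc m)) (suc m))) (sym (ℕ.+-suc (2 ℕ.* L) 1)))) ⟩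
    + (4 ^ triangular (suc (suc m)) ℕ.* Hf (suc (suc m)) ℕ.* U L (suc m)) ∎
    where
    c g d : ℕ
    c = column false L
    g = 4 ^ suc m ℕ.* factorial (suc m) ℕ.* poch (suc c) (suc m)
    d = 4 ^ triangular (suc m) ℕ.* Hf (suc m) ℕ.* U (suc L) m
    lem : ∀ f a p t h u → (f ℕ.* a ℕ.* p) ℕ.* (t ℕ.* h ℕ.* u) ≡ t ℕ.* f ℕ.* (h ℕ.* a) ℕ.* (p ℕ.* u)
    lem = ℕR.solve-∀

  rowProduct-last : ∀ r n o → rowProduct r (suc n) o ≡ rowProduct r n o * r (o ℕ.+ n)
  rowProduct-last r zero    o = trans (*-comm (r o) 1ℤ) (cong (λ k → 1ℤ * r k) (sym (ℕ.+-identityʳ o)))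
  rowProduct-last r (suc n) o = begin
    r o * rowProduct r (suc n) (suc o)                    ≡⟨ cong (r o *_) (rowProduct-last r n (suc o)) ⟩
    r o * (rowProduct r n (suc o) * r (suc o ℕ.+ n))      ≡⟨ sym (*-assoc (r o) _ _) ⟩
    r o * rowProduct r n (suc o) * r (suc (o ℕ.+ n))      ≡⟨ cong (λ k → r o * rowProduct r n (suc o) * r k) (sym (ℕ.+-suc o n)) ⟩
    rowProduct r (suc n) o * r (o ℕ.+ suc n) ∎

  rowFactor-pos : ∀ k → rowFactor true k ≡ + (2 ℕ.* suc (suc (dbl k))) × rowFactor false k ≡ + (2 ℕ.* suc (dbl k))
  rowFactor-pos k = sym (pos-* 2 (suc (suc (dbl k)))) , sym (pos-* 2 (suc (dbl k)))

  -- The factors of the two kinds of rows are twice the odd and twice the even numbers. Two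
  -- consecutive rows together thus give a factorial and a power of two, the source of `H₂` in the
  -- norms.
  rowProducts : ∀ k → rowProduct (rowFactor false) k 0 * rowProduct (rowFactor true) k 0 ≡ + (2 ^ dbl k ℕ.* factorial (dbl k))
  rowProducts′ : ∀ k → rowProduct (rowFactor false) (suc k) 0 * rowProduct (rowFactor true) k 0 ≡ + (2 ^ suc (dbl k) ℕ.* factorial (suc (dbl k)))
  rowProducts zero    = refl
  rowProducts (suc k) = begin
    rowProduct (rowFactor false) (suc k) 0 * rowProduct (rowFactor true) (suc k) 0
      ≡⟨ cong (rowProduct (rowFactor false) (suc k) 0 *_) (rowProduct-last (rowFactor true) k 0) ⟩
    rowProduct (rowFactor false) (suc k) 0 * (rowProduct (rowFactor true) k 0 * rowFactor true k)
      ≡⟨ sym (*-assoc (rowProduct (rowFactor false) (suc k) 0) _ _) ⟩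
    rowProduct (rowFactor false) (suc k) 0 * rowProduct (rowFactor true) k 0 * rowFactor true k
      ≡⟨ cong₂ _*_ (rowProducts′ k) (proj₁ (rowFactor-pos k)) ⟩
    + (2 ^ suc (dbl k) ℕ.* factorial (suc (dbl k))) * + (2 ℕ.* suc (suc (dbl k)))
      ≡⟨ sym (pos-* (2 ^ suc (dbl k) ℕ.* factorial (suc (dbl k))) _) ⟩
    + (2 ^ suc (dbl k) ℕ.* factorial (suc (dbl k)) ℕ.* (2 ℕ.* suc (suc (dbl k))))
      ≡⟨ cong +_ (lem (2 ^ suc (dbl k)) (factorial (suc (dbl k))) (suc (suc (dbl k)))) ⟩
    + (2 ^ dbl (suc k) ℕ.* factorial (dbl (suc k))) ∎
    where
    lem : ∀ p f n → p ℕ.* f ℕ.* (2 ℕ.* n) ≡ 2 ℕ.* p ℕ.* (n ℕ.* f)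
    lem = ℕR.solve-∀
  rowProducts′ k = begin
    rowProduct (rowFactor false) (suc k) 0 * rowProduct (rowFactor true) k 0
      ≡⟨ cong (_* rowProduct (rowFactor true) k 0) (rowProduct-last (rowFactor false) k 0) ⟩
    rowProduct (rowFactor false) k 0 * rowFactor false k * rowProduct (rowFactor true) k 0
      ≡⟨ lem₁ (rowProduct (rowFactor false) k 0) (rowFactor false k) (rowProduct (rowFactor true) k 0) ⟩
    rowProduct (rowFactor false) k 0 * rowProduct (rowFactor true) k 0 * rowFactor false k
      ≡⟨ cong₂ _*_ (rowProducts k) (proj₂ (rowFactor-pos k)) ⟩
    + (2 ^ dbl k ℕ.* factorial (dbl k)) * + (2 ℕ.* suc (dbl k))
      ≡⟨ sym (pos-* (2 ^ dbl k ℕ.* factorial (dbl k)) _) ⟩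
    + (2 ^ dbl k ℕ.* factorial (dbl k) ℕ.* (2 ℕ.* suc (dbl k)))
      ≡⟨ cong +_ (lem₂ (2 ^ dbl k) (factorial (dbl k)) (suc (dbl k))) ⟩
    + (2 ^ suc (dbl k) ℕ.* factorial (suc (dbl k))) ∎
    where
    lem₁ : ∀ a b c → a * b * c ≡ a * c * b
    lem₁ = solve-∀
    lem₂ : ∀ p f n → p ℕ.* f ℕ.* (2 ℕ.* n) ≡ 2 ℕ.* p ℕ.* (n ℕ.* f)
    lem₂ = ℕR.solve-∀

  norm-two : ∀ n → norm (suc (suc n)) ≡ rowProduct (rowFactor (not (ev n))) (rank (suc n)) 0 * rowProduct (rowFactor (ev n)) (rank n) 0 * norm n
  norm-two n = sym (*-assoc (rowProduct (rowFactor (not (ev n))) (rank (suc n)) 0) _ _)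

  norm-even : ∀ k → norm (dbl k) ≡ + (2 ^ (k ℕ.* k) ℕ.* H₂ (suc (dbl k)))
  norm-even zero    = refl
  norm-even (suc k) = begin
    norm (suc (suc (dbl k)))
      ≡⟨ norm-two (dbl k) ⟩
    rowProduct (rowFactor (not (ev (dbl k)))) (rank (suc (dbl k))) 0 * rowProduct (rowFactor (ev (dbl k))) (rank (dbl k)) 0 * norm (dbl k)
      ≡⟨ cong₂ (λ u v → u * v * norm (dbl k)) (cong₂ (λ b r → rowProduct (rowFactor (not b)) r 0) (ev-dbl k) (rank-odd k)) (cong₂ (λ b r → rowProduct (rowFactor b) r 0) (ev-dbl k) (rank-even k)) ⟩
    rowProduct (rowFactor false) (suc k) 0 * rowProduct (rowFactor true) k 0 * norm (dbl k)
      ≡⟨ cong₂ _*_ (rowProducts′ k) (norm-even k) ⟩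
    + (2 ^ suc (dbl k) ℕ.* factorial (suc (dbl k))) * + (2 ^ (k ℕ.* k) ℕ.* H₂ (suc (dbl k)))
      ≡⟨ sym (pos-* (2 ^ suc (dbl k) ℕ.* factorial (suc (dbl k))) _) ⟩
    + (2 ^ suc (dbl k) ℕ.* factorial (suc (dbl k)) ℕ.* (2 ^ (k ℕ.* k) ℕ.* H₂ (suc (dbl k))))
      ≡⟨ cong +_ (trans (lem (2 ^ suc (dbl k)) (factorial (suc (dbl k))) (2 ^ (k ℕ.* k)) (H₂ (suc (dbl k))))
           (cong (ℕ._* (H₂ (suc (dbl k)) ℕ.* factorial (suc (dbl k)))) (trans (sym (ℕ.^-distribˡ-+-* 2 (suc (dbl k)) (k ℕ.* k)))
             (cong (2 ^_) (trans (cong (λ d → suc d ℕ.+ k ℕ.* k) (dbl≡2* k)) (square k)))))) ⟩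
    + (2 ^ (suc k ℕ.* suc k) ℕ.* H₂ (suc (dbl (suc k)))) ∎
    where
    lem : ∀ a f b h → a ℕ.* f ℕ.* (b ℕ.* h) ≡ a ℕ.* b ℕ.* (h ℕ.* f)
    lem = ℕR.solve-∀
    square : ∀ k → suc (2 ℕ.* k) ℕ.+ k ℕ.* k ≡ suc k ℕ.* suc k
    square = ℕR.solve-∀

  norm-odd : ∀ k → norm (suc (dbl k)) ≡ + (2 ^ (suc k ℕ.* k) ℕ.* H₂ (dbl (suc k)))
  norm-odd zero    = refl
  norm-odd (suc k) = begin
    norm (suc (suc (suc (dbl k))))
      ≡⟨ norm-two (suc (dbl k)) ⟩
    rowProduct (rowFactor (not (not (ev (dbl k))))) (rank (suc (suc (dbl k)))) 0 * rowProduct (rowFactor (not (ev (dbl k)))) (rank (suc (dbl k))) 0 * norm (suc (dbl k))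
      ≡⟨ cong₂ (λ u v → u * v * norm (suc (dbl k))) (cong₂ (λ b r → rowProduct (rowFactor (not (not b))) r 0) (ev-dbl k) (rank-even (suc k))) (cong₂ (λ b r → rowProduct (rowFactor (not b)) r 0) (ev-dbl k) (rank-odd k)) ⟩
    rowProduct (rowFactor true) (suc k) 0 * rowProduct (rowFactor false) (suc k) 0 * norm (suc (dbl k))
      ≡⟨ cong₂ _*_ (trans (*-comm (rowProduct (rowFactor true) (suc k) 0) _) (rowProducts (suc k))) (norm-odd k) ⟩
    + (2 ^ dbl (suc k) ℕ.* factorial (dbl (suc k))) * + (2 ^ (suc k ℕ.* k) ℕ.* H₂ (dbl (suc k)))
      ≡⟨ sym (pos-* (2 ^ dbl (suc k) ℕ.* factorial (dbl (suc k))) _) ⟩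
    + (2 ^ dbl (suc k) ℕ.* factorial (dbl (suc k)) ℕ.* (2 ^ (suc k ℕ.* k) ℕ.* H₂ (dbl (suc k))))
      ≡⟨ cong +_ (trans (lem (2 ^ dbl (suc k)) (factorial (dbl (suc k))) (2 ^ (suc k ℕ.* k)) (H₂ (dbl (suc k))))
           (cong (ℕ._* (H₂ (dbl (suc k)) ℕ.* factorial (dbl (suc k)))) (trans (sym (ℕ.^-distribˡ-+-* 2 (dbl (suc k)) (suc k ℕ.* k)))
             (cong (2 ^_) (trans (cong (λ d → d ℕ.+ suc k ℕ.* k) (dbl≡2* (suc k))) (square k)))))) ⟩
    + (2 ^ (suc (suc k) ℕ.* suc k) ℕ.* H₂ (dbl (suc (suc k)))) ∎
    where
    lem : ∀ a f b h → a ℕ.* f ℕ.* (b ℕ.* h) ≡ a ℕ.* b ℕ.* (h ℕ.* f)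
    lem = ℕR.solve-∀
    square : ∀ k → 2 ℕ.* suc k ℕ.+ suc k ℕ.* k ≡ suc (suc k) ℕ.* suc k
    square = ℕR.solve-∀

  evaluates-even : ∀ r l → r ℕ.≤ l → Evaluates true r l (T (dbl r)) (+ (2 ^ (r ℕ.* r) ℕ.* H₂ (suc (dbl r))))
  evaluates-even r l h = subst (λ b → Evaluates b r l (T (dbl r)) (+ (2 ^ (r ℕ.* r) ℕ.* H₂ (suc (dbl r))))) (ev-dbl r)
    (subst₂ (λ k ν → Evaluates (ev (dbl r)) k l (T (dbl r)) ν) (rank-even r) (norm-even r)
      (T-evaluates (dbl r) l (subst (ℕ._≤ l) (sym (rank-even r)) h)))

  -- Indexed by the number `r` of dents instead of the number of rows, so that the degenerate case
  -- `r = 0` fits in.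
  evaluates-odd : ∀ r l → r ℕ.≤ l → Evaluates false r l (T (dbl r ℕ.∸ 1)) (+ (4 ^ triangular r ℕ.* H₂ (dbl r)))
  evaluates-odd zero    l h = none-evaluates false l
  evaluates-odd (suc k) l h = subst₂ (λ b ν → Evaluates b (suc k) l (T (suc (dbl k))) ν) (cong not (ev-dbl k)) closed
    (subst (λ r → Evaluates (ev (suc (dbl k))) r l (T (suc (dbl k))) (norm (suc (dbl k)))) (rank-odd k)
      (T-evaluates (suc (dbl k)) l (subst (ℕ._≤ l) (sym (rank-odd k)) h)))
    where
    exponent : suc k ℕ.* k ≡ dbl (triangular (suc k))
    exponent = ℕ.+-cancelʳ-≡ (suc k) _ _ (trans (lem k) (sym (triangular-square (suc k))))
      where
      lem : ∀ k → suc k ℕ.* k ℕ.+ suc k ≡ suc k ℕ.* suc k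
      lem = ℕR.solve-∀
    closed : norm (suc (dbl k)) ≡ + (4 ^ triangular (suc k) ℕ.* H₂ (dbl (suc k)))
    closed = trans (norm-odd k) (cong (λ p → + (p ℕ.* H₂ (dbl (suc k)))) (trans (cong (2 ^_) exponent) (sym (four-power (triangular (suc k))))))

  -- Turns the discriminant of a set of dents on its own back into a number of tilings, those of the
  -- trapezoid without `S`.
  discriminant-offset : ∀ {b r l t ν} k R → Evaluates b r l t ν → k ℕ.+ length R ≡ l → trueCount R ≡ r →
    + t (falses k ++ R) * ν ≡ discriminant b (points b k R)
  discriminant-offset {b} k R E e c = trans
    (Evaluates.hit E (falses k ++ R) (trans (length-++ (falses k)) (trans (cong (ℕ._+ length R) (length-replicate k)) e))
      (trans (trueCount-++ (falses k) R) (trans (cong (ℕ._+ trueCount R) (trueCount-falses k)) c)))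
    (cong (discriminant b) (trans (marks-++ (abscissa b) 0 (falses k) R)
      (cong₂ (λ u j → u ++ points b j R) (marks-falses (abscissa b) 0 k) (length-replicate k))))

  exchange-sumℕ : ∀ {b r l t₁ t₂ t₃ t₄ u v n₁ n₂ n₃ n₄ c₁ c₂ d} A z →
    Evaluates b (r ℕ.+ trueCount A) (l ℕ.+ length A) t₁ (+ n₁) →
    Evaluates b (r ℕ.+ trueCount (map not A ++ trues z)) (l ℕ.+ length (map not A ++ trues z)) t₂ (+ n₂) →
    Evaluates b r l t₃ (+ n₃) →
    Evaluates b (r ℕ.+ (length A ℕ.+ z)) (l ℕ.+ (length A ℕ.+ z)) t₄ (+ n₄) →
    Evaluates b (trueCount A) (l ℕ.+ length A) u (+ c₁) →
    Evaluates b (trueCount (map not A ++ trues z)) (l ℕ.+ length (map not A ++ trues z)) v (+ c₂) →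
    discriminant b (points b l (trues (length A ℕ.+ z))) ≡ + d →
    sumB l (λ S → t₂ (S ++ (map not A ++ trues z)) ℕ.* t₁ (S ++ A)) ℕ.* (n₁ ℕ.* n₂) ℕ.* d
      ≡ u (falses l ++ A) ℕ.* c₁ ℕ.* (v (falses l ++ (map not A ++ trues z)) ℕ.* c₂)
        ℕ.* (sumB l (λ S → t₃ S ℕ.* t₄ (S ++ trues (length A ℕ.+ z))) ℕ.* (n₃ ℕ.* n₄))
  exchange-sumℕ {b} {l = l} {t₁} {t₂} {t₃} {t₄} {u} {v} {n₁} {n₂} {n₃} {n₄} {c₁} {c₂} {d} A z E₁ E₂ E₃ E₄ Eᵤ Eᵥ ed = +-injective (begin
    + (Σ₁ ℕ.* (n₁ ℕ.* n₂) ℕ.* d)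
      ≡⟨ trans (pos-* (Σ₁ ℕ.* (n₁ ℕ.* n₂)) d) (cong (_* + d) (trans (pos-* Σ₁ _) (cong (+ Σ₁ *_) (pos-* n₁ n₂)))) ⟩
    + Σ₁ * (+ n₁ * + n₂) * + d
      ≡⟨ cong (+ Σ₁ * (+ n₁ * + n₂) *_) (sym ed) ⟩
    + Σ₁ * (+ n₁ * + n₂) * discriminant b (points b l (trues (length A ℕ.+ z)))
      ≡⟨ exchange-sum A z E₁ E₂ E₃ E₄ ⟩
    discriminant b (points b l A) * discriminant b (points b l B) * (+ Σ₂ * (+ n₃ * + n₄))
      ≡⟨ cong₂ (λ p q → p * q * (+ Σ₂ * (+ n₃ * + n₄))) (sym (discriminant-offset l A Eᵤ refl refl)) (sym (discriminant-offset l B Eᵥ refl refl)) ⟩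
    (+ u (falses l ++ A) * + c₁) * (+ v (falses l ++ B) * + c₂) * (+ Σ₂ * (+ n₃ * + n₄))
      ≡⟨ sym (trans (pos-* (u (falses l ++ A) ℕ.* c₁ ℕ.* (v (falses l ++ B) ℕ.* c₂)) _) (cong₂ _*_
           (trans (pos-* (u (falses l ++ A) ℕ.* c₁) _) (cong₂ _*_ (pos-* (u (falses l ++ A)) c₁) (pos-* (v (falses l ++ B)) c₂)))
           (trans (pos-* Σ₂ _) (cong (+ Σ₂ *_) (pos-* n₃ n₄))))) ⟩
    + (u (falses l ++ A) ℕ.* c₁ ℕ.* (v (falses l ++ B) ℕ.* c₂) ℕ.* (Σ₂ ℕ.* (n₃ ℕ.* n₄))) ∎)
    where
    B : List Bool
    B = map not A ++ trues z
    Σ₁ Σ₂ : ℕ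
    Σ₁ = sumB l (λ S → t₂ (S ++ B) ℕ.* t₁ (S ++ A))
    Σ₂ = sumB l (λ S → t₃ S ℕ.* t₄ (S ++ trues (length A ℕ.+ z)))

  -- The norm contains 2 to the power m² and the discriminant 4 to the power m(m - 1)/2; the factor
  -- `2 ^ m` is what cancellation leaves.
  block-even : ∀ x m → T (dbl m) (falses x ++ trues m) ℕ.* (2 ^ m ℕ.* H₂ (suc (dbl m))) ≡ Hf m ℕ.* U x m
  block-even x m = ℕ.*-cancelˡ-≡ _ _ (4 ^ triangular m) {{ℕ.m^n≢0 4 (triangular m)}} (begin
    4 ^ triangular m ℕ.* (t ℕ.* (2 ^ m ℕ.* H₂ (suc (dbl m))))
      ≡⟨ lem (4 ^ triangular m) t (2 ^ m) (H₂ (suc (dbl m))) ⟩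
    t ℕ.* (4 ^ triangular m ℕ.* 2 ^ m ℕ.* H₂ (suc (dbl m)))
      ≡⟨ cong (λ p → t ℕ.* (p ℕ.* H₂ (suc (dbl m)))) (trans (cong (ℕ._* 2 ^ m) (four-power (triangular m)))
           (trans (sym (ℕ.^-distribˡ-+-* 2 (dbl (triangular m)) m)) (cong (2 ^_) (triangular-square m)))) ⟩
    t ℕ.* (2 ^ (m ℕ.* m) ℕ.* H₂ (suc (dbl m)))
      ≡⟨ +-injective (trans (pos-* t _) (trans (discriminant-offset x (trues m) (evaluates-even m (x ℕ.+ m) (ℕ.m≤n+m m x)) (cong (x ℕ.+_) (length-replicate m)) (trueCount-trues m)) (discriminant-even x m))) ⟩
    4 ^ triangular m ℕ.* Hf m ℕ.* U x m
      ≡⟨ ℕ.*-assoc (4 ^ triangular m) _ _ ⟩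
    4 ^ triangular m ℕ.* (Hf m ℕ.* U x m) ∎)
    where
    t : ℕ
    t = T (dbl m) (falses x ++ trues m)
    lem : ∀ f t p h → f ℕ.* (t ℕ.* (p ℕ.* h)) ≡ t ℕ.* (f ℕ.* p ℕ.* h)
    lem = ℕR.solve-∀

  block-odd : ∀ x m → T (dbl (suc m) ℕ.∸ 1) (falses x ++ trues (suc m)) ℕ.* H₂ (dbl (suc m)) ≡ Hf (suc m) ℕ.* U x m
  block-odd x m = ℕ.*-cancelˡ-≡ _ _ (4 ^ triangular (suc m)) {{ℕ.m^n≢0 4 (triangular (suc m))}} (begin
    4 ^ triangular (suc m) ℕ.* (t ℕ.* H₂ (dbl (suc m)))
      ≡⟨ lem (4 ^ triangular (suc m)) t (H₂ (dbl (suc m))) ⟩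
    t ℕ.* (4 ^ triangular (suc m) ℕ.* H₂ (dbl (suc m)))
      ≡⟨ +-injective (trans (pos-* t _) (trans (discriminant-offset x (trues (suc m)) (evaluates-odd (suc m) (x ℕ.+ suc m) (ℕ.m≤n+m (suc m) x)) (cong (x ℕ.+_) (length-replicate (suc m))) (trueCount-trues (suc m))) (discriminant-odd x m))) ⟩
    4 ^ triangular (suc m) ℕ.* Hf (suc m) ℕ.* U x m
      ≡⟨ ℕ.*-assoc (4 ^ triangular (suc m)) _ _ ⟩
    4 ^ triangular (suc m) ℕ.* (Hf (suc m) ℕ.* U x m) ∎)
    where
    t : ℕ
    t = T (dbl (suc m) ℕ.∸ 1) (falses x ++ trues (suc m))
    lem : ∀ f t h → f ℕ.* (t ℕ.* h) ≡ t ℕ.* (f ℕ.* h)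
    lem = ℕR.solve-∀

-- The counting formula with denominators multiplied out

module Gluing where

  open Chains
  open Products using (dbl; discriminant; points)
  open Factorials
  open Evaluation
  open import Defs using (Hf; H₂)
  open import Data.Bool using (Bool; false; not)
  open import Data.Nat using (ℕ; zero; suc; _+_; _*_; _∸_; _^_; _≤_; NonZero)
  open import Data.Nat.Properties
  open import Data.Nat.Tactic.RingSolver using (solve-∀)
  open import Data.Integer as ℤ using ()
  open import Data.List using (List; _++_; length; map)
  open import Relation.Binary.PropositionalEquality
  open ≡-Reasoning

  hexagon-even : ∀ h x m → sumB (x + h) (λ S → T (dbl h) S * T (dbl (h + m)) (S ++ trues m))
    * (2 ^ (dbl h + m) * H₂ (suc (dbl (dbl h + m)))) ≡ Hf (dbl h + m) * U x (dbl h + m)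
  hexagon-even h x m = trans (cong (_* (2 ^ (dbl h + m) * H₂ (suc (dbl (dbl h + m)))))
    (trans (cong (λ l → sumB l (λ S → T (dbl h) S * T (dbl (h + m)) (S ++ trues m))) (trans (+-comm x h) (sym (baseLength-even h x))))
      (trans (half-hexagon (dbl h) x (dbl (h + m)) m (trans (ev-dbl h) (sym (ev-dbl (h + m)))))
        (cong (λ n → T n (falses x ++ trues (dbl h + m))) rows))))
    (block-even x (dbl h + m))
    where
    rows : dbl h + dbl (h + m) ≡ dbl (dbl h + m)
    rows rewrite dbl≡2* h | dbl≡2* (h + m) | dbl≡2* (2 * h + m) = lem h m
      where
      lem : ∀ h m → 2 * h + 2 * (h + m) ≡ 2 * (2 * h + m)
      lem = solve-∀

  -- Two odd numbers of rows add up to an even number `2 k`, so `block-even` applies, and `H₂-Hf`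
  -- adjusts its constant. For `h = 0` the lower part has no rows at all, the total remains odd, and
  -- `block-odd` is needed.
  hexagon-odd : ∀ h x m → sumB (x + h) (λ S → T (dbl h ∸ 1) S * T (dbl (h + suc m) ∸ 1) (S ++ trues (suc m)))
    * H₂ (dbl (dbl h + suc m)) ≡ Hf (dbl h + suc m) * U x (dbl h + m)
  hexagon-odd zero x m = trans (cong (_* H₂ (dbl (suc m)))
    (trans (cong (λ l → sumB l (λ S → none S * T (suc (dbl m)) (S ++ trues (suc m)))) (+-identityʳ x))
      (sumB-none x (λ S → T (suc (dbl m)) (S ++ trues (suc m))))))
    (block-odd x m)
  hexagon-odd (suc g) x m = *-cancelʳ-≡ _ _ (Hf k) {{Hf≢0 k}} (begin
    Σ′ * H₂ (dbl (suc (suc (dbl g + suc m)))) * Hf k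
      ≡⟨ trans (*-assoc Σ′ _ _) (cong (Σ′ *_) (H₂-Hf k)) ⟩
    Σ′ * (2 ^ k * H₂ (suc (dbl k)) * Hf (suc k))
      ≡⟨ sym (*-assoc Σ′ _ _) ⟩
    Σ′ * (2 ^ k * H₂ (suc (dbl k))) * Hf (suc k)
      ≡⟨ cong (λ σ → σ * (2 ^ k * H₂ (suc (dbl k))) * Hf (suc k)) Σ≡ ⟩
    T (dbl k) (falses x ++ trues k) * (2 ^ k * H₂ (suc (dbl k))) * Hf (suc k)
      ≡⟨ cong (_* Hf (suc k)) (block-even x k) ⟩
    Hf k * U x k * Hf (suc k)
      ≡⟨ lem (Hf k) (U x k) (Hf (suc k)) ⟩
    Hf (suc k) * U x k * Hf k
      ≡⟨ cong (λ j → Hf (suc k) * U x (suc j) * Hf k) (+-suc (dbl g) m) ⟩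
    Hf (suc (suc (dbl g + suc m))) * U x (suc (suc (dbl g + m))) * Hf k ∎)
    where
    k Σ′ : ℕ
    k = suc (dbl g) + suc m
    Σ′ = sumB (x + suc g) (λ S → T (suc (dbl g)) S * T (suc (dbl (g + suc m))) (S ++ trues (suc m)))
    lem : ∀ a u b → a * u * b ≡ b * u * a
    lem = solve-∀
    rows : suc (dbl g) + suc (dbl (g + suc m)) ≡ dbl k
    rows rewrite dbl≡2* (suc (dbl g) + suc m) | dbl≡2* (g + suc m) | dbl≡2* g = lem′ g m
      where
      lem′ : ∀ g m → suc (2 * g) + suc (2 * (g + suc m)) ≡ 2 * (suc (2 * g) + suc m)
      lem′ = solve-∀
    Σ≡ : Σ′ ≡ T (dbl k) (falses x ++ trues k)
    Σ≡ = trans (cong (λ l → sumB l (λ S → T (suc (dbl g)) S * T (suc (dbl (g + suc m))) (S ++ trues (suc m)))) (trans (+-comm x (suc g)) (sym (baseLength-odd g x))))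
      (trans (half-hexagon (suc (dbl g)) x (suc (dbl (g + suc m))) (suc m) (cong not (trans (ev-dbl g) (sym (ev-dbl (g + suc m))))))
        (cong (λ n → T n (falses x ++ trues k)) rows))

  module Glue (A : List Bool) (z x h : ℕ) where

    B : List Bool
    B = map not A ++ trues z

    o e m l : ℕ
    o = trueCount A
    e = trueCount B
    m = length A + z
    l = x + h

    room : ∀ R → h + trueCount R ≤ l + length R
    room R = +-mono-≤ (m≤n+m h x) (trueCount≤length R)

    room₀ : ∀ R → trueCount R ≤ l + length R
    room₀ R = ≤-trans (m≤n+m _ h) (room R)

    -- Combines the exchange of dents, the half hexagon and `U-steps`. The factor cancelled at the
    -- end collects the powers of two from the norms and discriminants, and `U l m` from the
    -- discriminant of the filled interval.
    glue-even : sumB l (λ S → T (dbl (h + e)) (S ++ B) * T (dbl (h + o)) (S ++ A)) * 2 ^ dbl h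
        * (Hf m * H₂ (suc (dbl (h + e))) * H₂ (suc (dbl (h + o))) * H₂ (suc (dbl (dbl h + m))))
      ≡ pochFactor x h m * (Hf (dbl h + m) * H₂ (suc (dbl h)) * H₂ (suc (dbl e)) * H₂ (suc (dbl o)) * H₂ (suc (dbl (h + m))))
        * T (dbl o) (falses l ++ A) * T (dbl e) (falses l ++ B)
    glue-even = *-cancelʳ-≡ _ _ (p₁ * p₂ * f * 2 ^ m * u)
      {{m*n≢0 (p₁ * p₂ * f * 2 ^ m) u {{subst NonZero (sym powers) q≢0}} {{U≢0 l m}}}} (begin
        s * 2 ^ dbl h * (Hf m * hₑ * hₒ * hb) * (p₁ * p₂ * f * 2 ^ m * u)
          ≡⟨ lem₁ s (2 ^ dbl h) (Hf m) hₑ hₒ hb p₁ p₂ f (2 ^ m) u ⟩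
        s * (p₁ * hₒ * (p₂ * hₑ)) * (f * Hf m * u) * (2 ^ dbl h * 2 ^ m * hb)
          ≡⟨ cong₂ (λ v w → v * (w * hb)) exchanged (sym (^-distribˡ-+-* 2 (dbl h) m)) ⟩
        t₁ * (q₁ * k₁) * (t₂ * (q₂ * k₂)) * (σ * (q₃ * k₃ * (q₄ * k₄))) * (2 ^ (dbl h + m) * hb)
          ≡⟨ lem₂ t₁ q₁ k₁ t₂ q₂ k₂ σ q₃ k₃ q₄ k₄ (2 ^ (dbl h + m)) hb ⟩
        σ * (2 ^ (dbl h + m) * hb) * (q₁ * q₂ * q₃ * q₄) * (t₁ * t₂ * k₁ * k₂ * k₃ * k₄)
          ≡⟨ cong₂ (λ v w → v * w * (t₁ * t₂ * k₁ * k₂ * k₃ * k₄)) (trans (hexagon-even h x m) (cong (Hf (dbl h + m) *_) (U-steps x h m))) (sym powers) ⟩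
        Hf (dbl h + m) * (u * pochFactor x h m) * (p₁ * p₂ * f * 2 ^ m) * (t₁ * t₂ * k₁ * k₂ * k₃ * k₄)
          ≡⟨ lem₃ (Hf (dbl h + m)) u (pochFactor x h m) (p₁ * p₂ * f * 2 ^ m) t₁ t₂ k₁ k₂ k₃ k₄ ⟩
        pochFactor x h m * (Hf (dbl h + m) * k₃ * k₂ * k₁ * k₄) * t₁ * t₂ * (p₁ * p₂ * f * 2 ^ m * u) ∎)
      where
      s σ t₁ t₂ u f p₁ p₂ q₁ q₂ q₃ q₄ hₒ hₑ hb k₁ k₂ k₃ k₄ : ℕ
      s = sumB l (λ S → T (dbl (h + e)) (S ++ B) * T (dbl (h + o)) (S ++ A))
      σ = sumB l (λ S → T (dbl h) S * T (dbl (h + m)) (S ++ trues m))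
      t₁ = T (dbl o) (falses l ++ A)
      t₂ = T (dbl e) (falses l ++ B)
      u = U l m
      f = 4 ^ triangular m
      p₁ = 2 ^ ((h + o) * (h + o))
      p₂ = 2 ^ ((h + e) * (h + e))
      q₁ = 2 ^ (o * o)
      q₂ = 2 ^ (e * e)
      q₃ = 2 ^ (h * h)
      q₄ = 2 ^ ((h + m) * (h + m))
      hₒ = H₂ (suc (dbl (h + o)))
      hₑ = H₂ (suc (dbl (h + e)))
      hb = H₂ (suc (dbl (dbl h + m)))
      k₁ = H₂ (suc (dbl o))
      k₂ = H₂ (suc (dbl e))
      k₃ = H₂ (suc (dbl h))
      k₄ = H₂ (suc (dbl (h + m)))
      exchanged : s * (p₁ * hₒ * (p₂ * hₑ)) * (f * Hf m * u)
        ≡ t₁ * (q₁ * k₁) * (t₂ * (q₂ * k₂)) * (σ * (q₃ * k₃ * (q₄ * k₄)))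
      exchanged = exchange-sumℕ A z
        (evaluates-even (h + o) _ (room A)) (evaluates-even (h + e) _ (room B)) (evaluates-even h l (m≤n+m h x))
        (evaluates-even (h + m) _ (+-monoˡ-≤ m (m≤n+m h x))) (evaluates-even o _ (room₀ A)) (evaluates-even e _ (room₀ B))
        (discriminant-even l m)
      -- The exponents agree because `o + e = m`: the dents on both sides fill the interval.
      powers : p₁ * p₂ * f * 2 ^ m ≡ q₁ * q₂ * q₃ * q₄
      powers = begin
        p₁ * p₂ * f * 2 ^ m
          ≡⟨ trans (*-assoc (p₁ * p₂) f (2 ^ m)) (cong (p₁ * p₂ *_) (trans (cong (_* 2 ^ m) (four-power (triangular m)))
               (trans (sym (^-distribˡ-+-* 2 (dbl (triangular m)) m)) (cong (2 ^_) (triangular-square m))))) ⟩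
        p₁ * p₂ * 2 ^ (m * m)
          ≡⟨ trans (cong (_* 2 ^ (m * m)) (sym (^-distribˡ-+-* 2 ((h + o) * (h + o)) _))) (sym (^-distribˡ-+-* 2 ((h + o) * (h + o) + (h + e) * (h + e)) _)) ⟩
        2 ^ ((h + o) * (h + o) + (h + e) * (h + e) + m * m)
          ≡⟨ cong (2 ^_) (subst (λ m → (h + o) * (h + o) + (h + e) * (h + e) + m * m ≡ o * o + e * e + h * h + (h + m) * (h + m))
               (trueCount-complement A z) (squares-sum h o e)) ⟩
        2 ^ (o * o + e * e + h * h + (h + m) * (h + m))
          ≡⟨ trans (^-distribˡ-+-* 2 (o * o + e * e + h * h) _) (cong (_* q₄)
               (trans (^-distribˡ-+-* 2 (o * o + e * e) _) (cong (_* q₃) (^-distribˡ-+-* 2 (o * o) _)))) ⟩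
        q₁ * q₂ * q₃ * q₄ ∎
        where
        squares-sum : ∀ h o e → (h + o) * (h + o) + (h + e) * (h + e) + (o + e) * (o + e)
          ≡ o * o + e * e + h * h + (h + (o + e)) * (h + (o + e))
        squares-sum = solve-∀
      q≢0 : NonZero (q₁ * q₂ * q₃ * q₄)
      q≢0 = m*n≢0 (q₁ * q₂ * q₃) q₄ {{m*n≢0 (q₁ * q₂) q₃ {{m*n≢0 q₁ q₂ {{m^n≢0 2 (o * o)}} {{m^n≢0 2 (e * e)}}}} {{m^n≢0 2 (h * h)}}}} {{m^n≢0 2 ((h + m) * (h + m))}}
      lem₁ : ∀ s d g e o b p q f m u → s * d * (g * e * o * b) * (p * q * f * m * u)
        ≡ s * (p * o * (q * e)) * (f * g * u) * (d * m * b)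
      lem₁ = solve-∀
      lem₂ : ∀ t a k t′ a′ k′ s b l c j w h → t * (a * k) * (t′ * (a′ * k′)) * (s * (b * l * (c * j))) * (w * h)
        ≡ s * (w * h) * (a * a′ * b * c) * (t * t′ * k * k′ * l * j)
      lem₂ = solve-∀
      lem₃ : ∀ f u p w t t′ a b c d → f * (u * p) * w * (t * t′ * a * b * c * d)
        ≡ p * (f * c * b * a * d) * t * t′ * (w * u)
      lem₃ = solve-∀

    -- At odd positions the discriminant of `m` consecutive points involves `U` of size m - 1, hence
    -- the predecessor `μ`.
    glue-odd : ∀ μ → m ≡ suc μ →
      sumB l (λ S → T (dbl (h + e) ∸ 1) (S ++ B) * T (dbl (h + o) ∸ 1) (S ++ A))
        * (Hf m * H₂ (dbl (h + e)) * H₂ (dbl (h + o)) * H₂ (dbl (dbl h + m)))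
      ≡ pochFactor x h μ * (Hf (dbl h + m) * H₂ (dbl h) * H₂ (dbl e) * H₂ (dbl o) * H₂ (dbl (h + m)))
        * T (dbl o ∸ 1) (falses l ++ A) * T (dbl e ∸ 1) (falses l ++ B)
    glue-odd μ em = *-cancelʳ-≡ _ _ (p₁ * p₂ * f * u)
      {{m*n≢0 (p₁ * p₂ * f) u {{subst NonZero (sym powers) q≢0}} {{U≢0 l μ}}}} (begin
        s * (Hf m * hₑ * hₒ * hb) * (p₁ * p₂ * f * u)
          ≡⟨ lem₁ s (Hf m) hₑ hₒ hb p₁ p₂ f u ⟩
        s * (p₁ * hₒ * (p₂ * hₑ)) * (f * Hf m * u) * hb
          ≡⟨ cong (_* hb) exchanged ⟩
        t₁ * (q₁ * k₁) * (t₂ * (q₂ * k₂)) * (σ * (q₃ * k₃ * (q₄ * k₄))) * hb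
          ≡⟨ lem₂ t₁ q₁ k₁ t₂ q₂ k₂ σ q₃ k₃ q₄ k₄ hb ⟩
        σ * hb * (q₁ * q₂ * q₃ * q₄) * (t₁ * t₂ * k₁ * k₂ * k₃ * k₄)
          ≡⟨ cong₂ (λ v w → v * w * (t₁ * t₂ * k₁ * k₂ * k₃ * k₄)) hexagon (sym powers) ⟩
        Hf (dbl h + m) * (u * pochFactor x h μ) * (p₁ * p₂ * f) * (t₁ * t₂ * k₁ * k₂ * k₃ * k₄)
          ≡⟨ lem₃ (Hf (dbl h + m)) u (pochFactor x h μ) (p₁ * p₂ * f) t₁ t₂ k₁ k₂ k₃ k₄ ⟩
        pochFactor x h μ * (Hf (dbl h + m) * k₃ * k₂ * k₁ * k₄) * t₁ * t₂ * (p₁ * p₂ * f * u) ∎)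
      where
      s σ t₁ t₂ u f p₁ p₂ q₁ q₂ q₃ q₄ hₒ hₑ hb k₁ k₂ k₃ k₄ : ℕ
      s = sumB l (λ S → T (dbl (h + e) ∸ 1) (S ++ B) * T (dbl (h + o) ∸ 1) (S ++ A))
      σ = sumB l (λ S → T (dbl h ∸ 1) S * T (dbl (h + m) ∸ 1) (S ++ trues m))
      t₁ = T (dbl o ∸ 1) (falses l ++ A)
      t₂ = T (dbl e ∸ 1) (falses l ++ B)
      u = U l μ
      f = 4 ^ triangular m
      p₁ = 4 ^ triangular (h + o)
      p₂ = 4 ^ triangular (h + e)
      q₁ = 4 ^ triangular o
      q₂ = 4 ^ triangular e
      q₃ = 4 ^ triangular h
      q₄ = 4 ^ triangular (h + m)
      hₒ = H₂ (dbl (h + o))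
      hₑ = H₂ (dbl (h + e))
      hb = H₂ (dbl (dbl h + m))
      k₁ = H₂ (dbl o)
      k₂ = H₂ (dbl e)
      k₃ = H₂ (dbl h)
      k₄ = H₂ (dbl (h + m))
      exchanged : s * (p₁ * hₒ * (p₂ * hₑ)) * (f * Hf m * u)
        ≡ t₁ * (q₁ * k₁) * (t₂ * (q₂ * k₂)) * (σ * (q₃ * k₃ * (q₄ * k₄)))
      exchanged = exchange-sumℕ A z
        (evaluates-odd (h + o) _ (room A)) (evaluates-odd (h + e) _ (room B)) (evaluates-odd h l (m≤n+m h x))
        (evaluates-odd (h + m) _ (+-monoˡ-≤ m (m≤n+m h x))) (evaluates-odd o _ (room₀ A)) (evaluates-odd e _ (room₀ B))
        (subst (λ m → discriminant false (points false l (trues m)) ≡ ℤ.+ (4 ^ triangular m * Hf m * u)) (sym em) (discriminant-odd l μ))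
      hexagon : σ * hb ≡ Hf (dbl h + m) * (u * pochFactor x h μ)
      hexagon = subst (λ m → sumB l (λ S → T (dbl h ∸ 1) S * T (dbl (h + m) ∸ 1) (S ++ trues m)) * H₂ (dbl (dbl h + m)) ≡ Hf (dbl h + m) * (u * pochFactor x h μ))
        (sym em) (trans (hexagon-odd h x μ) (cong (Hf (dbl h + suc μ) *_) (U-steps x h μ)))
      powers : p₁ * p₂ * f ≡ q₁ * q₂ * q₃ * q₄
      powers = begin
        p₁ * p₂ * f
          ≡⟨ trans (cong (_* f) (sym (^-distribˡ-+-* 4 (triangular (h + o)) _))) (sym (^-distribˡ-+-* 4 (triangular (h + o) + triangular (h + e)) _)) ⟩
        4 ^ (triangular (h + o) + triangular (h + e) + triangular m)
          ≡⟨ cong (4 ^_) (begin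
               triangular (h + o) + triangular (h + e) + triangular m
                 ≡⟨ cong₂ (λ a b → a + b + triangular m) (triangular-+ h o) (triangular-+ h e) ⟩
               (triangular h + triangular o + h * o) + (triangular h + triangular e + h * e) + triangular m
                 ≡⟨ regroup (triangular h) (triangular o) (triangular e) (triangular m) h o e ⟩
               triangular o + triangular e + triangular h + (triangular h + triangular m + h * (o + e))
                 ≡⟨ cong (λ n → triangular o + triangular e + triangular h + (triangular h + triangular m + h * n)) (trueCount-complement A z) ⟩
               triangular o + triangular e + triangular h + (triangular h + triangular m + h * m)
                 ≡⟨ cong (triangular o + triangular e + triangular h +_) (sym (triangular-+ h m)) ⟩
               triangular o + triangular e + triangular h + triangular (h + m) ∎) ⟩
        4 ^ (triangular o + triangular e + triangular h + triangular (h + m))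
          ≡⟨ trans (^-distribˡ-+-* 4 (triangular o + triangular e + triangular h) _) (cong (_* q₄)
               (trans (^-distribˡ-+-* 4 (triangular o + triangular e) _) (cong (_* q₃) (^-distribˡ-+-* 4 (triangular o) _)))) ⟩
        q₁ * q₂ * q₃ * q₄ ∎
        where
        regroup : ∀ th to te tm h o e → (th + to + h * o) + (th + te + h * e) + tm
          ≡ to + te + th + (th + tm + h * (o + e))
        regroup = solve-∀
      q≢0 : NonZero (q₁ * q₂ * q₃ * q₄)
      q≢0 = m*n≢0 (q₁ * q₂ * q₃) q₄ {{m*n≢0 (q₁ * q₂) q₃ {{m*n≢0 q₁ q₂ {{m^n≢0 4 (triangular o)}} {{m^n≢0 4 (triangular e)}}}} {{m^n≢0 4 (triangular h)}}}} {{m^n≢0 4 (triangular (h + m))}}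
      lem₁ : ∀ s g e o b p q f u → s * (g * e * o * b) * (p * q * f * u)
        ≡ s * (p * o * (q * e)) * (f * g * u) * b
      lem₁ = solve-∀
      lem₂ : ∀ t a k t′ a′ k′ s b l c j h → t * (a * k) * (t′ * (a′ * k′)) * (s * (b * l * (c * j))) * h
        ≡ s * h * (a * a′ * b * c) * (t * t′ * k * k′ * l * j)
      lem₂ = solve-∀
      lem₃ : ∀ f u p w t t′ a b c d → f * (u * p) * w * (t * t′ * a * b * c * d)
        ≡ p * (f * c * b * a * d) * t * t′ * (w * u)
      lem₃ = solve-∀

-- Ray casting along boundary words

module Crossings where

  open Transfer using (odd; odd-suc; ==ℤ-refl; ==ℤ-neq)
  open import Defs
  open import Data.Bool using (Bool; true; false; not; _∧_; _xor_)
  open import Data.Nat as ℕ using (ℕ; zero; suc; z≤n; s≤s)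
  import Data.Nat.Properties as ℕ
  open import Data.Integer using (ℤ; +_; 0ℤ; 1ℤ; -1ℤ; _+_; _-_; -_; _*_; _≤_; _<_; _≤?_; _<?_; _≟_)
  open import Data.Integer.Properties
  open import Algebra.Properties.AbelianGroup +-0-abelianGroup using () renaming (∙-cancelˡ to +-cancelˡ-≡)
  open import Data.Integer.Tactic.RingSolver using (solve-∀)
  open import Data.List using (List; []; _∷_)
  open import Data.Product using (_,_)
  open import Relation.Nullary using (yes; no)
  open import Relation.Nullary.Decidable using (dec-true; dec-false)
  open import Relation.Binary.PropositionalEquality
  open ≡-Reasoning

  parity : {A : Set} → (A → Bool) → List A → Bool
  parity f []       = false
  parity f (x ∷ xs) = f x xor parity f xs

  odd-count : {A : Set} (f : A → Bool) → ∀ xs → odd (count f xs) ≡ parity f xs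
  odd-count f []       = refl
  odd-count f (x ∷ xs) with f x
  ... | true  = trans (odd-suc (count f xs)) (cong not (odd-count f xs))
  ... | false = odd-count f xs

  crossAt : Tri → Dir → Point → Bool
  crossAt t d p = crosses t (p , step d p)

  run : Tri → Dir → ℕ → Point → Bool
  run t d zero    p = false
  run t d (suc k) p = crossAt t d p xor run t d k (step d p)

  wordParity : Tri → Point → Word → Bool
  wordParity t p []            = false
  wordParity t p ((d , k) ∷ w) = run t d k p xor wordParity t (steps d k p) w

  xor-assoc : ∀ a b c → (a xor b) xor c ≡ a xor (b xor c)
  xor-assoc true  true  c = sym (not-not c)
    where
    not-not : ∀ b → not (not b) ≡ b
    not-not true = refl
    not-not false = refl
  xor-assoc true  false c = refl
  xor-assoc false b     c = refl

  walk-parity : ∀ t p w → parity (crosses t) (segments (walk p w)) ≡ wordParity t p w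
  walk-parity t p [] = refl
  walk-parity t p ((d , zero) ∷ w)  = walk-parity t p w
  walk-parity t p ((d , suc k) ∷ w) = trans (cong (crossAt t d p xor_) (walk-parity t (step d p) ((d , k) ∷ w)))
    (sym (xor-assoc (crossAt t d p) (run t d k (step d p)) _))

  inside-parity : ∀ p w t → insideP (poly p w) t ≡ wordParity t p w
  inside-parity p w t = trans (odd-count (crosses t) (segments (walk p w))) (walk-parity t p w)

  run-miss : ∀ t d k p → (∀ j → j ℕ.< k → crossAt t d (steps d j p) ≡ false) → run t d k p ≡ false
  run-miss t d zero    p h = refl
  run-miss t d (suc k) p h = cong₂ _xor_ (h 0 (s≤s z≤n)) (run-miss t d k (step d p) (λ j a → h (suc j) (s≤s a)))

  -- A straight slanted run meets each horizontal strip at most once, so the parity of its crossings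
  -- is decided by a single segment.
  run-hit : ∀ t d k p i → i ℕ.< k → (∀ j → j ≢ i → crossAt t d (steps d j p) ≡ false) →
    run t d k p ≡ crossAt t d (steps d i p)
  run-hit t d (suc k) p zero    a h = trans (cong (crossAt t d p xor_) (run-miss t d k (step d p) (λ j _ → h (suc j) (λ ()))))
    (xor-false _)
    where
    xor-false : ∀ b → b xor false ≡ b
    xor-false true  = refl
    xor-false false = refl
  run-hit t d (suc k) p (suc i) (s≤s a) h = cong₂ _xor_ (h 0 (λ ())) (run-hit t d k (step d p) i a (λ j e → h (suc j) (λ e′ → e (ℕ.suc-injective e′))))

  ≤ℤ-true : ∀ {x y} → x ≤ y → (x ≤ℤ y) ≡ true
  ≤ℤ-true {x} {y} a = dec-true (x ≤? y) a

  ≤ℤ-false : ∀ {x y} → y < x → (x ≤ℤ y) ≡ false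
  ≤ℤ-false {x} {y} a = dec-false (x ≤? y) (<⇒≱ a)

  private
    ≢-+ : ∀ (x : ℤ) k → x ≢ x + + suc k
    ≢-+ x k e with () ← +-cancelˡ-≡ x 0ℤ (+ suc k) (trans (+-identityʳ x) e)

    ≢-- : ∀ (x : ℤ) → x ≢ x - 1ℤ
    ≢-- x e with () ← +-cancelˡ-≡ x 0ℤ (- 1ℤ) (trans (+-identityʳ x) e)

    x<x+1 : ∀ (x : ℤ) → x < x + 1ℤ
    x<x+1 x = subst (_< x + 1ℤ) (+-identityʳ x) (+-monoʳ-< x {0ℤ} {1ℤ} (_<_.+<+ (s≤s z≤n)))

    x-1<x : ∀ (x : ℤ) → x - 1ℤ < x
    x-1<x x = subst (x - 1ℤ <_) (+-identityʳ x) (+-monoʳ-< x { -1ℤ} {0ℤ} _<_.-<+)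

  x-1+1 : ∀ x → (x - 1ℤ) + 1ℤ ≡ x
  x-1+1 = solve-∀

  cross-E : ∀ t p → crossAt t E p ≡ false
  cross-E (tri y c) (X , Y) rewrite ==ℤ-refl Y = refl

  cross-W : ∀ t p → crossAt t W p ≡ false
  cross-W (tri y c) (X , Y) rewrite ==ℤ-refl Y = refl

  -- The edge runs from abscissa `X` to `X + 1`, so an integer `c` lies to its left exactly for
  -- `c ≤ X`. For an edge going from `X` to `X - 1` the condition becomes `c + 1 ≤ X`.
  cross-NE : ∀ y c X Y → crossAt (tri y c) NE (X , Y) ≡ (Y ==ℤ y) ∧ (c ≤ℤ X)
  cross-NE y c X Y rewrite ==ℤ-neq (≢-+ Y 0) | dec-true (Y <? Y + 1ℤ) (x<x+1 Y) | ==ℤ-refl (X + 1ℤ) = refl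

  cross-NW : ∀ y c X Y → crossAt (tri y c) NW (X , Y) ≡ (Y ==ℤ y) ∧ ((c + 1ℤ) ≤ℤ X)
  cross-NW y c X Y rewrite ==ℤ-neq (≢-+ Y 0) | dec-true (Y <? Y + 1ℤ) (x<x+1 Y) | ==ℤ-neq (<⇒≢ (<-trans (x-1<x X) (x<x+1 X))) = refl

  cross-SE : ∀ y c X Y → crossAt (tri y c) SE (X , Y) ≡ ((Y - 1ℤ) ==ℤ y) ∧ ((c + 1ℤ) ≤ℤ (X + 1ℤ))
  cross-SE y c X Y rewrite ==ℤ-neq (≢-- Y) | dec-false (Y <? Y - 1ℤ) (<-asym (x-1<x Y)) | ==ℤ-neq (<⇒≢ (<-trans (x<x+1 X) (x<x+1 (X + 1ℤ)))) = refl

  cross-SW : ∀ y c X Y → crossAt (tri y c) SW (X , Y) ≡ ((Y - 1ℤ) ==ℤ y) ∧ (c ≤ℤ (X - 1ℤ))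
  cross-SW y c X Y rewrite ==ℤ-neq (≢-- Y) | dec-false (Y <? Y - 1ℤ) (<-asym (x-1<x Y))
    | dec-true (X ≟ (X - 1ℤ) + 1ℤ) (sym (x-1+1 X)) = refl

  steps-E : ∀ j X Y → steps E j (X , Y) ≡ (X + + 2 * + j , Y)
  steps-E zero    X Y = cong (_, Y) (sym (+-identityʳ X))
  steps-E (suc j) X Y = trans (steps-E j (X + + 2) Y) (cong (_, Y) (lem X (+ j)))
    where
    lem : ∀ x j → x + + 2 + + 2 * j ≡ x + + 2 * (1ℤ + j)
    lem = solve-∀

  steps-NE : ∀ j X Y → steps NE j (X , Y) ≡ (X + + j , Y + + j)
  steps-NE zero    X Y = cong₂ _,_ (sym (+-identityʳ X)) (sym (+-identityʳ Y))
  steps-NE (suc j) X Y = trans (steps-NE j (X + 1ℤ) (Y + 1ℤ)) (cong₂ _,_ (+-assoc X 1ℤ (+ j)) (+-assoc Y 1ℤ (+ j)))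

  private
    sub-one-sub : ∀ x j → x - 1ℤ - j ≡ x - (1ℤ + j)
    sub-one-sub = solve-∀

  steps-NW : ∀ j X Y → steps NW j (X , Y) ≡ (X - + j , Y + + j)
  steps-NW zero    X Y = cong₂ _,_ (sym (+-identityʳ X)) (sym (+-identityʳ Y))
  steps-NW (suc j) X Y = trans (steps-NW j (X - 1ℤ) (Y + 1ℤ)) (cong₂ _,_ (sub-one-sub X (+ j)) (+-assoc Y 1ℤ (+ j)))

  steps-SW : ∀ j X Y → steps SW j (X , Y) ≡ (X - + j , Y - + j)
  steps-SW zero    X Y = cong₂ _,_ (sym (+-identityʳ X)) (sym (+-identityʳ Y))
  steps-SW (suc j) X Y = trans (steps-SW j (X - 1ℤ) (Y - 1ℤ)) (cong₂ _,_ (sub-one-sub X (+ j)) (sub-one-sub Y (+ j)))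

  run-E : ∀ t k p → run t E k p ≡ false
  run-E t k p = run-miss t E k p (λ j _ → cross-E t (steps E j p))

  run-W : ∀ t k p → run t W k p ≡ false
  run-W t k p = run-miss t W k p (λ j _ → cross-W t (steps W j p))

  crossAt-NE : ∀ y c X Y j → crossAt (tri y c) NE (steps NE j (X , Y)) ≡ ((Y + + j) ==ℤ y) ∧ (c ≤ℤ (X + + j))
  crossAt-NE y c X Y j = trans (cong (crossAt (tri y c) NE) (steps-NE j X Y)) (cross-NE y c (X + + j) (Y + + j))

  crossAt-NW : ∀ y c X Y j → crossAt (tri y c) NW (steps NW j (X , Y)) ≡ ((Y + + j) ==ℤ y) ∧ ((c + 1ℤ) ≤ℤ (X - + j))
  crossAt-NW y c X Y j = trans (cong (crossAt (tri y c) NW) (steps-NW j X Y)) (cross-NW y c (X - + j) (Y + + j))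

  crossAt-SW : ∀ y c X Y j → crossAt (tri y c) SW (steps SW j (X , Y)) ≡ ((Y - + suc j) ==ℤ y) ∧ (c ≤ℤ (X - + suc j))
  crossAt-SW y c X Y j = trans (cong (crossAt (tri y c) SW) (steps-SW j X Y)) (trans (cross-SW y c (X - + j) (Y - + j))
    (cong₂ (λ u v → (u ==ℤ y) ∧ (c ≤ℤ v)) (lem Y (+ j)) (lem X (+ j))))
    where
    lem : ∀ x j → x - j - 1ℤ ≡ x - (1ℤ + j)
    lem = solve-∀

  private
    neq-∧ : ∀ {x y b} → x ≢ y → (x ==ℤ y) ∧ b ≡ false
    neq-∧ {b = b} h = cong (_∧ b) (==ℤ-neq h)

    eq-∧ : ∀ x {b} → (x ==ℤ x) ∧ b ≡ b
    eq-∧ x {b} = cong (_∧ b) (==ℤ-refl x)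

    xor-ff : ∀ {a b} → a ≡ false → b ≡ false → a xor b ≡ false
    xor-ff refl refl = refl

    add-apart : ∀ Y {i j} → j ≢ i → Y + + j ≢ Y + + i
    add-apart Y h e = h (+-injective (+-cancelˡ-≡ Y _ _ e))

    sub-apart : ∀ Y {i j} → j ≢ i → Y - + suc j ≢ Y - + suc i
    sub-apart Y h e = h (ℕ.suc-injective (+-injective (neg-injective (+-cancelˡ-≡ Y _ _ e))))

  run-NE : ∀ c X Y k i → i ℕ.< k → run (tri (Y + + i) c) NE k (X , Y) ≡ (c ≤ℤ (X + + i))
  run-NE c X Y k i a = trans (run-hit _ NE k (X , Y) i a (λ j h → trans (crossAt-NE _ c X Y j) (neq-∧ (add-apart Y h))))
    (trans (crossAt-NE _ c X Y i) (eq-∧ (Y + + i)))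

  run-NE-miss : ∀ y c X Y k → (∀ j → j ℕ.< k → Y + + j ≢ y) → run (tri y c) NE k (X , Y) ≡ false
  run-NE-miss y c X Y k h = run-miss _ NE k (X , Y) (λ j a → trans (crossAt-NE y c X Y j) (neq-∧ (h j a)))

  run-NW : ∀ c X Y k i → i ℕ.< k → run (tri (Y + + i) c) NW k (X , Y) ≡ ((c + 1ℤ) ≤ℤ (X - + i))
  run-NW c X Y k i a = trans (run-hit _ NW k (X , Y) i a (λ j h → trans (crossAt-NW _ c X Y j) (neq-∧ (add-apart Y h))))
    (trans (crossAt-NW _ c X Y i) (eq-∧ (Y + + i)))

  run-NW-miss : ∀ y c X Y k → (∀ j → j ℕ.< k → Y + + j ≢ y) → run (tri y c) NW k (X , Y) ≡ false
  run-NW-miss y c X Y k h = run-miss _ NW k (X , Y) (λ j a → trans (crossAt-NW y c X Y j) (neq-∧ (h j a)))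

  run-SW : ∀ c X Y k i → i ℕ.< k → run (tri (Y - + suc i) c) SW k (X , Y) ≡ (c ≤ℤ (X - + suc i))
  run-SW c X Y k i a = trans (run-hit _ SW k (X , Y) i a (λ j h → trans (crossAt-SW _ c X Y j) (neq-∧ (sub-apart Y h))))
    (trans (crossAt-SW _ c X Y i) (eq-∧ (Y - + suc i)))

  run-SW-miss : ∀ y c X Y k → (∀ j → j ℕ.< k → Y - + suc j ≢ y) → run (tri y c) SW k (X , Y) ≡ false
  run-SW-miss y c X Y k h = run-miss _ SW k (X , Y) (λ j a → trans (crossAt-SW y c X Y j) (neq-∧ (h j a)))

  ≤ℤ-suc : ∀ c d → (c ≤ℤ d) ≡ ((c + 1ℤ) ≤ℤ (d + 1ℤ))
  ≤ℤ-suc c d with c ≤? d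
  ... | yes p = sym (≤ℤ-true (+-monoˡ-≤ 1ℤ p))
  ... | no ¬p = sym (≤ℤ-false (+-monoˡ-< 1ℤ (≰⇒> ¬p)))

  between : ℤ → ℤ → ℤ → Bool
  between l r c = (c ≤ℤ l) xor ((c + 1ℤ) ≤ℤ r)

  xor-comm : ∀ a b → a xor b ≡ b xor a
  xor-comm true  true  = refl
  xor-comm true  false = refl
  xor-comm false true  = refl
  xor-comm false false = refl

  xor-falseʳ : ∀ b → b xor false ≡ b
  xor-falseʳ b = xor-comm b false

  up-inside : ∀ X Y a c i → i ℕ.< a →
    insideP (upTriangle (X , Y) a) (tri (Y + + i) c) ≡ between (X + + i) (X + + 2 * + a - + i) c
  up-inside X Y a c i b = begin
    insideP (upTriangle (X , Y) a) t
      ≡⟨ inside-parity (X , Y) ((E , a) ∷ (NW , a) ∷ (SW , a) ∷ []) t ⟩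
    run t E a (X , Y) xor (run t NW a (steps E a (X , Y)) xor (run t SW a (steps NW a (steps E a (X , Y))) xor false))
      ≡⟨ cong₂ _xor_ (run-E t a (X , Y)) (cong₂ _xor_ (cong (run t NW a) (steps-E a X Y))
          (trans (xor-falseʳ _) (cong (run t SW a) (trans (cong (steps NW a) (steps-E a X Y)) (steps-NW a _ Y))))) ⟩
    run t NW a (X + + 2 * + a , Y) xor run t SW a (X + + 2 * + a - + a , Y + + a)
      ≡⟨ cong₂ _xor_ (run-NW c _ Y a i b) west ⟩
    ((c + 1ℤ) ≤ℤ (X + + 2 * + a - + i)) xor (c ≤ℤ (X + + i))
      ≡⟨ xor-comm ((c + 1ℤ) ≤ℤ (X + + 2 * + a - + i)) _ ⟩
    between (X + + i) (X + + 2 * + a - + i) c ∎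
    where
    t : Tri
    t = tri (Y + + i) c
    -- The south-western run descends from the apex, so it meets row `i` at its step number
    -- `a - 1 - i`.
    k : ℕ
    k = a ℕ.∸ suc i
    a≡ : a ≡ suc i ℕ.+ k
    a≡ = sym (ℕ.m+[n∸m]≡n b)
    lem₁ : ∀ y i k → y + i ≡ y + (1ℤ + i + k) - (1ℤ + k)
    lem₁ = solve-∀
    lem₂ : ∀ x i k → x + + 2 * (1ℤ + i + k) - (1ℤ + i + k) - (1ℤ + k) ≡ x + i
    lem₂ = solve-∀
    west : run t SW a (X + + 2 * + a - + a , Y + + a) ≡ (c ≤ℤ (X + + i))
    west = begin
      run (tri (Y + + i) c) SW a (X + + 2 * + a - + a , Y + + a)
        ≡⟨ cong (λ y → run (tri y c) SW a (X + + 2 * + a - + a , Y + + a))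
             (trans (lem₁ Y (+ i) (+ k)) (cong (λ a → Y + + a - + suc k) (sym a≡))) ⟩
      run (tri (Y + + a - + suc k) c) SW a (X + + 2 * + a - + a , Y + + a)
        ≡⟨ run-SW c _ _ a k (subst (k ℕ.<_) (sym a≡) (s≤s (ℕ.m≤n+m k i))) ⟩
      c ≤ℤ (X + + 2 * + a - + a - + suc k)
        ≡⟨ cong (c ≤ℤ_) (trans (cong (λ a → X + + 2 * + a - + a - + suc k) a≡) (lem₂ X (+ i) (+ k))) ⟩
      c ≤ℤ (X + + i) ∎

  up-outside : ∀ X Y a y c → (∀ j → j ℕ.< a → Y + + j ≢ y) → insideP (upTriangle (X , Y) a) (tri y c) ≡ false
  up-outside X Y a y c h = trans (inside-parity (X , Y) ((E , a) ∷ (NW , a) ∷ (SW , a) ∷ []) (tri y c)) (xor-ff (run-E t a (X , Y)) (xor-ff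
    (trans (cong (run t NW a) (steps-E a X Y)) (run-NW-miss y c _ Y a h))
    (trans (xor-falseʳ _) (trans (cong (run t SW a) (trans (cong (steps NW a) (steps-E a X Y)) (steps-NW a _ Y)))
      (run-SW-miss y c _ _ a (λ j b → λ e → h (a ℕ.∸ suc j) (ℕ.∸-monoʳ-< {a} {suc j} {0} (s≤s z≤n) b) (trans (flip j b) e)))))))
    where
    t : Tri
    t = tri y c
    lem : ∀ y i k → y + k ≡ y + (1ℤ + i + k) - (1ℤ + i)
    lem = solve-∀
    flip : ∀ j → j ℕ.< a → Y + + (a ℕ.∸ suc j) ≡ Y + + a - + suc j
    flip j b = trans (lem Y (+ j) (+ (a ℕ.∸ suc j))) (cong (λ a → Y + + a - + suc j) (ℕ.m+[n∸m]≡n b))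

  down-inside : ∀ X Y a c i → i ℕ.< a →
    insideP (downTriangle (X , Y) a) (tri (Y - + suc i) c) ≡ between (X + + i) (X + + 2 * + a - + i) c
  down-inside X Y a c i b = begin
    insideP (downTriangle (X , Y) a) t
      ≡⟨ inside-parity (X , Y) ((E , a) ∷ (SW , a) ∷ (NW , a) ∷ []) t ⟩
    run t E a (X , Y) xor (run t SW a (steps E a (X , Y)) xor (run t NW a (steps SW a (steps E a (X , Y))) xor false))
      ≡⟨ cong₂ _xor_ (run-E t a (X , Y)) (cong₂ _xor_ (cong (run t SW a) (steps-E a X Y))
          (trans (xor-falseʳ _) (cong (run t NW a) (trans (cong (steps SW a) (steps-E a X Y)) (steps-SW a _ Y))))) ⟩
    run t SW a (X + + 2 * + a , Y) xor run t NW a (X + + 2 * + a - + a , Y - + a)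
      ≡⟨ cong₂ _xor_ (trans (run-SW c _ Y a i b) east) west ⟩
    ((c + 1ℤ) ≤ℤ (X + + 2 * + a - + i)) xor (c ≤ℤ (X + + i))
      ≡⟨ xor-comm ((c + 1ℤ) ≤ℤ (X + + 2 * + a - + i)) _ ⟩
    between (X + + i) (X + + 2 * + a - + i) c ∎
    where
    t : Tri
    t = tri (Y - + suc i) c
    k : ℕ
    k = a ℕ.∸ suc i
    a≡ : a ≡ suc i ℕ.+ k
    a≡ = sym (ℕ.m+[n∸m]≡n b)
    lem₀ : ∀ x i → x - (1ℤ + i) + 1ℤ ≡ x - i
    lem₀ = solve-∀
    east : (c ≤ℤ (X + + 2 * + a - + suc i)) ≡ ((c + 1ℤ) ≤ℤ (X + + 2 * + a - + i))
    east = trans (≤ℤ-suc c _) (cong ((c + 1ℤ) ≤ℤ_) (lem₀ (X + + 2 * + a) (+ i)))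
    lem₁ : ∀ y i k → y - (1ℤ + i) ≡ y - (1ℤ + i + k) + k
    lem₁ = solve-∀
    lem₂ : ∀ x i k → x + + 2 * (1ℤ + i + k) - (1ℤ + i + k) - k ≡ x + i + 1ℤ
    lem₂ = solve-∀
    west : run t NW a (X + + 2 * + a - + a , Y - + a) ≡ (c ≤ℤ (X + + i))
    west = begin
      run (tri (Y - + suc i) c) NW a (X + + 2 * + a - + a , Y - + a)
        ≡⟨ cong (λ y → run (tri y c) NW a (X + + 2 * + a - + a , Y - + a))
             (trans (lem₁ Y (+ i) (+ k)) (cong (λ a → Y - + a + + k) (sym a≡))) ⟩
      run (tri (Y - + a + + k) c) NW a (X + + 2 * + a - + a , Y - + a)
        ≡⟨ run-NW c _ _ a k (subst (k ℕ.<_) (sym a≡) (s≤s (ℕ.m≤n+m k i))) ⟩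
      (c + 1ℤ) ≤ℤ (X + + 2 * + a - + a - + k)
        ≡⟨ cong ((c + 1ℤ) ≤ℤ_) (trans (cong (λ a → X + + 2 * + a - + a - + k) a≡) (lem₂ X (+ i) (+ k))) ⟩
      (c + 1ℤ) ≤ℤ (X + + i + 1ℤ)
        ≡⟨ sym (≤ℤ-suc c (X + + i)) ⟩
      c ≤ℤ (X + + i) ∎

  down-outside : ∀ X Y a y c → (∀ j → j ℕ.< a → Y - + suc j ≢ y) → insideP (downTriangle (X , Y) a) (tri y c) ≡ false
  down-outside X Y a y c h = trans (inside-parity (X , Y) ((E , a) ∷ (SW , a) ∷ (NW , a) ∷ []) (tri y c)) (xor-ff (run-E t a (X , Y)) (xor-ff
    (trans (cong (run t SW a) (steps-E a X Y)) (run-SW-miss y c _ Y a h))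
    (trans (xor-falseʳ _) (trans (cong (run t NW a) (trans (cong (steps SW a) (steps-E a X Y)) (steps-SW a _ Y)))
      (run-NW-miss y c _ _ a (λ j b → λ e → h (a ℕ.∸ suc j) (ℕ.∸-monoʳ-< {a} {suc j} {0} (s≤s z≤n) b) (trans (flip j b) e)))))))
    where
    t : Tri
    t = tri y c
    lem : ∀ y i k → y - (1ℤ + k) ≡ y - (1ℤ + i + k) + i
    lem = solve-∀
    flip : ∀ j → j ℕ.< a → Y - + suc (a ℕ.∸ suc j) ≡ Y - + a + + j
    flip j b = trans (lem Y (+ j) (+ (a ℕ.∸ suc j))) (cong (λ a → Y - + a + + j) (ℕ.m+[n∸m]≡n b))

-- Removed triangles as blocks of marks

module Masks where

  open Chains
  open Products using (dbl)
  open Trapezoids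
  open import Data.Bool using (Bool; true; false; not; _∧_; _∨_)
  open import Data.Bool.Properties using (∨-zeroʳ; ∧-zeroʳ; not-involutive)
  open import Data.Nat.ListAction using (sum)
  open import Data.List.Properties using (++-assoc; ++-identityʳ; length-++; length-replicate; map-++; map-replicate)
  open import Defs using (Osum; Esum)
  open import Data.Nat using (ℕ; zero; suc; _+_; _≤_; _<_; _<ᵇ_; z≤n; s≤s; s≤s⁻¹)
  open import Data.Nat.Properties
  open import Data.Bool.ListAction using (any)
  open import Data.List using (List; []; _∷_; _++_; length; map; replicate; applyUpTo)
  open import Data.List.Relation.Unary.All using (All; []; _∷_)
  open import Data.Product using (_×_; _,_; proj₁; proj₂)
  open import Relation.Binary.PropositionalEquality
  open import Function using (_∘_)
  open ≡-Reasoning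

  -- The block (u , a) stands for the triangle cut out over the base segment from u to u + a;
  -- in the i-th row from the base it consists of the cells c with 2u + i < c < 2(u + a) − i.
  Block : Set
  Block = ℕ × ℕ

  hits : Block → ℕ → ℕ → Bool
  hits (u , a) i c = (dbl u + i <ᵇ c) ∧ (c + i <ᵇ dbl (u + a))

  -- `r` is a coordinate constant along the north-west direction. In it the right side of a triangle
  -- stays at `u + a`, while the left side moves in by one per row.
  hitsBase : ℕ → ℕ → Block → Bool
  hitsBase i r (u , a) = (u + i <ᵇ suc r) ∧ (r <ᵇ u + a)

  mask : List Block → ℕ → ℕ → Bool
  mask B i c = any (λ b → hits b i c) B

  baseMask : List Block → ℕ → ℕ → Bool
  baseMask B i r = any (hitsBase i r) B

  dbl-+ : ∀ m n → dbl (m + n) ≡ dbl m + dbl n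
  dbl-+ zero    n = refl
  dbl-+ (suc m) n = cong (suc ∘ suc) (dbl-+ m n)

  dbl≡+ : ∀ n → dbl n ≡ n + n
  dbl≡+ zero    = refl
  dbl≡+ (suc n) = cong suc (trans (cong suc (dbl≡+ n)) (sym (+-suc n n)))

  <ᵇ-+ : ∀ m n k → (m <ᵇ n) ≡ (m + k <ᵇ n + k)
  <ᵇ-+ m n zero    = cong₂ _<ᵇ_ (sym (+-identityʳ m)) (sym (+-identityʳ n))
  <ᵇ-+ m n (suc k) = trans (<ᵇ-+ m n k) (cong₂ _<ᵇ_ (sym (+-suc m k)) (sym (+-suc n k)))

  dbl-<ᵇ : ∀ m n → (dbl m <ᵇ dbl n) ≡ (m <ᵇ n)
  dbl-<ᵇ zero    zero    = refl
  dbl-<ᵇ zero    (suc n) = refl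
  dbl-<ᵇ (suc m) zero    = refl
  dbl-<ᵇ (suc m) (suc n) = dbl-<ᵇ m n

  suc-dbl-<ᵇ : ∀ m n → (suc (dbl m) <ᵇ dbl n) ≡ (m <ᵇ n)
  suc-dbl-<ᵇ zero    zero    = refl
  suc-dbl-<ᵇ zero    (suc n) = refl
  suc-dbl-<ᵇ (suc m) zero    = refl
  suc-dbl-<ᵇ (suc m) (suc n) = suc-dbl-<ᵇ m n

  dbl-<ᵇ-suc : ∀ m n → (dbl m <ᵇ suc (dbl n)) ≡ (m <ᵇ suc n)
  dbl-<ᵇ-suc zero    n       = refl
  dbl-<ᵇ-suc (suc m) zero    = refl
  dbl-<ᵇ-suc (suc m) (suc n) = dbl-<ᵇ-suc m n

  private
    shift-left : ∀ u i c → (dbl u + i <ᵇ c) ≡ (dbl (u + i) <ᵇ c + i)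
    shift-left u i c = trans (<ᵇ-+ (dbl u + i) c i) (cong (_<ᵇ c + i) (trans (+-assoc (dbl u) i i)
      (trans (cong (dbl u +_) (sym (dbl≡+ i))) (sym (dbl-+ u i)))))

  -- Column `c` and coordinate `r` are related by `c + i = 2 r + 1` for an up-pointing cell and by
  -- `c + i = 2 r` for a down-pointing one. The latter has the same `r` as the cell above it, and
  -- both belong to the same triangles; hence `suc i` in `hits-down`.
  hits-up : ∀ b i c r → c + i ≡ suc (dbl r) → hits b i c ≡ hitsBase i r b
  hits-up (u , a) i c r e = cong₂ _∧_
    (trans (shift-left u i c) (trans (cong (dbl (u + i) <ᵇ_) e) (dbl-<ᵇ-suc (u + i) r)))
    (trans (cong (_<ᵇ dbl (u + a)) e) (suc-dbl-<ᵇ r (u + a)))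

  hits-down : ∀ b i c r → c + i ≡ dbl r → hits b i c ≡ hitsBase (suc i) r b
  hits-down (u , a) i c r e = cong₂ _∧_
    (trans (shift-left u i c) (trans (cong (dbl (u + i) <ᵇ_) e) (trans (dbl-<ᵇ (u + i) r) (cong (_<ᵇ suc r) (sym (+-suc u i))))))
    (trans (cong (_<ᵇ dbl (u + a)) e) (dbl-<ᵇ r (u + a)))

  any-cong : {A : Set} {f g : A → Bool} → (∀ x → f x ≡ g x) → ∀ l → any f l ≡ any g l
  any-cong h []      = refl
  any-cong h (x ∷ l) = cong₂ _∨_ (h x) (any-cong h l)

  any-mono : {A : Set} {f g : A → Bool} → (∀ x → f x ≡ true → g x ≡ true) → ∀ l → any f l ≡ true → any g l ≡ true
  any-mono {f = f} {g} h (x ∷ l) e with f x in eq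
  ... | true  = cong (_∨ any g l) (h x eq)
  ... | false = trans (cong (g x ∨_) (any-mono h l e)) (∨-zeroʳ (g x))

  <ᵇ-true : ∀ {m n} → m < n → (m <ᵇ n) ≡ true
  <ᵇ-true (s≤s z≤n)       = refl
  <ᵇ-true (s≤s (s≤s a)) = <ᵇ-true (s≤s a)

  <ᵇ-false : ∀ {m n} → n ≤ m → (m <ᵇ n) ≡ false
  <ᵇ-false z≤n     = refl
  <ᵇ-false (s≤s a) = <ᵇ-false a

  <ᵇ-true⁻¹ : ∀ {m n} → (m <ᵇ n) ≡ true → m < n
  <ᵇ-true⁻¹ {m}     {zero}  ()
  <ᵇ-true⁻¹ {zero}  {suc n} e = s≤s z≤n
  <ᵇ-true⁻¹ {suc m} {suc n} e = s≤s (<ᵇ-true⁻¹ e)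

  ∧-true : ∀ {a b} → a ∧ b ≡ true → a ≡ true × b ≡ true
  ∧-true {true} {true} e = refl , refl

  hitsBase-right : ∀ i r b → hitsBase (suc i) r b ≡ true → hitsBase i r b ≡ true
  hitsBase-right i r (u , a) e = let p , q = ∧-true {u + suc i <ᵇ suc r} e in
    cong₂ _∧_ (<ᵇ-true (≤-trans (s≤s (+-monoʳ-≤ u (n≤1+n i))) (<ᵇ-true⁻¹ {u + suc i} {suc r} p))) q

  hitsBase-left : ∀ i r b → hitsBase (suc i) (suc r) b ≡ true → hitsBase i r b ≡ true
  hitsBase-left i r (u , a) e = let p , q = ∧-true {u + suc i <ᵇ suc (suc r)} e in
    cong₂ _∧_ (<ᵇ-true (s≤s⁻¹ (subst (_< suc (suc r)) (+-suc u i) (<ᵇ-true⁻¹ {u + suc i} {suc (suc r)} p)))) (<ᵇ-true (<-trans (n<1+n r) (<ᵇ-true⁻¹ {suc r} {u + a} q)))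

  forced-tab : ∀ m p (d a : ℕ → Bool) → (d 0 ≡ true → p ≡ true) → (∀ t → d t ≡ true → a t ≡ true) →
    (∀ t → d (suc t) ≡ true → a t ≡ true) → Forced p (applyUpTo d m) (applyUpTo a m)
  forced-tab zero    p d a h₀ h₁ h₂ = done
  forced-tab (suc m) p d a h₀ h₁ h₂ with d 0 in e
  ... | false = unmarked (forced-tab m (a 0) (d ∘ suc) (a ∘ suc) (h₂ 0) (λ t → h₁ (suc t)) (λ t → h₂ (suc t)))
  ... | true rewrite h₀ refl | h₁ 0 e = marked (forced-tab m true (d ∘ suc) (a ∘ suc) (λ _ → refl) (λ t → h₁ (suc t)) (λ t → h₂ (suc t)))

  tab-falses : ∀ m (f : ℕ → Bool) → (∀ t → f t ≡ false) → applyUpTo f m ≡ falses m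
  tab-falses zero    f h = refl
  tab-falses (suc m) f h = cong₂ _∷_ (h 0) (tab-falses m (f ∘ suc) (λ t → h (suc t)))

  -- Triangles not higher than the trapezoid, so that its top is free of marks (`short-top`).
  Short : ℕ → List Block → Set
  Short n = All (λ b → proj₂ b ≤ n)

  short-top : ∀ {n} B → Short n B → ∀ r → baseMask B n r ≡ false
  short-top []            []      r = refl
  short-top {n} ((u , a) ∷ B) (s ∷ S) r = cong₂ _∨_ (outside (u + n <ᵇ suc r) refl) (short-top B S r)
    where
    outside : ∀ b → (u + n <ᵇ suc r) ≡ b → b ∧ (r <ᵇ u + a) ≡ false
    outside false e = refl
    outside true  e = <ᵇ-false (≤-trans (+-monoʳ-≤ u s) (s≤s⁻¹ (<ᵇ-true⁻¹ {u + n} e)))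

  baseRow : List Block → ℕ → ℕ → ℕ → ℕ → List Bool
  baseRow B n i h x = applyUpTo (λ t → baseMask B i (t + h)) (baseLength n x)

  -- A far-side cell of a removed triangle has both its neighbours in the row inside the same
  -- triangle.
  forces-baseRow : ∀ B b i h m → h ≤ i →
    Forces b (applyUpTo (λ t → baseMask B (suc i) (t + above b h)) m) (applyUpTo (λ t → baseMask B i (t + h)) (above b m))
  forces-baseRow B true i h m a = _ , _ , refl , forced-tab m _ _ _
    (λ e → any-mono (hitsBase-left i h) B e)
    (λ t e → any-mono (hitsBase-right i (suc t + h)) B (subst (λ r → baseMask B (suc i) r ≡ true) (+-suc t h) e))
    (λ t e → any-mono (hitsBase-left i (suc t + h)) B (subst (λ r → baseMask B (suc i) r ≡ true) (cong suc (+-suc t h)) e))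
  forces-baseRow B false i h m a = forced-tab m false _ _
    (λ e → trans (sym (left-edge B)) e)
    (λ t e → any-mono (hitsBase-right i (t + h)) B e)
    (λ t e → any-mono (hitsBase-left i (t + h)) B e)
    where
    -- Where the row opens with a far-side cell, no triangle contains that cell: the left side has
    -- already moved in by `i + 1`, more than `h`.
    left-edge : ∀ B → baseMask B (suc i) h ≡ false
    left-edge []            = refl
    left-edge ((u , a′) ∷ B) = cong₂ _∨_ (cong (_∧ (h <ᵇ u + a′)) (<ᵇ-false (≤-trans (s≤s a) (m≤n+m (suc i) u)))) (left-edge B)

  -- `h` is the value of `r` at the left end of the row. The zigzag makes it grow in every second
  -- row only, so it never exceeds the row number `i`.
  trapezoid : ∀ B n i h x → h ≤ i → Short (n + i) B → Trapezoid n (baseRow B n i h x)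
  trapezoid B zero    i h x a s = subst (Trapezoid 0) (sym (tab-falses x _ (λ t → short-top B s (t + h)))) (apex x)
  trapezoid B (suc n) i h x a s = layer (forces-baseRow B (ev n) i h (baseLength n x) a)
    (trapezoid B n (suc i) (above (ev n) h) x (≤-trans (above-suc (ev n)) (s≤s a)) (subst (λ k → Short k B) (sym (+-suc n i)) s))
    where
    above-suc : ∀ b → above b h ≤ suc h
    above-suc true  = ≤-refl
    above-suc false = n≤1+n h

  -- `δ` is the column of the first cell of each row in the coordinates of the blocks; it is 0 or 1,
  -- depending on the zigzag.
  maskRow : List Block → ℕ → ℕ → ℕ → List Bool
  maskRow B δ w i = applyUpTo (λ j → mask B i (j + δ)) w

  maskRowsAbove : List Block → ℕ → ℕ → ℕ → ℕ → List (List Bool)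
  maskRowsAbove B δ x zero    i = []
  maskRowsAbove B δ x (suc n) i = maskRow B δ (dbl x + suc n) i ∷ maskRowsAbove B δ x n (suc i)

  maskRowsBelow : List Block → ℕ → ℕ → ℕ → ℕ → List (List Bool) → List (List Bool)
  maskRowsBelow B δ x zero    i acc = acc
  maskRowsBelow B δ x (suc n) i acc = maskRowsBelow B δ x n (suc i) (maskRow B δ (dbl x + suc n) i ∷ acc)

  base-width : ∀ n x → (ev n ≡ true → dbl x + n ≡ dbl (baseLength n x)) × (ev n ≡ false → suc (dbl x + n) ≡ dbl (baseLength n x))
  base-width zero    x = (λ _ → +-identityʳ _) , (λ ())
  base-width (suc n) x with ev n | base-width n x
  ... | true  | p , q = (λ ()) , (λ _ → cong suc (trans (+-suc (dbl x) n) (cong suc (p refl))))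
  ... | false | p , q = (λ _ → trans (+-suc (dbl x) n) (q refl)) , (λ ())

  il-even : ∀ k (f g μ : ℕ → Bool) → (∀ t → f t ≡ μ (dbl t)) → (∀ t → g t ≡ μ (suc (dbl t))) →
    il (applyUpTo f k) (applyUpTo g k) ≡ applyUpTo μ (dbl k)
  il-odd : ∀ k (f g μ : ℕ → Bool) → (∀ t → f t ≡ μ (dbl t)) → (∀ t → g t ≡ μ (suc (dbl t))) →
    il (applyUpTo f (suc k)) (applyUpTo g k) ≡ applyUpTo μ (suc (dbl k))
  il-even zero    f g μ hf hg = refl
  il-even (suc k) f g μ hf hg = cong₂ _∷_ (hf 0) (il-odd k g (f ∘ suc) (μ ∘ suc) hg (λ t → hf (suc t)))
  il-odd zero    f g μ hf hg = cong (_∷ []) (hf 0)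
  il-odd (suc k) f g μ hf hg = cong₂ _∷_ (hf 0) (il-even (suc k) g (f ∘ suc) (μ ∘ suc) hg (λ t → hf (suc t)))

  offset : Bool → ℕ → ℕ
  offset true  h = suc (dbl h)
  offset false h = dbl h

  row-mask : ∀ B b δ x n i h → b ≡ ev n → δ + i ≡ offset b h →
    row b (applyUpTo (λ t → baseMask B i (t + h)) (above b (baseLength n x))) (applyUpTo (λ t → baseMask B (suc i) (t + above b h)) (baseLength n x))
      ≡ maskRow B δ (dbl x + suc n) i
  row-mask B true δ x n i h e o = trans
    (il-odd (baseLength n x) _ _ (λ j → mask B i (j + δ))
      (λ t → any-cong (λ b → sym (hits-up b i (dbl t + δ) (t + h) (up t))) B)
      (λ t → any-cong (λ b → sym (hits-down b i (suc (dbl t) + δ) (t + suc h) (down t))) B))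
    (cong (applyUpTo _) (sym (trans (+-suc (dbl x) n) (cong suc (proj₁ (base-width n x) (sym e))))))
    where
    up : ∀ t → dbl t + δ + i ≡ suc (dbl (t + h))
    up t = trans (+-assoc (dbl t) δ i) (trans (cong (dbl t +_) o) (trans (+-suc (dbl t) (dbl h)) (cong suc (sym (dbl-+ t h)))))
    down : ∀ t → suc (dbl t) + δ + i ≡ dbl (t + suc h)
    down t = trans (cong suc (up t)) (cong dbl (sym (+-suc t h)))
  row-mask B false δ x n i h e o = trans
    (il-even (baseLength n x) _ _ (λ j → mask B i (j + δ))
      (λ t → any-cong (λ b → sym (hits-down b i (dbl t + δ) (t + h) (down t))) B)
      (λ t → any-cong (λ b → sym (hits-up b i (suc (dbl t) + δ) (t + h) (cong suc (down t)))) B))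
    (cong (applyUpTo _) (sym (trans (+-suc (dbl x) n) (proj₂ (base-width n x) (sym e)))))
    where
    down : ∀ t → dbl t + δ + i ≡ dbl (t + h)
    down t = trans (+-assoc (dbl t) δ i) (trans (cong (dbl t +_) o) (sym (dbl-+ t h)))

  offset-step : ∀ b δ i h → δ + i ≡ offset b h → δ + suc i ≡ offset (not b) (above b h)
  offset-step true  δ i h o = trans (+-suc δ i) (cong suc o)
  offset-step false δ i h o = trans (+-suc δ i) (cong suc o)

  rowsAbove-apex : ∀ {A A′} (e : A ≡ A′) (t : Trapezoid 0 A) → rowsAbove (subst (Trapezoid 0) e t) ≡ rowsAbove t
  rowsAbove-apex refl t = refl

  rowsBelow-apex : ∀ {A A′} (e : A ≡ A′) (t : Trapezoid 0 A) acc → rowsBelow (subst (Trapezoid 0) e t) acc ≡ rowsBelow t acc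
  rowsBelow-apex refl t acc = refl

  above-masks : ∀ B δ n i h x a s → δ + i ≡ offset (not (ev n)) h →
    rowsAbove (trapezoid B n i h x a s) ≡ maskRowsAbove B δ x n i
  above-masks B δ zero    i h x a s o = rowsAbove-apex (sym (tab-falses x _ (λ t → short-top B s (t + h)))) (apex x)
  above-masks B δ (suc n) i h x a s o = cong₂ _∷_ (row-mask B (ev n) δ x n i h refl o′)
    (above-masks B δ n (suc i) _ x _ _ (offset-step (ev n) δ i h o′))
    where
    o′ : δ + i ≡ offset (ev n) h
    o′ = trans o (cong (λ b → offset b h) (not-involutive (ev n)))

  below-masks : ∀ B δ n i h x a s acc → δ + i ≡ offset (not (ev n)) h →
    rowsBelow (trapezoid B n i h x a s) acc ≡ maskRowsBelow B δ x n i acc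
  below-masks B δ zero    i h x a s acc o = rowsBelow-apex (sym (tab-falses x _ (λ t → short-top B s (t + h)))) (apex x) acc
  below-masks B δ (suc n) i h x a s acc o = trans (below-masks B δ n (suc i) _ x _ _ _ (offset-step (ev n) δ i h o′))
    (cong (λ r → maskRowsBelow B δ x n (suc i) (r ∷ acc)) (row-mask B (ev n) δ x n i h refl o′))
    where
    o′ : δ + i ≡ offset (ev n) h
    o′ = trans o (cong (λ b → offset b h) (not-involutive (ev n)))

  tab-++ : {A : Set} (f : ℕ → A) → ∀ m n → applyUpTo f (m + n) ≡ applyUpTo f m ++ applyUpTo (λ i → f (m + i)) n
  tab-++ f zero    n = refl
  tab-++ f (suc m) n = cong (f 0 ∷_) (tab-++ (f ∘ suc) m n)

  tab-cong : {A : Set} {f g : ℕ → A} → ∀ n → (∀ t → t < n → f t ≡ g t) → applyUpTo f n ≡ applyUpTo g n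
  tab-cong zero    h = refl
  tab-cong (suc n) h = cong₂ _∷_ (h 0 (s≤s z≤n)) (tab-cong n (λ t a → h (suc t) (s≤s a)))

  tab-replicate : {A : Set} {f : ℕ → A} {c : A} → ∀ n → (∀ t → t < n → f t ≡ c) → applyUpTo f n ≡ replicate n c
  tab-replicate zero    h = refl
  tab-replicate (suc n) h = cong₂ _∷_ (h 0 (s≤s z≤n)) (tab-replicate n (λ t a → h (suc t) (s≤s a)))

  hitsBase-before : ∀ u a r → r < u → hitsBase 0 r (u , a) ≡ false
  hitsBase-before u a r b = cong (_∧ (r <ᵇ u + a)) (<ᵇ-false (≤-trans b (≤-reflexive (sym (+-identityʳ u)))))

  hitsBase-after : ∀ u a r → u + a ≤ r → hitsBase 0 r (u , a) ≡ false
  hitsBase-after u a r b = trans (cong ((u + 0 <ᵇ suc r) ∧_) (<ᵇ-false b)) (∧-zeroʳ _)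

  hitsBase-inside : ∀ u a r → r < a → hitsBase 0 (u + r) (u , a) ≡ true
  hitsBase-inside u a r b = cong₂ _∧_ (<ᵇ-true (s≤s (+-monoʳ-≤ u z≤n))) (<ᵇ-true (+-monoʳ-< u b))

  -- The segments are listed from right to left, so a block starts after `L` and all segments that
  -- follow it in the list. The flag selects every second segment, that is, the triangles on one
  -- side of the line.
  lineBlocks : ℕ → Bool → List ℕ → List Block
  lineBlocks L b     []       = []
  lineBlocks L true  (a ∷ as) = (L + sum as , a) ∷ lineBlocks L false as
  lineBlocks L false (a ∷ as) = lineBlocks L true as

  lineBits : Bool → List ℕ → List Bool
  lineBits b []       = []
  lineBits b (a ∷ as) = lineBits (not b) as ++ replicate a b

  lineBits-not : ∀ b as → lineBits (not b) as ≡ map not (lineBits b as)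
  lineBits-not b []       = refl
  lineBits-not b (a ∷ as) = trans (cong₂ _++_ (lineBits-not (not b) as) (sym (map-replicate not a b)))
    (sym (map-++ not (lineBits (not b) as) (replicate a b)))

  lineBits-length : ∀ b as → length (lineBits b as) ≡ sum as
  lineBits-length b []       = refl
  lineBits-length b (a ∷ as) = trans (length-++ (lineBits (not b) as))
    (trans (cong₂ _+_ (lineBits-length (not b) as) (length-replicate a)) (+-comm (sum as) a))

  line-beyond : ∀ L b as r → L + sum as ≤ r → baseMask (lineBlocks L b as) 0 r ≡ false
  line-beyond L b     []       r h = refl
  line-beyond L true  (a ∷ as) r h = cong₂ _∨_
    (hitsBase-after (L + sum as) a r (≤-trans (≤-reflexive (trans (+-assoc L (sum as) a) (cong (L +_) (+-comm (sum as) a)))) h))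
    (line-beyond L false as r (≤-trans (+-monoʳ-≤ L (m≤n+m (sum as) a)) h))
  line-beyond L false (a ∷ as) r h = line-beyond L true as r (≤-trans (+-monoʳ-≤ L (m≤n+m (sum as) a)) h)

  line-bits : ∀ L b as → applyUpTo (baseMask (lineBlocks L b as) 0) (L + sum as) ≡ falses L ++ lineBits b as
  line-bits L b [] = begin
    applyUpTo (λ _ → false) (L + 0)  ≡⟨ tab-falses (L + 0) _ (λ _ → refl) ⟩
    falses (L + 0)                   ≡⟨ cong falses (+-identityʳ L) ⟩
    falses L                         ≡⟨ sym (++-identityʳ _) ⟩
    falses L ++ [] ∎
  line-bits L b (a ∷ as) = begin
    applyUpTo f (L + (a + sum as))
      ≡⟨ cong (applyUpTo f) (trans (cong (L +_) (+-comm a (sum as))) (sym (+-assoc L (sum as) a))) ⟩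
    applyUpTo f (L + sum as + a)
      ≡⟨ tab-++ f (L + sum as) a ⟩
    applyUpTo f (L + sum as) ++ applyUpTo (λ i → f (L + sum as + i)) a
      ≡⟨ cong₂ _++_ (trans (tab-cong (L + sum as) (left b)) (line-bits L (not b) as)) (tab-replicate a (right b)) ⟩
    (falses L ++ lineBits (not b) as) ++ replicate a b
      ≡⟨ ++-assoc (falses L) _ _ ⟩
    falses L ++ lineBits b (a ∷ as) ∎
    where
    f : ℕ → Bool
    f = baseMask (lineBlocks L b (a ∷ as)) 0
    left : ∀ b t → t < L + sum as → baseMask (lineBlocks L b (a ∷ as)) 0 t ≡ baseMask (lineBlocks L (not b) as) 0 t
    left true  t h = cong (_∨ baseMask (lineBlocks L false as) 0 t) (hitsBase-before (L + sum as) a t h)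
    left false t h = refl
    right : ∀ b t → t < a → baseMask (lineBlocks L b (a ∷ as)) 0 (L + sum as + t) ≡ b
    right true  t h = cong (_∨ baseMask (lineBlocks L false as) 0 (L + sum as + t)) (hitsBase-inside (L + sum as) a t h)
    right false t h = line-beyond L true as _ (m≤m+n _ t)

  -- The additional block is the cap of side `z` that completes the lower part to a trapezoid.
  line-bits-ended : ∀ L as z → applyUpTo (baseMask ((L + sum as , z) ∷ lineBlocks L false as) 0) (L + sum as + z)
    ≡ falses L ++ (lineBits false as ++ trues z)
  line-bits-ended L as z = begin
    applyUpTo f (L + sum as + z)
      ≡⟨ tab-++ f (L + sum as) z ⟩
    applyUpTo f (L + sum as) ++ applyUpTo (λ i → f (L + sum as + i)) z
      ≡⟨ cong₂ _++_
           (trans (tab-cong (L + sum as) (λ t h → cong (_∨ baseMask (lineBlocks L false as) 0 t) (hitsBase-before (L + sum as) z t h))) (line-bits L false as))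
           (tab-replicate z (λ t h → cong (_∨ baseMask (lineBlocks L false as) 0 (L + sum as + t)) (hitsBase-inside (L + sum as) z t h))) ⟩
    (falses L ++ lineBits false as) ++ trues z
      ≡⟨ ++-assoc (falses L) _ _ ⟩
    falses L ++ (lineBits false as ++ trues z) ∎
    where
    f : ℕ → Bool
    f = baseMask ((L + sum as , z) ∷ lineBlocks L false as) 0

  southBlocks : ℕ → List ℕ → List Block
  southBlocks u []             = []
  southBlocks u (t ∷ [])       = []
  southBlocks u (t ∷ t′ ∷ ts) = (u + t , t′) ∷ southBlocks (u + (t + t′)) ts

  southBits : List ℕ → List Bool
  southBits []             = []
  southBits (t ∷ [])       = falses t
  southBits (t ∷ t′ ∷ ts) = falses t ++ trues t′ ++ southBits ts

  south-before : ∀ u t r → r < u → baseMask (southBlocks u t) 0 r ≡ false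
  south-before u []             r h = refl
  south-before u (t ∷ [])       r h = refl
  south-before u (t ∷ t′ ∷ ts) r h = cong₂ _∨_ (hitsBase-before (u + t) t′ r (≤-trans h (m≤m+n u t))) (south-before _ ts r (≤-trans h (m≤m+n u _)))

  south-bits : ∀ u t → applyUpTo (λ r → baseMask (southBlocks u t) 0 (u + r)) (Esum t + Osum t) ≡ southBits t
  south-bits u []       = refl
  south-bits u (t ∷ []) = trans (tab-falses (t + 0) _ (λ _ → refl)) (cong falses (+-identityʳ t))
  south-bits u (t ∷ t′ ∷ ts) = begin
    applyUpTo f ((t′ + Esum ts) + (t + Osum ts))
      ≡⟨ cong (applyUpTo f) (regroup t t′ (Esum ts) (Osum ts)) ⟩
    applyUpTo f (t + (t′ + (Esum ts + Osum ts)))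
      ≡⟨ trans (tab-++ f t _) (cong (applyUpTo f t ++_) (tab-++ (λ i → f (t + i)) t′ _)) ⟩
    applyUpTo f t ++ applyUpTo (λ i → f (t + i)) t′ ++ applyUpTo (λ i → f (t + (t′ + i))) (Esum ts + Osum ts)
      ≡⟨ cong₂ _++_ (tab-replicate t gap) (cong₂ _++_ (tab-replicate t′ block) (trans (tab-cong _ (λ i _ → rest i)) (south-bits (u + (t + t′)) ts))) ⟩
    southBits (t ∷ t′ ∷ ts) ∎
    where
    f : ℕ → Bool
    f r = baseMask (southBlocks u (t ∷ t′ ∷ ts)) 0 (u + r)
    regroup : ∀ a b c d → (b + c) + (a + d) ≡ a + (b + (c + d))
    regroup a b c d = trans (+-comm (b + c) (a + d)) (trans (+-assoc a d (b + c)) (cong (a +_) (trans (+-comm d (b + c)) (+-assoc b c d))))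
    gap : ∀ r → r < t → f r ≡ false
    gap r h = cong₂ _∨_ (hitsBase-before (u + t) t′ (u + r) (+-monoʳ-< u h)) (south-before _ ts (u + r) (+-monoʳ-< u (≤-trans h (m≤m+n t t′))))
    block : ∀ r → r < t′ → f (t + r) ≡ true
    block r h = cong (_∨ baseMask (southBlocks (u + (t + t′)) ts) 0 (u + (t + r)))
      (trans (cong (λ v → hitsBase 0 v (u + t , t′)) (sym (+-assoc u t r))) (hitsBase-inside (u + t) t′ r h))
    rest : ∀ i → f (t + (t′ + i)) ≡ baseMask (southBlocks (u + (t + t′)) ts) 0 (u + (t + t′) + i)
    rest i = cong₂ _∨_ (hitsBase-after (u + t) t′ _ (≤-trans (≤-reflexive (+-assoc u t t′)) (≤-trans (m≤m+n _ i) (≤-reflexive (sym e)))))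
      (cong (baseMask (southBlocks (u + (t + t′)) ts) 0) e)
      where
      e : u + (t + (t′ + i)) ≡ u + (t + t′) + i
      e = trans (cong (u +_) (sym (+-assoc t t′ i))) (sym (+-assoc u (t + t′) i))

  short-weaken : ∀ {m n} B → m ≤ n → Short m B → Short n B
  short-weaken []      a []      = []
  short-weaken (b ∷ B) a (s ∷ S) = ≤-trans s a ∷ short-weaken B a S

  short-south : ∀ u t → Short (Esum t) (southBlocks u t)
  short-south u []             = []
  short-south u (t ∷ [])       = []
  short-south u (t ∷ t′ ∷ ts) = m≤m+n t′ _ ∷ short-weaken _ (m≤n+m (Esum ts) t′) (short-south _ ts)

  short-line : ∀ L as → Short (Osum as) (lineBlocks L true as) × Short (Esum as) (lineBlocks L false as)
  short-line L []       = [] , []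
  short-line L (a ∷ as) = let p , q = short-line L as in
    (m≤m+n a _ ∷ short-weaken _ (m≤n+m (Esum as) a) q) , p

  baseRow-0 : ∀ B n x → baseRow B n 0 0 x ≡ applyUpTo (baseMask B 0) (baseLength n x)
  baseRow-0 B n x = tab-cong (baseLength n x) (λ t _ → cong (baseMask B 0) (+-identityʳ t))

-- Filtering the bounding box

module Boxes where

  open Products using (dbl)
  open Transfer
  open Crossings
  open Masks
  open import Defs
  open import Data.Bool using (Bool; true; false; not; _∧_; _∨_; _xor_; if_then_else_)
  open import Data.Bool.Properties using (∧-zeroʳ)
  open import Data.Bool.ListAction using (any)
  open import Data.Nat as ℕ using (ℕ; zero; suc; z≤n; s≤s; _<ᵇ_)
  import Data.Nat.Properties as ℕ
  open import Data.Nat.ListAction using (sum)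
  open import Data.Integer using (ℤ; +_; -[1+_]; 0ℤ; 1ℤ; -1ℤ; _+_; _-_; -_; _*_; _≤_; _<_; _≤?_; _<?_; ∣_∣)
  open import Data.Integer.Properties hiding (∣i∣≡0⇒i≡0)
  open import Data.Integer.Tactic.RingSolver using (solve-∀)
  open import Data.List using (List; []; _∷_; _++_; map; filterᵇ; applyUpTo)
  open import Data.List.Properties using (++-identityʳ; ++-assoc)
  open import Data.List.Relation.Unary.Any using (here; there)
  open import Data.List.Membership.Propositional using (_∈_)
  open import Data.Product using (_,_; proj₁; proj₂)
  open import Relation.Nullary using (yes; no)
  open import Relation.Binary.PropositionalEquality
  open import Function using (_∘_; id)
  open ≡-Reasoning

  cat : {A : Set} → (ℕ → List A) → ℕ → List A
  cat F zero    = []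
  cat F (suc n) = F 0 ++ cat (F ∘ suc) n

  cat-cong : {A : Set} {F G : ℕ → List A} → ∀ n → (∀ i → i ℕ.< n → F i ≡ G i) → cat F n ≡ cat G n
  cat-cong zero    h = refl
  cat-cong (suc n) h = cong₂ _++_ (h 0 (s≤s z≤n)) (cat-cong n (λ i a → h (suc i) (s≤s a)))

  cat-empty : {A : Set} {F : ℕ → List A} → ∀ n → (∀ i → i ℕ.< n → F i ≡ []) → cat F n ≡ []
  cat-empty zero    h = refl
  cat-empty (suc n) h = cong₂ _++_ (h 0 (s≤s z≤n)) (cat-empty n (λ i a → h (suc i) (s≤s a)))

  cat-+ : {A : Set} (F : ℕ → List A) → ∀ m n → cat F (m ℕ.+ n) ≡ cat F m ++ cat (λ i → F (m ℕ.+ i)) n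
  cat-+ F zero    n = refl
  cat-+ F (suc m) n = trans (cong (F 0 ++_) (cat-+ (F ∘ suc) m n)) (sym (++-assoc (F 0) _ _))

  -- Both ranges are prolonged by empty parts to the common length `n + (a + N)`, which avoids
  -- comparing `n` with `a + N`.
  cat-window : {A : Set} (F : ℕ → List A) → ∀ a N n → (∀ i → i ℕ.< a → F i ≡ []) → (∀ i → F (a ℕ.+ (N ℕ.+ i)) ≡ []) →
    (∀ i → F (n ℕ.+ i) ≡ []) → cat F n ≡ cat (λ i → F (a ℕ.+ i)) N
  cat-window F a N n h₁ h₂ h₃ = begin
    cat F n
      ≡⟨ trans (sym (++-identityʳ _)) (cong (cat F n ++_) (sym (cat-empty (a ℕ.+ N) (λ i _ → h₃ i)))) ⟩
    cat F n ++ cat (λ i → F (n ℕ.+ i)) (a ℕ.+ N)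
      ≡⟨ trans (sym (cat-+ F n (a ℕ.+ N))) (trans (cong (cat F) (ℕ.+-comm n (a ℕ.+ N))) (cat-+ F (a ℕ.+ N) n)) ⟩
    cat F (a ℕ.+ N) ++ cat (λ i → F (a ℕ.+ N ℕ.+ i)) n
      ≡⟨ trans (cong (cat F (a ℕ.+ N) ++_) (cat-empty n (λ i _ → trans (cong F (ℕ.+-assoc a N i)) (h₂ i)))) (++-identityʳ _) ⟩
    cat F (a ℕ.+ N)
      ≡⟨ cat-+ F a N ⟩
    cat F a ++ cat (λ i → F (a ℕ.+ i)) N
      ≡⟨ cong (_++ cat (λ i → F (a ℕ.+ i)) N) (cat-empty a h₁) ⟩
    cat (λ i → F (a ℕ.+ i)) N ∎

  single : (Tri → Bool) → Tri → List Tri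
  single q t = if q t then t ∷ [] else []

  filter-cat : ∀ q y (f : ℕ → ℤ) (g : ℕ → ℕ) n →
    filterᵇ q (map (λ c → tri y c) (map f (applyUpTo g n))) ≡ cat (λ i → single q (tri y (f (g i)))) n
  filter-cat q y f g zero    = refl
  filter-cat q y f g (suc n) with q (tri y (f (g 0)))
  ... | true  = cong (tri y (f (g 0)) ∷_) (filter-cat q y f (g ∘ suc) n)
  ... | false = filter-cat q y f (g ∘ suc) n

  filter-concat : ∀ q (R : ℤ → List Tri) (f : ℕ → ℤ) (g : ℕ → ℕ) n →
    filterᵇ q (concatMap R (map f (applyUpTo g n))) ≡ cat (λ i → filterᵇ q (R (f (g i)))) n
  filter-concat q R f g zero    = refl
  filter-concat q R f g (suc n) = trans (filterᵇ-++ q (R (f (g 0))) _) (cong (filterᵇ q (R (f (g 0))) ++_) (filter-concat q R f (g ∘ suc) n))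

  cells-cat : ∀ i c (μ : ℕ → Bool) m → cellsOf i c (applyUpTo μ m) ≡ cat (λ j → if μ j then [] else tri (+ i) (+ (c ℕ.+ j)) ∷ []) m
  cells-cat i c μ zero    = refl
  cells-cat i c μ (suc m) with μ 0
  ... | true  = trans (cells-cat i (suc c) (μ ∘ suc) m) (cat-cong m (λ j _ → cong (λ d → if μ (suc j) then [] else tri (+ i) (+ d) ∷ []) (sym (ℕ.+-suc c j))))
  ... | false = cong₂ (λ d l → tri (+ i) (+ d) ∷ l) (sym (ℕ.+-identityʳ c))
    (trans (cells-cat i (suc c) (μ ∘ suc) m) (cat-cong m (λ j _ → cong (λ d → if μ (suc j) then [] else tri (+ i) (+ d) ∷ []) (sym (ℕ.+-suc c j)))))

  rows-cat : ∀ s k (R : ℕ → List Bool) N → rowsOf s k (applyUpTo R N) ≡ cat (λ i → cellsOf (k ℕ.+ i) s (R i)) N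
  rows-cat s k R zero    = refl
  rows-cat s k R (suc N) = cong₂ _++_ (cong (λ j → cellsOf j s (R 0)) (sym (ℕ.+-identityʳ k)))
    (trans (rows-cat s (suc k) (R ∘ suc) N) (cat-cong N (λ i _ → cong (λ j → cellsOf j s (R (suc i))) (sym (ℕ.+-suc k i)))))

  minL-≤ : ∀ d {x xs} → x ∈ xs → minL d xs ≤ x
  minL-≤ d {xs = y ∷ xs} (here refl) = i⊓j≤i y (minL y xs)
  minL-≤ d {xs = y ∷ xs} (there m)   = ≤-trans (i⊓j≤j y (minL y xs)) (minL-≤ y m)

  maxL-≥ : ∀ d {x xs} → x ∈ xs → x ≤ maxL d xs
  maxL-≥ d {xs = y ∷ xs} (here refl) = i≤i⊔j y (maxL y xs)
  maxL-≥ d {xs = y ∷ xs} (there m)   = ≤-trans (maxL-≥ y m) (i≤j⊔i y (maxL y xs))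

  neg-abs : ∀ {x} → x ≤ 0ℤ → x ≡ - + ∣ x ∣
  neg-abs {+ zero}   a = refl
  neg-abs {+ suc n}  (_≤_.+≤+ ())
  neg-abs { -[1+ n ]} a = refl

  at-window : ∀ {lo} → lo ≤ 0ℤ → ∀ k → lo + + (∣ lo ∣ ℕ.+ k) ≡ + k
  at-window {lo} a k = trans (cong (_+ + (∣ lo ∣ ℕ.+ k)) (neg-abs a)) (lem (+ ∣ lo ∣) (+ k))
    where
    lem : ∀ a k → - a + (a + k) ≡ k
    lem = solve-∀

  before-window : ∀ {lo} → lo ≤ 0ℤ → ∀ i → i ℕ.< ∣ lo ∣ → lo + + i < 0ℤ
  before-window {lo} a i b = subst (lo + + i <_) (trans (cong (λ n → lo + + n) (sym (ℕ.+-identityʳ ∣ lo ∣))) (at-window a 0)) (+-monoʳ-< lo (_<_.+<+ b))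

  beyond-window : ∀ lo hi i → hi < lo + + (suc ∣ hi - lo ∣ ℕ.+ i)
  beyond-window lo hi i = subst (_< lo + + (suc ∣ hi - lo ∣ ℕ.+ i)) (lem lo hi)
    (+-monoʳ-< lo (≤-<-trans (≤-abs (hi - lo)) (_<_.+<+ (s≤s (ℕ.m≤m+n ∣ hi - lo ∣ i)))))
    where
    lem : ∀ lo hi → lo + (hi - lo) ≡ hi
    lem = solve-∀
    ≤-abs : ∀ x → x ≤ + ∣ x ∣
    ≤-abs (+ n)    = ≤-refl
    ≤-abs -[1+ n ] = _≤_.-≤+

  module Box (P : Polygon) (q : Tri → Bool) (s N : ℕ) (w : ℕ → ℕ)
    (no-row : ∀ y c → (∀ i → i ℕ.< N → + i ≢ y) → q (tri y c) ≡ false)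
    (left   : ∀ i c → i ℕ.< N → c < + s → q (tri (+ i) c) ≡ false)
    (right  : ∀ i c → i ℕ.< N → + (s ℕ.+ w i) ≤ c → q (tri (+ i) c) ≡ false)
    (west  : 0 ℕ.< N → 0ℤ ∈ map proj₁ (vertices P)) (south : 0ℤ ∈ map proj₂ (vertices P))
    (X : ℤ) (east : X ∈ map proj₁ (vertices P)) (north : + N ∈ map proj₂ (vertices P))
    (bound : ∀ i c → i ℕ.< N → X ≤ c → q (tri (+ i) c) ≡ false) where

    x₀ x₁ y₀ y₁ : ℤ
    x₀ = minL 0ℤ (map proj₁ (vertices P))
    x₁ = maxL 0ℤ (map proj₁ (vertices P))
    y₀ = minL 0ℤ (map proj₂ (vertices P))
    y₁ = maxL 0ℤ (map proj₂ (vertices P))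

    markRow : ℕ → List Bool
    markRow i = applyUpTo (λ j → not (q (tri (+ i) (+ (s ℕ.+ j))))) (w i)

    rowTris : ℤ → List Tri
    rowTris y = map (λ c → tri y c) (rangeℤ x₀ x₁)

    single-false : ∀ {t} → q t ≡ false → single q t ≡ []
    single-false e rewrite e = refl

    row-filter : ∀ i → i ℕ.< N → filterᵇ q (rowTris (+ i)) ≡ cellsOf i s (markRow i)
    row-filter i a = begin
      filterᵇ q (rowTris (+ i))
        ≡⟨ filter-cat q (+ i) (λ k → x₀ + + k) id (suc ∣ x₁ - x₀ ∣) ⟩
      cat F (suc ∣ x₁ - x₀ ∣)
        ≡⟨ cat-window F (∣ x₀ ∣ ℕ.+ s) (w i) (suc ∣ x₁ - x₀ ∣) before after beyond ⟩
      cat (λ j → F (∣ x₀ ∣ ℕ.+ s ℕ.+ j)) (w i)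
        ≡⟨ cat-cong (w i) (λ j _ → trans (cong (λ c → single q (tri (+ i) c)) (at j)) (flip (q (tri (+ i) (+ (s ℕ.+ j)))))) ⟩
      cat (λ j → if not (q (tri (+ i) (+ (s ℕ.+ j)))) then [] else tri (+ i) (+ (s ℕ.+ j)) ∷ []) (w i)
        ≡⟨ sym (cells-cat i s _ (w i)) ⟩
      cellsOf i s (markRow i) ∎
      where
      F : ℕ → List Tri
      F k = single q (tri (+ i) (x₀ + + k))
      x₀≤0 : x₀ ≤ 0ℤ
      x₀≤0 = minL-≤ 0ℤ (west (ℕ.≤-trans (s≤s z≤n) a))
      at : ∀ j → x₀ + + (∣ x₀ ∣ ℕ.+ s ℕ.+ j) ≡ + (s ℕ.+ j)
      at j = trans (cong (λ k → x₀ + + k) (ℕ.+-assoc ∣ x₀ ∣ s j)) (at-window x₀≤0 (s ℕ.+ j))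
      flip : ∀ b {t : List Tri} → (if b then t else []) ≡ (if not b then [] else t)
      flip true  = refl
      flip false = refl
      before : ∀ k → k ℕ.< ∣ x₀ ∣ ℕ.+ s → F k ≡ []
      before k b = single-false (left i (x₀ + + k) a (subst (x₀ + + k <_) (at-window x₀≤0 s) (+-monoʳ-< x₀ (_<_.+<+ b))))
      after : ∀ k → F (∣ x₀ ∣ ℕ.+ s ℕ.+ (w i ℕ.+ k)) ≡ []
      after k = single-false (right i _ a (subst (+ (s ℕ.+ w i) ≤_) (sym (at (w i ℕ.+ k))) (_≤_.+≤+ (ℕ.+-monoʳ-≤ s (ℕ.m≤m+n (w i) k)))))
      beyond : ∀ k → F (suc ∣ x₁ - x₀ ∣ ℕ.+ k) ≡ []
      beyond k = single-false (bound i _ a (<⇒≤ (≤-<-trans (maxL-≥ 0ℤ east) (beyond-window x₀ x₁ k))))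

    no-row-filter : ∀ y → (∀ i → i ℕ.< N → + i ≢ y) → filterᵇ q (rowTris y) ≡ []
    no-row-filter y h = trans (filter-cat q y (λ k → x₀ + + k) id (suc ∣ x₁ - x₀ ∣))
      (cat-empty (suc ∣ x₁ - x₀ ∣) (λ k _ → single-false (no-row y (x₀ + + k) h)))

    -- The box is never computed. It suffices that the given vertices make it contain the origin,
    -- the rows up to `N` and everything to the right where `q` can hold; all else is filtered out.
    box-filter : filterᵇ q (boxTris P) ≡ rowsOf s 0 (applyUpTo markRow N)
    box-filter = begin
      filterᵇ q (boxTris P)
        ≡⟨ filter-concat q rowTris (λ k → y₀ + + k) id (suc ∣ y₁ - 1ℤ - y₀ ∣) ⟩
      cat F (suc ∣ y₁ - 1ℤ - y₀ ∣)
        ≡⟨ cat-window F ∣ y₀ ∣ N (suc ∣ y₁ - 1ℤ - y₀ ∣) before after beyond ⟩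
      cat (λ i → F (∣ y₀ ∣ ℕ.+ i)) N
        ≡⟨ cat-cong N (λ i a → trans (cong (λ y → filterᵇ q (rowTris y)) (at-window y₀≤0 i)) (row-filter i a)) ⟩
      cat (λ i → cellsOf i s (markRow i)) N
        ≡⟨ sym (rows-cat s 0 markRow N) ⟩
      rowsOf s 0 (applyUpTo markRow N) ∎
      where
      F : ℕ → List Tri
      F k = filterᵇ q (rowTris (y₀ + + k))
      y₀≤0 : y₀ ≤ 0ℤ
      y₀≤0 = minL-≤ 0ℤ south
      before : ∀ k → k ℕ.< ∣ y₀ ∣ → F k ≡ []
      before k b = no-row-filter _ (λ i _ e → <⇒≱ (before-window y₀≤0 k b) (subst (0ℤ ≤_) e (_≤_.+≤+ z≤n)))
      after : ∀ k → F (∣ y₀ ∣ ℕ.+ (N ℕ.+ k)) ≡ []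
      after k = no-row-filter _ (λ i a e → ℕ.<⇒≢ (ℕ.≤-trans a (ℕ.m≤m+n N k)) (+-injective (trans e (at-window y₀≤0 (N ℕ.+ k)))))
      beyond : ∀ k → F (suc ∣ y₁ - 1ℤ - y₀ ∣ ℕ.+ k) ≡ []
      beyond k = no-row-filter _ (λ i a → <⇒≢ (≤-<-trans (below-top i a) (beyond-window y₀ (y₁ - 1ℤ) k)))
        where
        below-top : ∀ i → i ℕ.< N → + i ≤ y₁ - 1ℤ
        below-top i a = subst (_≤ y₁ - 1ℤ) (lem (+ i)) (+-monoˡ-≤ -1ℤ (i<j⇒suc[i]≤j (<-≤-trans (_<_.+<+ a) (maxL-≥ 0ℤ north))))
          where
          lem : ∀ i → 1ℤ + i - 1ℤ ≡ i
          lem = solve-∀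

  ≤ℤ-shift : ∀ x y k {m n} → x + + k ≡ + m → y + + k ≡ + n → (x ≤ℤ y) ≡ (m <ᵇ suc n)
  ≤ℤ-shift x y k {m} {n} ex ey with m ℕ.≤? n
  ... | yes m≤n = trans (≤ℤ-true {x} {y} (+-cancelʳ-≤ {x} {y} (+ k) (subst₂ _≤_ (sym ex) (sym ey) (_≤_.+≤+ m≤n)))) (sym (<ᵇ-true (s≤s m≤n)))
    where
    +-cancelʳ-≤ : ∀ {x y} z → x + z ≤ y + z → x ≤ y
    +-cancelʳ-≤ {x} {y} z h = subst₂ _≤_ (lem x z) (lem y z) (+-monoˡ-≤ (- z) h)
      where
      lem : ∀ x z → x + z - z ≡ x
      lem = solve-∀
  ... | no m≰n = trans (≤ℤ-false {x} {y} (≰⇒> (λ h → m≰n (drop (subst₂ _≤_ ex ey (+-monoˡ-≤ (+ k) h)))))) (sym (<ᵇ-false (ℕ.≰⇒> m≰n)))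
    where
    drop : ∀ {m n} → + m ≤ + n → m ℕ.≤ n
    drop (_≤_.+≤+ h) = h

  not-<ᵇ : ∀ m n → (m <ᵇ suc n) ≡ not (n <ᵇ m)
  not-<ᵇ zero    zero    = refl
  not-<ᵇ zero    (suc n) = refl
  not-<ᵇ (suc m) zero    = refl
  not-<ᵇ (suc m) (suc n) = not-<ᵇ m n

  pos-dbl : ∀ n → + dbl n ≡ + 2 * + n
  pos-dbl zero    = refl
  pos-dbl (suc n) = trans (cong (λ x → + 2 + x) (pos-dbl n)) (lem (+ n))
    where
    lem : ∀ n → + 2 + + 2 * n ≡ + 2 * (1ℤ + n)
    lem = solve-∀

  -- Ray casting yields an exclusive or. It equals a conjunction because in a row with `i < a` a
  -- cell that is not past the left side lies before the right side.
  between-hits : ∀ X δ u a c i → i ℕ.< a → X + + δ ≡ + dbl u →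
    between (X + + i) (X + + 2 * + a - + i) (+ c) ≡ hits (u , a) i (c ℕ.+ δ)
  between-hits X δ u a c i b e = trans
    (cong₂ _xor_ (trans (≤ℤ-shift (+ c) (X + + i) δ {c ℕ.+ δ} {dbl u ℕ.+ i} refl e₁) (not-<ᵇ (c ℕ.+ δ) (dbl u ℕ.+ i)))
      (≤ℤ-shift (+ c + 1ℤ) (X + + 2 * + a - + i) (δ ℕ.+ i) {suc (c ℕ.+ δ ℕ.+ i)} {dbl (u ℕ.+ a)} (e₂ (+ c) (+ δ) (+ i)) e₃))
    (combine (dbl u ℕ.+ i <ᵇ c ℕ.+ δ) (c ℕ.+ δ ℕ.+ i <ᵇ dbl (u ℕ.+ a)) left-in)
    where
    e₁ : X + + i + + δ ≡ + (dbl u ℕ.+ i)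
    e₁ = trans (lem X (+ i) (+ δ)) (cong (_+ + i) e)
      where
      lem : ∀ x i d → x + i + d ≡ x + d + i
      lem = solve-∀
    e₂ : ∀ c d i → c + 1ℤ + (d + i) ≡ 1ℤ + (c + d + i)
    e₂ = solve-∀
    e₃ : X + + 2 * + a - + i + + (δ ℕ.+ i) ≡ + dbl (u ℕ.+ a)
    e₃ = trans (lem X (+ a) (+ i) (+ δ)) (trans (cong₂ _+_ e (sym (pos-dbl a))) (cong +_ (sym (dbl-+ u a))))
      where
      lem : ∀ x a i d → x + + 2 * a - i + (d + i) ≡ (x + d) + + 2 * a
      lem = solve-∀
    left-in : (dbl u ℕ.+ i <ᵇ c ℕ.+ δ) ≡ false → (c ℕ.+ δ ℕ.+ i <ᵇ dbl (u ℕ.+ a)) ≡ true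
    left-in h with c ℕ.+ δ ℕ.≤? dbl u ℕ.+ i
    ... | yes p = <ᵇ-true (ℕ.≤-<-trans (ℕ.+-monoˡ-≤ i p) (ℕ.<-≤-trans
            (ℕ.≤-<-trans (ℕ.≤-reflexive (trans (ℕ.+-assoc (dbl u) i i) (cong (dbl u ℕ.+_) (sym (dbl≡+ i))))) (ℕ.+-monoʳ-< (dbl u) (dbl-< b)))
            (ℕ.≤-reflexive (sym (dbl-+ u a)))))
      where
      dbl-< : ∀ {m n} → m ℕ.< n → dbl m ℕ.< dbl n
      dbl-< {zero}  (s≤s h) = s≤s z≤n
      dbl-< {suc m} (s≤s h) = s≤s (s≤s (dbl-< h))
    ... | no p with () ← trans (sym h) (<ᵇ-true (ℕ.≰⇒> p))
    combine : ∀ a b → (a ≡ false → b ≡ true) → not a xor b ≡ a ∧ b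
    combine true  b h = refl
    combine false b h = cong not (h refl)

  hits-beyond : ∀ u a i c → a ℕ.≤ i → hits (u , a) i c ≡ false
  hits-beyond u a i c h with dbl u ℕ.+ i ℕ.<? c
  ... | no p  = cong (_∧ (c ℕ.+ i <ᵇ dbl (u ℕ.+ a))) (<ᵇ-false (ℕ.≮⇒≥ p))
  ... | yes p = trans (cong ((dbl u ℕ.+ i <ᵇ c) ∧_) (<ᵇ-false (ℕ.≤-trans
      (ℕ.≤-reflexive (trans (dbl-+ u a) (cong (dbl u ℕ.+_) (dbl≡+ a))))
      (ℕ.≤-trans (ℕ.≤-reflexive (sym (ℕ.+-assoc (dbl u) a a))) (ℕ.+-mono-≤ (ℕ.≤-trans (ℕ.+-monoʳ-≤ (dbl u) h) (ℕ.<⇒≤ p)) h)))))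
    (∧-zeroʳ _)

  up-hits : ∀ X L δ u a i c → X + + δ ≡ + dbl u →
    insideP (upTriangle (X , + L) a) (tri (+ (L ℕ.+ i)) (+ c)) ≡ hits (u , a) i (c ℕ.+ δ)
  up-hits X L δ u a i c e with i ℕ.<? a
  ... | yes p = trans (up-inside X (+ L) a (+ c) i p) (between-hits X δ u a c i p e)
  ... | no p  = trans (up-outside X (+ L) a _ (+ c) (λ j h e′ → ℕ.<⇒≢ (ℕ.≤-trans h (ℕ.≮⇒≥ p)) (ℕ.+-cancelˡ-≡ L j i (+-injective e′))))
    (sym (hits-beyond u a i _ (ℕ.≮⇒≥ p)))

  down-hits : ∀ X L δ u a i c r → r ℕ.+ suc i ≡ L → X + + δ ≡ + dbl u →
    insideP (downTriangle (X , + L) a) (tri (+ r) (+ c)) ≡ hits (u , a) i (c ℕ.+ δ)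
  down-hits X L δ u a i c r refl e with i ℕ.<? a
  ... | yes p = trans (cong (λ y → insideP (downTriangle (X , + L) a) (tri y (+ c))) (lem (+ r) (+ i)))
    (trans (down-inside X (+ L) a (+ c) i p) (between-hits X δ u a c i p e))
    where
    lem : ∀ r i → r ≡ r + (1ℤ + i) - (1ℤ + i)
    lem = solve-∀
  ... | no p  = trans (down-outside X (+ L) a (+ r) (+ c) (λ j h e′ → ℕ.<⇒≢ (ℕ.≤-trans h (ℕ.≮⇒≥ p))
      (ℕ.suc-injective (ℕ.+-cancelˡ-≡ r (suc j) (suc i) (sym (+-injective (recover e′)))))))
    (sym (hits-beyond u a i _ (ℕ.≮⇒≥ p)))
    where
    recover : ∀ {l j} → + l - + suc j ≡ + r → + l ≡ + (r ℕ.+ suc j)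
    recover {l} {j} e′ = trans (lem (+ l) (+ suc j)) (cong (_+ + suc j) e′)
      where
      lem : ∀ l j → l ≡ l - j + j
      lem = solve-∀

  up-below : ∀ X L a r c → r ℕ.< L → insideP (upTriangle (X , + L) a) (tri (+ r) c) ≡ false
  up-below X L a r c h = up-outside X (+ L) a (+ r) c (λ j _ e → ℕ.>⇒≢ (ℕ.≤-trans h (ℕ.m≤m+n L j)) (+-injective e))

  down-above : ∀ X L a i c → insideP (downTriangle (X , + L) a) (tri (+ (L ℕ.+ i)) c) ≡ false
  down-above X L a i c = down-outside X (+ L) a _ c (λ j _ e → ℕ.m≢1+m+n L (lem₁ (+-injective (lem₂ (+ L) (+ suc j) (+ (L ℕ.+ i)) e))))
    where
    lem₂ : ∀ l j y → l - j ≡ y → l ≡ y + j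
    lem₂ l j y e = trans (lem l j) (cong (_+ j) e)
      where
      lem : ∀ l j → l ≡ l - j + j
      lem = solve-∀
    lem₁ : ∀ {j} → L ≡ L ℕ.+ i ℕ.+ suc j → L ≡ suc (L ℕ.+ (i ℕ.+ j))
    lem₁ {j} e = trans e (trans (ℕ.+-suc (L ℕ.+ i) j) (cong suc (ℕ.+-assoc L i j)))

  southHoles-mask : ∀ u X t i c → X ≡ + dbl u → any (λ h → insideP h (tri (+ i) (+ c))) (southHoles X t) ≡ mask (southBlocks u t) i c
  southHoles-mask u X []             i c e = refl
  southHoles-mask u X (t ∷ [])       i c e = refl
  southHoles-mask u X (t ∷ t′ ∷ ts) i c e = cong₂ _∨_
    (trans (up-hits _ 0 0 (u ℕ.+ t) t′ i c (trans (+-identityʳ _) (shift t))) (cong (hits (u ℕ.+ t , t′) i) (ℕ.+-identityʳ c)))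
    (southHoles-mask (u ℕ.+ (t ℕ.+ t′)) _ ts i c (shift (t ℕ.+ t′)))
    where
    shift : ∀ n → X + + (2 ℕ.* n) ≡ + dbl (u ℕ.+ n)
    shift n = trans (cong₂ _+_ e (trans (pos-* 2 n) (sym (pos-dbl n)))) (cong +_ (sym (dbl-+ u n)))

  next-hole : ∀ X l δ a as → X + + δ ≡ + dbl (l ℕ.+ (a ℕ.+ sum as)) → X - + (2 ℕ.* a) + + δ ≡ + dbl (l ℕ.+ sum as)
  next-hole X l δ a as e = begin
    X - + (2 ℕ.* a) + + δ                              ≡⟨ lem₁ X (+ (2 ℕ.* a)) (+ δ) ⟩
    X + + δ - + (2 ℕ.* a)                              ≡⟨ cong₂ _-_ e (trans (pos-* 2 a) (sym (pos-dbl a))) ⟩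
    + dbl (l ℕ.+ (a ℕ.+ sum as)) - + dbl a             ≡⟨ cong (λ n → + n - + dbl a) (trans (cong dbl (trans (cong (l ℕ.+_) (ℕ.+-comm a (sum as))) (sym (ℕ.+-assoc l (sum as) a)))) (dbl-+ (l ℕ.+ sum as) a)) ⟩
    + dbl (l ℕ.+ sum as) + + dbl a - + dbl a           ≡⟨ lem₂ (+ dbl (l ℕ.+ sum as)) (+ dbl a) ⟩
    + dbl (l ℕ.+ sum as) ∎
    where
    lem₁ : ∀ x y d → x - y + d ≡ x + d - y
    lem₁ = solve-∀
    lem₂ : ∀ x y → x + y - y ≡ x
    lem₂ = solve-∀

  -- Triangles of the other orientation hang below the line and miss this row, so every second
  -- segment drops out. In `lineHoles-below` the two orientations change roles, whence `not b`.
  lineHoles-above : ∀ X L l δ b as i c → X + + δ ≡ + dbl (l ℕ.+ sum as) →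
    any (λ h → insideP h (tri (+ (L ℕ.+ i)) (+ c))) (lineHoles (X , + L) b as) ≡ mask (lineBlocks l b as) i (c ℕ.+ δ)
  lineHoles-above X L l δ b     []       i c e = refl
  lineHoles-above X L l δ b (a ∷ as) i c e = head b
    where
    e′ : X - + (2 ℕ.* a) + + δ ≡ + dbl (l ℕ.+ sum as)
    e′ = next-hole X l δ a as e
    head : ∀ b → any (λ h → insideP h (tri (+ (L ℕ.+ i)) (+ c))) (lineHoles (X , + L) b (a ∷ as)) ≡ mask (lineBlocks l b (a ∷ as)) i (c ℕ.+ δ)
    head true  = cong₂ _∨_ (up-hits _ L δ (l ℕ.+ sum as) a i c e′) (lineHoles-above _ L l δ false as i c e′)
    head false = cong₂ _∨_ (down-above (X - + (2 ℕ.* a)) L a i (+ c)) (lineHoles-above _ L l δ true as i c e′)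

  lineHoles-below : ∀ X L l δ b as i r c → r ℕ.+ suc i ≡ L → X + + δ ≡ + dbl (l ℕ.+ sum as) →
    any (λ h → insideP h (tri (+ r) (+ c))) (lineHoles (X , + L) b as) ≡ mask (lineBlocks l (not b) as) i (c ℕ.+ δ)
  lineHoles-below X L l δ b     []       i r c eL e = refl
  lineHoles-below X L l δ b (a ∷ as) i r c eL e = head b
    where
    e′ : X - + (2 ℕ.* a) + + δ ≡ + dbl (l ℕ.+ sum as)
    e′ = next-hole X l δ a as e
    head : ∀ b → any (λ h → insideP h (tri (+ r) (+ c))) (lineHoles (X , + L) b (a ∷ as)) ≡ mask (lineBlocks l (not b) (a ∷ as)) i (c ℕ.+ δ)
    head true  = cong₂ _∨_ (up-below (X - + (2 ℕ.* a)) L a r (+ c) (subst (r ℕ.<_) eL (ℕ.m<m+n r (s≤s z≤n)))) (lineHoles-below _ L l δ false as i r c eL e′)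
    head false = cong₂ _∨_ (down-hits _ L δ (l ℕ.+ sum as) a i c r eL e′) (lineHoles-below _ L l δ true as i r c eL e′)

-- The regions as single and glued trapezoids

module Regions where

  open Chains
  open Products using (dbl)
  open Transfer
  open Trapezoids
  open Factorials using (ev-dbl; baseLength-even; baseLength-odd; dbl≡2*)
  open Crossings
  open Masks
  open Boxes
  open import Defs
  open import Data.Bool using (Bool; true; false; not; _∧_; _∨_; _xor_)
  open import Data.Bool.Properties using (∧-identityʳ; not-involutive; ∧-distribʳ-xor)
  open import Data.Bool.ListAction using (any)
  open import Data.Nat as ℕ using (ℕ; zero; suc; z≤n; s≤s; s≤s⁻¹; _∸_; _<ᵇ_)
  import Data.Nat.Properties as ℕ
  open import Data.Nat.ListAction using (sum)
  open import Data.Integer using (ℤ; +_; 0ℤ; 1ℤ; _+_; _-_; -_; _*_; _≤_; _<_; _<?_)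
  open import Data.Integer.Properties hiding (∣i∣≡0⇒i≡0)
  open import Data.Integer.Tactic.RingSolver using (solve-∀)
  open import Data.List using (List; []; _∷_; _++_; length; map; filterᵇ; applyUpTo)
  open import Data.List.Properties using (++-assoc; applyUpTo-∷ʳ)
  open import Data.List.Relation.Unary.All using (_∷_)
  open import Data.List.Relation.Unary.Any using (here; there)
  open import Data.List.Membership.Propositional using (_∈_)
  open import Data.List.Membership.Propositional.Properties using (∈-map⁺)
  open import Data.Product using (_,_; proj₁; proj₂)
  open import Data.Sum using (inj₁; inj₂)
  open import Data.Empty using (⊥-elim)
  open import Relation.Nullary using (yes; no; Dec)
  open import Relation.Binary.PropositionalEquality
  open ≡-Reasoning

  rowParity : ℕ → ℤ → Bool
  rowParity zero    y = false
  rowParity (suc n) y = ((+ n) ==ℤ y) xor rowParity n y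

  rowParity-miss : ∀ n y → (∀ i → i ℕ.< n → + i ≢ y) → rowParity n y ≡ false
  rowParity-miss zero    y h = refl
  rowParity-miss (suc n) y h = cong₂ _xor_ (==ℤ-neq (h n ℕ.≤-refl)) (rowParity-miss n y (λ i a → h i (ℕ.m≤n⇒m≤1+n a)))

  rowParity-hit : ∀ n i → i ℕ.< n → rowParity n (+ i) ≡ true
  rowParity-hit (suc n) i a with ℕ.m≤n⇒m<n∨m≡n (s≤s⁻¹ a)
  ... | inj₁ b    = cong₂ _xor_ (==ℤ-neq (+-neq (ℕ.>⇒≢ b))) (rowParity-hit n i b)
  ... | inj₂ refl = cong₂ _xor_ (==ℤ-refl (+ n)) (rowParity-miss n (+ n) (λ j b → +-neq (ℕ.<⇒≢ b)))

  endX : ℕ → ℤ → ℤ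
  endX zero          X = X
  endX (suc zero)    X = X - 1ℤ
  endX (suc (suc n)) X = endX n (X - 1ℤ + 1ℤ)

  endX-even : ∀ k X → endX (dbl k) X ≡ X
  endX-even zero    X = refl
  endX-even (suc k) X = trans (endX-even k _) (x-1+1 X)

  endX-odd : ∀ k X → endX (suc (dbl k)) X ≡ X - 1ℤ
  endX-odd zero    X = refl
  endX-odd (suc k) X = trans (endX-odd k _) (cong (_- 1ℤ) (x-1+1 X))

  -- For ray casting the zigzag is as good as a vertical side at abscissa `X`: each row is crossed
  -- by one step, and the steps from `X` to `X - 1` and back lead to the same test `c + 1 ≤ X`.
  zigzag-parity : ∀ n X y c w → wordParity (tri y c) (X , + n) (zigzag n ++ w)
    ≡ (rowParity n y ∧ ((c + 1ℤ) ≤ℤ X)) xor wordParity (tri y c) (endX n X , 0ℤ) w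
  zigzag-parity zero X y c w = refl
  zigzag-parity (suc zero) X y c w = cong (_xor wordParity (tri y c) (X - 1ℤ , 0ℤ) w)
    (trans (xor-falseʳ _) (trans (cross-SW y c X (+ 1)) (cong₂ _∧_ (sym (xor-falseʳ (0ℤ ==ℤ y)))
      (trans (≤ℤ-suc c (X - 1ℤ)) (cong ((c + 1ℤ) ≤ℤ_) (x-1+1 X))))))
  zigzag-parity (suc (suc n)) X y c w = begin
    run t SW 1 (X , + suc (suc n)) xor (run t SE 1 (X - 1ℤ , + suc n) xor wordParity t (X - 1ℤ + 1ℤ , + n) (zigzag n ++ w))
      ≡⟨ cong₂ _xor_ (trans (xor-falseʳ _) (trans (cross-SW y c X (+ suc (suc n))) (cong (_∧_ ((+ suc n) ==ℤ y)) (trans (≤ℤ-suc c (X - 1ℤ)) (cong ((c + 1ℤ) ≤ℤ_) (x-1+1 X))))))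
          (cong₂ _xor_ (trans (xor-falseʳ _) (trans (cross-SE y c (X - 1ℤ) (+ suc n)) (cong (λ u → ((+ n) ==ℤ y) ∧ ((c + 1ℤ) ≤ℤ u)) (x-1+1 X))))
            (trans (zigzag-parity n (X - 1ℤ + 1ℤ) y c w) (cong (λ u → (rowParity n y ∧ ((c + 1ℤ) ≤ℤ u)) xor end) (x-1+1 X)))) ⟩
    (a ∧ l) xor ((b ∧ l) xor ((r ∧ l) xor end))
      ≡⟨ cong ((a ∧ l) xor_) (trans (sym (xor-assoc (b ∧ l) (r ∧ l) end)) (cong (_xor end) (sym (∧-distribʳ-xor l b r)))) ⟩
    (a ∧ l) xor (((b xor r) ∧ l) xor end)
      ≡⟨ trans (sym (xor-assoc (a ∧ l) ((b xor r) ∧ l) end)) (cong (_xor end) (sym (∧-distribʳ-xor l a (b xor r)))) ⟩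
    ((a xor (b xor r)) ∧ l) xor end ∎
    where
    t : Tri
    t = tri y c
    a b r l end : Bool
    a = (+ suc n) ==ℤ y
    b = (+ n) ==ℤ y
    r = rowParity n y
    l = (c + 1ℤ) ≤ℤ X
    end = wordParity t (endX n (X - 1ℤ + 1ℤ) , 0ℤ) w

  endpoint : Point → Word → Point
  endpoint p []            = p
  endpoint p ((d , k) ∷ w) = endpoint (steps d k p) w

  endpoint-∈ : ∀ w w′ p → endpoint p w ∈ walk p (w ++ w′)
  endpoint-∈ []                w′ p = here refl
  endpoint-∈ ((d , zero) ∷ w)  w′ p = endpoint-∈ w w′ p
  endpoint-∈ ((d , suc k) ∷ w) w′ p = there (endpoint-∈ ((d , k) ∷ w) w′ (step d p))

  endpoint-++ : ∀ w w′ p → endpoint p (w ++ w′) ≡ endpoint (endpoint p w) w′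
  endpoint-++ []            w′ p = refl
  endpoint-++ ((d , k) ∷ w) w′ p = endpoint-++ w w′ (steps d k p)

  endpoint-zigzag : ∀ n X → endpoint (X , + n) (zigzag n) ≡ (endX n X , 0ℤ)
  endpoint-zigzag zero          X = refl
  endpoint-zigzag (suc zero)    X = refl
  endpoint-zigzag (suc (suc n)) X = endpoint-zigzag n (X - 1ℤ + 1ℤ)

  interval : ℤ → ℤ → ℤ → Bool
  interval l r c = ((c + 1ℤ) ≤ℤ l) xor ((c + 1ℤ) ≤ℤ r)

  private
    <⇒+1≤ : ∀ {c l} → c < l → c + 1ℤ ≤ l
    <⇒+1≤ {c} {l} h = subst (_≤ l) (+-comm 1ℤ c) (i<j⇒suc[i]≤j h)

    ≤⇒<+1 : ∀ {c l} → l ≤ c → l < c + 1ℤ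
    ≤⇒<+1 {c} {l} h = ≤-<-trans h (subst (_< c + 1ℤ) (+-identityʳ c) (+-monoʳ-< c {0ℤ} {1ℤ} (_<_.+<+ (s≤s z≤n))))

  interval-left : ∀ {l r c} → c < l → l ≤ r → interval l r c ≡ false
  interval-left h k = cong₂ _xor_ (≤ℤ-true (<⇒+1≤ h)) (≤ℤ-true (<⇒+1≤ (<-≤-trans h k)))

  interval-right : ∀ {l r c} → r ≤ c → l ≤ r → interval l r c ≡ false
  interval-right h k = cong₂ _xor_ (≤ℤ-false (≤⇒<+1 (≤-trans k h))) (≤ℤ-false (≤⇒<+1 h))

  interval-inside : ∀ {l r c} → l ≤ c → c < r → interval l r c ≡ true
  interval-inside h k = cong₂ _xor_ (≤ℤ-false (≤⇒<+1 h)) (≤ℤ-true (<⇒+1≤ k))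

  count-trapezoid : ∀ s {n A} (t : Trapezoid n A) → (0 ℕ.< n → down 0 s ≡ ev n) →
    tilingsCount (length (rowsOf s 0 (rowsAbove t))) (rowsOf s 0 (rowsAbove t)) ≡ T n A
  count-trapezoid s (apex x) h = sym (none-falses x)
  count-trapezoid s (layer {n} {D} {A} f t) h = trans (tilings-process s 0 (row (ev n) A D) (rowsAbove t) _ ℕ.≤-refl)
    (trans (cong (λ d → process d (row (ev n) A D) (rowsAbove t)) (h (s≤s z≤n))) (process-trapezoid f t A (⊑-refl A)))

  above-tab : ∀ B δ x n i → maskRowsAbove B δ x n i ≡ applyUpTo (λ k → maskRow B δ (dbl x ℕ.+ (n ∸ k)) (i ℕ.+ k)) n
  above-tab B δ x zero    i = refl
  above-tab B δ x (suc n) i = cong₂ _∷_ (cong (maskRow B δ (dbl x ℕ.+ suc n)) (sym (ℕ.+-identityʳ i)))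
    (trans (above-tab B δ x n (suc i)) (tab-cong n (λ k _ → cong (maskRow B δ (dbl x ℕ.+ (n ∸ k))) (sym (ℕ.+-suc i k)))))

  -- Treats `Q` and `K` together; `s` is the abscissa of the north-west corner. Four hypotheses are
  -- restricted to `0 < N` because they fail for `K` with `Esum t = 0`, where truncated subtraction
  -- gives no rows although `s = 1`.
  module South (t : List ℕ) (s N : ℕ)
    (ends   : 0 ℕ.< N → endX N (+ s) ≡ 0ℤ)
    (height : 0 ℕ.< N → s ℕ.+ N ≡ dbl (Esum t))
    (side   : 0 ℕ.< N → s ℕ.+ 0 ≡ offset (not (ev N)) 0)
    (facing : 0 ℕ.< N → down 0 s ≡ ev N)
    (short  : Esum t ℕ.≤ N)
    (base   : baseLength N (Osum t) ≡ Esum t ℕ.+ Osum t) where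

    e o : ℕ
    e = Esum t
    o = Osum t

    B : List Block
    B = southBlocks 0 t

    sides : Word
    sides = (E , e ℕ.+ o) ∷ (NW , N) ∷ (W , o) ∷ []

    P : Polygon
    P = poly (+ s , + N) (zigzag N ++ sides)

    inHole q : Tri → Bool
    inHole u = any (λ h → insideP h u) (southHoles 0ℤ t)
    q u = insideP P u ∧ not (inHole u)

    w : ℕ → ℕ
    w i = dbl o ℕ.+ (N ∸ i)

    inside-P : ∀ y c → insideP P (tri y c) ≡ (rowParity N y ∧ ((c + 1ℤ) ≤ℤ (+ s))) xor run (tri y c) NW N (endX N (+ s) + + 2 * + (e ℕ.+ o) , 0ℤ)
    inside-P y c = trans (inside-parity (+ s , + N) (zigzag N ++ sides) (tri y c)) (trans (zigzag-parity N (+ s) y c sides)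
      (cong ((rowParity N y ∧ ((c + 1ℤ) ≤ℤ (+ s))) xor_) (trans
        (cong₂ _xor_ (run-E (tri y c) (e ℕ.+ o) (endX N (+ s) , 0ℤ)) (trans (cong (run (tri y c) NW N se xor_) (trans (xor-falseʳ _) (run-W (tri y c) o (steps NW N se)))) (xor-falseʳ _)))
        (cong (run (tri y c) NW N) (steps-E (e ℕ.+ o) (endX N (+ s)) 0ℤ)))))
      where
      se : Point
      se = steps E (e ℕ.+ o) (endX N (+ s) , 0ℤ)

    right-end : ∀ i → i ℕ.< N → endX N (+ s) + + 2 * + (e ℕ.+ o) - + i ≡ + (s ℕ.+ w i)
    right-end i a = begin
      endX N (+ s) + + 2 * + (e ℕ.+ o) - + i
        ≡⟨ cong₂ (λ u v → u + v - + i) (ends N>0) (trans (sym (pos-dbl (e ℕ.+ o))) (cong +_ (trans (dbl-+ e o) (cong (ℕ._+ dbl o) (sym (height N>0)))))) ⟩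
      0ℤ + + (s ℕ.+ N ℕ.+ dbl o) - + i
        ≡⟨ cong (λ n → 0ℤ + + (s ℕ.+ n ℕ.+ dbl o) - + i) (sym (ℕ.m+[n∸m]≡n (ℕ.<⇒≤ a))) ⟩
      0ℤ + + (s ℕ.+ (i ℕ.+ (N ∸ i)) ℕ.+ dbl o) - + i
        ≡⟨ lem (+ s) (+ i) (+ (N ∸ i)) (+ dbl o) ⟩
      + (s ℕ.+ w i) ∎
      where
      N>0 : 0 ℕ.< N
      N>0 = ℕ.≤-trans (s≤s z≤n) a
      lem : ∀ s i n o → 0ℤ + (s + (i + n) + o) - i ≡ s + (o + n)
      lem = solve-∀

    inside-row : ∀ i c → i ℕ.< N → insideP P (tri (+ i) c) ≡ interval (+ s) (+ (s ℕ.+ w i)) c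
    inside-row i c a = trans (inside-P (+ i) c) (cong₂ _xor_ (cong (_∧ ((c + 1ℤ) ≤ℤ (+ s))) (rowParity-hit N i a))
      (trans (run-NW c _ 0ℤ N i a) (cong ((c + 1ℤ) ≤ℤ_) (right-end i a))))

    vertex : ∀ w₁ w₂ → zigzag N ++ sides ≡ w₁ ++ w₂ → endpoint (+ s , + N) w₁ ∈ vertices P
    vertex w₁ w₂ eq = subst (λ w → endpoint (+ s , + N) w₁ ∈ walk (+ s , + N) w) (sym eq) (endpoint-∈ w₁ w₂ (+ s , + N))

    corner : endpoint (+ s , + N) (zigzag N) ≡ (endX N (+ s) , 0ℤ)
    corner = endpoint-zigzag N (+ s)

    south-east : endpoint (+ s , + N) (zigzag N ++ (E , e ℕ.+ o) ∷ []) ≡ (endX N (+ s) + + 2 * + (e ℕ.+ o) , 0ℤ)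
    south-east = trans (endpoint-++ (zigzag N) _ _) (trans (cong (λ p → steps E (e ℕ.+ o) p) corner) (steps-E (e ℕ.+ o) _ 0ℤ))

    tris : filterᵇ q (boxTris P) ≡ rowsOf s 0 (maskRowsAbove B s o N 0)
    tris = trans (Box.box-filter P q s N w
        (λ y c h → cong (_∧ not (inHole (tri y c))) (trans (inside-P y c) (cong₂ _xor_ (cong (_∧ ((c + 1ℤ) ≤ℤ (+ s))) (rowParity-miss N y h)) (run-NW-miss y c _ 0ℤ N h))))
        (λ i c a h → cong (_∧ not (inHole (tri (+ i) c))) (trans (inside-row i c a) (interval-left h (+≤+ (ℕ.m≤m+n s (w i))))))
        (λ i c a h → cong (_∧ not (inHole (tri (+ i) c))) (trans (inside-row i c a) (interval-right h (+≤+ (ℕ.m≤m+n s (w i))))))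
        (λ N>0 → subst (_∈ map proj₁ (vertices P)) (trans (cong proj₁ corner) (ends N>0)) (∈-map⁺ proj₁ (vertex (zigzag N) sides refl)))
        (subst (_∈ map proj₂ (vertices P)) (cong proj₂ corner) (∈-map⁺ proj₂ (vertex (zigzag N) sides refl)))
        (endX N (+ s) + + 2 * + (e ℕ.+ o))
        (subst (_∈ map proj₁ (vertices P)) (cong proj₁ south-east) (∈-map⁺ proj₁ (vertex (zigzag N ++ (E , e ℕ.+ o) ∷ []) _ (sym (++-assoc (zigzag N) _ _)))))
        (∈-map⁺ proj₂ (vertex [] (zigzag N ++ sides) refl))
        (λ i c a h → cong (_∧ not (inHole (tri (+ i) c))) (trans (inside-row i c a) (interval-right
          (≤-trans (subst (_≤ endX N (+ s) + + 2 * + (e ℕ.+ o)) (right-end i a) (x-i≤x _ i)) h) (+≤+ (ℕ.m≤m+n s (w i)))))))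
      (cong (rowsOf s 0) (trans (tab-cong N row-marks) (sym (above-tab B s o N 0))))
      where
      +≤+ : ∀ {m n} → m ℕ.≤ n → + m ≤ + n
      +≤+ = _≤_.+≤+
      x-i≤x : ∀ x i → x - + i ≤ x
      x-i≤x x i = subst (x - + i ≤_) (+-identityʳ x) (+-monoʳ-≤ x (neg-mono-≤ (_≤_.+≤+ z≤n)))
      row-marks : ∀ i → i ℕ.< N → applyUpTo (λ j → not (q (tri (+ i) (+ (s ℕ.+ j))))) (w i) ≡ maskRow B s (w i) i
      row-marks i a = tab-cong (w i) (λ j b → trans
        (cong (λ u → not (u ∧ not (inHole (tri (+ i) (+ (s ℕ.+ j))))))
          (trans (inside-row i (+ (s ℕ.+ j)) a) (interval-inside (+≤+ (ℕ.m≤m+n s j)) (_<_.+<+ (ℕ.+-monoʳ-< s b)))))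
        (trans (not-involutive (inHole (tri (+ i) (+ (s ℕ.+ j))))) (trans (southHoles-mask 0 0ℤ t i (s ℕ.+ j) refl) (cong (mask B i) (ℕ.+-comm s j)))))

    trap : Trapezoid N (baseRow B N 0 0 o)
    trap = trapezoid B N 0 0 o z≤n (subst (λ n → Short n B) (sym (ℕ.+-identityʳ N)) (short-weaken B short (short-south 0 t)))

    rows-trap : ∀ n → n ≡ N → maskRowsAbove B s o N 0 ≡ rowsAbove trap
    rows-trap zero    refl = sym (rowsAbove-apex _ (apex o))
    rows-trap (suc n) refl = sym (above-masks B s N 0 0 o z≤n _ (side (s≤s z≤n)))

    count-south : tilingsCount (length (filterᵇ q (boxTris P))) (filterᵇ q (boxTris P)) ≡ T N (southBits t)
    count-south = begin
      tilingsCount (length (filterᵇ q (boxTris P))) (filterᵇ q (boxTris P))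
        ≡⟨ cong (λ l → tilingsCount (length l) l) (trans tris (cong (rowsOf s 0) (rows-trap N refl))) ⟩
      tilingsCount (length (rowsOf s 0 (rowsAbove trap))) (rowsOf s 0 (rowsAbove trap))
        ≡⟨ count-trapezoid s trap facing ⟩
      T N (baseRow B N 0 0 o)
        ≡⟨ cong (T N) (trans (baseRow-0 B N o) (trans (cong (applyUpTo (baseMask B 0)) base) (south-bits 0 t))) ⟩
      T N (southBits t) ∎

  ≤-dbl : ∀ n → n ℕ.≤ dbl n
  ≤-dbl zero    = z≤n
  ≤-dbl (suc n) = s≤s (ℕ.m≤n⇒m≤1+n (≤-dbl n))

  Q-trapezoid : ∀ t → Q t ≡ T (dbl (Esum t)) (southBits t)
  Q-trapezoid t = subst
    (λ N → M (region (poly (0ℤ , + N) (zigzag N ++ (E , e ℕ.+ o) ∷ (NW , N) ∷ (W , o) ∷ [])) (southHoles 0ℤ t)) ≡ T (dbl e) (southBits t))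
    (dbl≡2* e)
    (South.count-south t 0 (dbl e) (λ _ → endX-even e 0ℤ) (λ _ → refl)
      (λ _ → cong (λ b → offset (not b) 0) (sym (ev-dbl e))) (λ _ → sym (ev-dbl e)) (≤-dbl e) (baseLength-even e o))
    where
    e o : ℕ
    e = Esum t
    o = Osum t

  K-trapezoid : ∀ t → K t ≡ T (dbl (Esum t) ∸ 1) (southBits t)
  K-trapezoid t = subst
    (λ N → M (region (poly (1ℤ , + N) (zigzag N ++ (E , e ℕ.+ o) ∷ (NW , N) ∷ (W , o) ∷ [])) (southHoles 0ℤ t)) ≡ T (dbl e ∸ 1) (southBits t))
    (cong (_∸ 1) (dbl≡2* e))
    (South.count-south t 1 (dbl e ∸ 1) (ends e) (height e) (side e) (facing e) (short e) (base e refl))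
    where
    e o : ℕ
    e = Esum t
    o = Osum t
    ends : ∀ e → 0 ℕ.< dbl e ∸ 1 → endX (dbl e ∸ 1) 1ℤ ≡ 0ℤ
    ends (suc k) _ = endX-odd k 1ℤ
    height : ∀ e → 0 ℕ.< dbl e ∸ 1 → suc (dbl e ∸ 1) ≡ dbl e
    height (suc k) _ = refl
    side : ∀ e → 0 ℕ.< dbl e ∸ 1 → 1 ≡ offset (not (ev (dbl e ∸ 1))) 0
    side (suc k) _ rewrite ev-dbl k = refl
    facing : ∀ e → 0 ℕ.< dbl e ∸ 1 → down 0 1 ≡ ev (dbl e ∸ 1)
    facing (suc k) _ rewrite ev-dbl k = refl
    short : ∀ e → e ℕ.≤ dbl e ∸ 1
    short zero    = z≤n
    short (suc k) = s≤s (≤-dbl k)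
    base : ∀ e′ → e ≡ e′ → baseLength (dbl e′ ∸ 1) o ≡ e ℕ.+ o
    base zero    eq = cong (ℕ._+ o) (sym eq)
    base (suc k) eq = trans (baseLength-odd k o) (cong (ℕ._+ o) (sym eq))

  below-tab : ∀ B δ x n i acc → maskRowsBelow B δ x n i acc ≡ applyUpTo (λ r → maskRow B δ (dbl x ℕ.+ suc r) (i ℕ.+ (n ∸ suc r))) n ++ acc
  below-tab B δ x zero    i acc = refl
  below-tab B δ x (suc n) i acc = begin
    maskRowsBelow B δ x n (suc i) (maskRow B δ (dbl x ℕ.+ suc n) i ∷ acc)
      ≡⟨ below-tab B δ x n (suc i) _ ⟩
    applyUpTo (λ r → maskRow B δ (dbl x ℕ.+ suc r) (suc i ℕ.+ (n ∸ suc r))) n ++ maskRow B δ (dbl x ℕ.+ suc n) i ∷ acc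
      ≡⟨ cong₂ (λ l j → l ++ maskRow B δ (dbl x ℕ.+ suc n) j ∷ acc)
           (tab-cong n (λ r a → cong (maskRow B δ (dbl x ℕ.+ suc r)) (trans (sym (ℕ.+-suc i _)) (cong (i ℕ.+_) (sym (ℕ.+-∸-assoc 1 a))))))
           (sym (trans (cong (i ℕ.+_) (ℕ.n∸n≡0 n)) (ℕ.+-identityʳ i))) ⟩
    applyUpTo f n ++ f n ∷ acc
      ≡⟨ sym (trans (cong (_++ acc) (sym (applyUpTo-∷ʳ f n))) (++-assoc (applyUpTo f n) _ acc)) ⟩
    applyUpTo f (suc n) ++ acc ∎
    where
    f : ℕ → List Bool
    f r = maskRow B δ (dbl x ℕ.+ suc r) (i ℕ.+ (suc n ∸ suc r))

  -- `se` and `ne` are the two eastern sides, `N₁` and `N₂` the numbers of rows above and below `ℓ`,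
  -- and `l` counts the places of `ℓ` open to vertical lozenges. `position` and `balance` compare
  -- abscissas on the eastern boundary; they stay abstract so that both parities of `y` are covered.
  module Glued (a : List ℕ) (x z se ne H half N₁ N₂ l δ : ℕ)
    (height   : H ≡ dbl half)
    (total    : se ℕ.+ ne ≡ H)
    (upper    : N₁ ℕ.+ z ≡ ne)
    (lower    : se ℕ.+ z ≡ N₂)
    (balance  : se ℕ.+ dbl (Osum a) ≡ ne ℕ.+ dbl (Esum a))
    (position : dbl (x ℕ.+ Osum a) ℕ.+ se ℕ.+ δ ≡ dbl (l ℕ.+ sum a) ℕ.+ z)
    (parity   : ev N₂ ≡ ev N₁)
    (side     : δ ≡ offset (not (ev N₁)) 0)
    (shortᵘ   : Osum a ℕ.≤ N₁) (shortˡ : Esum a ℕ.≤ N₂)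
    (baseᵘ    : baseLength N₁ (x ℕ.+ Esum a) ≡ l ℕ.+ sum a)
    (baseˡ    : baseLength N₂ (x ℕ.+ Osum a) ≡ l ℕ.+ sum a ℕ.+ z) where

    xᵘ xˡ s : ℕ
    xᵘ = x ℕ.+ Esum a
    xˡ = x ℕ.+ Osum a
    s = sum a

    Bᵘ Bˡ : List Block
    Bᵘ = lineBlocks l true a
    Bˡ = (l ℕ.+ s , z) ∷ lineBlocks l false a

    sides : Word
    sides = (E , xˡ) ∷ (NE , se) ∷ (NW , ne) ∷ (W , xᵘ) ∷ []

    P : Polygon
    P = poly (0ℤ , + H) (zigzag H ++ sides)

    apexPoint : Point
    apexPoint = steps NW z (steps NE se (+ (2 ℕ.* xˡ) , 0ℤ))

    inHole q : Tri → Bool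
    inHole u = any (λ h → insideP h u) (lineHoles apexPoint true a)
    q u = insideP P u ∧ not (inHole u)

    east-corner : steps NE se (steps E xˡ (0ℤ , 0ℤ)) ≡ (+ (dbl xˡ ℕ.+ se) , + se)
    east-corner = trans (cong (steps NE se) (steps-E xˡ 0ℤ 0ℤ)) (trans (steps-NE se _ 0ℤ)
      (cong (λ u → (u + + se , + se)) (trans (+-identityˡ _) (sym (pos-dbl xˡ)))))

    apexPoint≡ : apexPoint ≡ (+ (dbl xˡ ℕ.+ se) - + z , + N₂)
    apexPoint≡ = trans (cong (steps NW z) (trans (steps-NE se _ 0ℤ) (cong (λ u → (+ (u ℕ.+ se) , + se)) (sym (dbl≡2* xˡ)))))
      (trans (steps-NW z _ _) (cong (λ u → (+ (dbl xˡ ℕ.+ se) - + z , + u)) lower))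

    apex-abscissa : + (dbl xˡ ℕ.+ se) - + z + + δ ≡ + dbl (l ℕ.+ s)
    apex-abscissa = trans (lem₁ (+ (dbl xˡ ℕ.+ se)) (+ z) (+ δ)) (trans (cong (λ n → + n - + z) position) (lem₂ (+ dbl (l ℕ.+ s)) (+ z)))
      where
      lem₁ : ∀ v z d → v - z + d ≡ v + d - z
      lem₁ = solve-∀
      lem₂ : ∀ v z → v + z - z ≡ v
      lem₂ = solve-∀

    inHole≡ : ∀ u → inHole u ≡ any (λ h → insideP h u) (lineHoles (+ (dbl xˡ ℕ.+ se) - + z , + N₂) true a)
    inHole≡ u = cong (λ p → any (λ h → insideP h u) (lineHoles p true a)) apexPoint≡

    ends : endX H 0ℤ ≡ 0ℤ
    ends = trans (cong (λ n → endX n 0ℤ) height) (endX-even half 0ℤ)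

    corner : endpoint (0ℤ , + H) (zigzag H) ≡ (0ℤ , 0ℤ)
    corner = trans (endpoint-zigzag H 0ℤ) (cong (_, 0ℤ) ends)

    inside-P : ∀ y c → insideP P (tri y c) ≡ (rowParity H y ∧ ((c + 1ℤ) ≤ℤ 0ℤ))
      xor (run (tri y c) NE se (+ dbl xˡ , 0ℤ) xor run (tri y c) NW ne (+ (dbl xˡ ℕ.+ se) , + se))
    inside-P y c = trans (inside-parity (0ℤ , + H) (zigzag H ++ sides) t) (trans (zigzag-parity H 0ℤ y c sides)
      (cong ((rowParity H y ∧ ((c + 1ℤ) ≤ℤ 0ℤ)) xor_) (trans (cong (λ v → wordParity t (v , 0ℤ) sides) ends)
        (trans (cong (_xor wordParity t p₁ ((NE , se) ∷ (NW , ne) ∷ (W , xᵘ) ∷ [])) (run-E t xˡ (0ℤ , 0ℤ)))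
          (cong₂ _xor_ (cong (run t NE se) (trans (steps-E xˡ 0ℤ 0ℤ) (cong (_, 0ℤ) (trans (+-identityˡ _) (sym (pos-dbl xˡ))))))
            (trans (cong (run t NW ne p₂ xor_) (trans (xor-falseʳ _) (run-W t xᵘ (steps NW ne p₂))))
              (trans (xor-falseʳ _) (cong (run t NW ne) east-corner))))))))
      where
      t : Tri
      t = tri y c
      p₁ p₂ : Point
      p₁ = steps E xˡ (0ℤ , 0ℤ)
      p₂ = steps NE se p₁

    inside-low : ∀ r c → r ℕ.< se → insideP P (tri (+ r) c) ≡ interval 0ℤ (+ suc (dbl xˡ ℕ.+ r)) c
    inside-low r c h = trans (inside-P (+ r) c) (cong₂ _xor_
      (cong (_∧ ((c + 1ℤ) ≤ℤ 0ℤ)) (rowParity-hit H r (subst (r ℕ.<_) total (ℕ.≤-trans h (ℕ.m≤m+n se ne)))))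
      (trans (cong₂ _xor_ (run-NE c (+ dbl xˡ) 0ℤ se r h)
          (run-NW-miss (+ r) c (+ (dbl xˡ ℕ.+ se)) (+ se) ne (λ j _ e → ℕ.>⇒≢ (ℕ.≤-trans h (ℕ.m≤m+n se j)) (+-injective e))))
        (trans (xor-falseʳ _) (trans (≤ℤ-suc c (+ (dbl xˡ ℕ.+ r))) (cong ((c + 1ℤ) ≤ℤ_) (+-comm (+ (dbl xˡ ℕ.+ r)) 1ℤ))))))

    edge : ∀ {k} → k ℕ.< ne → dbl xᵘ ℕ.+ (ne ∸ k) ℕ.+ k ≡ dbl xˡ ℕ.+ se
    edge {k} h = trans (ℕ.+-assoc (dbl xᵘ) (ne ∸ k) k) (trans (cong (dbl xᵘ ℕ.+_) (ℕ.m∸n+n≡m (ℕ.<⇒≤ h))) (sym corners))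
      where
      regroup : ∀ a b c d → a ℕ.+ b ℕ.+ (c ℕ.+ d) ≡ a ℕ.+ (b ℕ.+ d) ℕ.+ c
      regroup a b c d = trans (ℕ.+-assoc a b _) (trans (cong (a ℕ.+_) (trans (cong (b ℕ.+_) (ℕ.+-comm c d)) (sym (ℕ.+-assoc b d c)))) (sym (ℕ.+-assoc a _ c)))
      corners : dbl xˡ ℕ.+ se ≡ dbl xᵘ ℕ.+ ne
      corners = begin
        dbl (x ℕ.+ Osum a) ℕ.+ se              ≡⟨ cong (ℕ._+ se) (dbl-+ x (Osum a)) ⟩
        dbl x ℕ.+ dbl (Osum a) ℕ.+ se          ≡⟨ trans (ℕ.+-assoc (dbl x) _ se) (cong (dbl x ℕ.+_) (trans (ℕ.+-comm (dbl (Osum a)) se) balance)) ⟩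
        dbl x ℕ.+ (ne ℕ.+ dbl (Esum a))        ≡⟨ trans (cong (dbl x ℕ.+_) (ℕ.+-comm ne _)) (sym (ℕ.+-assoc (dbl x) _ ne)) ⟩
        dbl x ℕ.+ dbl (Esum a) ℕ.+ ne          ≡⟨ cong (ℕ._+ ne) (sym (dbl-+ x (Esum a))) ⟩
        dbl xᵘ ℕ.+ ne ∎

    inside-high : ∀ k c → k ℕ.< ne → insideP P (tri (+ (se ℕ.+ k)) c) ≡ interval 0ℤ (+ (dbl xᵘ ℕ.+ (ne ∸ k))) c
    inside-high k c h = trans (inside-P (+ (se ℕ.+ k)) c) (cong₂ _xor_
      (cong (_∧ ((c + 1ℤ) ≤ℤ 0ℤ)) (rowParity-hit H (se ℕ.+ k) (subst (se ℕ.+ k ℕ.<_) total (ℕ.+-monoʳ-< se h))))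
      (cong₂ _xor_ (run-NE-miss (+ (se ℕ.+ k)) c (+ dbl xˡ) 0ℤ se (λ j b e → ℕ.<⇒≢ (ℕ.≤-trans b (ℕ.m≤m+n se k)) (+-injective e)))
        (trans (run-NW c (+ (dbl xˡ ℕ.+ se)) (+ se) ne k h)
          (cong ((c + 1ℤ) ≤ℤ_) (trans (cong (λ n → + n - + k) (sym (edge h))) (lem (+ (dbl xᵘ ℕ.+ (ne ∸ k))) (+ k)))))))
      where
      lem : ∀ v k → v + k - k ≡ v
      lem = solve-∀

    outside-P : ∀ y c → (∀ i → i ℕ.< H → + i ≢ y) → insideP P (tri y c) ≡ false
    outside-P y c h = trans (inside-P y c) (cong₂ _xor_ (cong (_∧ ((c + 1ℤ) ≤ℤ 0ℤ)) (rowParity-miss H y h))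
      (cong₂ _xor_ (run-NE-miss y c _ 0ℤ se (λ j b → h j (subst (j ℕ.<_) total (ℕ.≤-trans b (ℕ.m≤m+n se ne)))))
        (run-NW-miss y c _ (+ se) ne (λ j b → h (se ℕ.+ j) (subst (se ℕ.+ j ℕ.<_) total (ℕ.+-monoʳ-< se b))))))

    wᵇ : Bool → ℕ → ℕ
    wᵇ true  r = dbl xˡ ℕ.+ suc r
    wᵇ false r = dbl xᵘ ℕ.+ (N₁ ∸ (r ∸ N₂))

    w : ℕ → ℕ
    w r = wᵇ (r <ᵇ N₂) r

    w-low : ∀ {r} → r ℕ.< N₂ → w r ≡ dbl xˡ ℕ.+ suc r
    w-low {r} h = cong (λ b → wᵇ b r) (<ᵇ-true h)

    w-high : ∀ i → w (N₂ ℕ.+ i) ≡ dbl xᵘ ℕ.+ (N₁ ∸ i)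
    w-high i = trans (cong (λ b → wᵇ b (N₂ ℕ.+ i)) (<ᵇ-false (ℕ.m≤m+n N₂ i))) (cong (λ j → dbl xᵘ ℕ.+ (N₁ ∸ j)) (ℕ.m+n∸m≡n N₂ i))

    -- In the rows of `mid`, between the eastern vertex and `ℓ`, the region already narrows while
    -- the completed lower trapezoid keeps widening.
    data RowCase : ℕ → Set where
      low  : ∀ {r} → r ℕ.< se → RowCase r
      mid  : ∀ {k} → k ℕ.< z → RowCase (se ℕ.+ k)
      high : ∀ {i} → i ℕ.< N₁ → RowCase (N₂ ℕ.+ i)

    rowCase : ∀ r → r ℕ.< H → RowCase r
    rowCase r h with r ℕ.<? se
    ... | yes p = low p
    ... | no p with r ℕ.<? N₂
    ...   | yes p′ = subst RowCase (ℕ.m+[n∸m]≡n (ℕ.≮⇒≥ p))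
              (mid (ℕ.+-cancelˡ-< se _ _ (subst₂ ℕ._<_ (sym (ℕ.m+[n∸m]≡n (ℕ.≮⇒≥ p))) (sym lower) p′)))
    ...   | no p′  = subst RowCase (ℕ.m+[n∸m]≡n (ℕ.≮⇒≥ p′))
              (high (ℕ.+-cancelˡ-< N₂ _ _ (subst₂ ℕ._<_ (sym (ℕ.m+[n∸m]≡n (ℕ.≮⇒≥ p′))) (sym H≡) h)))
      where
      H≡ : N₂ ℕ.+ N₁ ≡ H
      H≡ = trans (cong (ℕ._+ N₁) (sym lower)) (trans (ℕ.+-assoc se z N₁) (trans (cong (se ℕ.+_) (trans (ℕ.+-comm z N₁) upper)) total))

    high-row : ∀ i → N₂ ℕ.+ i ≡ se ℕ.+ (z ℕ.+ i)
    high-row i = trans (cong (ℕ._+ i) (sym lower)) (ℕ.+-assoc se z i)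

    high-width : ∀ i → ne ∸ (z ℕ.+ i) ≡ N₁ ∸ i
    high-width i = trans (sym (ℕ.∸-+-assoc ne z i)) (cong (_∸ i) (trans (cong (_∸ z) (sym upper)) (ℕ.m+n∸n≡m N₁ z)))

    z+i<ne : ∀ {i} → i ℕ.< N₁ → z ℕ.+ i ℕ.< ne
    z+i<ne {i} h = subst (z ℕ.+ i ℕ.<_) (trans (ℕ.+-comm z N₁) upper) (ℕ.+-monoʳ-< z h)

    k<ne : ∀ {k} → k ℕ.< z → k ℕ.< ne
    k<ne h = ℕ.≤-trans h (subst (z ℕ.≤_) upper (ℕ.m≤n+m z N₁))

    record Extent (r : ℕ) : Set where
      field
        extent : ℕ
        inside : ∀ c → insideP P (tri (+ r) c) ≡ interval 0ℤ (+ extent) c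
        ≤width : extent ℕ.≤ w r
        ≤east  : extent ℕ.≤ dbl xˡ ℕ.+ se

    rowOf : ∀ {r} → RowCase r → Extent r
    rowOf (low {r} h) = record
      { extent = suc (dbl xˡ ℕ.+ r)
      ; inside = λ c → inside-low r c h
      ; ≤width = ℕ.≤-reflexive (sym (trans (w-low (subst (r ℕ.<_) lower (ℕ.≤-trans h (ℕ.m≤m+n se z)))) (ℕ.+-suc (dbl xˡ) r)))
      ; ≤east  = ℕ.+-monoʳ-< (dbl xˡ) h }
    rowOf (mid {k} h) = record
      { extent = dbl xᵘ ℕ.+ (ne ∸ k)
      ; inside = λ c → inside-high k c (k<ne h)
      ; ≤width = ℕ.≤-trans (ℕ.m≤m+n _ k) (ℕ.≤-trans (ℕ.≤-reflexive (edge (k<ne h))) (ℕ.≤-trans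
          (ℕ.+-monoʳ-≤ (dbl xˡ) (ℕ.≤-trans (ℕ.m≤m+n se k) (ℕ.n≤1+n _)))
          (ℕ.≤-reflexive (sym (w-low (subst (se ℕ.+ k ℕ.<_) lower (ℕ.+-monoʳ-< se h)))))))
      ; ≤east  = ℕ.≤-trans (ℕ.m≤m+n _ k) (ℕ.≤-reflexive (edge (k<ne h))) }
    rowOf (high {i} h) = record
      { extent = dbl xᵘ ℕ.+ (N₁ ∸ i)
      ; inside = λ c → trans (cong (λ r → insideP P (tri (+ r) c)) (high-row i))
          (trans (inside-high (z ℕ.+ i) c (z+i<ne h)) (cong (λ n → interval 0ℤ (+ (dbl xᵘ ℕ.+ n)) c) (high-width i)))
      ; ≤width = ℕ.≤-reflexive (sym (w-high i))
      ; ≤east  = ℕ.≤-trans (ℕ.≤-reflexive (cong (dbl xᵘ ℕ.+_) (sym (high-width i))))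
          (ℕ.≤-trans (ℕ.m≤m+n _ (z ℕ.+ i)) (ℕ.≤-reflexive (edge (z+i<ne h)))) }

    below-line : ∀ {r} → r ℕ.< N₂ → r ℕ.+ suc (N₂ ∸ suc r) ≡ N₂
    below-line {r} h = trans (ℕ.+-suc r _) (ℕ.m+[n∸m]≡n h)

    inHole-low : ∀ r c → r ℕ.< N₂ → inHole (tri (+ r) (+ c)) ≡ mask (lineBlocks l false a) (N₂ ∸ suc r) (c ℕ.+ δ)
    inHole-low r c h = trans (inHole≡ (tri (+ r) (+ c))) (lineHoles-below _ N₂ l δ true a (N₂ ∸ suc r) r c (below-line h) apex-abscissa)

    inHole-high : ∀ i c → inHole (tri (+ (N₂ ℕ.+ i)) (+ c)) ≡ mask Bᵘ i (c ℕ.+ δ)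
    inHole-high i c = trans (inHole≡ (tri (+ (N₂ ℕ.+ i)) (+ c))) (lineHoles-above _ N₂ l δ true a i c apex-abscissa)

    cap-edge : ∀ {i k} → suc i ℕ.+ k ≡ z → ∀ R → R ℕ.+ k ≡ dbl xˡ ℕ.+ se → suc (dbl (l ℕ.+ s) ℕ.+ i) ≡ R ℕ.+ δ
    cap-edge {i} {k} ez R eR = ℕ.+-cancelʳ-≡ k _ _ (begin
      suc (dbl (l ℕ.+ s) ℕ.+ i) ℕ.+ k     ≡⟨ cong (ℕ._+ k) (sym (ℕ.+-suc (dbl (l ℕ.+ s)) i)) ⟩
      dbl (l ℕ.+ s) ℕ.+ suc i ℕ.+ k       ≡⟨ trans (ℕ.+-assoc (dbl (l ℕ.+ s)) (suc i) k) (cong (dbl (l ℕ.+ s) ℕ.+_) ez) ⟩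
      dbl (l ℕ.+ s) ℕ.+ z                 ≡⟨ sym position ⟩
      dbl xˡ ℕ.+ se ℕ.+ δ                 ≡⟨ cong (ℕ._+ δ) (sym eR) ⟩
      R ℕ.+ k ℕ.+ δ                       ≡⟨ trans (ℕ.+-assoc R k δ) (trans (cong (R ℕ.+_) (ℕ.+-comm k δ)) (sym (ℕ.+-assoc R δ k))) ⟩
      R ℕ.+ δ ℕ.+ k ∎)

    cap-right : ∀ {r} → r ℕ.< N₂ → ∀ j → j ℕ.< dbl xˡ ℕ.+ suc r → j ℕ.+ δ ℕ.+ (N₂ ∸ suc r) ℕ.< dbl (l ℕ.+ s ℕ.+ z)
    cap-right {r} h j b = subst₂ ℕ._<_ (sym (ℕ.+-assoc j δ _)) total-right (ℕ.+-monoˡ-< (δ ℕ.+ (N₂ ∸ suc r)) b)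
      where
      total-right : dbl xˡ ℕ.+ suc r ℕ.+ (δ ℕ.+ (N₂ ∸ suc r)) ≡ dbl (l ℕ.+ s ℕ.+ z)
      total-right = begin
        dbl xˡ ℕ.+ suc r ℕ.+ (δ ℕ.+ (N₂ ∸ suc r))      ≡⟨ regroup (dbl xˡ) (suc r) δ (N₂ ∸ suc r) ⟩
        dbl xˡ ℕ.+ (suc r ℕ.+ (N₂ ∸ suc r)) ℕ.+ δ      ≡⟨ cong (λ n → dbl xˡ ℕ.+ n ℕ.+ δ) (trans (ℕ.m+[n∸m]≡n h) (sym lower)) ⟩
        dbl xˡ ℕ.+ (se ℕ.+ z) ℕ.+ δ                    ≡⟨ regroup′ (dbl xˡ) se z δ ⟩
        dbl xˡ ℕ.+ se ℕ.+ δ ℕ.+ z                      ≡⟨ cong (ℕ._+ z) position ⟩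
        dbl (l ℕ.+ s) ℕ.+ z ℕ.+ z                      ≡⟨ trans (ℕ.+-assoc (dbl (l ℕ.+ s)) z z) (trans (cong (dbl (l ℕ.+ s) ℕ.+_) (sym (dbl≡+ z))) (sym (dbl-+ (l ℕ.+ s) z))) ⟩
        dbl (l ℕ.+ s ℕ.+ z) ∎
        where
        regroup : ∀ a b c d → a ℕ.+ b ℕ.+ (c ℕ.+ d) ≡ a ℕ.+ (b ℕ.+ d) ℕ.+ c
        regroup a b c d = trans (ℕ.+-assoc a b _) (trans (cong (a ℕ.+_) (trans (cong (b ℕ.+_) (ℕ.+-comm c d)) (sym (ℕ.+-assoc b d c)))) (sym (ℕ.+-assoc a _ c)))
        regroup′ : ∀ a b c d → a ℕ.+ (b ℕ.+ c) ℕ.+ d ≡ a ℕ.+ b ℕ.+ d ℕ.+ c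
        regroup′ a b c d = trans (cong (ℕ._+ d) (sym (ℕ.+-assoc a b c))) (trans (ℕ.+-assoc (a ℕ.+ b) c d) (trans (cong (a ℕ.+ b ℕ.+_) (ℕ.+-comm c d)) (sym (ℕ.+-assoc (a ℕ.+ b) d c))))

    -- The cells that completion adds to a row are exactly those past the left side of the cap
    -- `(l + s , z)`; by `cap-right` the row ends before the right side of the cap.
    cap-left : ∀ {r} → RowCase r → r ℕ.< N₂ → ∀ j → j ℕ.< dbl xˡ ℕ.+ suc r →
      not (insideP P (tri (+ r) (+ j))) ≡ (dbl (l ℕ.+ s) ℕ.+ (N₂ ∸ suc r) <ᵇ j ℕ.+ δ)
    cap-left (low {r} h) h′ j b = trans
      (cong not (trans (inside-low r (+ j) h) (interval-inside (_≤_.+≤+ z≤n) (_<_.+<+ (subst (j ℕ.<_) (ℕ.+-suc (dbl xˡ) r) b)))))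
      (sym (<ᵇ-false (ℕ.≤-trans
        (ℕ.+-monoˡ-≤ δ (ℕ.≤-trans (ℕ.<⇒≤ b) (ℕ.+-monoʳ-≤ (dbl xˡ) h)))
        (ℕ.≤-trans (ℕ.≤-reflexive position) (ℕ.+-monoʳ-≤ (dbl (l ℕ.+ s))
          (ℕ.≤-trans (ℕ.≤-reflexive (sym (ℕ.m+n∸m≡n se z))) (ℕ.≤-trans (ℕ.≤-reflexive (cong (_∸ se) lower)) (ℕ.∸-monoʳ-≤ N₂ h))))))))
    cap-left (mid {k} h) h′ j b = trans (cong not (inside-high k (+ j) (k<ne h))) (split (j ℕ.<? R))
      where
      R : ℕ
      R = dbl xᵘ ℕ.+ (ne ∸ k)
      suc-left : suc (dbl (l ℕ.+ s) ℕ.+ (N₂ ∸ suc (se ℕ.+ k))) ≡ R ℕ.+ δ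
      suc-left = cap-edge {k = k} (trans (cong (λ n → suc (n ∸ suc (se ℕ.+ k)) ℕ.+ k) (sym lower))
        (trans (sym (ℕ.+-suc _ k)) (trans (cong (λ n → se ℕ.+ z ∸ n ℕ.+ suc k) (sym (ℕ.+-suc se k)))
          (trans (cong (ℕ._+ suc k) (ℕ.[m+n]∸[m+o]≡n∸o se z (suc k))) (ℕ.m∸n+n≡m h))))) R (edge (k<ne h))
      split : Dec (j ℕ.< R) → not (interval 0ℤ (+ R) (+ j)) ≡ (dbl (l ℕ.+ s) ℕ.+ (N₂ ∸ suc (se ℕ.+ k)) <ᵇ j ℕ.+ δ)
      split (yes p) = trans (cong not (interval-inside (_≤_.+≤+ z≤n) (_<_.+<+ p)))
        (sym (<ᵇ-false (s≤s⁻¹ (ℕ.≤-trans (ℕ.+-monoˡ-< δ p) (ℕ.≤-reflexive (sym suc-left))))))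
      split (no p)  = trans (cong not (interval-right (_≤_.+≤+ (ℕ.≮⇒≥ p)) (_≤_.+≤+ z≤n)))
        (sym (<ᵇ-true (ℕ.≤-trans (ℕ.≤-reflexive suc-left) (ℕ.+-monoˡ-≤ δ (ℕ.≮⇒≥ p)))))
    cap-left (high {i} h) h′ j b = ⊥-elim (ℕ.<⇒≱ h′ (ℕ.m≤m+n N₂ i))

    markRow : ℕ → List Bool
    markRow r = applyUpTo (λ j → not (q (tri (+ r) (+ j)))) (w r)

    low-marks : ∀ r → r ℕ.< N₂ → markRow r ≡ maskRow Bˡ δ (dbl xˡ ℕ.+ suc r) (N₂ ∸ suc r)
    low-marks r h = trans (cong (applyUpTo _) (w-low h)) (tab-cong (dbl xˡ ℕ.+ suc r) (λ j b → trans
      (de-morgan (insideP P (tri (+ r) (+ j))) (inHole (tri (+ r) (+ j))))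
      (cong₂ _∨_ (trans (cap-left (rowCase r (ℕ.≤-trans h N₂≤H)) h j b)
          (sym (trans (cong ((dbl (l ℕ.+ s) ℕ.+ (N₂ ∸ suc r) <ᵇ j ℕ.+ δ) ∧_) (<ᵇ-true (cap-right h j b))) (∧-identityʳ _))))
        (inHole-low r j h))))
      where
      de-morgan : ∀ a b → not (a ∧ not b) ≡ not a ∨ b
      de-morgan true  b = not-involutive b
      de-morgan false b = refl
      N₂≤H : N₂ ℕ.≤ H
      N₂≤H = subst₂ ℕ._≤_ lower total (ℕ.+-monoʳ-≤ se (subst (z ℕ.≤_) upper (ℕ.m≤n+m z N₁)))

    high-marks : ∀ i → i ℕ.< N₁ → markRow (N₂ ℕ.+ i) ≡ maskRow Bᵘ δ (dbl xᵘ ℕ.+ (N₁ ∸ i)) i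
    high-marks i h = trans (cong (applyUpTo _) (w-high i)) (tab-cong (dbl xᵘ ℕ.+ (N₁ ∸ i)) (λ j b → trans
      (cong (λ u → not (u ∧ not (inHole (tri (+ (N₂ ℕ.+ i)) (+ j)))))
        (trans (Extent.inside (rowOf (high h)) (+ j)) (interval-inside (_≤_.+≤+ z≤n) (_<_.+<+ b))))
      (trans (not-involutive _) (inHole-high i j))))

    extent : ∀ r → r ℕ.< H → Extent r
    extent r h = rowOf (rowCase r h)

    outside-row : ∀ r c (h : r ℕ.< H) → + Extent.extent (extent r h) ≤ c → q (tri (+ r) c) ≡ false
    outside-row r c h b = cong (_∧ not (inHole (tri (+ r) c)))
      (trans (Extent.inside (extent r h) c) (interval-right b (_≤_.+≤+ z≤n)))

    vertex : ∀ w₁ w₂ → zigzag H ++ sides ≡ w₁ ++ w₂ → endpoint (0ℤ , + H) w₁ ∈ vertices P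
    vertex w₁ w₂ eq = subst (λ w → endpoint (0ℤ , + H) w₁ ∈ walk (0ℤ , + H) w) (sym eq) (endpoint-∈ w₁ w₂ (0ℤ , + H))

    east-vertex : endpoint (0ℤ , + H) (zigzag H ++ (E , xˡ) ∷ (NE , se) ∷ []) ≡ (+ (dbl xˡ ℕ.+ se) , + se)
    east-vertex = trans (endpoint-++ (zigzag H) _ _) (trans (cong (λ p → steps NE se (steps E xˡ p)) corner) east-corner)

    tris : filterᵇ q (boxTris P) ≡ rowsOf 0 0 (maskRowsBelow Bˡ δ xˡ N₂ 0 (maskRowsAbove Bᵘ δ xᵘ N₁ 0))
    tris = trans (Box.box-filter P q 0 H w
        (λ y c h → cong (_∧ not (inHole (tri y c))) (outside-P y c h))
        (λ r c h b → cong (_∧ not (inHole (tri (+ r) c))) (trans (Extent.inside (extent r h) c) (interval-left b (_≤_.+≤+ z≤n))))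
        (λ r c h b → outside-row r c h (≤-trans (_≤_.+≤+ (Extent.≤width (extent r h))) b))
        (λ _ → subst (_∈ map proj₁ (vertices P)) (cong proj₁ corner) (∈-map⁺ proj₁ (vertex (zigzag H) sides refl)))
        (subst (_∈ map proj₂ (vertices P)) (cong proj₂ corner) (∈-map⁺ proj₂ (vertex (zigzag H) sides refl)))
        (+ (dbl xˡ ℕ.+ se))
        (subst (_∈ map proj₁ (vertices P)) (cong proj₁ east-vertex) (∈-map⁺ proj₁ (vertex (zigzag H ++ (E , xˡ) ∷ (NE , se) ∷ []) _ (sym (++-assoc (zigzag H) _ _)))))
        (∈-map⁺ proj₂ (vertex [] (zigzag H ++ sides) refl))
        (λ r c h b → outside-row r c h (≤-trans (_≤_.+≤+ (Extent.≤east (extent r h))) b)))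
      (cong (rowsOf 0 0) rows)
      where
      rows : applyUpTo markRow H ≡ maskRowsBelow Bˡ δ xˡ N₂ 0 (maskRowsAbove Bᵘ δ xᵘ N₁ 0)
      rows = begin
        applyUpTo markRow H
          ≡⟨ cong (applyUpTo markRow) (sym (trans (cong (ℕ._+ N₁) (sym lower)) (trans (ℕ.+-assoc se z N₁) (trans (cong (se ℕ.+_) (trans (ℕ.+-comm z N₁) upper)) total)))) ⟩
        applyUpTo markRow (N₂ ℕ.+ N₁)
          ≡⟨ tab-++ markRow N₂ N₁ ⟩
        applyUpTo markRow N₂ ++ applyUpTo (λ i → markRow (N₂ ℕ.+ i)) N₁
          ≡⟨ cong₂ _++_ (tab-cong N₂ low-marks) (trans (tab-cong N₁ high-marks) (sym (above-tab Bᵘ δ xᵘ N₁ 0))) ⟩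
        applyUpTo (λ r → maskRow Bˡ δ (dbl xˡ ℕ.+ suc r) (N₂ ∸ suc r)) N₂ ++ maskRowsAbove Bᵘ δ xᵘ N₁ 0
          ≡⟨ sym (below-tab Bˡ δ xˡ N₂ 0 _) ⟩
        maskRowsBelow Bˡ δ xˡ N₂ 0 (maskRowsAbove Bᵘ δ xᵘ N₁ 0) ∎

    A : List Bool
    A = lineBits true a

    count-rows : ∀ rs → tilingsCount (length (rowsOf 0 0 rs)) (rowsOf 0 0 rs) ≡ processAll true rs
    count-rows []       = refl
    count-rows (r ∷ rs) = tilings-process 0 0 r rs _ ℕ.≤-refl

    -- The upper part is required to have a row, so that its trapezoid is a `layer` as in
    -- `process-glued`; the lower part may be empty.
    count-glued : ∀ n₁ → N₁ ≡ suc n₁ →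
      tilingsCount (length (filterᵇ q (boxTris P))) (filterᵇ q (boxTris P))
        ≡ sumB l (λ S → T N₂ (S ++ (map not A ++ trues z)) ℕ.* T N₁ (S ++ A))
    count-glued n₁ refl = begin
      tilingsCount (length (filterᵇ q (boxTris P))) (filterᵇ q (boxTris P))
        ≡⟨ cong (λ ts → tilingsCount (length ts) ts) tris ⟩
      tilingsCount (length (rowsOf 0 0 all)) (rowsOf 0 0 all)
        ≡⟨ count-rows all ⟩
      processAll true all
        ≡⟨ cong (processAll true) (trans (cong (maskRowsBelow Bˡ δ xˡ N₂ 0) (sym (above-masks Bᵘ δ N₁ 0 0 xᵘ z≤n sᵘ (trans (ℕ.+-identityʳ δ) side))))
             (sym (below-masks Bˡ δ N₂ 0 0 xˡ z≤n sˡ _ (trans (ℕ.+-identityʳ δ) (trans side (cong (λ b → offset (not b) 0) (sym parity))))))) ⟩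
      processAll true (rowsBelow (trapezoid Bˡ N₂ 0 0 xˡ z≤n sˡ) (rowsAbove (trapezoid Bᵘ N₁ 0 0 xᵘ z≤n sᵘ)))
        ≡⟨ glue (trapezoid Bᵘ N₁ 0 0 xᵘ z≤n sᵘ) baseRowᵘ ⟩
      sumB l (λ S → T N₂ (S ++ (map not A ++ trues z)) ℕ.* T N₁ (S ++ A)) ∎
      where
      all : List (List Bool)
      all = maskRowsBelow Bˡ δ xˡ N₂ 0 (maskRowsAbove Bᵘ δ xᵘ N₁ 0)
      sᵘ : Short (N₁ ℕ.+ 0) Bᵘ
      sᵘ = subst (λ n → Short n Bᵘ) (sym (ℕ.+-identityʳ N₁)) (short-weaken Bᵘ shortᵘ (proj₁ (short-line l a)))
      sˡ : Short (N₂ ℕ.+ 0) Bˡ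
      sˡ = subst (λ n → Short n Bˡ) (sym (ℕ.+-identityʳ N₂))
        (subst (z ℕ.≤_) lower (ℕ.m≤n+m z se) ∷ short-weaken _ shortˡ (proj₂ (short-line l a)))
      baseRowᵘ : baseRow Bᵘ N₁ 0 0 xᵘ ≡ falses l ++ A
      baseRowᵘ = trans (baseRow-0 Bᵘ N₁ xᵘ) (trans (cong (applyUpTo (baseMask Bᵘ 0)) baseᵘ) (line-bits l true a))
      baseRowˡ : baseRow Bˡ N₂ 0 0 xˡ ≡ falses l ++ (map not A ++ trues z)
      baseRowˡ = trans (baseRow-0 Bˡ N₂ xˡ) (trans (cong (applyUpTo (baseMask Bˡ 0)) baseˡ) (trans (line-bits-ended l a z)
        (cong (λ u → falses l ++ (u ++ trues z)) (lineBits-not true a))))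
      glue : ∀ {C} (u : Trapezoid (suc n₁) C) → C ≡ falses l ++ A →
        processAll true (rowsBelow (trapezoid Bˡ N₂ 0 0 xˡ z≤n sˡ) (rowsAbove u))
          ≡ sumB l (λ S → T N₂ (S ++ (map not A ++ trues z)) ℕ.* T (suc n₁) (S ++ A))
      glue (layer f u) refl = process-glued l A z (trapezoid Bˡ N₂ 0 0 xˡ z≤n sˡ) f u baseRowˡ parity

-- Quotients of natural numbers as rationals

module Fractions where

  open import Defs using (⟦_⟧; _//_)
  open import Data.Nat using (zero; suc; _+_; _*_; NonZero)
  open import Data.Nat.Properties
  open import Data.Nat.Tactic.RingSolver using (solve-∀)
  open import Data.Integer as ℤ using (+_)
  import Data.Integer.Properties as ℤ
  open import Data.Rational as ℚ using (ℚ) renaming (_*_ to _·_)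
  import Data.Rational.Properties as ℚ
  open import Data.Rational.Unnormalised as ℚᵘ using (mkℚᵘ; *≡*)
  import Data.Rational.Unnormalised.Properties as ℚᵘ
  open import Relation.Binary.PropositionalEquality
  open ≡-Reasoning

  -- Products are compared as unnormalised fractions, where equality is cross multiplication and no
  -- common divisors intervene.
  fromℚᵘ-* : ∀ p q → ℚ.fromℚᵘ p · ℚ.fromℚᵘ q ≡ ℚ.fromℚᵘ (p ℚᵘ.* q)
  fromℚᵘ-* p q = ℚ.toℚᵘ-injective (ℚᵘ.≃-trans (ℚ.toℚᵘ-homo-* (ℚ.fromℚᵘ p) (ℚ.fromℚᵘ q))
    (ℚᵘ.≃-trans (ℚᵘ.*-cong (ℚ.toℚᵘ-fromℚᵘ p) (ℚ.toℚᵘ-fromℚᵘ q)) (ℚᵘ.≃-sym (ℚ.toℚᵘ-fromℚᵘ (p ℚᵘ.* q)))))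

  //-cancel : ∀ m n d → .{{NonZero d}} → m * d ≡ n → ⟦ m ⟧ ≡ n // d
  //-cancel m n (suc d) e = ℚ.fromℚᵘ-cong {mkℚᵘ (+ m) 0} {mkℚᵘ (+ n) d}
    (*≡* (trans (sym (ℤ.pos-* m (suc d))) (trans (cong +_ e) (sym (ℤ.*-identityʳ (+ n))))))

  ⟦⟧-// : ∀ m n d → ⟦ m ⟧ · (n // d) ≡ (m * n) // d
  ⟦⟧-// m n zero    = ℚ.*-zeroʳ ⟦ m ⟧
  ⟦⟧-// m n (suc d) = trans (fromℚᵘ-* (mkℚᵘ (+ m) 0) (mkℚᵘ (+ n) d))
    (ℚ.fromℚᵘ-cong {mkℚᵘ (+ m) 0 ℚᵘ.* mkℚᵘ (+ n) d} {mkℚᵘ (+ (m * n)) d}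
      (*≡* (cong₂ ℤ._*_ (sym (ℤ.pos-* m n)) (cong (λ k → + suc k) (sym (+-identityʳ d))))))

  //-// : ∀ m n d k → .{{NonZero d}} → .{{NonZero k}} → (m // d) · (n // k) ≡ (m * n) // (d * k)
  //-// m n (suc d) (suc k) = trans (fromℚᵘ-* (mkℚᵘ (+ m) d) (mkℚᵘ (+ n) k))
    (ℚ.fromℚᵘ-cong {mkℚᵘ (+ m) d ℚᵘ.* mkℚᵘ (+ n) k} {mkℚᵘ (+ (m * n)) (k + d * suc k)} (*≡* (cong (ℤ._* + suc (k + d * suc k)) (sym (ℤ.pos-* m n)))))

  ratio : ∀ p n d a b c → .{{NonZero d}} → c * d ≡ p * n * a * b → ⟦ c ⟧ ≡ ⟦ p ⟧ · (n // d) · ⟦ a ⟧ · ⟦ b ⟧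
  ratio p n d a b c e = begin
    ⟦ c ⟧                                          ≡⟨ //-cancel c (p * n * a * b) d e ⟩
    (p * n * a * b) // d                           ≡⟨ cong (_// d) (lem p n a b) ⟩
    (b * (a * (p * n))) // d                       ≡⟨ sym (trans (cong (λ u → ⟦ b ⟧ · (⟦ a ⟧ · u)) (⟦⟧-// p n d)) (trans (cong (⟦ b ⟧ ·_) (⟦⟧-// a _ d)) (⟦⟧-// b _ d))) ⟩
    ⟦ b ⟧ · (⟦ a ⟧ · (⟦ p ⟧ · (n // d)))           ≡⟨ trans (ℚ.*-comm ⟦ b ⟧ _) (cong (_· ⟦ b ⟧) (ℚ.*-comm ⟦ a ⟧ _)) ⟩
    ⟦ p ⟧ · (n // d) · ⟦ a ⟧ · ⟦ b ⟧ ∎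
    where
    lem : ∀ p n a b → p * n * a * b ≡ b * (a * (p * n))
    lem = solve-∀

  ratio₂ : ∀ p k n d a b c → .{{NonZero k}} → .{{NonZero d}} → c * k * d ≡ p * n * a * b →
    ⟦ c ⟧ ≡ ⟦ p ⟧ · (1 // k) · (n // d) · ⟦ a ⟧ · ⟦ b ⟧
  ratio₂ p k n d a b c e = trans (ratio p n (k * d) a b c {{m*n≢0 k d}} (trans (sym (*-assoc c k d)) e))
    (cong (λ u → u · ⟦ a ⟧ · ⟦ b ⟧) (trans (cong (⟦ p ⟧ ·_) (trans (cong (_// (k * d)) (sym (*-identityˡ n))) (sym (//-// 1 n k d))))
      (sym (ℚ.*-assoc ⟦ p ⟧ (1 // k) (n // d)))))

-- The lists of the theorem, side lengths and final form

module Assembly where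

  open Fractions
  open Chains
  open Products using (dbl)
  open Factorials
  open Gluing using (module Glue)
  open Masks using (lineBits; lineBits-not; lineBits-length; southBits; offset)
  open Regions
  open import Defs
  open import Data.Bool using (Bool; true; false; not)
  open import Data.Bool.Properties using (not-involutive)
  open import Data.Nat using (ℕ; zero; suc; _+_; _*_; _∸_; _^_; _≤_; z≤n; s≤s; ⌊_/2⌋; NonZero)
  open import Data.Nat.Properties
  open import Data.Nat.Tactic.RingSolver using (solve-∀)
  open import Data.Nat.ListAction using (sum)
  open import Data.Rational using () renaming (_*_ to _·_)
  open import Data.List using (List; []; _∷_; _++_; length; map; replicate)
  open import Data.List.Properties using (++-identityʳ; ++-assoc)
  open import Data.Product using (Σ; _×_; _,_; proj₁; proj₂)
  open import Relation.Binary.PropositionalEquality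
  open ≡-Reasoning

  altBits : Bool → List ℕ → List Bool
  altBits c []       = []
  altBits c (t ∷ ts) = replicate t c ++ altBits (not c) ts

  southBits-alt : ∀ t → southBits t ≡ altBits false t
  southBits-alt []             = refl
  southBits-alt (t ∷ [])       = sym (++-identityʳ _)
  southBits-alt (t ∷ t′ ∷ ts) = cong (λ u → falses t ++ trues t′ ++ u) (southBits-alt ts)

  flip : ℕ → Bool → Bool
  flip zero    c = c
  flip (suc j) c = not (flip j c)

  flip-not : ∀ j c → flip j (not c) ≡ not (flip j c)
  flip-not zero    c = refl
  flip-not (suc j) c = cong not (flip-not j c)

  flip-double : ∀ j c → flip (2 * j) c ≡ c
  flip-double j c = trans (cong (λ n → flip n c) (sym (dbl≡2* j))) (go j)
    where
    go : ∀ j → flip (dbl j) c ≡ c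
    go zero    = refl
    go (suc j) = trans (not-involutive _) (go j)

  desc-snoc : ∀ x as j → desc (x ∷ as) (suc j) ≡ desc as j ++ x ∷ []
  desc-snoc x as zero    = refl
  desc-snoc x as (suc j) = cong (aget as (suc j) ∷_) (desc-snoc x as j)

  length-desc : ∀ as j → length (desc as j) ≡ j
  length-desc as zero    = refl
  length-desc as (suc j) = cong suc (length-desc as j)

  altBits-snoc : ∀ c ts x → altBits c (ts ++ x ∷ []) ≡ altBits c ts ++ replicate x (flip (length ts) c)
  altBits-snoc c []       x = ++-identityʳ _
  altBits-snoc c (t ∷ ts) x = trans (cong (replicate t c ++_) (trans (altBits-snoc (not c) ts x)
      (cong (λ b → altBits (not c) ts ++ replicate x b) (flip-not (length ts) c))))
    (sym (++-assoc (replicate t c) _ _))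

  -- `desc` reverses the list and pads it with zeros up to length `j`. A zero is an empty run and
  -- merely switches the initial bit, so all that matters is that the last run, of length a₁, gets
  -- the bit `b`.
  altBits-desc : ∀ as j c b → length as ≤ j → flip j c ≡ not b → altBits c (desc as j) ≡ lineBits b as
  altBits-desc []       zero    c b h e = refl
  altBits-desc []       (suc j) c b h e = altBits-desc [] j (not c) b z≤n (trans (flip-not j c) e)
  altBits-desc (x ∷ as) (suc j) c b (s≤s h) e = begin
    altBits c (desc (x ∷ as) (suc j))
      ≡⟨ cong (altBits c) (desc-snoc x as j) ⟩
    altBits c (desc as j ++ x ∷ [])
      ≡⟨ altBits-snoc c (desc as j) x ⟩
    altBits c (desc as j) ++ replicate x (flip (length (desc as j)) c)
      ≡⟨ cong₂ (λ u d → u ++ replicate x d) (altBits-desc as j c (not b) h (trans flip≡ (sym (not-involutive b)))) (trans (cong (λ n → flip n c) (length-desc as j)) flip≡) ⟩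
    lineBits (not b) as ++ replicate x b ∎
    where
    flip≡ : flip j c ≡ b
    flip≡ = trans (sym (not-involutive (flip j c))) (trans (cong not e) (not-involutive b))

  trueCount-alt : ∀ t → (trueCount (altBits false t) ≡ Esum t) × (trueCount (altBits true t) ≡ Osum t)
  trueCount-alt []       = refl , refl
  trueCount-alt (t ∷ ts) = let p , q = trueCount-alt ts in
    trans (trueCount-++ (falses t) _) (cong₂ _+_ (trueCount-falses t) q) , trans (trueCount-++ (trues t) _) (cong₂ _+_ (trueCount-trues t) p)

  trueCount-line : ∀ as → (trueCount (lineBits true as) ≡ Osum as) × (trueCount (lineBits false as) ≡ Esum as)
  trueCount-line []       = refl , refl
  trueCount-line (x ∷ as) = let p , q = trueCount-line as in
    trans (trueCount-++ (lineBits false as) _) (trans (cong₂ _+_ q (trueCount-trues x)) (+-comm (Esum as) x)) ,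
    trans (trueCount-++ (lineBits true as) _) (trans (cong₂ _+_ p (trueCount-falses x)) (+-identityʳ _))

  southBits-gap : ∀ l g t → southBits (l + g ∷ t) ≡ falses l ++ altBits false (g ∷ t)
  southBits-gap l g t = trans (southBits-alt (l + g ∷ t)) (trans (cong (_++ altBits true t) (falses-+ l)) (++-assoc (falses l) (falses g) (altBits true t)))
    where
    falses-+ : ∀ l → falses (l + g) ≡ falses l ++ falses g
    falses-+ zero    = refl
    falses-+ (suc l) = cong (false ∷_) (falses-+ l)

  half-bound : ∀ n → n ≤ 2 * ⌊ n + 1 /2⌋ × n ≤ 2 * ⌊ n /2⌋ + 1
  half-bound zero          = z≤n , z≤n
  half-bound (suc zero)    = s≤s z≤n , s≤s z≤n
  half-bound (suc (suc n)) = let p , q = half-bound n in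
    ≤-trans (s≤s (s≤s p)) (≤-reflexive (sym (*-suc 2 ⌊ n + 1 /2⌋))) ,
    ≤-trans (s≤s (s≤s q)) (≤-reflexive (cong (_+ 1) (sym (*-suc 2 ⌊ n /2⌋))))

  -- `m` is the least even number not below the length of `a`. Thus a₁ sits at an even place of the
  -- list and is a removed triangle, and for odd length the leading gap gets the additional entry 0.
  upper-list : ∀ l a₁ as → let a = a₁ ∷ as ; m = 2 * ⌊ length a + 1 /2⌋ in
    southBits (l + aget a m ∷ desc a (m ∸ 1)) ≡ falses l ++ lineBits true a
  upper-list l a₁ as = trans (southBits-gap l (aget a m) (desc a (m ∸ 1))) (cong (falses l ++_) (bits m refl))
    where
    a : List ℕ
    a = a₁ ∷ as
    m : ℕ
    m = 2 * ⌊ length a + 1 /2⌋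
    bits : ∀ k → k ≡ m → altBits false (aget a k ∷ desc a (k ∸ 1)) ≡ lineBits true a
    bits zero    e with () ← ≤-trans (proj₁ (half-bound (length a))) (≤-reflexive (sym e))
    bits (suc k) e = altBits-desc a (suc k) false true (≤-trans (proj₁ (half-bound (length a))) (≤-reflexive (sym e)))
      (trans (cong (λ n → flip n false) e) (flip-double ⌊ length a + 1 /2⌋ false))

  -- With `k + 1` entries, an odd number, a₁ becomes a gap, and the cap `z` that follows it is a
  -- removed triangle.
  lower-list : ∀ l a z → let k = 2 * ⌊ length a /2⌋ in
    southBits (l + aget a (k + 1) ∷ (desc a k ++ z ∷ [])) ≡ falses l ++ (lineBits false a ++ trues z)
  lower-list l a z = trans (southBits-gap l (aget a (k + 1)) (desc a k ++ z ∷ [])) (cong (falses l ++_) (begin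
    altBits false (aget a (k + 1) ∷ desc a k ++ z ∷ [])
      ≡⟨ cong (λ n → altBits false (aget a n ∷ desc a k ++ z ∷ [])) (+-comm k 1) ⟩
    altBits false (desc a (suc k) ++ z ∷ [])
      ≡⟨ altBits-snoc false (desc a (suc k)) z ⟩
    altBits false (desc a (suc k)) ++ replicate z (flip (length (desc a (suc k))) false)
      ≡⟨ cong₂ (λ u b → u ++ replicate z b)
           (altBits-desc a (suc k) false false (≤-trans (proj₂ (half-bound (length a))) (≤-reflexive (+-comm k 1))) odd-flip)
           (trans (cong (λ n → flip n false) (length-desc a (suc k))) odd-flip) ⟩
    lineBits false a ++ trues z ∎))
    where
    k : ℕ
    k = 2 * ⌊ length a /2⌋
    odd-flip : flip (suc k) false ≡ true
    odd-flip = cong not (flip-double ⌊ length a /2⌋ false)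

  Esum-south : ∀ t → Esum t ≡ trueCount (southBits t)
  Esum-south t = trans (sym (proj₁ (trueCount-alt t))) (cong trueCount (sym (southBits-alt t)))

  trueCount-shift : ∀ l R → trueCount (falses l ++ R) ≡ trueCount R
  trueCount-shift l R = trans (trueCount-++ (falses l) R) (cong (_+ trueCount R) (trueCount-falses l))

  Q-bits : ∀ t l R → southBits t ≡ falses l ++ R → Q t ≡ T (dbl (trueCount R)) (falses l ++ R)
  Q-bits t l R e = trans (Q-trapezoid t) (cong₂ (λ k P → T (dbl k) P) (trans (Esum-south t) (trans (cong trueCount e) (trueCount-shift l R))) e)

  K-bits : ∀ t l R → southBits t ≡ falses l ++ R → K t ≡ T (dbl (trueCount R) ∸ 1) (falses l ++ R)
  K-bits t l R e = trans (K-trapezoid t) (cong₂ (λ k P → T (dbl k ∸ 1) P) (trans (Esum-south t) (trans (cong trueCount e) (trueCount-shift l R))) e)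

  sum-split : ∀ a → sum a ≡ Osum a + Esum a
  sum-split []      = refl
  sum-split (x ∷ a) = trans (cong (x +_) (trans (sum-split a) (+-comm (Osum a) (Esum a)))) (sym (+-assoc x _ _))

  -- For `y = 1 + 2 * h` the subtractions of 1 in the side lengths reduce by computation. Both parts
  -- have even numbers of rows, and the blocks need no shift.
  tilings-odd : ∀ x h z a k → h + Osum a ≡ suc k →
    M (RRegion x (1 + 2 * h) z a) ≡ sumB (x + h) (λ S → T (dbl (h + (Esum a + z))) (S ++ (map not (lineBits true a) ++ trues z)) * T (dbl (h + Osum a)) (S ++ lineBits true a))
  tilings-odd x h z a k ek = Glued.count-glued a x z (2 * h + z + 2 * e) (2 * h + z + 2 * o) (2 * (2 * h + z + s)) (2 * h + z + s)
    (dbl (h + o)) (dbl (h + (e + z))) (x + h) 0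
    (sym (dbl≡2* (2 * h + z + s)))
    (trans (lem₁ h z o e) (cong (λ s → 2 * (2 * h + z + s)) (sym (sum-split a))))
    (trans (cong (_+ z) (dbl≡2* (h + o))) (lem₂ h z o))
    (trans (lem₃ h z e) (sym (dbl≡2* (h + (e + z)))))
    (trans (cong (2 * h + z + 2 * e +_) (dbl≡2* o)) (trans (lem₄ h z o e) (cong (2 * h + z + 2 * o +_) (sym (dbl≡2* e)))))
    (trans (cong (λ d → d + (2 * h + z + 2 * e) + 0) (dbl≡2* (x + o))) (trans (lem₅ x h z o e) (cong (_+ z) (trans (cong (λ s → 2 * (x + h + s)) (sym (sum-split a))) (sym (dbl≡2* (x + h + s)))))))
    (trans (ev-dbl (h + (e + z))) (sym (ev-dbl (h + o))))
    (cong (λ b → offset (not b) 0) (sym (ev-dbl (h + o))))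
    (≤-trans (m≤n+m o h) (≤-dbl (h + o)))
    (≤-trans (m≤m+n e z) (≤-trans (m≤n+m (e + z) h) (≤-dbl (h + (e + z)))))
    (trans (baseLength-even (h + o) (x + e)) (trans (lem₆ x h o e) (cong (λ s → x + h + s) (sym (sum-split a)))))
    (trans (baseLength-even (h + (e + z)) (x + o)) (trans (lem₇ x h z o e) (cong (λ s → x + h + s + z) (sym (sum-split a)))))
    (suc (dbl k)) (cong dbl ek)
    where
    o e s : ℕ
    o = Osum a
    e = Esum a
    s = sum a
    lem₁ : ∀ h z o e → 2 * h + z + 2 * e + (2 * h + z + 2 * o) ≡ 2 * (2 * h + z + (o + e))
    lem₁ = solve-∀
    lem₂ : ∀ h z o → 2 * (h + o) + z ≡ 2 * h + z + 2 * o
    lem₂ = solve-∀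
    lem₃ : ∀ h z e → 2 * h + z + 2 * e + z ≡ 2 * (h + (e + z))
    lem₃ = solve-∀
    lem₄ : ∀ h z o e → 2 * h + z + 2 * e + 2 * o ≡ 2 * h + z + 2 * o + 2 * e
    lem₄ = solve-∀
    lem₅ : ∀ x h z o e → 2 * (x + o) + (2 * h + z + 2 * e) + 0 ≡ 2 * (x + h + (o + e)) + z
    lem₅ = solve-∀
    lem₆ : ∀ x h o e → h + o + (x + e) ≡ x + h + (o + e)
    lem₆ = solve-∀
    lem₇ : ∀ x h z o e → h + (e + z) + (x + o) ≡ x + h + (o + e) + z
    lem₇ = solve-∀

  -- Both parts have odd numbers of rows, and the columns are shifted by `δ = 1`. The subtractions
  -- do not reduce here, so several length equations are proved with 1 added back; for the
  -- southeastern side this rests on the last hypothesis.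
  tilings-even : ∀ x h z a k j → h + Osum a ≡ suc k → h + (Esum a + z) ≡ suc j → 1 ≤ 2 * h + z + 2 * Esum a →
    M (RRegion x (2 * h) z a) ≡ sumB (x + h) (λ S → T (dbl (h + (Esum a + z)) ∸ 1) (S ++ (map not (lineBits true a) ++ trues z)) * T (dbl (h + Osum a) ∸ 1) (S ++ lineBits true a))
  tilings-even x h z a k j ek ej low = trans
    (Glued.count-glued a x z (2 * h + z + 2 * e ∸ 1) (2 * h + z + 2 * o ∸ 1) (2 * (2 * h + z + s ∸ 1)) (2 * h + z + s ∸ 1)
      (suc (dbl k)) (suc (dbl j)) (x + h) 1
      (sym (dbl≡2* (2 * h + z + s ∸ 1)))
      (suc-injective (suc-injective (begin
        suc (suc (se + ne))                       ≡⟨ cong suc (sym (+-suc se ne)) ⟩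
        suc se + suc ne                           ≡⟨ cong₂ _+_ se+1 ne+1 ⟩
        2 * h + z + 2 * e + (2 * h + z + 2 * o)   ≡⟨ lem₁ h z o e ⟩
        2 * (2 * h + z + (o + e))                 ≡⟨ cong (λ s → 2 * (2 * h + z + s)) (sym (sum-split a)) ⟩
        2 * (2 * h + z + s)                       ≡⟨ cong (2 *_) (sym half+1) ⟩
        2 * suc (2 * h + z + s ∸ 1)               ≡⟨ *-suc 2 (2 * h + z + s ∸ 1) ⟩
        suc (suc (2 * (2 * h + z + s ∸ 1))) ∎)))
      (suc-injective (begin
        dbl (suc k) + z       ≡⟨ cong (λ n → dbl n + z) (sym ek) ⟩
        dbl (h + o) + z       ≡⟨ cong (_+ z) (dbl≡2* (h + o)) ⟩
        2 * (h + o) + z       ≡⟨ lem₂ h z o ⟩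
        2 * h + z + 2 * o     ≡⟨ sym ne+1 ⟩
        suc ne ∎))
      (suc-injective (begin
        suc se + z              ≡⟨ cong (_+ z) se+1 ⟩
        2 * h + z + 2 * e + z   ≡⟨ lem₃ h z e ⟩
        2 * (h + (e + z))       ≡⟨ trans (sym (dbl≡2* (h + (e + z)))) (cong dbl ej) ⟩
        dbl (suc j) ∎))
      (suc-injective (begin
        suc se + dbl o              ≡⟨ cong₂ _+_ se+1 (dbl≡2* o) ⟩
        2 * h + z + 2 * e + 2 * o   ≡⟨ lem₄ h z o e ⟩
        2 * h + z + 2 * o + 2 * e   ≡⟨ cong₂ _+_ (sym ne+1) (sym (dbl≡2* e)) ⟩
        suc ne + dbl e ∎))
      (begin
        dbl (x + o) + se + 1                  ≡⟨ trans (+-assoc (dbl (x + o)) se 1) (cong₂ _+_ (dbl≡2* (x + o)) (trans (+-comm se 1) se+1)) ⟩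
        2 * (x + o) + (2 * h + z + 2 * e)     ≡⟨ lem₅ x h z o e ⟩
        2 * (x + h + (o + e)) + z             ≡⟨ cong (_+ z) (trans (cong (λ s → 2 * (x + h + s)) (sym (sum-split a))) (sym (dbl≡2* (x + h + s)))) ⟩
        dbl (x + h + s) + z ∎)
      (cong not (trans (ev-dbl j) (sym (ev-dbl k))))
      (cong (λ b → offset (not (not b)) 0) (sym (ev-dbl k)))
      (≤-trans (m≤n+m o h) (≤-trans (≤-reflexive ek) (s≤s (≤-dbl k))))
      (≤-trans (m≤m+n e z) (≤-trans (m≤n+m (e + z) h) (≤-trans (≤-reflexive ej) (s≤s (≤-dbl j)))))
      (trans (baseLength-odd k (x + e)) (trans (cong (_+ (x + e)) (sym ek)) (trans (lem₆ x h o e) (cong (λ s → x + h + s) (sym (sum-split a))))))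
      (trans (baseLength-odd j (x + o)) (trans (cong (_+ (x + o)) (sym ej)) (trans (lem₇ x h z o e) (cong (λ s → x + h + s + z) (sym (sum-split a))))))
      (dbl k) refl)
    (cong₂ (λ m n → sumB (x + h) (λ S → T (dbl m ∸ 1) (S ++ (map not (lineBits true a) ++ trues z)) * T (dbl n ∸ 1) (S ++ lineBits true a))) (sym ej) (sym ek))
    where
    o e s se ne : ℕ
    o = Osum a
    e = Esum a
    s = sum a
    se = 2 * h + z + 2 * e ∸ 1
    ne = 2 * h + z + 2 * o ∸ 1
    suc-pred′ : ∀ {n} → 1 ≤ n → suc (n ∸ 1) ≡ n
    suc-pred′ (s≤s _) = refl
    se+1 : suc se ≡ 2 * h + z + 2 * e
    se+1 = suc-pred′ low
    ne+1 : suc ne ≡ 2 * h + z + 2 * o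
    ne+1 = suc-pred′ (subst (1 ≤_) (trans (cong (λ n → n + n + z) (sym ek)) (lem₈ h z o)) (s≤s z≤n))
      where
      lem₈ : ∀ h z o → h + o + (h + o) + z ≡ 2 * h + z + 2 * o
      lem₈ = solve-∀
    half+1 : suc (2 * h + z + s ∸ 1) ≡ 2 * h + z + s
    half+1 = suc-pred′ (≤-trans (subst (1 ≤_) (sym ek) (s≤s z≤n)) (≤-trans (+-mono-≤ (≤-trans (m≤m+n h _) (m≤m+n (2 * h) z)) (≤-trans (m≤m+n o e) (≤-reflexive (sym (sum-split a))))) ≤-refl))
    lem₁ : ∀ h z o e → 2 * h + z + 2 * e + (2 * h + z + 2 * o) ≡ 2 * (2 * h + z + (o + e))
    lem₁ = solve-∀
    lem₂ : ∀ h z o → 2 * (h + o) + z ≡ 2 * h + z + 2 * o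
    lem₂ = solve-∀
    lem₃ : ∀ h z e → 2 * h + z + 2 * e + z ≡ 2 * (h + (e + z))
    lem₃ = solve-∀
    lem₄ : ∀ h z o e → 2 * h + z + 2 * e + 2 * o ≡ 2 * h + z + 2 * o + 2 * e
    lem₄ = solve-∀
    lem₅ : ∀ x h z o e → 2 * (x + o) + (2 * h + z + 2 * e) ≡ 2 * (x + h + (o + e)) + z
    lem₅ = solve-∀
    lem₆ : ∀ x h o e → h + o + (x + e) ≡ x + h + (o + e)
    lem₆ = solve-∀
    lem₇ : ∀ x h z o e → h + (e + z) + (x + o) ≡ x + h + (o + e) + z
    lem₇ = solve-∀

  prodTo-cong : ∀ n {f g : ℕ → ℕ} → (∀ i → f i ≡ g i) → prodTo n f ≡ prodTo n g
  prodTo-cong zero    h = refl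
  prodTo-cong (suc n) h = cong₂ _*_ (prodTo-cong n h) (h (suc n))

  cong₅ : (f : ℕ → ℕ → ℕ → ℕ → ℕ → ℕ) → ∀ {a a′ b b′ c c′ d d′ e e′} → a ≡ a′ → b ≡ b′ → c ≡ c′ → d ≡ d′ → e ≡ e′ → f a b c d e ≡ f a′ b′ c′ d′ e′
  cong₅ f refl refl refl refl refl = refl

  complement-count : ∀ a z → trueCount (map not (lineBits true a) ++ trues z) ≡ Esum a + z
  complement-count a z = trans (trueCount-++ (map not (lineBits true a)) _)
    (cong₂ _+_ (trans (cong trueCount (sym (lineBits-not true a))) (proj₂ (trueCount-line a))) (trueCount-trues z))

  module Final (x z a₁ : ℕ) (as : List ℕ) (a₁>0 : 1 ≤ a₁) (h : ℕ) where

    a : List ℕ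
    a = a₁ ∷ as

    n s e o m₁ k₂ : ℕ
    n = length a
    s = sum a
    e = Esum a
    o = Osum a
    m₁ = 2 * ⌊ n + 1 /2⌋
    k₂ = 2 * ⌊ n /2⌋

    t₁ t₂ : List ℕ
    t₁ = (x + h + aget a m₁) ∷ desc a (m₁ ∸ 1)
    t₂ = (x + h + aget a (k₂ + 1)) ∷ (desc a k₂ ++ (z ∷ []))

    A B : List Bool
    A = lineBits true a
    B = map not A ++ trues z

    module G = Glue A z x h

    o≡ : trueCount A ≡ o
    o≡ = proj₁ (trueCount-line a)

    e≡ : trueCount B ≡ e + z
    e≡ = complement-count a z

    m≡ : length A + z ≡ s + z
    m≡ = cong (_+ z) (lineBits-length true a)

    bits₁ : southBits t₁ ≡ falses (x + h) ++ A
    bits₁ = upper-list (x + h) a₁ as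

    bits₂ : southBits t₂ ≡ falses (x + h) ++ B
    bits₂ = trans (lower-list (x + h) a z) (cong (λ b → falses (x + h) ++ (b ++ trues z)) (lineBits-not true a))

    h+o>0 : Σ ℕ (λ k → h + o ≡ suc k)
    h+o>0 = positive (≤-trans a₁>0 (≤-trans (m≤m+n a₁ _) (m≤n+m o h)))
      where
      positive : ∀ {n} → 1 ≤ n → Σ ℕ (λ k → n ≡ suc k)
      positive (s≤s {n = k} _) = k , refl

    final-odd : let y = 1 + 2 * h in
      M (RRegion x y z a) * 2 ^ (y ∸ 1)
        * (Hf (s + z) * H₂ (2 * e + y + 2 * z) * H₂ (2 * o + y) * H₂ (2 * s + 2 * y + 2 * z ∸ 1))
      ≡ prodTo h (λ i → poch (2 * x + 2 * i) (2 * s + 2 * y + 2 * z + 1 ∸ 4 * i))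
        * (Hf (s + y + z ∸ 1) * H₂ y * H₂ (2 * e + 2 * z + 1) * H₂ (2 * o + 1) * H₂ (2 * s + y + 2 * z)) * Q t₁ * Q t₂
    final-odd = trans (sym (cong₂ _*_ (cong₂ _*_ tilings (cong (2 ^_) (dbl≡2* h)))
        (cong₅ (λ a b c d _ → a * b * c * d) (cong Hf m≡) (cong H₂ i₁) (cong H₂ i₂) (cong H₂ i₃) (refl {x = 0}))))
      (trans G.glue-even (cong₂ _*_ (cong₂ _*_ (cong₂ _*_
        (prodTo-cong h (λ i → cong (λ v → poch (2 * x + 2 * i) (v ∸ 4 * i)) i₄))
        (cong₅ (λ a b c d e → a * b * c * d * e) (cong Hf i₅) (cong H₂ i₆) (cong H₂ i₇) (cong H₂ i₈) (cong H₂ i₉)))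
        (sym (Q-bits t₁ (x + h) A bits₁))) (sym (Q-bits t₂ (x + h) B bits₂))))
      where
      tilings : sumB (x + h) (λ S → T (dbl (h + trueCount B)) (S ++ B) * T (dbl (h + trueCount A)) (S ++ A)) ≡ M (RRegion x (1 + 2 * h) z a)
      tilings = trans (cong₂ (λ u v → sumB (x + h) (λ S → T (dbl (h + u)) (S ++ B) * T (dbl (h + v)) (S ++ A))) e≡ o≡)
        (sym (tilings-odd x h z a (proj₁ h+o>0) (proj₂ h+o>0)))
      i₁ : suc (dbl (h + trueCount B)) ≡ 2 * e + (1 + 2 * h) + 2 * z
      i₁ = trans (cong suc (trans (dbl≡2* (h + trueCount B)) (cong (λ u → 2 * (h + u)) e≡))) (lem h e z)
        where
        lem : ∀ h e z → suc (2 * (h + (e + z))) ≡ 2 * e + (1 + 2 * h) + 2 * z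
        lem = solve-∀
      i₂ : suc (dbl (h + trueCount A)) ≡ 2 * o + (1 + 2 * h)
      i₂ = trans (cong suc (trans (dbl≡2* (h + trueCount A)) (cong (λ u → 2 * (h + u)) o≡))) (lem h o)
        where
        lem : ∀ h o → suc (2 * (h + o)) ≡ 2 * o + (1 + 2 * h)
        lem = solve-∀
      i₃ : suc (dbl (dbl h + (length A + z))) ≡ 2 * s + 2 * (1 + 2 * h) + 2 * z ∸ 1
      i₃ = trans (cong suc (trans (dbl≡2* (dbl h + (length A + z))) (cong₂ (λ u v → 2 * (u + v)) (dbl≡2* h) m≡)))
        (sym (cong (_∸ 1) (lem h s z)))
        where
        lem : ∀ h s z → 2 * s + 2 * (1 + 2 * h) + 2 * z ≡ suc (suc (2 * (2 * h + (s + z))))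
        lem = solve-∀
      i₄ : 2 * (length A + z) + 3 + 4 * h ≡ 2 * s + 2 * (1 + 2 * h) + 2 * z + 1
      i₄ = trans (cong (λ u → 2 * u + 3 + 4 * h) m≡) (lem h s z)
        where
        lem : ∀ h s z → 2 * (s + z) + 3 + 4 * h ≡ 2 * s + 2 * (1 + 2 * h) + 2 * z + 1
        lem = solve-∀
      i₅ : dbl h + (length A + z) ≡ s + (1 + 2 * h) + z ∸ 1
      i₅ = trans (cong₂ _+_ (dbl≡2* h) m≡) (sym (cong (_∸ 1) (lem h s z)))
        where
        lem : ∀ h s z → s + (1 + 2 * h) + z ≡ suc (2 * h + (s + z))
        lem = solve-∀
      i₆ : suc (dbl h) ≡ 1 + 2 * h
      i₆ = cong suc (dbl≡2* h)
      i₇ : suc (dbl (trueCount B)) ≡ 2 * e + 2 * z + 1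
      i₇ = trans (cong suc (trans (dbl≡2* (trueCount B)) (cong (2 *_) e≡))) (lem e z)
        where
        lem : ∀ e z → suc (2 * (e + z)) ≡ 2 * e + 2 * z + 1
        lem = solve-∀
      i₈ : suc (dbl (trueCount A)) ≡ 2 * o + 1
      i₈ = trans (cong suc (trans (dbl≡2* (trueCount A)) (cong (2 *_) o≡))) (+-comm 1 (2 * o))
      i₉ : suc (dbl (h + (length A + z))) ≡ 2 * s + (1 + 2 * h) + 2 * z
      i₉ = trans (cong suc (trans (dbl≡2* (h + (length A + z))) (cong (λ u → 2 * (h + u)) m≡))) (lem h s z)
        where
        lem : ∀ h s z → suc (2 * (h + (s + z))) ≡ 2 * s + (1 + 2 * h) + 2 * z
        lem = solve-∀

    final-even : let y = 2 * h in 1 ≤ y + z + 2 * e →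
      M (RRegion x y z a)
        * (Hf (s + z) * H₂ (2 * e + y + 2 * z) * H₂ (2 * o + y) * H₂ (2 * s + 2 * y + 2 * z))
      ≡ prodTo h (λ i → poch (2 * x + 2 * i) (2 * s + 2 * y + 2 * z + 1 ∸ 4 * i))
        * (Hf (s + y + z) * H₂ y * H₂ (2 * e + 2 * z) * H₂ (2 * o) * H₂ (2 * s + y + 2 * z)) * K t₁ * K t₂
    final-even low = trans (sym (cong₂ _*_ tilings
        (cong₅ (λ a b c d _ → a * b * c * d) (cong Hf m≡) (cong H₂ i₁) (cong H₂ i₂) (cong H₂ i₃) (refl {x = 0}))))
      (trans (G.glue-odd (proj₁ m>0) (proj₂ m>0)) (cong₂ _*_ (cong₂ _*_ (cong₂ _*_
        (prodTo-cong h (λ i → cong (λ v → poch (2 * x + 2 * i) (v ∸ 4 * i)) i₄))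
        (cong₅ (λ a b c d e → a * b * c * d * e) (cong Hf i₅) (cong H₂ (dbl≡2* h)) (cong H₂ i₇) (cong H₂ i₈) (cong H₂ i₉)))
        (sym (K-bits t₁ (x + h) A bits₁))) (sym (K-bits t₂ (x + h) B bits₂))))
      where
      positive : ∀ {n} → 1 ≤ n → Σ ℕ (λ k → n ≡ suc k)
      positive (s≤s {n = k} _) = k , refl
      -- The positive length bound by `low`, increased by `z`, is twice `h + (e + z)`.
      h+e+z>0 : Σ ℕ (λ k → h + (e + z) ≡ suc k)
      h+e+z>0 = positive (go (h + (e + z)) refl)
        where
        lem : ∀ h e z → 2 * h + z + 2 * e + z ≡ 2 * (h + (e + z))
        lem = solve-∀
        go : ∀ n → h + (e + z) ≡ n → 1 ≤ n
        go (suc n) _ = s≤s z≤n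
        go zero    q = ≤-trans low (≤-trans (m≤m+n _ z) (≤-reflexive (trans (lem h e z) (cong (2 *_) q))))
      m>0 : Σ ℕ (λ k → length A + z ≡ suc k)
      m>0 = positive (≤-trans a₁>0 (≤-trans (≤-trans (m≤m+n a₁ (sum as)) (m≤m+n s z)) (≤-reflexive (sym m≡))))
      tilings : sumB (x + h) (λ S → T (dbl (h + trueCount B) ∸ 1) (S ++ B) * T (dbl (h + trueCount A) ∸ 1) (S ++ A)) ≡ M (RRegion x (2 * h) z a)
      tilings = trans (cong₂ (λ u v → sumB (x + h) (λ S → T (dbl (h + u) ∸ 1) (S ++ B) * T (dbl (h + v) ∸ 1) (S ++ A))) e≡ o≡)
        (sym (tilings-even x h z a (proj₁ h+o>0) (proj₁ h+e+z>0) (proj₂ h+o>0) (proj₂ h+e+z>0) low))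
      i₁ : dbl (h + trueCount B) ≡ 2 * e + 2 * h + 2 * z
      i₁ = trans (dbl≡2* (h + trueCount B)) (trans (cong (λ u → 2 * (h + u)) e≡) (lem h e z))
        where
        lem : ∀ h e z → 2 * (h + (e + z)) ≡ 2 * e + 2 * h + 2 * z
        lem = solve-∀
      i₂ : dbl (h + trueCount A) ≡ 2 * o + 2 * h
      i₂ = trans (dbl≡2* (h + trueCount A)) (trans (cong (λ u → 2 * (h + u)) o≡) (lem h o))
        where
        lem : ∀ h o → 2 * (h + o) ≡ 2 * o + 2 * h
        lem = solve-∀
      i₃ : dbl (dbl h + (length A + z)) ≡ 2 * s + 2 * (2 * h) + 2 * z
      i₃ = trans (dbl≡2* (dbl h + (length A + z))) (trans (cong₂ (λ u v → 2 * (u + v)) (dbl≡2* h) m≡) (lem h s z))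
        where
        lem : ∀ h s z → 2 * (2 * h + (s + z)) ≡ 2 * s + 2 * (2 * h) + 2 * z
        lem = solve-∀
      i₄ : 2 * proj₁ m>0 + 3 + 4 * h ≡ 2 * s + 2 * (2 * h) + 2 * z + 1
      i₄ = trans (lem₁ h (proj₁ m>0)) (trans (cong (λ u → 2 * u + 1 + 4 * h) (trans (sym (proj₂ m>0)) m≡)) (lem₂ h s z))
        where
        lem₁ : ∀ h m → 2 * m + 3 + 4 * h ≡ 2 * suc m + 1 + 4 * h
        lem₁ = solve-∀
        lem₂ : ∀ h s z → 2 * (s + z) + 1 + 4 * h ≡ 2 * s + 2 * (2 * h) + 2 * z + 1
        lem₂ = solve-∀
      i₅ : dbl h + (length A + z) ≡ s + 2 * h + z
      i₅ = trans (cong₂ _+_ (dbl≡2* h) m≡) (lem h s z)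
        where
        lem : ∀ h s z → 2 * h + (s + z) ≡ s + 2 * h + z
        lem = solve-∀
      i₇ : dbl (trueCount B) ≡ 2 * e + 2 * z
      i₇ = trans (dbl≡2* (trueCount B)) (trans (cong (2 *_) e≡) (*-distribˡ-+ 2 e z))
      i₈ : dbl (trueCount A) ≡ 2 * o
      i₈ = trans (dbl≡2* (trueCount A)) (cong (2 *_) o≡)
      i₉ : dbl (h + (length A + z)) ≡ 2 * s + 2 * h + 2 * z
      i₉ = trans (dbl≡2* (h + (length A + z))) (trans (cong (λ u → 2 * (h + u)) m≡) (lem h s z))
        where
        lem : ∀ h s z → 2 * (h + (s + z)) ≡ 2 * s + 2 * h + 2 * z
        lem = solve-∀

    denominator≢0 : ∀ i j k l → NonZero (Hf i * H₂ j * H₂ k * H₂ l)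
    denominator≢0 i j k l = m*n≢0 (Hf i * H₂ j * H₂ k) (H₂ l) {{m*n≢0 (Hf i * H₂ j) (H₂ k) {{m*n≢0 (Hf i) (H₂ j) {{Hf≢0 i}} {{H₂≢0 j}}}} {{H₂≢0 k}}}} {{H₂≢0 l}}

    formula-odd : let y = 1 + 2 * h in
      ⟦ M (RRegion x y z a) ⟧ ≡ ⟦ prodTo h (λ i → poch (2 * x + 2 * i) (2 * s + 2 * y + 2 * z + 1 ∸ 4 * i)) ⟧ · (1 // (2 ^ (y ∸ 1)))
        · ((Hf (s + y + z ∸ 1) * H₂ y * H₂ (2 * e + 2 * z + 1) * H₂ (2 * o + 1) * H₂ (2 * s + y + 2 * z))
           // (Hf (s + z) * H₂ (2 * e + y + 2 * z) * H₂ (2 * o + y) * H₂ (2 * s + 2 * y + 2 * z ∸ 1)))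
        · ⟦ Q t₁ ⟧ · ⟦ Q t₂ ⟧
    formula-odd = let y = 1 + 2 * h in
      ratio₂ (prodTo h (λ i → poch (2 * x + 2 * i) (2 * s + 2 * y + 2 * z + 1 ∸ 4 * i))) (2 ^ (y ∸ 1))
        (Hf (s + y + z ∸ 1) * H₂ y * H₂ (2 * e + 2 * z + 1) * H₂ (2 * o + 1) * H₂ (2 * s + y + 2 * z))
        (Hf (s + z) * H₂ (2 * e + y + 2 * z) * H₂ (2 * o + y) * H₂ (2 * s + 2 * y + 2 * z ∸ 1))
        (Q t₁) (Q t₂) (M (RRegion x y z a)) {{m^n≢0 2 (2 * h)}}
        {{denominator≢0 (s + z) (2 * e + y + 2 * z) (2 * o + y) (2 * s + 2 * y + 2 * z ∸ 1)}} final-odd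

    formula-even : let y = 2 * h in 1 ≤ y + z + 2 * e →
      ⟦ M (RRegion x y z a) ⟧ ≡ ⟦ prodTo h (λ i → poch (2 * x + 2 * i) (2 * s + 2 * y + 2 * z + 1 ∸ 4 * i)) ⟧
        · ((Hf (s + y + z) * H₂ y * H₂ (2 * e + 2 * z) * H₂ (2 * o) * H₂ (2 * s + y + 2 * z))
           // (Hf (s + z) * H₂ (2 * e + y + 2 * z) * H₂ (2 * o + y) * H₂ (2 * s + 2 * y + 2 * z)))
        · ⟦ K t₁ ⟧ · ⟦ K t₂ ⟧
    formula-even low = let y = 2 * h in
      ratio (prodTo h (λ i → poch (2 * x + 2 * i) (2 * s + 2 * y + 2 * z + 1 ∸ 4 * i)))
        (Hf (s + y + z) * H₂ y * H₂ (2 * e + 2 * z) * H₂ (2 * o) * H₂ (2 * s + y + 2 * z))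
        (Hf (s + z) * H₂ (2 * e + y + 2 * z) * H₂ (2 * o + y) * H₂ (2 * s + 2 * y + 2 * z))
        (K t₁) (K t₂) (M (RRegion x y z a))
        {{denominator≢0 (s + z) (2 * e + y + 2 * z) (2 * o + y) (2 * s + 2 * y + 2 * z)}} (final-even low)

open import Defs
open import Data.Nat using (ℕ; _+_; _*_; _∸_; _^_; _≤_; ⌊_/2⌋)
open import Data.Rational using (ℚ) renaming (_*_ to _·_)
open import Data.List using (List; []; _∷_; _++_; length)
open import Data.List.Relation.Unary.All using (All)
open import Data.Nat.ListAction using (sum)
open import Data.Product using (_×_)
open import Relation.Binary.PropositionalEquality using (_≡_)
import Data.List.Relation.Unary.All as All
open import Data.Product using (_,_)
open import Relation.Binary.PropositionalEquality using (refl)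
open Assembly using (module Final)

theorem1p5 :
  (x y z : ℕ) (a₁ : ℕ) (as : List ℕ) →
  let a = a₁ ∷ as
      n = length a
      s = sum a
      e = Esum a
      o = Osum a
      m₁ = 2 * ⌊ n + 1 /2⌋
      m₂ = 2 * ⌊ n /2⌋ + 1
      t₁ = λ (h : ℕ) → (x + h + aget a m₁) ∷ desc a (m₁ ∸ 1)
      t₂ = λ (h : ℕ) → (x + h + aget a m₂) ∷ (desc a (2 * ⌊ n /2⌋) ++ (z ∷ []))
      pochProd = λ (h : ℕ) → prodTo h (λ i → poch (2 * x + 2 * i) (2 * s + 2 * y + 2 * z + 1 ∸ 4 * i))
  in
  All (λ b → 1 ≤ b) a →
  a₁ + 1 ≤ y + 2 * o →
  -- the southeastern side y+z+2E(a)-1 of ℛ has non-negative length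
  1 ≤ y + z + 2 * e →
  ((h : ℕ) → y ≡ 1 + 2 * h →
    ⟦ M (RRegion x y z a) ⟧
      ≡ ⟦ pochProd h ⟧ · (1 // (2 ^ (y ∸ 1)))
        · ((Hf (s + y + z ∸ 1) * H₂ y * H₂ (2 * e + 2 * z + 1) * H₂ (2 * o + 1) * H₂ (2 * s + y + 2 * z))
           // (Hf (s + z) * H₂ (2 * e + y + 2 * z) * H₂ (2 * o + y) * H₂ (2 * s + 2 * y + 2 * z ∸ 1)))
        · ⟦ Q (t₁ h) ⟧ · ⟦ Q (t₂ h) ⟧)
  ×
  ((h : ℕ) → y ≡ 2 * h →
    ⟦ M (RRegion x y z a) ⟧
      ≡ ⟦ pochProd h ⟧
        · ((Hf (s + y + z) * H₂ y * H₂ (2 * e + 2 * z) * H₂ (2 * o) * H₂ (2 * s + y + 2 * z))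
           // (Hf (s + z) * H₂ (2 * e + y + 2 * z) * H₂ (2 * o + y) * H₂ (2 * s + 2 * y + 2 * z)))
        · ⟦ K (t₁ h) ⟧ · ⟦ K (t₂ h) ⟧)
theorem1p5 x y z a₁ as positive _ low =
  (λ { h refl → Final.formula-odd x z a₁ as (All.head positive) h }) ,
  (λ { h refl → Final.formula-even x z a₁ as (All.head positive) h low })
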